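{- For each positive integer $n$, the number of acyclic directed graphs on the vertex set $\{1,\dots,n\}$ is equal to the number of $n\times n$ matrices with entries in $\{0,1\}$ all of whose (complex) eigenvalues are positive real numbers.
   Context: A directed graph (digraph) on vertex set $\{1,\dots,n\}$ has, for each ordered pair $(i,j)$ with $1\le i,j\le n$, at most one edge directed from $i$ to $j$; loops (edges from $i$ to $i$) and pairs of opposite edges are permitted, parallel edges are not. A digraph is acyclic if it contains no directed cycle of any length, including cycles of length $1$ (loops) and length $2$. -}

module Defs where

open import Data.Fin using (Fin; zero; suc; inject₁; fromℕ; toℕ)
open import Data.Fin.Subset using (Subset; _∈_)
open import Data.Integer using (+_)
open import Data.List using (List; length)
import Data.List.Membership.Propositional as List
open import Data.List.Relation.Unary.Unique.Propositional using (Unique)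
open import Data.Nat as ℕ using (ℕ; _⊔_)
open import Data.Nat.Properties using (m⊔n≤o⇒m≤o; m⊔n≤o⇒n≤o)
import Data.Nat.Properties as ℕ
open import Data.Product using (Σ; ∃-syntax; _×_; _,_)
open import Data.Rational as ℚ using (ℚ; 0ℚ; 1ℚ; ½; ∣_∣)
open import Data.Rational.Properties as ℚ
open import Data.Rational.Solver using (module +-*-Solver)
open import Data.Vec using (Vec; lookup)
open import Data.Vec.Functional using (Vector; foldr)
open import Function.Bundles using (_⇔_)
open import Function.Definitions using (Injective)
open import Relation.Binary.PropositionalEquality
  using (_≡_; refl; sym; trans; cong; cong₂; subst)
open import Relation.Nullary using (¬_)

-- Real numbers are Cauchy sequences of rationals, compared with _≈ᴿ_ rather
-- than _≡_.
IsCauchy : (ℕ → ℚ) → Set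
IsCauchy x = ∀ ε → 0ℚ ℚ.< ε →
  ∃[ N ] ∀ m n → N ℕ.≤ m → N ℕ.≤ n → ∣ x m ℚ.- x n ∣ ℚ.< ε

record ℝ : Set where
  constructor mkℝ
  field
    seq    : ℕ → ℚ
    cauchy : IsCauchy seq

open ℝ public

private
  open +-*-Solver using (solve; _:+_; _:-_; _:*_; :-_; _:=_; con)

  abstract
    half : ∀ ε → 0ℚ ℚ.< ε → 0ℚ ℚ.< ½ ℚ.* ε
    half ε 0<ε = ℚ.*-monoʳ-<-pos ½ 0<ε

    half+half : ∀ ε → ½ ℚ.* ε ℚ.+ ½ ℚ.* ε ≡ ε
    half+half = solve 1 (λ e → con ½ :* e :+ con ½ :* e := e) refl

    bounded : ∀ x → IsCauchy x →
              ∃[ B ] ∃[ N ] ℚ.Positive B × (∀ n → N ℕ.≤ n → ∣ x n ∣ ℚ.≤ B)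
    bounded x c with c 1ℚ (ℚ.positive⁻¹ 1ℚ)
    ... | N , h = 1ℚ ℚ.+ ∣ x N ∣ , N , ℚ.positive 0<B , bound
      where
      open ℚ.≤-Reasoning
      0<B : 0ℚ ℚ.< 1ℚ ℚ.+ ∣ x N ∣
      0<B = ℚ.+-mono-<-≤ (ℚ.positive⁻¹ 1ℚ) (ℚ.0≤∣p∣ (x N))
      bound : ∀ n → N ℕ.≤ n → ∣ x n ∣ ℚ.≤ 1ℚ ℚ.+ ∣ x N ∣
      bound n N≤n = begin
        ∣ x n ∣
          ≡⟨ cong ∣_∣ (solve 2 (λ a b → a := (a :- b) :+ b) refl (x n) (x N)) ⟩
        ∣ (x n ℚ.- x N) ℚ.+ x N ∣
          ≤⟨ ℚ.∣p+q∣≤∣p∣+∣q∣ (x n ℚ.- x N) (x N) ⟩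
        ∣ x n ℚ.- x N ∣ ℚ.+ ∣ x N ∣
          ≤⟨ ℚ.+-monoˡ-≤ ∣ x N ∣ (ℚ.<⇒≤ (h n N N≤n ℕ.≤-refl)) ⟩
        1ℚ ℚ.+ ∣ x N ∣ ∎

    scaled : ∀ B .{{_ : ℚ.Positive B}} ε → 0ℚ ℚ.< ε →
             ∃[ δ ] 0ℚ ℚ.< δ × B ℚ.* δ ≡ ε
    scaled B ε 0<ε = ε ℚ.* B⁻¹ , 0<δ , eq
      where
      instance
        B≢0 : ℚ.NonZero B
        B≢0 = ℚ.pos⇒nonZero B
      B⁻¹ : ℚ
      B⁻¹ = ℚ.1/ B
      0<δ : 0ℚ ℚ.< ε ℚ.* B⁻¹
      0<δ = subst (ℚ._< ε ℚ.* B⁻¹) (ℚ.*-zeroˡ B⁻¹)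
              (ℚ.*-monoˡ-<-pos B⁻¹ {{ℚ.1/pos⇒pos B}} 0<ε)
      eq : B ℚ.* (ε ℚ.* B⁻¹) ≡ ε
      eq = trans (solve 3 (λ b e c → b :* (e :* c) := e :* (b :* c)) refl B ε B⁻¹)
                 (trans (cong (ε ℚ.*_) (ℚ.*-inverseʳ B)) (ℚ.*-identityʳ ε))

    +-cauchy : ∀ x y → IsCauchy x → IsCauchy y → IsCauchy (λ n → x n ℚ.+ y n)
    +-cauchy x y cx cy ε 0<ε with cx _ (half ε 0<ε) | cy _ (half ε 0<ε)
    ... | M , f | N , g = M ⊔ N , λ m n p q → begin-strict
      ∣ (x m ℚ.+ y m) ℚ.- (x n ℚ.+ y n) ∣
        ≡⟨ cong ∣_∣ (solve 4 (λ a b c d → (a :+ b) :- (c :+ d) := (a :- c) :+ (b :- d))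
                       refl (x m) (y m) (x n) (y n)) ⟩
      ∣ (x m ℚ.- x n) ℚ.+ (y m ℚ.- y n) ∣
        ≤⟨ ℚ.∣p+q∣≤∣p∣+∣q∣ (x m ℚ.- x n) (y m ℚ.- y n) ⟩
      ∣ x m ℚ.- x n ∣ ℚ.+ ∣ y m ℚ.- y n ∣
        <⟨ ℚ.+-mono-< (f m n (m⊔n≤o⇒m≤o M N p) (m⊔n≤o⇒m≤o M N q))
                      (g m n (m⊔n≤o⇒n≤o M N p) (m⊔n≤o⇒n≤o M N q)) ⟩
      ½ ℚ.* ε ℚ.+ ½ ℚ.* ε
        ≡⟨ half+half ε ⟩
      ε ∎
      where open ℚ.≤-Reasoning

    neg-cauchy : ∀ x → IsCauchy x → IsCauchy (λ n → ℚ.- x n)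
    neg-cauchy x cx ε 0<ε with cx ε 0<ε
    ... | N , f = N , λ m n p q → subst (ℚ._< ε) (eq m n) (f m n p q)
      where
      eq : ∀ m n → ∣ x m ℚ.- x n ∣ ≡ ∣ (ℚ.- x m) ℚ.- (ℚ.- x n) ∣
      eq m n = trans (sym (ℚ.∣-p∣≡∣p∣ (x m ℚ.- x n)))
        (cong ∣_∣ (solve 2 (λ a b → :- (a :- b) := (:- a) :- (:- b)) refl (x m) (x n)))

    product< : ∀ a b A d → ℚ.Positive A → ∣ a ∣ ℚ.≤ A → ∣ b ∣ ℚ.< d →
               ∣ a ℚ.* b ∣ ℚ.< A ℚ.* d
    product< a b A d 0<A ∣a∣≤A ∣b∣<d = begin-strict
      ∣ a ℚ.* b ∣
        ≡⟨ ℚ.∣p*q∣≡∣p∣*∣q∣ a b ⟩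
      ∣ a ∣ ℚ.* ∣ b ∣
        ≤⟨ ℚ.*-monoʳ-≤-nonNeg ∣ b ∣ {{ℚ.nonNegative (ℚ.0≤∣p∣ b)}} ∣a∣≤A ⟩
      A ℚ.* ∣ b ∣
        <⟨ ℚ.*-monoʳ-<-pos A {{0<A}} ∣b∣<d ⟩
      A ℚ.* d ∎
      where open ℚ.≤-Reasoning

    ∣Δ*∣< : ∀ a b c d B δ C η → ℚ.Positive B → ℚ.Positive C →
            ∣ a ∣ ℚ.≤ B → ∣ b ℚ.- d ∣ ℚ.< δ → ∣ d ∣ ℚ.≤ C → ∣ a ℚ.- c ∣ ℚ.< η →
            ∣ a ℚ.* b ℚ.- c ℚ.* d ∣ ℚ.< B ℚ.* δ ℚ.+ C ℚ.* η
    ∣Δ*∣< a b c d B δ C η 0<B 0<C ∣a∣≤B ∣b-d∣<δ ∣d∣≤C ∣a-c∣<η = begin-strict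
      ∣ a ℚ.* b ℚ.- c ℚ.* d ∣
        ≡⟨ cong ∣_∣ (solve 4 (λ a b c d → a :* b :- c :* d := a :* (b :- d) :+ d :* (a :- c))
                       refl a b c d) ⟩
      ∣ a ℚ.* (b ℚ.- d) ℚ.+ d ℚ.* (a ℚ.- c) ∣
        ≤⟨ ℚ.∣p+q∣≤∣p∣+∣q∣ (a ℚ.* (b ℚ.- d)) (d ℚ.* (a ℚ.- c)) ⟩
      ∣ a ℚ.* (b ℚ.- d) ∣ ℚ.+ ∣ d ℚ.* (a ℚ.- c) ∣
        <⟨ ℚ.+-mono-< (product< a (b ℚ.- d) B δ 0<B ∣a∣≤B ∣b-d∣<δ)
                      (product< d (a ℚ.- c) C η 0<C ∣d∣≤C ∣a-c∣<η) ⟩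
      B ℚ.* δ ℚ.+ C ℚ.* η ∎
      where open ℚ.≤-Reasoning

    *-cauchy : ∀ x y → IsCauchy x → IsCauchy y → IsCauchy (λ n → x n ℚ.* y n)
    *-cauchy x y cx cy ε 0<ε =
      let B , K , 0<B , ∣x∣≤B = bounded x cx
          C , L , 0<C , ∣y∣≤C = bounded y cy
          δ , 0<δ , Bδ≡       = scaled B {{0<B}} (½ ℚ.* ε) (half ε 0<ε)
          η , 0<η , Cη≡       = scaled C {{0<C}} (½ ℚ.* ε) (half ε 0<ε)
          M , f               = cx η 0<η
          N , g               = cy δ 0<δ
      in (K ⊔ L) ⊔ (M ⊔ N) , λ m n p q →
        let K≤m = m⊔n≤o⇒m≤o K L (m⊔n≤o⇒m≤o (K ⊔ L) (M ⊔ N) p)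
            L≤n = m⊔n≤o⇒n≤o K L (m⊔n≤o⇒m≤o (K ⊔ L) (M ⊔ N) q)
            p′  = m⊔n≤o⇒n≤o (K ⊔ L) (M ⊔ N) p
            q′  = m⊔n≤o⇒n≤o (K ⊔ L) (M ⊔ N) q
        in subst (∣ x m ℚ.* y m ℚ.- x n ℚ.* y n ∣ ℚ.<_)
             (trans (cong₂ ℚ._+_ Bδ≡ Cη≡) (half+half ε))
             (∣Δ*∣< (x m) (y m) (x n) (y n) B δ C η 0<B 0<C
               (∣x∣≤B m K≤m) (g m n (m⊔n≤o⇒n≤o M N p′) (m⊔n≤o⇒n≤o M N q′))
               (∣y∣≤C n L≤n) (f m n (m⊔n≤o⇒m≤o M N p′) (m⊔n≤o⇒m≤o M N q′)))

infix  4 _≈ᴿ_ _<ᴿ_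
infixl 6 _+ᴿ_ _-ᴿ_
infixl 7 _*ᴿ_
infix  8 -ᴿ_

_≈ᴿ_ : ℝ → ℝ → Set
x ≈ᴿ y = ∀ ε → 0ℚ ℚ.< ε →
  ∃[ N ] ∀ n → N ℕ.≤ n → ∣ seq x n ℚ.- seq y n ∣ ℚ.< ε

_<ᴿ_ : ℝ → ℝ → Set
x <ᴿ y = ∃[ ε ] 0ℚ ℚ.< ε ×
  (∃[ N ] ∀ n → N ℕ.≤ n → seq x n ℚ.+ ε ℚ.< seq y n)

fromℚ : ℚ → ℝ
fromℚ q = mkℝ (λ _ → q) λ ε 0<ε → 0 , λ _ _ _ _ →
  subst (λ r → ∣ r ∣ ℚ.< ε) (sym (ℚ.+-inverseʳ q)) 0<ε

0ᴿ : ℝ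
0ᴿ = fromℚ 0ℚ

_+ᴿ_ : ℝ → ℝ → ℝ
x +ᴿ y = mkℝ (λ n → seq x n ℚ.+ seq y n) (+-cauchy (seq x) (seq y) (cauchy x) (cauchy y))

-ᴿ_ : ℝ → ℝ
-ᴿ x = mkℝ (λ n → ℚ.- seq x n) (neg-cauchy (seq x) (cauchy x))

_-ᴿ_ : ℝ → ℝ → ℝ
x -ᴿ y = x +ᴿ (-ᴿ y)

_*ᴿ_ : ℝ → ℝ → ℝ
x *ᴿ y = mkℝ (λ n → seq x n ℚ.* seq y n) (*-cauchy (seq x) (seq y) (cauchy x) (cauchy y))

record ℂ : Set where
  constructor _+i_
  field
    re : ℝ
    im : ℝ

open ℂ public

infix  4 _≈ᶜ_
infixl 6 _+ᶜ_
infixl 7 _*ᶜ_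

_≈ᶜ_ : ℂ → ℂ → Set
z ≈ᶜ w = (re z ≈ᴿ re w) × (im z ≈ᴿ im w)

0ᶜ : ℂ
0ᶜ = 0ᴿ +i 0ᴿ

fromℕᶜ : ℕ → ℂ
fromℕᶜ k = fromℚ (+ k ℚ./ 1) +i 0ᴿ

_+ᶜ_ _*ᶜ_ : ℂ → ℂ → ℂ
z +ᶜ w = (re z +ᴿ re w) +i (im z +ᴿ im w)
z *ᶜ w = (re z *ᴿ re w -ᴿ im z *ᴿ im w) +i (re z *ᴿ im w +ᴿ im z *ᴿ re w)

IsPositiveReal : ℂ → Set
IsPositiveReal z = (im z ≈ᴿ 0ᴿ) × (0ᴿ <ᴿ re z)

ComplexMatrix : ℕ → Set
ComplexMatrix n = Fin n → Fin n → ℂ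

_·_ : ∀ {n} → ComplexMatrix n → Vector ℂ n → Vector ℂ n
(A · v) i = foldr _+ᶜ_ 0ᶜ λ j → A i j *ᶜ v j

IsEigenvalue : ∀ {n} → ComplexMatrix n → ℂ → Set
IsEigenvalue {n} A μ = Σ (Vector ℂ n) λ v →
  ¬ (∀ i → v i ≈ᶜ 0ᶜ) × (∀ i → (A · v) i ≈ᶜ μ *ᶜ v i)

AllEigenvaluesPositive : ∀ {n} → ComplexMatrix n → Set
AllEigenvaluesPositive A = ∀ μ → IsEigenvalue A μ → IsPositiveReal μ

Matrix01 : ℕ → Set
Matrix01 n = Vec (Vec (Fin 2) n) n

complexify : ∀ {n} → Matrix01 n → ComplexMatrix n
complexify A i j = fromℕᶜ (toℕ (lookup (lookup A i) j))

-- A digraph is given by the set of out-neighbours of each vertex, so loops and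
-- opposite edges are allowed and parallel edges are not.
Digraph : ℕ → Set
Digraph n = Vec (Subset n) n

Edge : ∀ {n} → Digraph n → Fin n → Fin n → Set
Edge G i j = j ∈ lookup G i

-- A cycle of length ℓ + 1 on distinct vertices c 0 → c 1 → ⋯ → c ℓ → c 0.
record DirectedCycle {n} (G : Digraph n) : Set where
  field
    ℓ        : ℕ
    c        : Fin (ℕ.suc ℓ) → Fin n
    distinct : Injective _≡_ _≡_ c
    step     : ∀ (i : Fin ℓ) → Edge G (c (inject₁ i)) (c (suc i))
    close    : Edge G (c (fromℕ ℓ)) (c zero)

Acyclic : ∀ {n} → Digraph n → Set
Acyclic G = ¬ DirectedCycle G

-- Exactly k elements satisfy P, whatever the number of proofs of P x for
-- each of them.
record NumberOf {A : Set} (P : A → Set) (k : ℕ) : Set where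
  field
    elements : List A
    unique   : Unique elements
    complete : ∀ x → P x ⇔ x List.∈ elements
    size     : length elements ≡ k

{-# OPTIONS --safe #-}
-- Write A = I + B with A a 0-1 matrix.  If B is the adjacency matrix of an acyclic digraph, it is
-- nilpotent, so 1 is the only eigenvalue of A.  Conversely let all eigenvalues of A be positive.
-- Their sum is the trace, at most n, and their product is the nonzero integer det A, at least 1, so
-- by the inequality of arithmetic and geometric means they are all 1.  Hence B has trace 0, thus zero
-- diagonal, and det (s I − B) = sⁿ, so B is a nilpotent nonnegative integer matrix and its digraph is
-- acyclic.  Complementing the loops turns G ↦ I + B into a bijection of all digraphs with all matrices.
--
-- Eigenvalues have to be constructed.  Kneser's proof of the fundamental theorem of algebra is run on
-- Gaussian rationals, where all comparisons are decidable: a descent step shrinks |p(z)| by a constant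
-- factor with step length O(|p(z)|^(1/n)), so it converges to a root near any z with |p(z)| small.
-- Repeated division then yields approximate factorisations of the characteristic polynomial, and a
-- quantitative form of the mean inequality shows that its approximate roots concentrate at 1.
module Submission where

-- Equality and order of Cauchy reals are undecidable, and this shapes the proof. The hypothesis on
-- A speaks of limits only, so it can be used only by building a limit eigenvalue together with an
-- eigenvector. Pivots exist only up to double negation, hence so does the eigenvector; the double
-- negation is dropped because the conclusions drawn from it are decidable or negative: a Gaussian
-- rational is near the positive axis, or det A ≠ 0. The polynomial under study is that of A - I,
-- whose roots have to be shown small. Its approximate factorisations carry errors, but its
-- coefficients are fixed Gaussian rationals, so an equality valid up to every ε is exact. Square
-- roots are missing, so moduli are replaced by the norm |a| + |b|. It is submultiplicative, so the
-- norms of the 1 + yᵢ, yᵢ the approximate roots, have product at least about |det A|; for nearly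
-- positive numbers they add up to about the trace. These are the two inputs of the mean inequality.
-- Nilpotency of B is read off from det (sI - B) at one large integer s by Cramer's rule, without
-- the Cayley-Hamilton theorem.

open import Algebra.Bundles using (CommutativeRing; RawRing)
open import Level using (Level)

-- Ring solver with integer coefficients

module IntSolver {c ℓ : Level} (R : CommutativeRing c ℓ) where
  open import Algebra.Solver.Ring.AlmostCommutativeRing
    using (fromCommutativeRing; _-Raw-AlmostCommutative⟶_)
  open import Data.Integer as ℤ using (ℤ; +_; -[1+_]; +[1+_]; _⊖_)
  import Data.Integer.Properties as ℤ
  open import Data.Maybe using (Maybe; just; nothing)
  open import Data.Nat as ℕ using (ℕ; zero; suc)
  import Data.Nat.Properties as ℕ
  open import Relation.Binary.PropositionalEquality as ≡ using (_≡_)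
  open import Relation.Nullary using (yes; no)

  open CommutativeRing R
  open import Algebra.Properties.Ring ring
    using (-‿distribˡ-*; -‿distribʳ-*; -0#≈0#; -‿involutive)
  open import Algebra.Properties.AbelianGroup +-abelianGroup using (⁻¹-∙-comm)
  open import Algebra.Properties.Semiring.Mult.TCOptimised semiring
    using (_×_; 1+×; ×-homo-+; ×1-homo-*)
  open import Relation.Binary.Reasoning.Setoid setoid

  -- Integer coefficients let the solver compare constants although equality in the ring may be
  -- undecidable. With the optimised multiple `fromℤ (+ 1)` reduces to `1#`, so numerals match the
  -- units of the ring.
  fromℤ : ℤ → Carrier
  fromℤ (+ n)    = n × 1#
  fromℤ -[1+ n ] = - (suc n × 1#)

  private
    ⊖-homo : ∀ m n → fromℤ (m ⊖ n) ≈ m × 1# - n × 1#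
    ⊖-homo zero    zero    = sym (-‿inverseʳ 0#)
    ⊖-homo zero    (suc n) = sym (+-identityˡ _)
    ⊖-homo (suc m) zero    = sym (trans (+-congˡ -0#≈0#) (+-identityʳ _))
    ⊖-homo (suc m) (suc n) = begin
      fromℤ (suc m ⊖ suc n)                  ≡⟨ ≡.cong fromℤ (ℤ.[1+m]⊖[1+n]≡m⊖n m n) ⟩
      fromℤ (m ⊖ n)                          ≈⟨ ⊖-homo m n ⟩
      m × 1# - n × 1#                        ≈⟨ +-congʳ (+-identityʳ _) ⟨
      m × 1# + 0# - n × 1#                   ≈⟨ +-congʳ (+-congˡ (-‿inverseʳ 1#)) ⟨
      m × 1# + (1# - 1#) - n × 1#            ≈⟨ +-congʳ (+-assoc _ _ _) ⟨
      m × 1# + 1# - 1# - n × 1#              ≈⟨ +-assoc _ _ _ ⟩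
      m × 1# + 1# + (- 1# - n × 1#)          ≈⟨ +-cong (trans (+-comm _ _) (sym (1+× m 1#)))
                                                   (trans (⁻¹-∙-comm _ _) (-‿cong (sym (1+× n 1#)))) ⟩
      suc m × 1# - suc n × 1#                ∎

  fromℤ-+ : ∀ i j → fromℤ (i ℤ.+ j) ≈ fromℤ i + fromℤ j
  fromℤ-+ (+ m)    (+ n)    = ×-homo-+ 1# m n
  fromℤ-+ (+ m)    -[1+ n ] = ⊖-homo m (suc n)
  fromℤ-+ -[1+ m ] (+ n)    = trans (⊖-homo n (suc m)) (+-comm _ _)
  fromℤ-+ -[1+ m ] -[1+ n ] = begin
    - (suc (suc (m ℕ.+ n)) × 1#)       ≡⟨ ≡.cong (λ k → - (suc k × 1#)) (≡.sym (ℕ.+-suc m n)) ⟩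
    - ((suc m ℕ.+ suc n) × 1#)         ≈⟨ -‿cong (×-homo-+ 1# (suc m) (suc n)) ⟩
    - (suc m × 1# + suc n × 1#)        ≈⟨ ⁻¹-∙-comm _ _ ⟨
    - (suc m × 1#) + - (suc n × 1#)    ∎

  fromℤ-neg : ∀ i → fromℤ (ℤ.- i) ≈ - fromℤ i
  fromℤ-neg (+ zero)  = sym -0#≈0#
  fromℤ-neg +[1+ n ]  = refl
  fromℤ-neg -[1+ n ]  = sym (-‿involutive _)

  private
    fromℤ-*-pos : ∀ m j → fromℤ (+ m ℤ.* j) ≈ m × 1# * fromℤ j
    fromℤ-*-pos m (+ n) = begin
      fromℤ (+ m ℤ.* + n)     ≡⟨ ≡.cong fromℤ (≡.sym (ℤ.pos-* m n)) ⟩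
      (m ℕ.* n) × 1#          ≈⟨ ×1-homo-* m n ⟩
      m × 1# * n × 1#         ∎
    fromℤ-*-pos m -[1+ n ] = begin
      fromℤ (+ m ℤ.* -[1+ n ])        ≡⟨ ≡.cong fromℤ (≡.sym (ℤ.neg-distribʳ-* (+ m) (+ suc n))) ⟩
      fromℤ (ℤ.- (+ m ℤ.* + suc n))   ≈⟨ fromℤ-neg (+ m ℤ.* + suc n) ⟩
      - fromℤ (+ m ℤ.* + suc n)       ≈⟨ -‿cong (fromℤ-*-pos m (+ suc n)) ⟩
      - (m × 1# * suc n × 1#)         ≈⟨ -‿distribʳ-* _ _ ⟩
      m × 1# * - (suc n × 1#)         ∎

  fromℤ-* : ∀ i j → fromℤ (i ℤ.* j) ≈ fromℤ i * fromℤ j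
  fromℤ-* (+ m)    j = fromℤ-*-pos m j
  fromℤ-* -[1+ m ] j = begin
    fromℤ (-[1+ m ] ℤ.* j)          ≡⟨ ≡.cong fromℤ (≡.sym (ℤ.neg-distribˡ-* (+ suc m) j)) ⟩
    fromℤ (ℤ.- (+ suc m ℤ.* j))     ≈⟨ fromℤ-neg (+ suc m ℤ.* j) ⟩
    - fromℤ (+ suc m ℤ.* j)         ≈⟨ -‿cong (fromℤ-*-pos (suc m) j) ⟩
    - (suc m × 1# * fromℤ j)        ≈⟨ -‿distribˡ-* _ _ ⟩
    - (suc m × 1#) * fromℤ j        ∎

  private
    ℤ-rawRing : RawRing _ _
    ℤ-rawRing = record
      { Carrier = ℤ ; _≈_ = _≡_ ; _+_ = ℤ._+_ ; _*_ = ℤ._*_ ; -_ = ℤ.-_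
      ; 0# = + 0 ; 1# = + 1 }

    homomorphism : ℤ-rawRing -Raw-AlmostCommutative⟶ fromCommutativeRing R
    homomorphism = record
      { ⟦_⟧ = fromℤ ; +-homo = fromℤ-+ ; *-homo = fromℤ-* ; -‿homo = fromℤ-neg
      ; 0-homo = refl ; 1-homo = refl }

    dec : ∀ i j → Maybe (fromℤ i ≈ fromℤ j)
    dec i j with i ℤ.≟ j
    ... | yes ≡.refl = just refl
    ... | no _       = nothing

  open import Algebra.Solver.Ring ℤ-rawRing (fromCommutativeRing R) homomorphism dec public

-- Determinants, Cramer's rule and kernel vectors

module Det {c ℓ : Level} (R : CommutativeRing c ℓ) where
  open import Data.Empty using (⊥-elim)
  open import Data.Fin as Fin using (Fin; zero; suc; punchIn; punchOut; toℕ)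
  import Data.Fin.Properties as Fin
  open import Data.Nat as ℕ using (ℕ; zero; suc)
  import Data.Nat.Properties as ℕ
  open import Data.Product using (Σ; ∃-syntax; _×_; _,_)
  open import Data.Sum using (_⊎_; inj₁; inj₂)
  open import Data.Vec.Functional using (Vector; updateAt)
  import Data.Vec.Functional.Properties as Vec
  open import Function using (_∘_; const)
  open import Relation.Binary.PropositionalEquality as ≡ using (_≡_; _≢_)
  open import Relation.Nullary using (¬_; Dec; yes; no)
  open import Relation.Binary.Definitions using (tri<; tri≈; tri>)

  open CommutativeRing R hiding (zero)
  open import Algebra.Properties.Ring ring using (-0#≈0#)
  open import Algebra.Properties.Semiring.Sum semiring public
    using (sum; sum-cong-≋; *-distribˡ-sum; *-distribʳ-sum; ∑-distrib-+; ∑-comm; sum-replicate-zero)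
  open IntSolver R using (solve; _:+_; _:*_; _:-_; :-_; _:=_; con)
  open import Data.Integer using (+_)
  open import Relation.Binary.Reasoning.Setoid setoid

  Matrix : ℕ → ℕ → Set c
  Matrix m n = Fin m → Fin n → Carrier

  -- Subtracting the whole tail yields the signs of a cofactor expansion without powers of -1.
  altsum : ∀ {n} → Vector Carrier n → Carrier
  altsum {zero}  f = 0#
  altsum {suc n} f = f zero - altsum (f ∘ suc)

  minor : ∀ {n} → Matrix (suc n) (suc n) → Fin (suc n) → Matrix n n
  minor M i r j = M (punchIn i r) (suc j)

  det : ∀ {n} → Matrix n n → Carrier
  det {zero}  M = 1#
  det {suc n} M = altsum λ i → M i zero * det (minor M i)

  altsum-cong : ∀ {n} {f g : Vector Carrier n} → (∀ i → f i ≈ g i) → altsum f ≈ altsum g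
  altsum-cong {zero}  h = refl
  altsum-cong {suc n} h = +-cong (h zero) (-‿cong (altsum-cong (h ∘ suc)))

  altsum-linear : ∀ {n} a (f g : Vector Carrier n) →
                  altsum (λ i → a * f i + g i) ≈ a * altsum f + altsum g
  altsum-linear {zero}  a f g = solve 1 (λ a → con (+ 0) := a :* con (+ 0) :+ con (+ 0)) refl a
  altsum-linear {suc n} a f g = begin
    (a * f zero + g zero) - altsum (λ i → a * f (suc i) + g (suc i))
      ≈⟨ +-congˡ (-‿cong (altsum-linear a (f ∘ suc) (g ∘ suc))) ⟩
    (a * f zero + g zero) - (a * altsum (f ∘ suc) + altsum (g ∘ suc))
      ≈⟨ solve 5 (λ a x y s t → (a :* x :+ y) :- (a :* s :+ t) := a :* (x :- s) :+ (y :- t))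
           refl a _ _ _ _ ⟩
    a * (f zero - altsum (f ∘ suc)) + (g zero - altsum (g ∘ suc)) ∎

  altsum-neg : ∀ {n} {f g : Vector Carrier n} → (∀ i → f i ≈ - g i) → altsum f ≈ - altsum g
  altsum-neg {zero}  h = sym -0#≈0#
  altsum-neg {suc n} h = trans (+-cong (h zero) (-‿cong (altsum-neg (h ∘ suc))))
    (solve 2 (λ x s → :- x :- (:- s) := :- (x :- s)) refl _ _)

  altsum-zero : ∀ {n} {f : Vector Carrier n} → (∀ i → f i ≈ 0#) → altsum f ≈ 0#
  altsum-zero {zero}  h = refl
  altsum-zero {suc n} h = trans (+-cong (h zero) (-‿cong (altsum-zero (h ∘ suc)))) (-‿inverseʳ 0#)

  altsum-single : ∀ {n} {f : Vector Carrier n} r → (∀ i → i ≢ r → f i ≈ 0#) →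
                  altsum f ≈ 0# → f r ≈ 0#
  altsum-single {suc n} {f} zero h s≈0 = begin
    f zero                        ≈⟨ solve 2 (λ x s → x := (x :- s) :+ s) refl _ _ ⟩
    altsum f + altsum (f ∘ suc)   ≈⟨ +-cong s≈0 (altsum-zero λ i → h (suc i) λ ()) ⟩
    0# + 0#                       ≈⟨ +-identityˡ 0# ⟩
    0#                            ∎
  altsum-single {suc n} {f} (suc r) h s≈0 =
    altsum-single r (λ i i≢r → h (suc i) (i≢r ∘ Fin.suc-injective)) (begin
      altsum (f ∘ suc)     ≈⟨ solve 2 (λ x s → s := x :- (x :- s)) refl _ _ ⟩
      f zero - altsum f    ≈⟨ +-cong (h zero λ ()) (-‿cong s≈0) ⟩
      0# - 0#              ≈⟨ -‿inverseʳ 0# ⟩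
      0#                   ∎)

  det-cong : ∀ {n} {X Y : Matrix n n} → (∀ i j → X i j ≈ Y i j) → det X ≈ det Y
  det-cong {zero}  h = refl
  det-cong {suc n} h = altsum-cong λ i →
    *-cong (h i zero) (det-cong λ r j → h (punchIn i r) (suc j))

  module _ {n} {k i : Fin (suc n)} (k≢i : k ≢ i) where
    punchIn≢ : ∀ r → r ≢ punchOut k≢i → punchIn k r ≢ i
    punchIn≢ r r≢ eq = r≢ (Fin.punchIn-injective k r _
      (≡.trans eq (≡.sym (Fin.punchIn-punchOut k≢i))))

    ≡punchIn : i ≡ punchIn k (punchOut k≢i)
    ≡punchIn = ≡.sym (Fin.punchIn-punchOut k≢i)

  -- The three matrices are related entrywise instead of by row replacement, so that the hypotheses
  -- pass to minors, where row `i` becomes row `punchOut`.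
  det-linear : ∀ {n} i a {X Y Z : Matrix n n} →
    (∀ j → Z i j ≈ a * X i j + Y i j) →
    (∀ k → k ≢ i → ∀ j → Z k j ≈ X k j) → (∀ k → k ≢ i → ∀ j → Z k j ≈ Y k j) →
    det Z ≈ a * det X + det Y
  det-linear {suc n} i a {X} {Y} {Z} Zi Z≈X Z≈Y =
    trans (altsum-cong term)
      (altsum-linear {suc n} a (λ k → X k zero * det (minor X k)) (λ k → Y k zero * det (minor Y k)))
    where
    term : ∀ k → Z k zero * det (minor Z k) ≈
                 a * (X k zero * det (minor X k)) + Y k zero * det (minor Y k)
    term k with k Fin.≟ i
    ... | yes ≡.refl = begin
      Z k zero * det (minor Z k)
        ≈⟨ *-congʳ (Zi zero) ⟩
      (a * X k zero + Y k zero) * det (minor Z k)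
        ≈⟨ solve 4 (λ a x y d → (a :* x :+ y) :* d := a :* (x :* d) :+ y :* d) refl a _ _ _ ⟩
      a * (X k zero * det (minor Z k)) + Y k zero * det (minor Z k)
        ≈⟨ +-cong (*-congˡ (*-congˡ (det-cong λ r j → Z≈X _ (Fin.punchInᵢ≢i k r) (suc j))))
                  (*-congˡ (det-cong λ r j → Z≈Y _ (Fin.punchInᵢ≢i k r) (suc j))) ⟩
      a * (X k zero * det (minor X k)) + Y k zero * det (minor Y k) ∎
    ... | no k≢i = begin
      Z k zero * det (minor Z k)
        ≈⟨ *-congˡ (det-linear (punchOut k≢i) a
             (λ j → ≡.subst (λ l → Z l (suc j) ≈ a * X l (suc j) + Y l (suc j)) (≡punchIn k≢i)
                 (Zi (suc j)))
             (λ r r≢ j → Z≈X _ (punchIn≢ k≢i r r≢) (suc j))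
             (λ r r≢ j → Z≈Y _ (punchIn≢ k≢i r r≢) (suc j))) ⟩
      Z k zero * (a * det (minor X k) + det (minor Y k))
        ≈⟨ solve 4 (λ z a d e → z :* (a :* d :+ e) := a :* (z :* d) :+ z :* e) refl _ a _ _ ⟩
      a * (Z k zero * det (minor X k)) + Z k zero * det (minor Y k)
        ≈⟨ +-cong (*-congˡ (*-congʳ (Z≈X k k≢i zero))) (*-congʳ (Z≈Y k k≢i zero)) ⟩
      a * (X k zero * det (minor X k)) + Y k zero * det (minor Y k) ∎

  -- A zero row r equals 1 · r + r, so linearity gives det = det + det.
  det-zeroRow : ∀ {n} i (X : Matrix n n) → (∀ j → X i j ≈ 0#) → det X ≈ 0#
  det-zeroRow i X Xi≈0 = begin
    det X                      ≈⟨ solve 1 (λ d → d := (con (+ 1) :* d :+ d) :- d) refl (det X) ⟩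
    1# * det X + det X - det X ≈⟨ +-congʳ (det-linear i 1# row (λ _ _ _ → refl) (λ _ _ _ → refl)) ⟨
    det X - det X              ≈⟨ -‿inverseʳ _ ⟩
    0#                         ∎
    where
    row : ∀ j → X i j ≈ 1# * X i j + X i j
    row j = trans (Xi≈0 j) (sym (trans (+-cong (trans (*-identityˡ _) (Xi≈0 j)) (Xi≈0 j))
        (+-identityˡ 0#)))

  data Adjacent : ∀ {n} → Fin n → Fin n → Set where
    here  : ∀ {n} → Adjacent {suc (suc n)} zero (suc zero)
    there : ∀ {n} {i j : Fin n} → Adjacent i j → Adjacent (suc i) (suc j)

  Adjacent-punchOut : ∀ {n} {k i j : Fin (suc n)} → Adjacent i j → (p : k ≢ i) (q : k ≢ j) →
                      Adjacent (punchOut p) (punchOut q)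
  Adjacent-punchOut {k = zero}            here      p q = ⊥-elim (p ≡.refl)
  Adjacent-punchOut {k = suc zero}        here      p q = ⊥-elim (q ≡.refl)
  Adjacent-punchOut {n = suc (suc _)} {k = suc (suc k)} here p q = here
  Adjacent-punchOut {k = zero}            (there a) p q = a
  Adjacent-punchOut {n = suc _} {k = suc k} (there a) p q =
    there (Adjacent-punchOut a (p ∘ ≡.cong suc) (q ∘ ≡.cong suc))

  Adjacent-punchIn : ∀ {n} {i j : Fin (suc n)} → Adjacent i j → ∀ r →
                     punchIn i r ≡ punchIn j r ⊎ (punchIn i r ≡ j × punchIn j r ≡ i)
  Adjacent-punchIn here      zero    = inj₂ (≡.refl , ≡.refl)
  Adjacent-punchIn here      (suc r) = inj₁ ≡.refl
  Adjacent-punchIn (there a) zero    = inj₁ ≡.refl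
  Adjacent-punchIn {n = suc _} (there a) (suc r) with Adjacent-punchIn a r
  ... | inj₁ eq       = inj₁ (≡.cong suc eq)
  ... | inj₂ (p , q)  = inj₂ (≡.cong suc p , ≡.cong suc q)

  altsum-cancel : ∀ {n} {i j} {f : Vector Carrier n} → Adjacent i j →
    (∀ k → k ≢ i → k ≢ j → f k ≈ 0#) → f i ≈ f j → altsum f ≈ 0#
  altsum-cancel {f = f} here h eq = begin
    f zero - (f (suc zero) - altsum (λ k → f (suc (suc k))))
      ≈⟨ +-cong eq (-‿cong (+-congˡ (-‿cong (altsum-zero λ k → h (suc (suc k)) (λ ()) (λ ()))))) ⟩
    f (suc zero) - (f (suc zero) - 0#)
      ≈⟨ solve 1 (λ x → x :- (x :- con (+ 0)) := con (+ 0)) refl _ ⟩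
    0# ∎
  altsum-cancel {f = f} (there a) h eq = begin
    f zero - altsum (f ∘ suc)
      ≈⟨ +-cong (h zero (λ ()) (λ ())) (-‿cong (altsum-cancel a
           (λ k p q → h (suc k) (p ∘ Fin.suc-injective) (q ∘ Fin.suc-injective)) eq)) ⟩
    0# - 0#
      ≈⟨ -‿inverseʳ 0# ⟩
    0# ∎

  altsum-swap : ∀ {n} {i j} {f g : Vector Carrier n} → Adjacent i j →
    (∀ k → k ≢ i → k ≢ j → f k ≈ - g k) → f i ≈ g j → f j ≈ g i → altsum f ≈ - altsum g
  altsum-swap {f = f} {g} here h p q = begin
    f zero - (f (suc zero) - altsum (λ k → f (suc (suc k))))
      ≈⟨ +-cong p (-‿cong (+-cong q (-‿cong (altsum-neg λ k → h (suc (suc k)) (λ ()) (λ ()))))) ⟩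
    g (suc zero) - (g zero - - altsum (λ k → g (suc (suc k))))
      ≈⟨ solve 3 (λ x y s → y :- (x :- (:- s)) := :- (x :- (y :- s))) refl _ _ _ ⟩
    - (g zero - (g (suc zero) - altsum (λ k → g (suc (suc k))))) ∎
  altsum-swap {f = f} {g} (there a) h p q = begin
    f zero - altsum (f ∘ suc)
      ≈⟨ +-cong (h zero (λ ()) (λ ())) (-‿cong (altsum-swap a
           (λ k p q → h (suc k) (p ∘ Fin.suc-injective) (q ∘ Fin.suc-injective)) p q)) ⟩
    - g zero - - altsum (g ∘ suc)
      ≈⟨ solve 2 (λ x s → :- x :- (:- s) := :- (x :- s)) refl _ _ ⟩
    - (g zero - altsum (g ∘ suc)) ∎

  -- Minors that keep both equal rows vanish by induction. The two remaining terms have equal minors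
  -- and, the rows being neighbours, opposite signs.
  det-alternating-adjacent : ∀ {n} {i j} {X : Matrix n n} → Adjacent i j →
                             (∀ c → X i c ≈ X j c) → det X ≈ 0#
  det-alternating-adjacent {suc n} {i} {j} {X} a Xi≈Xj = altsum-cancel a other
    (*-cong (Xi≈Xj zero) (det-cong λ r c → same r (suc c)))
    where
    other : ∀ k → k ≢ i → k ≢ j → X k zero * det (minor X k) ≈ 0#
    other k k≢i k≢j = trans (*-congˡ (det-alternating-adjacent
      (Adjacent-punchOut a k≢i k≢j)
      λ c → ≡.subst₂ (λ p q → X p (suc c) ≈ X q (suc c)) (≡punchIn k≢i) (≡punchIn k≢j) (Xi≈Xj (suc c))))
      (zeroʳ _)
    same : ∀ r c → X (punchIn i r) c ≈ X (punchIn j r) c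
    same r c with Adjacent-punchIn a r
    ... | inj₁ eq      = reflexive (≡.cong (λ p → X p c) eq)
    ... | inj₂ (p , q) = ≡.subst₂ (λ p q → X p c ≈ X q c) (≡.sym p) (≡.sym q) (sym (Xi≈Xj c))

  -- Deleting row `i` from `X` and row `j` from `Y` leaves the same minor, at positions whose signs
  -- differ; all other minors are swapped by induction.
  det-swap : ∀ {n} {i j} {X Y : Matrix n n} → Adjacent i j →
    (∀ c → X i c ≈ Y j c) → (∀ c → X j c ≈ Y i c) →
    (∀ k → k ≢ i → k ≢ j → ∀ c → X k c ≈ Y k c) → det X ≈ - det Y
  det-swap {suc n} {i} {j} {X} {Y} a Xi≈Yj Xj≈Yi X≈Y = altsum-swap a other
    (*-cong (Xi≈Yj zero) (det-cong λ r c → left r (suc c)))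
    (*-cong (Xj≈Yi zero) (det-cong λ r c → right r (suc c)))
    where
    other : ∀ k → k ≢ i → k ≢ j → X k zero * det (minor X k) ≈ - (Y k zero * det (minor Y k))
    other k k≢i k≢j = trans
      (*-cong (X≈Y k k≢i k≢j zero) (det-swap {X = minor X k} {minor Y k} (Adjacent-punchOut a k≢i k≢j)
        (λ c → ≡.subst₂ (λ p q → X p (suc c) ≈ Y q (suc c)) (≡punchIn k≢i) (≡punchIn k≢j)
            (Xi≈Yj (suc c)))
        (λ c → ≡.subst₂ (λ p q → X p (suc c) ≈ Y q (suc c)) (≡punchIn k≢j) (≡punchIn k≢i)
            (Xj≈Yi (suc c)))
        (λ r p q c → X≈Y _ (punchIn≢ k≢i r p) (punchIn≢ k≢j r q) (suc c))))
      (solve 2 (λ x d → x :* (:- d) := :- (x :* d)) refl _ _)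
    left : ∀ r c → X (punchIn i r) c ≈ Y (punchIn j r) c
    left r c with Adjacent-punchIn a r
    ... | inj₂ (p , q) = ≡.subst₂ (λ p q → X p c ≈ Y q c) (≡.sym p) (≡.sym q) (Xj≈Yi c)
    ... | inj₁ eq      = ≡.subst (λ p → X (punchIn i r) c ≈ Y p c) eq
      (X≈Y _ (Fin.punchInᵢ≢i i r) (λ e → Fin.punchInᵢ≢i j r (≡.trans (≡.sym eq) e)) c)
    right : ∀ r c → X (punchIn j r) c ≈ Y (punchIn i r) c
    right r c with Adjacent-punchIn a r
    ... | inj₂ (p , q) = ≡.subst₂ (λ p q → X p c ≈ Y q c) (≡.sym q) (≡.sym p) (Xi≈Yj c)
    ... | inj₁ eq      = ≡.subst (λ p → X p c ≈ Y (punchIn i r) c) eq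
      (X≈Y _ (Fin.punchInᵢ≢i i r) (λ e → Fin.punchInᵢ≢i j r (≡.trans (≡.sym eq) e)) c)

  data Below : ∀ {n} → Fin n → Fin n → Set where
    adjacent : ∀ {n} {i j : Fin n} → Adjacent i j → Below i j
    step     : ∀ {n} {i i′ j : Fin n} → Adjacent i i′ → Below i′ j → Below i j

  Below-suc : ∀ {n} {i j : Fin n} → Below i j → Below (suc i) (suc j)
  Below-suc (adjacent a) = adjacent (there a)
  Below-suc (step a b)   = step (there a) (Below-suc b)

  <⇒Below : ∀ {n} {i j : Fin n} → i Fin.< j → Below i j
  <⇒Below {i = zero}  {suc zero}    _ = adjacent here
  <⇒Below {i = zero}  {suc (suc j)} _ = step here (Below-suc (<⇒Below {i = zero} {suc j} (ℕ.s≤s ℕ.z≤n)))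
  <⇒Below {i = suc i} {suc j} (ℕ.s≤s i<j) = Below-suc (<⇒Below i<j)

  module _ {n} (X : Matrix n n) (i j : Fin n) where
    swapRows : Matrix n n
    swapRows k with k Fin.≟ i | k Fin.≟ j
    ... | yes _ | _     = X j
    ... | no _  | yes _ = X i
    ... | no _  | no _  = X k

    swapRows-i : ∀ c → swapRows i c ≡ X j c
    swapRows-i c with i Fin.≟ i
    ... | yes _  = ≡.refl
    ... | no i≢i = ⊥-elim (i≢i ≡.refl)

    swapRows-j : ∀ c → swapRows j c ≡ X i c
    swapRows-j c with j Fin.≟ i | j Fin.≟ j
    ... | yes ≡.refl | _      = ≡.refl
    ... | no _       | yes _  = ≡.refl
    ... | no _       | no j≢j = ⊥-elim (j≢j ≡.refl)

    swapRows-other : ∀ k → k ≢ i → k ≢ j → ∀ c → swapRows k c ≡ X k c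
    swapRows-other k k≢i k≢j c with k Fin.≟ i | k Fin.≟ j
    ... | yes k≡i | _       = ⊥-elim (k≢i k≡i)
    ... | no _    | yes k≡j = ⊥-elim (k≢j k≡j)
    ... | no _    | no _    = ≡.refl

  -- Neighbour swaps change only the sign, so row `i` is moved down until it sits next to its
  -- duplicate.
  det-alternating-below : ∀ {n} {i j} → Below i j → i ≢ j → (X : Matrix n n) →
                          (∀ c → X i c ≈ X j c) → det X ≈ 0#
  det-alternating-below (adjacent a) _ X eq = det-alternating-adjacent a eq
  det-alternating-below {i = i} {j} (step {i′ = i′} a b) i≢j X eq with i′ Fin.≟ j
  ... | yes ≡.refl = det-alternating-adjacent a eq
  ... | no i′≢j = begin
    det X
      ≈⟨ det-swap {Y = swapRows X i i′} a (λ c → sym (reflexive (swapRows-j X i i′ c)))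
           (λ c → sym (reflexive (swapRows-i X i i′ c)))
           (λ k p q c → sym (reflexive (swapRows-other X i i′ k p q c))) ⟩
    - det (swapRows X i i′)
      ≈⟨ -‿cong (det-alternating-below b i′≢j (swapRows X i i′) λ c →
           trans (reflexive (swapRows-j X i i′ c)) (trans (eq c)
             (sym (reflexive (swapRows-other X i i′ j (i≢j ∘ ≡.sym) (i′≢j ∘ ≡.sym) c))))) ⟩
    - 0#
      ≈⟨ -0#≈0# ⟩
    0# ∎

  det-alternating : ∀ {n} {i j} (X : Matrix n n) → i ≢ j → (∀ c → X i c ≈ X j c) → det X ≈ 0#
  det-alternating {i = i} {j} X i≢j Xi≈Xj with Fin.<-cmp i j
  ... | tri< i<j _ _ = det-alternating-below (<⇒Below i<j) i≢j X Xi≈Xj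
  ... | tri≈ _ i≡j _ = ⊥-elim (i≢j i≡j)
  ... | tri> _ _ j<i = det-alternating-below (<⇒Below j<i) (i≢j ∘ ≡.sym) X (λ c → sym (Xi≈Xj c))

  _[_≔_] : ∀ {m n} → Matrix m n → Fin m → Vector Carrier n → Matrix m n
  M [ i ≔ v ] = updateAt M i (const v)

  replaced : ∀ {m n} (M : Matrix m n) i v c → (M [ i ≔ v ]) i c ≡ v c
  replaced M i v c = ≡.cong (λ r → r c) (Vec.updateAt-updates i M)

  unreplaced : ∀ {m n} (M : Matrix m n) i v k → k ≢ i → ∀ c → (M [ i ≔ v ]) k c ≡ M k c
  unreplaced M i v k k≢i c = ≡.cong (λ r → r c) (Vec.updateAt-minimal k i M k≢i)

  det-[≔]-cong : ∀ {n} (M : Matrix n n) k {v w} → (∀ c → v c ≈ w c) →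
                 det (M [ k ≔ v ]) ≈ det (M [ k ≔ w ])
  det-[≔]-cong M k {v} {w} v≈w = det-cong row
    where
    row : ∀ r c → (M [ k ≔ v ]) r c ≈ (M [ k ≔ w ]) r c
    row r c with r Fin.≟ k
    ... | yes ≡.refl = trans (reflexive (replaced M k v c))
        (trans (v≈w c) (sym (reflexive (replaced M k w c))))
    ... | no r≢k = reflexive (≡.trans (unreplaced M k v r r≢k c) (≡.sym (unreplaced M k w r r≢k c)))

  det-[≔]-linear : ∀ {n} (M : Matrix n n) k a v w →
    det (M [ k ≔ (λ c → a * v c + w c) ]) ≈ a * det (M [ k ≔ v ]) + det (M [ k ≔ w ])
  det-[≔]-linear M k a v w = det-linear k a
    (λ c → trans (reflexive (replaced M k _ c))
      (sym (+-cong (*-congˡ (reflexive (replaced M k v c))) (reflexive (replaced M k w c)))))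
    (λ r r≢k c → reflexive (≡.trans (unreplaced M k _ r r≢k c) (≡.sym (unreplaced M k v r r≢k c))))
    (λ r r≢k c → reflexive (≡.trans (unreplaced M k _ r r≢k c) (≡.sym (unreplaced M k w r r≢k c))))

  det-[≔]-sum : ∀ {n m} (M : Matrix n n) k (a : Vector Carrier m) (v : Matrix m n) →
    sum (λ j → a j * det (M [ k ≔ v j ])) ≈ det (M [ k ≔ (λ c → sum (λ j → a j * v j c)) ])
  det-[≔]-sum {m = zero}  M k a v = sym (det-zeroRow k _ λ c → reflexive (replaced M k _ c))
  det-[≔]-sum {m = suc m} M k a v =
    trans (+-congˡ (det-[≔]-sum M k (a ∘ suc) (v ∘ suc))) (sym (det-[≔]-linear M k (a zero) (v zero) _))

  δ : ∀ {n} → Fin n → Fin n → Carrier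
  δ zero    zero    = 1#
  δ zero    (suc j) = 0#
  δ (suc i) zero    = 0#
  δ (suc i) (suc j) = δ i j

  δ-refl : ∀ {n} (i : Fin n) → δ i i ≡ 1#
  δ-refl zero    = ≡.refl
  δ-refl (suc i) = δ-refl i

  δ-≢ : ∀ {n} {i j : Fin n} → i ≢ j → δ i j ≡ 0#
  δ-≢ {i = zero}  {zero}  i≢j = ⊥-elim (i≢j ≡.refl)
  δ-≢ {i = zero}  {suc j} i≢j = ≡.refl
  δ-≢ {i = suc i} {zero}  i≢j = ≡.refl
  δ-≢ {i = suc i} {suc j} i≢j = δ-≢ (i≢j ∘ ≡.cong suc)

  δ-sym : ∀ {n} (i k : Fin n) → δ i k ≡ δ k i
  δ-sym zero    zero    = ≡.refl
  δ-sym zero    (suc k) = ≡.refl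
  δ-sym (suc i) zero    = ≡.refl
  δ-sym (suc i) (suc k) = δ-sym i k

  sum-zero : ∀ {n} {f : Vector Carrier n} → (∀ i → f i ≈ 0#) → sum f ≈ 0#
  sum-zero {n} h = trans (sum-cong-≋ h) (sum-replicate-zero n)

  sum-δ : ∀ {n} (v : Vector Carrier n) i → sum (λ j → v j * δ j i) ≈ v i
  sum-δ v zero    = trans (+-cong (*-identityʳ _) (sum-zero λ j → zeroʳ (v (suc j)))) (+-identityʳ _)
  sum-δ v (suc i) = trans (+-cong (zeroʳ _) (sum-δ (v ∘ suc) i)) (+-identityˡ _)

  sum-linear : ∀ {n} a b (x y v : Vector Carrier n) →
    sum (λ j → (a * x j + b * y j) * v j) ≈ a * sum (λ j → x j * v j) + b * sum (λ j → y j * v j)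
  sum-linear {n} a b x y v = begin
    sum (λ j → (a * x j + b * y j) * v j)
      ≈⟨ sum-cong-≋ (λ j → solve 5 (λ a b x y v → (a :* x :+ b :* y) :* v := a :* (x :* v) :+ b :*
          (y :* v))
           refl a b (x j) (y j) (v j)) ⟩
    sum (λ j → a * (x j * v j) + b * (y j * v j))
      ≈⟨ ∑-distrib-+ {n} (λ j → a * (x j * v j)) (λ j → b * (y j * v j)) ⟩
    sum (λ j → a * (x j * v j)) + sum (λ j → b * (y j * v j))
      ≈⟨ +-cong (sym (*-distribˡ-sum {n} a (λ j → x j * v j)))
          (sym (*-distribˡ-sum {n} b (λ j → y j * v j))) ⟩
    a * sum (λ j → x j * v j) + b * sum (λ j → y j * v j) ∎

  infix 9 _·ᵛ_
  _·ᵛ_ : ∀ {m n} → Matrix m n → Vector Carrier n → Vector Carrier m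
  (M ·ᵛ v) i = sum λ j → M i j * v j

  -- These are the entries of M · adj M: putting row `i` in place of row `k` creates a repeated row
  -- unless `i = k`.
  replace-by-row : ∀ {n} (M : Matrix n n) i k → det (M [ k ≔ M i ]) ≈ det M * δ i k
  replace-by-row M i k with i Fin.≟ k
  ... | no i≢k = begin
    det (M [ k ≔ M i ])  ≈⟨ det-alternating _ i≢k (λ c → reflexive
                              (≡.trans (unreplaced M k (M i) i i≢k c) (≡.sym (replaced M k (M i) c)))) ⟩
    0#                   ≈⟨ zeroʳ _ ⟨
    det M * 0#           ≡⟨ ≡.cong (det M *_) (≡.sym (δ-≢ i≢k)) ⟩
    det M * δ i k        ∎
  ... | yes ≡.refl = begin
    det (M [ k ≔ M k ])  ≈⟨ det-cong row ⟩
    det M                ≈⟨ *-identityʳ _ ⟨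
    det M * 1#           ≡⟨ ≡.cong (det M *_) (≡.sym (δ-refl k)) ⟩
    det M * δ k k        ∎
    where
    row : ∀ r c → (M [ k ≔ M k ]) r c ≈ M r c
    row r c with r Fin.≟ k
    ... | yes ≡.refl = reflexive (replaced M k _ c)
    ... | no r≢k     = reflexive (unreplaced M k _ r r≢k c)

  cramer : ∀ {n} (M : Matrix n n) (u : Vector Carrier n) →
           Σ (Vector Carrier n) λ w → ∀ i → (M ·ᵛ w) i ≈ det M * u i
  cramer {n} M u = w , λ i → begin
    sum (λ j → M i j * sum (λ k → u k * det (M [ k ≔ δ j ])))
      ≈⟨ sum-cong-≋ (λ j → *-distribˡ-sum {n} (M i j) (λ k → u k * det (M [ k ≔ δ j ]))) ⟩
    sum (λ j → sum (λ k → M i j * (u k * det (M [ k ≔ δ j ]))))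
      ≈⟨ ∑-comm {n} {n} (λ j k → M i j * (u k * det (M [ k ≔ δ j ]))) ⟩
    sum (λ k → sum (λ j → M i j * (u k * det (M [ k ≔ δ j ]))))
      ≈⟨ sum-cong-≋ (λ k → column i k) ⟩
    sum (λ k → (det M * u k) * δ k i)
      ≈⟨ sum-δ (λ k → det M * u k) i ⟩
    det M * u i ∎
    where
    w : Vector Carrier n
    -- `det (M [ k ≔ δ j ])` is the cofactor of the entry (k, j), so `w` is the adjugate of `M`
    -- applied to `u`.
    w j = sum λ k → u k * det (M [ k ≔ δ j ])
    column : ∀ i k → sum (λ j → M i j * (u k * det (M [ k ≔ δ j ]))) ≈ (det M * u k) * δ k i
    column i k = begin
      sum (λ j → M i j * (u k * det (M [ k ≔ δ j ])))
        ≈⟨ sum-cong-≋ (λ j → solve 3 (λ m u d → m :* (u :* d) := u :* (m :* d)) refl (M i j) (u k) _) ⟩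
      sum (λ j → u k * (M i j * det (M [ k ≔ δ j ])))
        ≈⟨ *-distribˡ-sum {n} (u k) (λ j → M i j * det (M [ k ≔ δ j ])) ⟨
      u k * sum (λ j → M i j * det (M [ k ≔ δ j ]))
        ≈⟨ *-congˡ (det-[≔]-sum M k (M i) δ) ⟩
      u k * det (M [ k ≔ (λ c → sum (λ j → M i j * δ j c)) ])
        ≈⟨ *-congˡ (det-[≔]-cong M k (sum-δ (M i))) ⟩
      u k * det (M [ k ≔ M i ])
        ≈⟨ *-congˡ (replace-by-row M i k) ⟩
      u k * (det M * δ i k)
        ≡⟨ ≡.cong (λ d → u k * (det M * d)) (δ-sym i k) ⟩
      u k * (det M * δ k i)
        ≈⟨ solve 3 (λ u d e → u :* (d :* e) := d :* u :* e) refl (u k) (det M) _ ⟩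
      (det M * u k) * δ k i ∎

  -- The search for a pivot: without a zero test the alternative is available only under double
  -- negation.
  ¬¬-any : ∀ {n} (f : Vector Carrier n) →
           ¬ ¬ ((∀ i → f i ≈ 0#) ⊎ (∃[ i ] ¬ f i ≈ 0#))
  ¬¬-any {zero}  f k = k (inj₁ λ ())
  ¬¬-any {suc n} f k = ¬¬-any (f ∘ suc) λ where
    (inj₂ (i , fi≉0)) → k (inj₂ (suc i , fi≉0))
    (inj₁ f≈0)        → k (inj₂ (zero , λ f0≈0 → k (inj₁ λ where
      zero    → f0≈0
      (suc i) → f≈0 i)))

  Singular : ∀ {m n} → Matrix m n → Set _
  Singular {n = n} M =
    Σ (Vector Carrier n) λ v → ¬ (∀ i → v i ≈ 0#) × (∀ i → (M ·ᵛ v) i ≈ 0#)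

  module Elimination {n} (M : Matrix (suc n) (suc n)) (r : Fin (suc n)) where
    a : Carrier
    a = M r zero

    -- Elimination without division. It multiplies the determinant by `a` for each treated row,
    -- which is harmless for a determinant that is zero.
    newRow : Fin (suc n) → Vector Carrier (suc n)
    newRow i j = a * M i j + - M i zero * M r j

    -- `t` counts the rows already treated. Consecutive matrices differ in at most one row, so
    -- linearity in that row applies.
    reduced : ℕ → Matrix (suc n) (suc n)
    reduced t i with toℕ i ℕ.<? t | i Fin.≟ r
    ... | yes _ | no _  = newRow i
    ... | yes _ | yes _ = M i
    ... | no _  | _     = M i

    reduced-new : ∀ t i → toℕ i ℕ.< t → i ≢ r → ∀ j → reduced t i j ≡ newRow i j
    reduced-new t i i<t i≢r j with toℕ i ℕ.<? t | i Fin.≟ r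
    ... | yes _   | no _    = ≡.refl
    ... | yes _   | yes i≡r = ⊥-elim (i≢r i≡r)
    ... | no i≮t  | _       = ⊥-elim (i≮t i<t)

    reduced-old : ∀ t i → ¬ toℕ i ℕ.< t → ∀ j → reduced t i j ≡ M i j
    reduced-old t i i≮t j with toℕ i ℕ.<? t | i Fin.≟ r
    ... | yes i<t | _ = ⊥-elim (i≮t i<t)
    ... | no _    | _ = ≡.refl

    reduced-r : ∀ t j → reduced t r j ≡ M r j
    reduced-r t j with toℕ r ℕ.<? t | r Fin.≟ r
    ... | yes _ | no r≢r = ⊥-elim (r≢r ≡.refl)
    ... | yes _ | yes _  = ≡.refl
    ... | no _  | _      = ≡.refl

    reduced-step : ∀ t i → toℕ i ≢ t → ∀ j → reduced (suc t) i j ≡ reduced t i j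
    reduced-step t i i≢t j with toℕ i ℕ.<? suc t | toℕ i ℕ.<? t | i Fin.≟ r
    ... | yes _   | yes _   | no _  = ≡.refl
    ... | yes _   | yes _   | yes _ = ≡.refl
    ... | yes i<t | no i≮t  | _     = ⊥-elim (i≮t (ℕ.≤∧≢⇒< (ℕ.s≤s⁻¹ i<t) i≢t))
    ... | no i≮t  | yes i<t | _     = ⊥-elim (i≮t (ℕ.m≤n⇒m≤1+n i<t))
    ... | no _    | no _    | _     = ≡.refl

    reduced-step-r : ∀ t → toℕ r ≡ t → ∀ i j → reduced (suc t) i j ≡ reduced t i j
    reduced-step-r t r≡t i j = byCases (i Fin.≟ r)
      where
      byCases : Dec (i ≡ r) → reduced (suc t) i j ≡ reduced t i j
      byCases (yes i≡r) = ≡.subst (λ k → reduced (suc t) k j ≡ reduced t k j) (≡.sym i≡r)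
        (≡.trans (reduced-r (suc t) j) (≡.sym (reduced-r t j)))
      byCases (no i≢r)  = reduced-step t i (λ i≡t → i≢r (Fin.toℕ-injective (≡.trans i≡t (≡.sym r≡t)))) j

    -- The new row is `a` times the old one plus a multiple of the pivot row. The first part
    -- contributes zero by induction, the second a determinant with a repeated row.
    det-reduced : det M ≈ 0# → ∀ t → det (reduced t) ≈ 0#
    det-reduced detM≈0 zero = trans (det-cong λ i j → reflexive (reduced-old 0 i (λ ()) j)) detM≈0
    det-reduced detM≈0 (suc t) with t ℕ.<? suc n
    ... | no t≮n = trans (det-cong λ i j → reflexive
        (reduced-step t i (λ i≡t → t≮n (≡.subst (ℕ._< suc n) i≡t (Fin.toℕ<n i))) j))
                         (det-reduced detM≈0 t)
    ... | yes t<n with Fin.fromℕ< t<n | Fin.toℕ-fromℕ< t<n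
    ...   | i | i≡t with i Fin.≟ r
    ...     | yes i≡r = trans (det-cong λ k j → reflexive (reduced-step-r t
                            (≡.subst (λ k → toℕ k ≡ t) i≡r i≡t) k j)) (det-reduced detM≈0 t)
    ...     | no i≢r = begin
      det (reduced (suc t))
        ≈⟨ det-linear i a first
             (λ k k≢i j → reflexive (other k k≢i j))
             (λ k k≢i j → reflexive (≡.trans (other k k≢i j) (≡.sym (unreplaced _ i _ k k≢i j)))) ⟩
      a * det (reduced t) + det (reduced t [ i ≔ (λ j → - M i zero * M r j) ])
        ≈⟨ +-cong (trans (*-congˡ (det-reduced detM≈0 t)) (zeroʳ a)) second ⟩
      0# + 0#
        ≈⟨ +-identityˡ 0# ⟩
      0# ∎
      where
      other : ∀ k → k ≢ i → ∀ j → reduced (suc t) k j ≡ reduced t k j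
      other k k≢i = reduced-step t k (λ k≡t → k≢i (Fin.toℕ-injective (≡.trans k≡t (≡.sym i≡t))))
      first : ∀ j → reduced (suc t) i j ≈ a * reduced t i j +
          (reduced t [ i ≔ (λ j → - M i zero * M r j) ]) i j
      first j = reflexive (≡.trans (reduced-new (suc t) i (ℕ.≤-reflexive (≡.cong suc i≡t)) i≢r j)
        (≡.sym (≡.cong₂ (λ x y → a * x + y)
          (reduced-old t i (λ i<t → ℕ.<-irrefl i≡t i<t) j) (replaced _ i _ j))))
      second : det (reduced t [ i ≔ (λ j → - M i zero * M r j) ]) ≈ 0#
      second = begin
        det (reduced t [ i ≔ (λ j → - M i zero * M r j) ])
          ≈⟨ det-[≔]-cong (reduced t) i (λ j → sym (+-identityʳ _)) ⟩
        det (reduced t [ i ≔ (λ j → - M i zero * M r j + 0#) ])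
          ≈⟨ det-[≔]-linear (reduced t) i (- M i zero) (M r) (λ _ → 0#) ⟩
        - M i zero * det (reduced t [ i ≔ M r ]) + det (reduced t [ i ≔ (λ _ → 0#) ])
          ≈⟨ +-cong (*-congˡ (det-alternating (reduced t [ i ≔ M r ]) i≢r λ j → reflexive
               (≡.trans (replaced (reduced t) i (M r) j)
               (≡.sym (≡.trans (unreplaced (reduced t) i (M r) r (i≢r ∘ ≡.sym) j) (reduced-r t j))))))
               (det-zeroRow i (reduced t [ i ≔ (λ _ → 0#) ]) λ j → reflexive
                   (replaced (reduced t) i (λ _ → 0#) j)) ⟩
        - M i zero * 0# + 0#
          ≈⟨ trans (+-identityʳ _) (zeroʳ _) ⟩
        0# ∎

    R′ : Matrix (suc n) (suc n)
    R′ = reduced (suc n)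

    R′-new : ∀ i → i ≢ r → ∀ j → R′ i j ≡ newRow i j
    R′-new i = reduced-new (suc n) i (Fin.toℕ<n i)

    -- After elimination the pivot is the only entry left in the first column, so a single term of
    -- the expansion survives.
    det-minor : det M ≈ 0# → R′ r zero * det (minor R′ r) ≈ 0#
    det-minor detM≈0 = altsum-single {f = λ i → R′ i zero * det (minor R′ i)} r
      (λ i i≢r → trans (*-congʳ (trans (reflexive (R′-new i i≢r zero))
        (solve 2 (λ a m → a :* m :+ (:- m) :* a := con (+ 0)) refl a (M i zero)))) (zeroˡ _))
      (det-reduced detM≈0 (suc n))

    -- Back substitution: the pivot row determines the first entry.
    lift-kernel : (∀ {y} → a * y ≈ 0# → y ≈ 0#) → Singular (minor R′ r) → Singular M
    lift-kernel cancel (v , v≉0 , Rv≈0) = w , (λ w≈0 → v≉0 λ j → cancel (w≈0 (suc j))) , kills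
      where
      dot : Fin (suc n) → Carrier
      dot i = sum λ j → M i (suc j) * v j
      w : Vector Carrier (suc n)
      w zero    = - dot r
      w (suc j) = a * v j
      row : ∀ i → (M ·ᵛ w) i ≈ a * dot i + - M i zero * dot r
      row i = begin
        M i zero * - dot r + sum (λ j → M i (suc j) * (a * v j))
          ≈⟨ +-congˡ (sum-cong-≋ λ j → solve 3 (λ m a v → m :* (a :* v) := a :* (m :* v)) refl
              (M i (suc j)) a (v j)) ⟩
        M i zero * - dot r + sum (λ j → a * (M i (suc j) * v j))
          ≈⟨ +-congˡ (*-distribˡ-sum {n} a (λ j → M i (suc j) * v j)) ⟨
        M i zero * - dot r + a * dot i
          ≈⟨ solve 4 (λ m d a e → m :* (:- d) :+ a :* e := a :* e :+ (:- m) :* d) refl (M i zero)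
              (dot r) a (dot i) ⟩
        a * dot i + - M i zero * dot r ∎
      kills : ∀ i → (M ·ᵛ w) i ≈ 0#
      kills i with i Fin.≟ r
      ... | yes ≡.refl = trans (row i) (solve 2 (λ a d → a :* d :+ (:- a) :* d := con (+ 0)) refl a
          (dot i))
      ... | no i≢r = begin
        (M ·ᵛ w) i
          ≈⟨ row i ⟩
        a * dot i + - M i zero * dot r
          ≈⟨ sum-linear a (- M i zero) (λ j → M i (suc j)) (λ j → M r (suc j)) v ⟨
        sum (λ j → newRow i (suc j) * v j)
          ≈⟨ sum-cong-≋ (λ j → *-congʳ (reflexive (≡.trans (≡.sym (R′-new i i≢r (suc j)))
               (≡.cong (λ k → R′ k (suc j)) (≡.sym (Fin.punchIn-punchOut (i≢r ∘ ≡.sym))))))) ⟩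
        (minor R′ r ·ᵛ v) (punchOut (i≢r ∘ ≡.sym))
          ≈⟨ Rv≈0 _ ⟩
        0# ∎

  module _ (cancel : ∀ {x y} → ¬ x ≈ 0# → x * y ≈ 0# → y ≈ 0#) (1≉0 : ¬ 1# ≈ 0#) where
    -- `cancel` replaces inverses. A zero first column has the first basis vector in its kernel;
    -- otherwise a pivot is eliminated and the kernel of the smaller minor is lifted. The search for
    -- the pivot is the source of the double negation.
    det≈0⇒singular : ∀ {n} (M : Matrix n n) → det M ≈ 0# → ¬ ¬ Singular M
    det≈0⇒singular {zero}  M 1≈0 k = 1≉0 1≈0
    det≈0⇒singular {suc n} M detM≈0 k = ¬¬-any (λ i → M i zero) λ where
      (inj₁ column≈0) → k (δ zero , (λ δ≈0 → 1≉0 (δ≈0 zero)) , λ i →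
        trans (+-cong (trans (*-congʳ (column≈0 i)) (zeroˡ _)) (sum-zero λ j → zeroʳ (M i (suc j))))
            (+-identityˡ 0#))
      (inj₂ (r , a≉0)) → let open Elimination M r in
        det≈0⇒singular (minor R′ r)
          (cancel (λ R≈0 → a≉0 (trans (reflexive (≡.sym (reduced-r (suc n) zero))) R≈0))
              (det-minor detM≈0))
          λ s → k (lift-kernel (cancel a≉0) s)

-- Determinants under ring homomorphisms

module DetHom where
  open import Data.Fin using (Fin; zero; suc)
  open import Data.Nat using (zero; suc)
  open import Function using (_∘_)
  open import Level using (_⊔_)

  -- φ need not respect the equality of A.
  record RawHomomorphism {c₁ ℓ₁ c₂ ℓ₂ : Level} (A : CommutativeRing c₁ ℓ₁) (B : CommutativeRing c₂ ℓ₂)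
    : Set (c₁ ⊔ c₂ ⊔ ℓ₂) where
    private
      module A = CommutativeRing A
      module B = CommutativeRing B
    field
      φ     : A.Carrier → B.Carrier
      φ-+   : ∀ x y → φ (x A.+ y) B.≈ φ x B.+ φ y
      φ-*   : ∀ x y → φ (x A.* y) B.≈ φ x B.* φ y
      φ-neg : ∀ x → φ (A.- x) B.≈ B.- φ x
      φ-0   : φ A.0# B.≈ B.0#
      φ-1   : φ A.1# B.≈ B.1#

  module _ {c₁ ℓ₁ c₂ ℓ₂ : Level} {A : CommutativeRing c₁ ℓ₁} {B : CommutativeRing c₂ ℓ₂}
    (hom : RawHomomorphism A B) where
    open RawHomomorphism hom
    private
      module A  = CommutativeRing A
      module B  = CommutativeRing B
      module DA = Det A
      module DB = Det B

    altsum-homo : ∀ {n} (f : Fin n → A.Carrier) → φ (DA.altsum f) B.≈ DB.altsum (φ ∘ f)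
    altsum-homo {zero}  f = φ-0
    altsum-homo {suc n} f = B.trans (φ-+ _ _)
        (B.+-cong B.refl (B.trans (φ-neg _) (B.-‿cong (altsum-homo (f ∘ suc)))))

    -- Serves the embedding of the integers and the map sending a complex number to the k-th term of
    -- its sequence, which preserves operations but not equality.
    det-homo : ∀ {n} (M : DA.Matrix n n) → φ (DA.det M) B.≈ DB.det (λ i j → φ (M i j))
    det-homo {zero}  M = φ-1
    det-homo {suc n} M = B.trans (altsum-homo λ i → M i zero A.* DA.det (DA.minor M i))
        (DB.altsum-cong λ i →
      B.trans (φ-* (M i zero) (DA.det (DA.minor M i))) (B.*-cong B.refl (det-homo (DA.minor M i))))

-- Monic polynomials and the characteristic polynomial

module Poly {c ℓ : Level} (R : CommutativeRing c ℓ) where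
  open import Data.Fin as Fin using (Fin; zero; suc; punchOut)
  import Data.Fin.Properties as Fin
  open import Data.Integer using (+_)
  open import Data.Nat using (ℕ; zero; suc)
  open import Data.Product using (Σ; ∃-syntax; _×_; _,_; proj₁; proj₂)
  open import Data.Vec using (Vec; []; _∷_)
  open import Data.Vec.Functional using (Vector)
  open import Function using (_∘_)
  open import Relation.Binary.PropositionalEquality as ≡ using (_≡_)
  open import Relation.Nullary using (yes; no)

  open CommutativeRing R hiding (zero)
  open IntSolver R using (solve; _:+_; _:*_; _:-_; :-_; _:=_; con)
  open import Relation.Binary.Reasoning.Setoid setoid
  open Det R

  eval : ∀ {n} → Vec Carrier n → Carrier → Carrier
  eval []       z = 0#
  eval (c ∷ cs) z = c + z * eval cs z

  -- The coefficient of the leading power is 1 and not part of the vector.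
  evalM : ∀ {n} → Vec Carrier n → Carrier → Carrier
  evalM []       z = 1#
  evalM (c ∷ cs) z = c + z * evalM cs z

  -- The coefficient below the leading one; the polynomial 1 has none and yields a.
  second : ∀ {n} → Carrier → Vec Carrier n → Carrier
  second a []      = a
  second a (c ∷ p) = second c p

  -- The coefficients of c + (x + b) p(x).
  mulAdd : ∀ {n} → Carrier → Carrier → Vec Carrier n → Vec Carrier (suc n)
  mulAdd c b []      = (c + b) ∷ []
  mulAdd c b (d ∷ p) = (c + b * d) ∷ mulAdd d b p

  evalM-mulAdd : ∀ {n} c b (p : Vec Carrier n) z → evalM (mulAdd c b p) z ≈ c + (z + b) * evalM p z
  evalM-mulAdd c b [] z = solve 3 (λ c b z → (c :+ b) :+ z :* con (+ 1) := c :+ (z :+ b) :* con (+ 1))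
      refl c b z
  evalM-mulAdd c b (d ∷ p) z = trans (+-congˡ (*-congˡ (evalM-mulAdd d b p z)))
    (solve 5 (λ c b d z e → (c :+ b :* d) :+ z :* (d :+ (z :+ b) :* e) := c :+ (z :+ b) :*
        (d :+ z :* e))
      refl c b d z (evalM p z))

  second-mulAdd : ∀ {n} a c b (p : Vec Carrier n) → second a (mulAdd c b p) ≈ second c p + b
  second-mulAdd a c b []      = refl
  second-mulAdd a c b (d ∷ p) = second-mulAdd (c + b * d) d b p

  taylor : ∀ {n} (p : Vec Carrier n) z → ∃[ q ] ∀ w → evalM {n} q w ≈ evalM p (z + w)
  taylor []      z = [] , λ w → refl
  taylor (c ∷ p) z with taylor p z
  ... | q , h = mulAdd c z q , λ w → trans (evalM-mulAdd c z q w)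
    (+-congˡ (*-cong (+-comm w z) (h w)))

  -- Synthetic division by z - y: the Horner values at `y` are the coefficients of the quotient, and
  -- the last one is the remainder.
  quotient : ∀ {n} → Vec Carrier (suc n) → Carrier → Vec Carrier n
  quotient (c ∷ [])    y = []
  quotient (c ∷ d ∷ p) y = evalM (d ∷ p) y ∷ quotient (d ∷ p) y

  evalM-quotient : ∀ {n} (p : Vec Carrier (suc n)) y z →
                   evalM p z ≈ evalM p y + (z - y) * evalM (quotient p y) z
  evalM-quotient (c ∷ [])    y z =
    solve 3 (λ c y z → c :+ z :* con (+ 1) := (c :+ y :* con (+ 1)) :+ (z :- y) :* con (+ 1)) refl c y z
  evalM-quotient (c ∷ d ∷ p) y z = trans (+-congˡ (*-congˡ (evalM-quotient (d ∷ p) y z)))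
    (solve 5 (λ c y z e q → c :+ z :* (e :+ (z :- y) :* q) := (c :+ y :* e) :+ (z :- y) :*
        (e :+ z :* q))
      refl c y z (evalM (d ∷ p) y) (evalM (quotient (d ∷ p) y) z))

  -- Vieta's rule for one division: splitting off z - y adds `y` to the second coefficient. Both
  -- polynomials have positive degree, so the default values `a` and `b` are arbitrary.
  second-quotient : ∀ {n} a b (p : Vec Carrier (suc (suc n))) y →
                    second a (quotient p y) ≈ second b p + y
  second-quotient a b (c ∷ d ∷ [])    y = +-congˡ (*-identityʳ y)
  second-quotient a b (c ∷ d ∷ e ∷ p) y = second-quotient (evalM (d ∷ e ∷ p) y) c (d ∷ e ∷ p) y

  IsPoly : ℕ → (Carrier → Carrier) → Set _
  IsPoly d f = Σ (Vec Carrier d) λ p → ∀ z → f z ≈ eval p z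

  IsPoly-resp : ∀ {d f g} → (∀ z → f z ≈ g z) → IsPoly d f → IsPoly d g
  IsPoly-resp h (p , e) = p , λ z → trans (sym (h z)) (e z)

  IsPoly-0 : ∀ d → IsPoly d (λ _ → 0#)
  IsPoly-0 zero    = [] , λ z → refl
  IsPoly-0 (suc d) with IsPoly-0 d
  ... | p , e = (0# ∷ p) , λ z → sym (trans (+-identityˡ _) (trans (*-congˡ (sym (e z))) (zeroʳ z)))

  IsPoly-linear : ∀ {d f g} a → IsPoly d f → IsPoly d g → IsPoly d (λ z → a * f z + g z)
  IsPoly-linear {d} {f} {g} a (p , e) (q , h) = proj₁ (add p q) , λ z →
    trans (+-cong (*-congˡ (e z)) (h z)) (proj₂ (add p q) z)
    where
    add : ∀ {d} (p q : Vec Carrier d) → IsPoly d (λ z → a * eval p z + eval q z)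
    add [] [] = [] , λ z → trans (+-identityʳ _) (zeroʳ a)
    add (x ∷ p) (y ∷ q) = (a * x + y) ∷ proj₁ (add p q) , λ z → begin
      a * (x + z * eval p z) + (y + z * eval q z)
        ≈⟨ solve 6 (λ a x y z e h → a :* (x :+ z :* e) :+ (y :+ z :* h) := (a :* x :+ y) :+ z :*
            (a :* e :+ h))
             refl a x y z (eval p z) (eval q z) ⟩
      (a * x + y) + z * (a * eval p z + eval q z)
        ≈⟨ +-congˡ (*-congˡ (proj₂ (add p q) z)) ⟩
      (a * x + y) + z * eval (proj₁ (add p q)) z ∎

  IsPoly-suc : ∀ {d f} → IsPoly d f → IsPoly (suc d) f
  IsPoly-suc (p , e) = proj₁ (snoc p) , λ z → trans (e z) (proj₂ (snoc p) z)
    where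
    snoc : ∀ {d} (p : Vec Carrier d) → IsPoly (suc d) (eval p)
    snoc []      = (0# ∷ []) , λ z → sym (trans (+-identityˡ _) (zeroʳ z))
    snoc (x ∷ p) = x ∷ proj₁ (snoc p) , λ z → +-congˡ (*-congˡ (proj₂ (snoc p) z))

  IsPoly-mulX : ∀ {d f} → IsPoly d f → IsPoly (suc d) (λ z → z * f z)
  IsPoly-mulX (p , e) = (0# ∷ p) , λ z → trans (*-congˡ (e z)) (sym (+-identityˡ _))

  IsPoly-scale : ∀ {d f} a → IsPoly d f → IsPoly d (λ z → a * f z)
  IsPoly-scale {d} a P = IsPoly-resp (λ z → +-identityʳ _) (IsPoly-linear a P (IsPoly-0 d))

  IsPoly-mulLinear : ∀ {d f} a b → IsPoly d f → IsPoly (suc d) (λ z → (a + z * b) * f z)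
  IsPoly-mulLinear a b P = IsPoly-resp
    (λ z → solve 4 (λ a b z f → a :* f :+ b :* (z :* f) := (a :+ z :* b) :* f) refl a b z _)
    (IsPoly-linear a (IsPoly-suc P) (IsPoly-scale b (IsPoly-mulX P)))

  IsPoly-altsum : ∀ {n d} {f : Fin n → Carrier → Carrier} → (∀ i → IsPoly d (f i)) →
                  IsPoly d (λ z → altsum λ i → f i z)
  IsPoly-altsum {zero}  {d} P = IsPoly-0 d
  IsPoly-altsum {suc n} {d} P = IsPoly-resp
    (λ z → solve 2 (λ x s → (:- con (+ 1)) :* s :+ x := x :- s) refl _ _)
    (IsPoly-linear (- 1#) (IsPoly-altsum (P ∘ suc)) (P zero))

  pencil : ∀ {n} → Matrix n n → Matrix n n → Carrier → Matrix n n
  pencil A B z i j = A i j + z * B i j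

  IsPoly-det : ∀ {n} (A B : Matrix n n) → IsPoly (suc n) (λ z → det (pencil A B z))
  IsPoly-det {zero}  A B = (1# ∷ []) , λ z → sym (trans (+-congˡ (zeroʳ z)) (+-identityʳ 1#))
  IsPoly-det {suc n} A B = IsPoly-altsum λ k →
    IsPoly-mulLinear (A k zero) (B k zero) (IsPoly-det (minor A k) (minor B k))

  -- A row free of the variable lowers the degree by one compared with `IsPoly-det`. This makes the
  -- off-diagonal part of the characteristic polynomial too small to reach its second coefficient.
  IsPoly-det-constantRow : ∀ {n} (A B : Matrix n n) r → (∀ j → B r j ≈ 0#) →
                           IsPoly n (λ z → det (pencil A B z))
  IsPoly-det-constantRow {suc n} A B r Br≈0 = IsPoly-altsum term
    where
    term : ∀ k → IsPoly (suc n) (λ z → pencil A B z k zero * det (minor (pencil A B z) k))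
    term k with k Fin.≟ r
    ... | yes ≡.refl = IsPoly-resp
      (λ z → *-congʳ (sym (trans (+-congˡ (trans (*-congˡ (Br≈0 zero)) (zeroʳ z))) (+-identityʳ _))))
      (IsPoly-scale (A k zero) (IsPoly-det (minor A k) (minor B k)))
    ... | no k≢r = IsPoly-mulLinear (A k zero) (B k zero)
      (IsPoly-det-constantRow (minor A k) (minor B k) (punchOut k≢r) λ j →
        ≡.subst (λ l → B l (suc j) ≈ 0#) (≡punchIn k≢r) (Br≈0 (suc j)))

  char : ∀ {n} → Matrix n n → Carrier → Matrix n n
  char B = pencil (λ i j → - B i j) δ

  char-kernel : ∀ {n} (A : Matrix n n) z (v : Vector Carrier n) i →
                (char A z ·ᵛ v) i ≈ z * v i - (A ·ᵛ v) i
  char-kernel {n} A z v i = begin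
    sum (λ j → (- A i j + z * δ i j) * v j)
      ≈⟨ sum-cong-≋ {n} (λ j → *-congʳ (+-congʳ (solve 1 (λ a → :- a := :- con (+ 1) :* a) refl
          (A i j)))) ⟩
    sum (λ j → (- 1# * A i j + z * δ i j) * v j)
      ≈⟨ sum-linear (- 1#) z (A i) (δ i) v ⟩
    - 1# * (A ·ᵛ v) i + z * sum (λ j → δ i j * v j)
      ≈⟨ +-congˡ (*-congˡ (trans (sum-cong-≋ {n} λ j → trans (*-comm _ _) (*-congˡ
          (reflexive (δ-sym i j)))) (sum-δ v i))) ⟩
    - 1# * (A ·ᵛ v) i + z * v i
      ≈⟨ solve 2 (λ a y → :- con (+ 1) :* a :+ y := y :- a) refl ((A ·ᵛ v) i) (z * v i) ⟩
    z * v i - (A ·ᵛ v) i ∎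

  char-kernel⇒eigen : ∀ {n} (A : Matrix n n) z (v : Vector Carrier n) i →
                      (char A z ·ᵛ v) i ≈ 0# → (A ·ᵛ v) i ≈ z * v i
  char-kernel⇒eigen A z v i h = begin
    (A ·ᵛ v) i                           ≈⟨ solve 2 (λ a y → a := y :- (y :- a)) refl _ _ ⟩
    z * v i - (z * v i - (A ·ᵛ v) i)     ≈⟨ +-congˡ (-‿cong (trans (sym (char-kernel A z v i)) h)) ⟩
    z * v i - 0#                         ≈⟨ solve 1 (λ y → y :- con (+ 0) := y) refl _ ⟩
    z * v i                              ∎

  -- Used with x = vᵢ and y = (A v)ᵢ: if I - A kills the i-th coordinate, an eigenvalue z other than
  -- 1 forces vᵢ to vanish.
  fixed⇒eigen-1 : ∀ {z x y} → y ≈ z * x → 1# * x - y ≈ 0# → (z - 1#) * x ≈ 0#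
  fixed⇒eigen-1 {z} {x} {y} y≈zx h = begin
    (z - 1#) * x          ≈⟨ solve 2 (λ z x → (z :- con (+ 1)) :* x := :- (con (+ 1) :* x :- z :* x))
        refl z x ⟩
    - (1# * x - z * x)    ≈⟨ -‿cong (trans (+-congˡ (-‿cong (sym y≈zx))) h) ⟩
    - 0#                  ≈⟨ solve 0 (:- con (+ 0) := con (+ 0)) refl ⟩
    0#                    ∎

  x-1≈0⇒x≈1 : ∀ {x} → x - 1# ≈ 0# → x ≈ 1#
  x-1≈0⇒x≈1 {x} h = begin
    x                ≈⟨ solve 1 (λ x → x := (x :- con (+ 1)) :+ con (+ 1)) refl x ⟩
    (x - 1#) + 1#    ≈⟨ +-congʳ h ⟩
    0# + 1#          ≈⟨ +-identityˡ 1# ⟩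
    1#               ∎

  private
    -- A correction with `n` coefficients has degree below `n`, so it leaves the two top
    -- coefficients of a monic polynomial of degree n + 1 alone.
    addLow : ∀ {n} (g : Vec Carrier n) (p : Vec Carrier (suc n)) a →
             Σ (Vec Carrier (suc n)) λ q →
               (∀ z → evalM q z ≈ evalM p z + eval g z) × second a q ≈ second a p
    addLow [] p a = p , (λ z → sym (+-identityʳ _)) , refl
    addLow (x ∷ g) (y ∷ p) a with addLow g p y
    ... | q , e , s = (y + x) ∷ q , (λ z → trans (+-congˡ (*-congˡ (e z)))
        (solve 5 (λ x y z e h → y :+ x :+ z :* (e :+ h) := (y :+ z :* e) :+ (x :+ z :* h)) refl x y z
            (evalM p z) (eval g z)))
      , seconds q p s
      where
      seconds : ∀ {m} (q p : Vec Carrier (suc m)) → second y q ≈ second y p → second (y + x) q ≈ second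
          y p
      seconds (_ ∷ _) p s = s

  -- Expansion along the first column. The leading term is z - B₀₀ times the polynomial of the
  -- remaining block; every other minor retains row 0 without its diagonal entry, a row free of z,
  -- and contributes only to lower coefficients.
  charPoly : ∀ {n} (B : Matrix n n) → Σ (Vec Carrier n) λ p →
             (∀ z → evalM p z ≈ det (char B z)) × second 0# p ≈ - sum (λ i → B i i)
  charPoly {zero}  B = [] , (λ z → refl) , solve 0 (con (+ 0) := :- con (+ 0)) refl
  charPoly {suc n} B with charPoly {n} (λ i j → B (suc i) (suc j))
  ... | p , e , s = finish (IsPoly-altsum low)
    where
    low : ∀ k → IsPoly n (λ z → char B z (suc k) zero * det (minor (char B z) (suc k)))
    low k = IsPoly-resp (λ z → *-congʳ (sym (trans (+-congˡ (zeroʳ z)) (+-identityʳ _))))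
      (IsPoly-scale (- B (suc k) zero) (lowMinor {n} {B} k))
      where
      lowMinor : ∀ {n} {B : Matrix (suc n) (suc n)} (k : Fin n) →
                 IsPoly n (λ z → det (minor (char B z) (suc k)))
      lowMinor {suc n} {B} k = IsPoly-det-constantRow (minor (λ i j → - B i j) (suc k))
          (minor δ (suc k)) zero (λ j → refl)
    finish : IsPoly n (λ z → altsum λ k → char B z (suc k) zero * det (minor (char B z) (suc k))) → _
    finish (g , h) with addLow (Data.Vec.map -_ g) (mulAdd 0# (- B zero zero) p) 0#
    ... | q , f , t = q , (λ z → begin
        evalM q z
          ≈⟨ f z ⟩
        evalM (mulAdd 0# (- B zero zero) p) z + eval (Data.Vec.map -_ g) z
          ≈⟨ +-cong (evalM-mulAdd 0# _ p z) (eval-neg g z) ⟩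
        (0# + (z + - B zero zero) * evalM p z) + - eval g z
          ≈⟨ +-cong (solve 3 (λ z b e → con (+ 0) :+ (z :+ b) :* e := (b :+ z :* con (+ 1)) :* e) refl z
              _ _)
               (-‿cong (sym (h z))) ⟩
        (- B zero zero + z * 1#) * evalM p z + - _
          ≈⟨ +-congʳ (*-congˡ (e z)) ⟩
        det (char B z) ∎)
      , trans t (trans (second-mulAdd 0# 0# _ p) (trans (+-congʳ s)
          (solve 2 (λ s b → :- s :+ (:- b) := :- (b :+ s)) refl _ _)))
      where
      eval-neg : ∀ {d} (g : Vec Carrier d) z → eval (Data.Vec.map -_ g) z ≈ - eval g z
      eval-neg []      z = solve 0 (con (+ 0) := :- con (+ 0)) refl
      eval-neg (x ∷ g) z = trans (+-congˡ (*-congˡ (eval-neg g z)))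
        (solve 3 (λ x z e → :- x :+ z :* (:- e) := :- (x :+ z :* e)) refl x z (eval g z))

-- Archimedean ordered fields with decidable order

module Ordered where
  open import Algebra.Structures using (IsCommutativeRing)
  open import Data.Integer using (+_)
  open import Data.Nat as ℕ using (ℕ; zero; suc)
  open import Data.Product using (∃-syntax; _×_; _,_)
  open import Data.Sum using (_⊎_; inj₁; inj₂)
  open import Level using (0ℓ)
  open import Relation.Binary.PropositionalEquality as ≡ using (_≡_; _≢_; refl; sym; trans; cong; cong₂; subst)
  open import Relation.Binary.Definitions using (Asymmetric; _Respects₂_)
  open import Relation.Binary.Structures using (IsPreorder)
  open import Relation.Nullary using (¬_; Dec; yes; no; contradiction)

  record OrderedField : Set₁ where
    infixl 6 _+_
    infixl 7 _*_
    infix  8 -_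
    field
      Carrier           : Set
      _+_ _*_           : Carrier → Carrier → Carrier
      -_                : Carrier → Carrier
      0# 1#             : Carrier
      isCommutativeRing : IsCommutativeRing _≡_ _+_ _*_ -_ 0# 1#
      NonNeg            : Carrier → Set
      nonNeg?           : ∀ a → Dec (NonNeg a)
      nonNeg-total      : ∀ a → NonNeg a ⊎ NonNeg (- a)
      nonNeg-antisym    : ∀ {a} → NonNeg a → NonNeg (- a) → a ≡ 0#
      nonNeg-+          : ∀ {a b} → NonNeg a → NonNeg b → NonNeg (a + b)
      nonNeg-*          : ∀ {a b} → NonNeg a → NonNeg b → NonNeg (a * b)
      inverse           : ∀ a → a ≢ 0# → ∃[ b ] a * b ≡ 1#
      1≢0               : 1# ≢ 0#

    commutativeRing : CommutativeRing 0ℓ 0ℓ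
    commutativeRing = record { isCommutativeRing = isCommutativeRing }

    field
      archimedean : ∀ a → ∃[ n ] NonNeg (IntSolver.fromℤ commutativeRing (+ n) + - a)

  module Order (K : OrderedField) where
    open OrderedField K public
    open CommutativeRing commutativeRing public
      using (_-_; +-comm; *-comm; *-identityˡ; *-identityʳ; +-identityˡ; +-identityʳ; *-assoc; +-assoc;
          zeroˡ; zeroʳ)
    open IntSolver commutativeRing public
      using (fromℤ; fromℤ-+; fromℤ-*; fromℤ-neg; solve; _:+_; _:*_; _:-_; :-_; _:=_; con)

    infix 4 _≤_ _<_
    _≤_ _<_ : Carrier → Carrier → Set
    a ≤ b = NonNeg (b - a)
    a < b = ¬ b ≤ a

    _≤?_ : ∀ a b → Dec (a ≤ b)
    a ≤? b = nonNeg? (b - a)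

    -- The pattern of the estimates that follow: a combination of nonnegative quantities which the
    -- ring solver identifies with `b - a`.
    by : ∀ {a b d} → NonNeg d → d ≡ b - a → a ≤ b
    by h e = subst NonNeg e h

    nonNeg : ∀ {a} → 0# ≤ a → NonNeg a
    nonNeg h = subst NonNeg (solve 1 (λ a → a :- con (+ 0) := a) refl _) h

    0≤ : ∀ {a} → NonNeg a → 0# ≤ a
    0≤ h = by h (solve 1 (λ a → a := a :- con (+ 0)) refl _)

    nonNeg-sq : ∀ a → NonNeg (a * a)
    nonNeg-sq a with nonNeg-total a
    ... | inj₁ h = nonNeg-* h h
    ... | inj₂ h = subst NonNeg (solve 1 (λ a → (:- a) :* (:- a) := a :* a) refl a) (nonNeg-* h h)

    nonNeg-1 : NonNeg 1#
    nonNeg-1 = subst NonNeg (*-identityʳ 1#) (nonNeg-sq 1#)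

    nonNeg-0 : NonNeg 0#
    nonNeg-0 = subst NonNeg (zeroˡ 0#) (nonNeg-sq 0#)

    ≤-reflexive : ∀ {a b} → a ≡ b → a ≤ b
    ≤-reflexive {a} refl = by nonNeg-0 (solve 1 (λ a → con (+ 0) := a :- a) refl a)

    ≤-refl : ∀ {a} → a ≤ a
    ≤-refl = ≤-reflexive refl

    ≤-trans : ∀ {a b c} → a ≤ b → b ≤ c → a ≤ c
    ≤-trans {a} {b} {c} h k = by (nonNeg-+ h k)
      (solve 3 (λ a b c → (b :- a) :+ (c :- b) := c :- a) refl a b c)

    ≤-antisym : ∀ {a b} → a ≤ b → b ≤ a → a ≡ b
    ≤-antisym {a} {b} h k = begin
      a            ≡⟨ solve 2 (λ a b → a := b :- (b :- a)) refl a b ⟩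
      b - (b - a)  ≡⟨ cong (λ x → b - x) (nonNeg-antisym h
          (subst NonNeg (solve 2 (λ a b → a :- b := :- (b :- a)) refl a b) k)) ⟩
      b - 0#       ≡⟨ solve 1 (λ b → b :- con (+ 0) := b) refl b ⟩
      b            ∎
      where open ≡.≡-Reasoning

    ≤-total : ∀ a b → a ≤ b ⊎ b ≤ a
    ≤-total a b with nonNeg-total (b - a)
    ... | inj₁ h = inj₁ h
    ... | inj₂ h = inj₂ (by h (solve 2 (λ a b → :- (b :- a) := a :- b) refl a b))

    <⇒≤ : ∀ {a b} → a < b → a ≤ b
    <⇒≤ {a} {b} h with ≤-total a b
    ... | inj₁ k = k
    ... | inj₂ k = contradiction k h

    <-irrefl : ∀ {a b} → a ≡ b → ¬ a < b
    <-irrefl refl h = h ≤-refl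

    <-≤-trans : ∀ {a b c} → a < b → b ≤ c → a < c
    <-≤-trans h k c≤a = h (≤-trans k c≤a)

    ≤-<-trans : ∀ {a b c} → a ≤ b → b < c → a < c
    ≤-<-trans h k c≤a = k (≤-trans c≤a h)

    <-trans : ∀ {a b c} → a < b → b < c → a < c
    <-trans h k = <-≤-trans h (<⇒≤ k)

    0<- : ∀ {a b} → a < b → 0# < b - a
    0<- {a} {b} a<b h = a<b (by h (solve 2 (λ a b → con (+ 0) :- (b :- a) := a :- b) refl a b))

    ≤-isPreorder : IsPreorder _≡_ _≤_
    ≤-isPreorder = record { isEquivalence = ≡.isEquivalence ; reflexive = ≤-reflexive ; trans = ≤-trans }

    <-asym : Asymmetric _<_
    <-asym h k = h (<⇒≤ k)

    <-resp-≡ : _<_ Respects₂ _≡_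
    <-resp-≡ = ≡.resp₂ _<_

    module ≤-Reasoning where
      open import Relation.Binary.Reasoning.Base.Triple
        ≤-isPreorder <-asym <-trans <-resp-≡ <⇒≤ <-≤-trans ≤-<-trans public

    +-mono-≤ : ∀ {a b c d} → a ≤ b → c ≤ d → a + c ≤ b + d
    +-mono-≤ {a} {b} {c} {d} h k = by (nonNeg-+ h k)
      (solve 4 (λ a b c d → (b :- a) :+ (d :- c) := (b :+ d) :- (a :+ c)) refl a b c d)

    *-monoˡ-≤ : ∀ {a b c} → 0# ≤ a → b ≤ c → a * b ≤ a * c
    *-monoˡ-≤ {a} {b} {c} h k = by (nonNeg-* (nonNeg h) k)
      (solve 3 (λ a b c → a :* (c :- b) := a :* c :- a :* b) refl a b c)

    *-monoʳ-≤ : ∀ {a b c} → 0# ≤ a → b ≤ c → b * a ≤ c * a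
    *-monoʳ-≤ {a} {b} {c} h k = by (nonNeg-* (nonNeg h) k)
      (solve 3 (λ a b c → a :* (c :- b) := c :* a :- b :* a) refl a b c)

    *-mono-≤ : ∀ {a b c d} → 0# ≤ a → 0# ≤ d → a ≤ b → c ≤ d → a * c ≤ b * d
    *-mono-≤ 0≤a 0≤d h k = ≤-trans (*-monoˡ-≤ 0≤a k) (*-monoʳ-≤ 0≤d h)

    neg-mono-≤ : ∀ {a b} → a ≤ b → - b ≤ - a
    neg-mono-≤ {a} {b} h = by h (solve 2 (λ a b → b :- a := :- a :- :- b) refl a b)

    0≤+ : ∀ {a b} → 0# ≤ a → 0# ≤ b → 0# ≤ a + b
    0≤+ h k = 0≤ (nonNeg-+ (nonNeg h) (nonNeg k))

    0≤* : ∀ {a b} → 0# ≤ a → 0# ≤ b → 0# ≤ a * b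
    0≤* h k = 0≤ (nonNeg-* (nonNeg h) (nonNeg k))

    0≤sq : ∀ a → 0# ≤ a * a
    0≤sq a = 0≤ (nonNeg-sq a)

    0≤1 : 0# ≤ 1#
    0≤1 = 0≤ nonNeg-1

    0<1 : 0# < 1#
    0<1 h = 1≢0 (≤-antisym h 0≤1)

    +-cancel-≤ : ∀ {a b c} → a + c ≤ b + c → a ≤ b
    +-cancel-≤ {a} {b} {c} h = by h (solve 3 (λ a b c → (b :+ c) :- (a :+ c) := b :- a) refl a b c)

    +-mono-<-≤ : ∀ {a b c d} → a < b → c ≤ d → a + c < b + d
    +-mono-<-≤ {a} {b} {c} {d} h k g = h (by (nonNeg-+ g k)
      (solve 4 (λ a b c d → ((a :+ c) :- (b :+ d)) :+ (d :- c) := a :- b) refl a b c d))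

    0<+ : ∀ {a b} → 0# < a → 0# ≤ b → 0# < a + b
    0<+ h k = subst (_< _) (+-identityˡ 0#) (+-mono-<-≤ h k)

    <⇒≢ : ∀ {a b} → a < b → b ≢ a
    <⇒≢ h e = h (≤-reflexive e)

    0≤∧≢⇒0< : ∀ {a} → 0# ≤ a → a ≢ 0# → 0# < a
    0≤∧≢⇒0< h a≢0 k = a≢0 (≤-antisym k h)

    *-cancelˡ-0 : ∀ {a b} → a ≢ 0# → a * b ≡ 0# → b ≡ 0#
    *-cancelˡ-0 {a} {b} a≢0 ab≡0 with inverse a a≢0
    ... | a⁻¹ , e = begin
      b              ≡⟨ sym (*-identityˡ b) ⟩
      1# * b         ≡⟨ cong (_* b) (sym e) ⟩
      a * a⁻¹ * b    ≡⟨ solve 3 (λ a i b → a :* i :* b := i :* (a :* b)) refl a a⁻¹ b ⟩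
      a⁻¹ * (a * b)  ≡⟨ cong (a⁻¹ *_) ab≡0 ⟩
      a⁻¹ * 0#       ≡⟨ zeroʳ a⁻¹ ⟩
      0#             ∎
      where open ≡.≡-Reasoning

    0<* : ∀ {a b} → 0# < a → 0# < b → 0# < a * b
    0<* h k = 0≤∧≢⇒0< (0≤* (<⇒≤ h) (<⇒≤ k)) λ e → <⇒≢ k (*-cancelˡ-0 (<⇒≢ h) e)

    *-cancelˡ-≤ : ∀ {a b c} → 0# < a → a * b ≤ a * c → b ≤ c
    *-cancelˡ-≤ {a} {b} {c} 0<a h with ≤-total b c
    ... | inj₁ k = k
    ... | inj₂ k = ≤-reflexive (begin
      b            ≡⟨ solve 2 (λ b c → b := c :+ (b :- c)) refl b c ⟩
      c + (b - c)  ≡⟨ cong (λ x → c + x) (*-cancelˡ-0 (<⇒≢ 0<a)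
          (trans (solve 3 (λ a b c → a :* (b :- c) := a :* b :- a :* c) refl a b c)
                        (nonNeg-antisym (*-monoˡ-≤ (<⇒≤ 0<a) k)
                            (subst NonNeg (solve 2 (λ x y → y :- x := :- (x :- y)) refl (a * b) (a * c))
                            h)))) ⟩
      c + 0#       ≡⟨ +-identityʳ c ⟩
      c            ∎)
      where open ≡.≡-Reasoning

    inverse⁺ : ∀ {a} → 0# < a → ∃[ b ] 0# < b × a * b ≡ 1#
    inverse⁺ {a} 0<a with inverse a (<⇒≢ 0<a)
    ... | b , e = b , 0<b , e
      where
      0<b : 0# < b
      0<b b≤0 = 0<1 (subst (_≤ 0#) e (by (nonNeg-* (nonNeg (<⇒≤ 0<a)) b≤0)
        (solve 2 (λ a b → a :* (con (+ 0) :- b) := con (+ 0) :- a :* b) refl a b)))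

    infixr 8 _^_
    _^_ : Carrier → ℕ → Carrier
    a ^ zero  = 1#
    a ^ suc n = a * a ^ n

    0≤^ : ∀ {a} n → 0# ≤ a → 0# ≤ a ^ n
    0≤^ zero    h = 0≤1
    0≤^ (suc n) h = 0≤* h (0≤^ n h)

    0<^ : ∀ {a} n → 0# < a → 0# < a ^ n
    0<^ zero    h = 0<1
    0<^ (suc n) h = 0<* h (0<^ n h)

    1≤^ : ∀ {a} n → 1# ≤ a → 1# ≤ a ^ n
    1≤^ zero    h = ≤-refl
    1≤^ (suc n) h = ≤-trans (≤-reflexive (sym (*-identityˡ 1#)))
      (*-mono-≤ 0≤1 (0≤^ n (≤-trans 0≤1 h)) h (1≤^ n h))

    ^≤1 : ∀ {a} n → 0# ≤ a → a ≤ 1# → a ^ n ≤ 1#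
    ^≤1 zero    h k = ≤-refl
    ^≤1 (suc n) h k = ≤-trans (*-mono-≤ h 0≤1 k (^≤1 n h k)) (≤-reflexive (*-identityˡ 1#))

    ^-mono-≤ : ∀ {a b} n → 0# ≤ a → a ≤ b → a ^ n ≤ b ^ n
    ^-mono-≤ zero    h k = ≤-refl
    ^-mono-≤ (suc n) h k = *-mono-≤ h (0≤^ n (≤-trans h k)) k (^-mono-≤ n h k)

    ^-distrib-* : ∀ a b n → (a * b) ^ n ≡ a ^ n * b ^ n
    ^-distrib-* a b zero    = sym (*-identityˡ 1#)
    ^-distrib-* a b (suc n) = trans (cong (a * b *_) (^-distrib-* a b n))
      (solve 4 (λ a b x y → a :* b :* (x :* y) := a :* x :* (b :* y)) refl a b (a ^ n) (b ^ n))

    ^-+ : ∀ a m n → a ^ (m ℕ.+ n) ≡ a ^ m * a ^ n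
    ^-+ a zero    n = sym (*-identityˡ _)
    ^-+ a (suc m) n = trans (cong (a *_) (^-+ a m n)) (sym (*-assoc a _ _))

    1^ : ∀ n → 1# ^ n ≡ 1#
    1^ zero    = refl
    1^ (suc n) = trans (*-identityˡ _) (1^ n)

    *-mono-< : ∀ {a b c d} → 0# ≤ a → 0# ≤ c → a < b → c < d → a * c < b * d
    *-mono-< {a} {b} {c} {d} 0≤a 0≤c a<b c<d bd≤ac = 0<* (0<- a<b) 0<d (≤-trans
      (by (nonNeg-+ bd≤ac (nonNeg-* (nonNeg 0≤a) (<⇒≤ c<d)))
        (solve 4 (λ a b c d → ((a :* c) :- (b :* d)) :+ a :* (d :- c) := con (+ 0) :- (b :- a) :* d)
            refl a b c d)) ≤-refl)
      where
      0<d : 0# < d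
      0<d = ≤-<-trans 0≤c c<d

    ^-mono-< : ∀ {a b} n → 0# ≤ a → a < b → a ^ suc n < b ^ suc n
    ^-mono-< zero    h k = λ g → k (≤-trans (≤-reflexive (sym (*-identityʳ _)))
        (≤-trans g (≤-reflexive (*-identityʳ _))))
    ^-mono-< {a} (suc n) h k = *-mono-< h (0≤^ (suc n) h) k (^-mono-< n h k)

    -- Takes the place of extracting roots, which the field need not contain.
    ^-cancel-≤ : ∀ {a b} n → 0# ≤ b → a ^ suc n ≤ b ^ suc n → a ≤ b
    ^-cancel-≤ {a} {b} n h k with a ≤? b
    ... | yes g = g
    ... | no g  = contradiction k (^-mono-< n h g)

    ∣_∣ : Carrier → Carrier
    ∣ a ∣ with nonNeg? a
    ... | yes _ = a
    ... | no _  = - a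

    ∣∣-cases : ∀ a → (NonNeg a × ∣ a ∣ ≡ a) ⊎ (NonNeg (- a) × ∣ a ∣ ≡ - a)
    ∣∣-cases a with nonNeg? a
    ... | yes h = inj₁ (h , refl)
    ... | no h with nonNeg-total a
    ...   | inj₁ k = contradiction k h
    ...   | inj₂ k = inj₂ (k , refl)

    0≤∣∣ : ∀ a → 0# ≤ ∣ a ∣
    0≤∣∣ a with ∣∣-cases a
    ... | inj₁ (h , e) = subst (0# ≤_) (sym e) (0≤ h)
    ... | inj₂ (h , e) = subst (0# ≤_) (sym e) (0≤ h)

    a≤∣a∣ : ∀ a → a ≤ ∣ a ∣
    a≤∣a∣ a with ∣∣-cases a
    ... | inj₁ (h , e) = ≤-reflexive (sym e)
    ... | inj₂ (h , e) = subst (a ≤_) (sym e)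
        (by (nonNeg-+ h h) (solve 1 (λ a → :- a :+ :- a := :- a :- a) refl a))

    -a≤∣a∣ : ∀ a → - a ≤ ∣ a ∣
    -a≤∣a∣ a with ∣∣-cases a
    ... | inj₁ (h , e) = subst (- a ≤_) (sym e)
        (by (nonNeg-+ h h) (solve 1 (λ a → a :+ a := a :- (:- a)) refl a))
    ... | inj₂ (h , e) = ≤-reflexive (sym e)

    ∣∣≤ : ∀ {a b} → a ≤ b → - a ≤ b → ∣ a ∣ ≤ b
    ∣∣≤ {a} h k with ∣∣-cases a
    ... | inj₁ (_ , e) = subst (_≤ _) (sym e) h
    ... | inj₂ (_ , e) = subst (_≤ _) (sym e) k

    ∣-∣ : ∀ a → ∣ - a ∣ ≡ ∣ a ∣
    ∣-∣ a = ≤-antisym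
      (∣∣≤ (-a≤∣a∣ a) (≤-trans (≤-reflexive (solve 1 (λ a → :- (:- a) := a) refl a)) (a≤∣a∣ a)))
      (∣∣≤ (≤-trans (≤-reflexive (solve 1 (λ a → a := :- (:- a)) refl a)) (-a≤∣a∣ (- a))) (a≤∣a∣ (- a)))

    ∣+∣ : ∀ a b → ∣ a + b ∣ ≤ ∣ a ∣ + ∣ b ∣
    ∣+∣ a b = ∣∣≤ (+-mono-≤ (a≤∣a∣ a) (a≤∣a∣ b))
      (≤-trans (≤-reflexive (solve 2 (λ a b → :- (a :+ b) := :- a :+ :- b) refl a b))
          (+-mono-≤ (-a≤∣a∣ a) (-a≤∣a∣ b)))

    nonNeg⇒∣∣≡ : ∀ {a} → NonNeg a → ∣ a ∣ ≡ a
    nonNeg⇒∣∣≡ {a} h = ≤-antisym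
      (∣∣≤ ≤-refl (by (nonNeg-+ h h) (solve 1 (λ a → a :+ a := a :- (:- a)) refl a))) (a≤∣a∣ a)

    nonPos⇒∣∣≡ : ∀ {a} → NonNeg (- a) → ∣ a ∣ ≡ - a
    nonPos⇒∣∣≡ {a} h = trans (sym (∣-∣ a)) (nonNeg⇒∣∣≡ h)

    ∣*∣ : ∀ a b → ∣ a * b ∣ ≡ ∣ a ∣ * ∣ b ∣
    ∣*∣ a b with ∣∣-cases a | ∣∣-cases b
    ... | inj₁ (h , e) | inj₁ (k , f) = trans (nonNeg⇒∣∣≡ (nonNeg-* h k)) (sym (cong₂ _*_ e f))
    ... | inj₁ (h , e) | inj₂ (k , f) = trans
        (nonPos⇒∣∣≡ (subst NonNeg (solve 2 (λ a b → a :* (:- b) := :- (a :* b)) refl a b)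
        (nonNeg-* h k)))
        (trans (solve 2 (λ a b → :- (a :* b) := a :* (:- b)) refl a b) (sym (cong₂ _*_ e f)))
    ... | inj₂ (h , e) | inj₁ (k , f) = trans
        (nonPos⇒∣∣≡ (subst NonNeg (solve 2 (λ a b → (:- a) :* b := :- (a :* b)) refl a b)
        (nonNeg-* h k)))
        (trans (solve 2 (λ a b → :- (a :* b) := (:- a) :* b) refl a b) (sym (cong₂ _*_ e f)))
    ... | inj₂ (h , e) | inj₂ (k , f) = trans
        (nonNeg⇒∣∣≡ (subst NonNeg (solve 2 (λ a b → (:- a) :* (:- b) := a :* b) refl a b)
        (nonNeg-* h k)))
        (trans (solve 2 (λ a b → a :* b := (:- a) :* (:- b)) refl a b) (sym (cong₂ _*_ e f)))

    ∣∣≤0⇒≡0 : ∀ {a} → ∣ a ∣ ≤ 0# → a ≡ 0#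
    ∣∣≤0⇒≡0 {a} h = ≤-antisym (≤-trans (a≤∣a∣ a) h)
      (by (nonNeg-* nonNeg-1 (≤-trans (-a≤∣a∣ a) h))
          (solve 1 (λ a → con (+ 1) :* (con (+ 0) :- (:- a)) := a :- con (+ 0)) refl a))

    fromℤ-suc : ∀ n → fromℤ (+ suc n) ≡ 1# + fromℤ (+ n)
    fromℤ-suc n = fromℤ-+ (+ 1) (+ n)

    fromℤ-nonNeg : ∀ n → 0# ≤ fromℤ (+ n)
    fromℤ-nonNeg zero    = ≤-refl
    fromℤ-nonNeg (suc n) = subst (0# ≤_) (sym (fromℤ-suc n)) (0≤+ 0≤1 (fromℤ-nonNeg n))

    0<fromℤ-suc : ∀ n → 0# < fromℤ (+ suc n)
    0<fromℤ-suc n = subst (0# <_) (sym (fromℤ-suc n)) (0<+ 0<1 (fromℤ-nonNeg n))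

    -- Bernoulli's inequality; with the Archimedean property it yields explicit growth and decay
    -- rates of powers.
    1+n·τ≤[1+τ]^n : ∀ n {τ} → 0# ≤ τ → 1# + fromℤ (+ n) * τ ≤ (1# + τ) ^ n
    1+n·τ≤[1+τ]^n zero    {τ} 0≤τ = ≤-reflexive
        (solve 1 (λ τ → con (+ 1) :+ con (+ 0) :* τ := con (+ 1)) refl τ)
    1+n·τ≤[1+τ]^n (suc n) {τ} 0≤τ = begin
      1# + fromℤ (+ suc n) * τ
        ≡⟨ cong (λ s → 1# + s * τ) (fromℤ-suc n) ⟩
      1# + (1# + fromℤ (+ n)) * τ
        ≤⟨ by (nonNeg-* (nonNeg (fromℤ-nonNeg n)) (nonNeg-sq τ))
             (solve 2 (λ n τ → n :* (τ :* τ) := (con (+ 1) :+ τ) :* (con (+ 1) :+ n :* τ) :- (con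
                 (+ 1) :+ (con (+ 1) :+ n) :* τ))
               refl (fromℤ (+ n)) τ) ⟩
      (1# + τ) * (1# + fromℤ (+ n) * τ)
        ≤⟨ *-monoˡ-≤ (0≤+ 0≤1 0≤τ) (1+n·τ≤[1+τ]^n n 0≤τ) ⟩
      (1# + τ) ^ suc n ∎
      where open ≤-Reasoning

    archimedean′ : ∀ a {b} → 0# < b → ∃[ n ] a ≤ fromℤ (+ n) * b
    archimedean′ a {b} 0<b with inverse⁺ 0<b
    ... | i , 0<i , e with archimedean (a * i)
    ...   | n , h = n , ≤-trans (≤-reflexive (begin
        a            ≡⟨ sym (*-identityʳ a) ⟩
        a * 1#       ≡⟨ cong (a *_) (sym e) ⟩
        a * (b * i)  ≡⟨ solve 3 (λ a b i → a :* (b :* i) := a :* i :* b) refl a b i ⟩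
        a * i * b    ∎)) (*-monoʳ-≤ (<⇒≤ 0<b) h)
      where open ≡.≡-Reasoning

    minimum⁺ : ∀ {a b} → 0# < a → 0# < b → ∃[ c ] 0# < c × c ≤ a × c ≤ b
    minimum⁺ {a} {b} 0<a 0<b with ≤-total a b
    ... | inj₁ a≤b = a , 0<a , ≤-refl , a≤b
    ... | inj₂ b≤a = b , 0<b , b≤a , ≤-refl

    maximum : ∀ a b → ∃[ c ] a ≤ c × b ≤ c
    maximum a b with ≤-total a b
    ... | inj₁ a≤b = b , a≤b , ≤-refl
    ... | inj₂ b≤a = a , ≤-refl , b≤a

open Ordered

-- Gaussian numbers over an ordered field

module ComplexNumbers where
  open import Data.Integer using (+_)
  open import Data.Product using (∃-syntax; _×_; _,_; proj₁; proj₂)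
  open import Data.Sum using (inj₁; inj₂)
  open import Level using (0ℓ)
  open import Relation.Binary.PropositionalEquality as ≡ using (_≡_; _≢_; refl; sym; trans; cong; cong₂)

  -- Stated for a ring with its own equality, since the laws serve both the Gaussian numbers with
  -- `_≡_` and the limits with `_≈ᶜ_`.
  module ComplexLaws {c ℓ : Level} (R : CommutativeRing c ℓ) where
    open CommutativeRing R hiding (refl; sym; trans)
    private module R = CommutativeRing R
    open IntSolver R

    infixl 6 _⊕_
    infixl 7 _⊗_
    _⊕_ _⊗_ : Carrier × Carrier → Carrier × Carrier → Carrier × Carrier
    (a , b) ⊕ (c , d) = a + c , b + d
    (a , b) ⊗ (c , d) = a * c - b * d , a * d + b * c

    infix 4 _≋_
    _≋_ : Carrier × Carrier → Carrier × Carrier → Set ℓ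
    (a , b) ≋ (c , d) = (a ≈ c) × (b ≈ d)

    ⊗-assoc : ∀ x y z → (x ⊗ y) ⊗ z ≋ x ⊗ (y ⊗ z)
    ⊗-assoc (a , b) (c , d) (e , f) =
        solve 6 (λ a b c d e f → (a :* c :- b :* d) :* e :- (a :* d :+ b :* c) :* f
                              := a :* (c :* e :- d :* f) :- b :* (c :* f :+ d :* e)) R.refl a b c d e f
      , solve 6 (λ a b c d e f → (a :* c :- b :* d) :* f :+ (a :* d :+ b :* c) :* e
                              := a :* (c :* f :+ d :* e) :+ b :* (c :* e :- d :* f)) R.refl a b c d e f

    ⊗-comm : ∀ x y → x ⊗ y ≋ y ⊗ x
    ⊗-comm (a , b) (c , d) =
        solve 4 (λ a b c d → a :* c :- b :* d := c :* a :- d :* b) R.refl a b c d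
      , solve 4 (λ a b c d → a :* d :+ b :* c := c :* b :+ d :* a) R.refl a b c d

    ⊗-identityˡ : ∀ x → (1# , 0#) ⊗ x ≋ x
    ⊗-identityˡ (a , b) =
        solve 2 (λ a b → con (+ 1) :* a :- con (+ 0) :* b := a) R.refl a b
      , solve 2 (λ a b → con (+ 1) :* b :+ con (+ 0) :* a := b) R.refl a b

    ⊗-distribˡ : ∀ x y z → x ⊗ (y ⊕ z) ≋ (x ⊗ y) ⊕ (x ⊗ z)
    ⊗-distribˡ (a , b) (c , d) (e , f) =
        solve 6 (λ a b c d e f → a :* (c :+ e) :- b :* (d :+ f)
                              := (a :* c :- b :* d) :+ (a :* e :- b :* f)) R.refl a b c d e f
      , solve 6 (λ a b c d e f → a :* (d :+ f) :+ b :* (c :+ e)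
                              := (a :* d :+ b :* c) :+ (a :* f :+ b :* e)) R.refl a b c d e f

  module Gaussian (K : OrderedField) where
    open Order K
    open ComplexLaws commutativeRing using (⊗-assoc; ⊗-comm; ⊗-identityˡ; ⊗-distribˡ)
    private
      module K = CommutativeRing commutativeRing

    F : Set
    F = Carrier × Carrier

    infixl 6 _+F_
    infixl 7 _*F_
    _+F_ _*F_ : F → F → F
    (a , b) +F (c , d) = a + c , b + d
    (a , b) *F (c , d) = a * c - b * d , a * d + b * c

    -F_ : F → F
    -F (a , b) = - a , - b

    0F 1F : F
    0F = 0# , 0#
    1F = 1# , 0#

    private
      pair : ∀ {a b c d : Carrier} → (a ≡ c) × (b ≡ d) → (a , b) ≡ (c , d)
      pair (e , f) = cong₂ _,_ e f

      *F-comm : ∀ x y → x *F y ≡ y *F x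
      *F-comm x y = pair (⊗-comm x y)

      *F-identityˡ : ∀ x → 1F *F x ≡ x
      *F-identityˡ x = pair (⊗-identityˡ x)

      *F-distribˡ : ∀ x y z → x *F (y +F z) ≡ x *F y +F x *F z
      *F-distribˡ x y z = pair (⊗-distribˡ x y z)

    ring : CommutativeRing 0ℓ 0ℓ
    ring = record
      { Carrier = F ; _≈_ = _≡_ ; _+_ = _+F_ ; _*_ = _*F_ ; -_ = -F_ ; 0# = 0F ; 1# = 1F
      ; isCommutativeRing = record
        { isRing = record
          { +-isAbelianGroup = record
            { isGroup = record
              { isMonoid = record
                { isSemigroup = record
                  { isMagma = record { isEquivalence = ≡.isEquivalence ; ∙-cong = cong₂ _+F_ }
                  ; assoc   = λ (a , b) (c , d) (e , f) → cong₂ _,_ (+-assoc a c e) (+-assoc b d f) }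
                ; identity = (λ (a , b) → cong₂ _,_ (+-identityˡ a) (+-identityˡ b))
                           , (λ (a , b) → cong₂ _,_ (+-identityʳ a) (+-identityʳ b)) }
              ; inverse = (λ (a , b) → cong₂ _,_ (K.-‿inverseˡ a) (K.-‿inverseˡ b))
                        , (λ (a , b) → cong₂ _,_ (K.-‿inverseʳ a) (K.-‿inverseʳ b))
              ; ⁻¹-cong = cong -F_ }
            ; comm = λ (a , b) (c , d) → cong₂ _,_ (+-comm a c) (+-comm b d) }
          ; *-cong     = cong₂ _*F_
          ; *-assoc    = λ x y z → pair (⊗-assoc x y z)
          ; *-identity = *F-identityˡ , λ x → trans (*F-comm x 1F) (*F-identityˡ x)
          ; distrib    = *F-distribˡ , λ x y z → trans (*F-comm (y +F z) x)
              (trans (*F-distribˡ x y z) (cong₂ _+F_ (*F-comm x y) (*F-comm x z))) }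
        ; *-comm = *F-comm } }

    private
      module S = IntSolver ring

    infixl 6 _-F_
    _-F_ : F → F → F
    z -F w = z +F (-F w)

    re im : F → Carrier
    re = proj₁
    im = proj₂

    -- The 1-norm needs no square root and is still submultiplicative. The exactly multiplicative
    -- quantity is the squared modulus `N`, comparable to it by N ≤ ‖·‖² ≤ 2N.
    ‖_‖ : F → Carrier
    ‖ a , b ‖ = ∣ a ∣ + ∣ b ∣

    0≤‖‖ : ∀ z → 0# ≤ ‖ z ‖
    0≤‖‖ (a , b) = 0≤+ (0≤∣∣ a) (0≤∣∣ b)

    ‖+‖ : ∀ z w → ‖ z +F w ‖ ≤ ‖ z ‖ + ‖ w ‖
    ‖+‖ (a , b) (c , d) = ≤-trans (+-mono-≤ (∣+∣ a c) (∣+∣ b d)) (≤-reflexive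
      (solve 4 (λ a b c d → (a :+ c) :+ (b :+ d) := (a :+ b) :+ (c :+ d)) refl _ _ _ _))

    ‖-‖ : ∀ z → ‖ -F z ‖ ≡ ‖ z ‖
    ‖-‖ (a , b) = cong₂ _+_ (∣-∣ a) (∣-∣ b)

    ‖*‖ : ∀ z w → ‖ z *F w ‖ ≤ ‖ z ‖ * ‖ w ‖
    ‖*‖ (a , b) (c , d) = begin
      ∣ a * c - b * d ∣ + ∣ a * d + b * c ∣
        ≤⟨ +-mono-≤ (∣+∣ (a * c) (- (b * d))) (∣+∣ (a * d) (b * c)) ⟩
      (∣ a * c ∣ + ∣ - (b * d) ∣) + (∣ a * d ∣ + ∣ b * c ∣)
        ≡⟨ cong₂ _+_ (cong₂ _+_ (∣*∣ a c) (trans (∣-∣ (b * d)) (∣*∣ b d)))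
            (cong₂ _+_ (∣*∣ a d) (∣*∣ b c)) ⟩
      (∣ a ∣ * ∣ c ∣ + ∣ b ∣ * ∣ d ∣) + (∣ a ∣ * ∣ d ∣ + ∣ b ∣ * ∣ c ∣)
        ≡⟨ solve 4 (λ a b c d → (a :* c :+ b :* d) :+ (a :* d :+ b :* c) := (a :+ b) :* (c :+ d)) refl _
            _ _ _ ⟩
      (∣ a ∣ + ∣ b ∣) * (∣ c ∣ + ∣ d ∣) ∎
      where open ≤-Reasoning

    ∣re∣≤‖‖ : ∀ z → ∣ re z ∣ ≤ ‖ z ‖
    ∣re∣≤‖‖ (a , b) = by (nonNeg (0≤∣∣ b)) (solve 2 (λ a b → b := (a :+ b) :- a) refl ∣ a ∣ ∣ b ∣)

    ∣im∣≤‖‖ : ∀ z → ∣ im z ∣ ≤ ‖ z ‖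
    ∣im∣≤‖‖ (a , b) = by (nonNeg (0≤∣∣ a)) (solve 2 (λ a b → a := (a :+ b) :- b) refl ∣ a ∣ ∣ b ∣)

    ‖K‖ : ∀ {a} → 0# ≤ a → ‖ a , 0# ‖ ≡ a
    ‖K‖ h = trans (cong₂ _+_ (nonNeg⇒∣∣≡ (nonNeg h)) (nonNeg⇒∣∣≡ nonNeg-0)) (+-identityʳ _)

    ‖0‖ : ‖ 0F ‖ ≡ 0#
    ‖0‖ = ‖K‖ ≤-refl

    ‖1‖ : ‖ 1F ‖ ≡ 1#
    ‖1‖ = ‖K‖ 0≤1

    ‖‖≤0⇒≡0 : ∀ z → ‖ z ‖ ≤ 0# → z ≡ 0F
    ‖‖≤0⇒≡0 (a , b) h = cong₂ _,_ (∣∣≤0⇒≡0 (≤-trans (∣re∣≤‖‖ (a , b)) h))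
        (∣∣≤0⇒≡0 (≤-trans (∣im∣≤‖‖ (a , b)) h))

    N : F → Carrier
    N (a , b) = a * a + b * b

    0≤N : ∀ z → 0# ≤ N z
    0≤N (a , b) = 0≤+ (0≤sq a) (0≤sq b)

    N-* : ∀ z w → N (z *F w) ≡ N z * N w
    N-* (a , b) (c , d) = solve 4 (λ a b c d →
      (a :* c :- b :* d) :* (a :* c :- b :* d) :+ (a :* d :+ b :* c) :* (a :* d :+ b :* c)
      := (a :* a :+ b :* b) :* (c :* c :+ d :* d)) refl a b c d

    ∣∣² : ∀ a → ∣ a ∣ * ∣ a ∣ ≡ a * a
    ∣∣² a with ∣∣-cases a
    ... | inj₁ (_ , e) = cong₂ _*_ e e

    ... | inj₂ (_ , e) = trans (cong₂ _*_ e e) (solve 1 (λ a → (:- a) :* (:- a) := a :* a) refl a)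

    N≤‖‖² : ∀ z → N z ≤ ‖ z ‖ * ‖ z ‖
    N≤‖‖² (a , b) = by (nonNeg-+ (nonNeg-* (nonNeg (0≤∣∣ a)) (nonNeg (0≤∣∣ b)))
        (nonNeg-* (nonNeg (0≤∣∣ a)) (nonNeg (0≤∣∣ b))))
      (trans (solve 2 (λ a b → a :* b :+ a :* b := (a :+ b) :* (a :+ b) :-
          (a :* a :+ b :* b)) refl ∣ a ∣ ∣ b ∣)
        (cong (λ s → (∣ a ∣ + ∣ b ∣) * (∣ a ∣ + ∣ b ∣) - s) (cong₂ _+_ (∣∣² a) (∣∣² b))))

    2K : Carrier
    2K = 1# + 1#

    ‖‖²≤2N : ∀ z → ‖ z ‖ * ‖ z ‖ ≤ 2K * N z
    ‖‖²≤2N (a , b) = by (nonNeg-sq (∣ a ∣ - ∣ b ∣))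
      (trans (solve 2 (λ a b → (a :- b) :* (a :- b) := (con (+ 1) :+ con (+ 1)) :* (a :* a :+ b :* b) :-
          (a :+ b) :* (a :+ b)) refl ∣ a ∣ ∣ b ∣)
        (cong (λ s → 2K * s - (∣ a ∣ + ∣ b ∣) * (∣ a ∣ + ∣ b ∣)) (cong₂ _+_ (∣∣² a) (∣∣² b))))

    invF : ∀ z → z ≢ 0F → ∃[ w ] z *F w ≡ 1F
    invF z@(a , b) z≢0 = (a * i , (- b) * i) , cong₂ _,_ (trans (real a b i) (proj₂ inv))
        (imaginary a b i)
      where
      N≢0 : N z ≢ 0#
      N≢0 e = z≢0 (‖‖≤0⇒≡0 z (^-cancel-≤ 1 ≤-refl (≤-trans
        (≤-trans (≤-reflexive (cong (‖ z ‖ *_) (*-identityʳ _))) (‖‖²≤2N z))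
        (≤-reflexive (trans (cong (2K *_) e) (trans (zeroʳ 2K) (sym (zeroˡ _))))))))
      inv : ∃[ i ] N z * i ≡ 1#
      inv = inverse (N z) N≢0
      i : Carrier
      i = proj₁ inv
      real : ∀ a b i → a * (a * i) - b * (- b * i) ≡ (a * a + b * b) * i
      real = solve 3 (λ a b i → a :* (a :* i) :- b :* (:- b :* i) := (a :* a :+ b :* b) :* i) refl
      imaginary : ∀ a b i → a * (- b * i) + b * (a * i) ≡ 0#
      imaginary = solve 3 (λ a b i → a :* (:- b :* i) :+ b :* (a :* i) := con (+ 0)) refl

open ComplexNumbers

-- Directions in which a monomial decreases

module Direction (K : OrderedField) where
  open import Data.Empty using (⊥-elim)
  open import Data.Integer as ℤ using (ℤ; +_; -[1+_])
  open import Data.Nat as ℕ using (ℕ; zero; suc)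
  open import Data.Product using (∃-syntax; _×_; _,_; proj₁; proj₂)
  open import Data.Sum using (inj₁; inj₂)
  open import Relation.Binary.PropositionalEquality using (_≡_; _≢_; refl; sym; trans; cong; cong₂; subst)
  open import Relation.Nullary using (¬_; yes; no)
  import Data.Nat.Properties as ℕ

  open Order K
  open Gaussian K
  open import Algebra.Properties.Semiring.Exp (CommutativeRing.semiring ring) using () renaming (_^_ to _^F_) public
  open import Algebra.Properties.CommutativeSemiring.Exp (CommutativeRing.commutativeSemiring ring) using () renaming (^-distrib-* to ^F-distrib-*) public
  private
    module F = CommutativeRing ring

  IsInteger : Carrier → Set
  IsInteger x = ∃[ i ] x ≡ fromℤ i

  IsInteger-con : ∀ i → IsInteger (fromℤ i)
  IsInteger-con i = i , refl

  IsInteger-+ : ∀ {x y} → IsInteger x → IsInteger y → IsInteger (x + y)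
  IsInteger-+ (i , refl) (j , refl) = i ℤ.+ j , sym (fromℤ-+ i j)

  IsInteger-* : ∀ {x y} → IsInteger x → IsInteger y → IsInteger (x * y)
  IsInteger-* (i , refl) (j , refl) = i ℤ.* j , sym (fromℤ-* i j)

  IsInteger-neg : ∀ {x} → IsInteger x → IsInteger (- x)
  IsInteger-neg (i , refl) = ℤ.- i , sym (fromℤ-neg i)

  private
    -- Powers of 3 + 4i are congruent to 3 + 4i modulo 5, hence never real.
    oblique : Carrier → Carrier → F
    oblique a b = fromℤ (+ 5) * a + fromℤ (+ 3) , fromℤ (+ 5) * b + fromℤ (+ 4)

    Oblique : F → Set
    Oblique z = ∃[ a ] ∃[ b ] IsInteger a × IsInteger b × z ≡ oblique a b

    Oblique-* : ∀ {z w} → Oblique z → Oblique w → Oblique (z *F w)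
    Oblique-* (a , b , Ia , Ib , refl) (c , d , Ic , Id , refl) =
      _ , _ ,
      IsInteger-+ (IsInteger-* (IsInteger-con (+ 5))
          (IsInteger-+ (IsInteger-* Ia Ic) (IsInteger-neg (IsInteger-* Ib Id))))
        (IsInteger-+ (IsInteger-* (IsInteger-con (+ 3)) (IsInteger-+ Ia Ic))
          (IsInteger-+ (IsInteger-* (IsInteger-con -[1+ 3 ]) (IsInteger-+ Ib Id))
              (IsInteger-con -[1+ 1 ]))) ,
      IsInteger-+ (IsInteger-* (IsInteger-con (+ 5))
          (IsInteger-+ (IsInteger-* Ia Id) (IsInteger-* Ib Ic)))
        (IsInteger-+ (IsInteger-* (IsInteger-con (+ 4)) (IsInteger-+ Ia Ic))
          (IsInteger-+ (IsInteger-* (IsInteger-con (+ 3)) (IsInteger-+ Ib Id)) (IsInteger-con (+ 4)))) ,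
      cong₂ _,_ (real a b c d) (imaginary a b c d)
      where
      real : ∀ a b c d → _
      real = solve 4 (λ a b c d →
        (con (+ 5) :* a :+ con (+ 3)) :* (con (+ 5) :* c :+ con (+ 3)) :- (con (+ 5) :* b :+ con (+ 4))
            :* (con (+ 5) :* d :+ con (+ 4))
        := con (+ 5) :* (con (+ 5) :* (a :* c :+ :- (b :* d)) :+
            (con (+ 3) :* (a :+ c) :+ (con -[1+ 3 ] :* (b :+ d) :+ con -[1+ 1 ])))
           :+ con (+ 3)) refl
      imaginary : ∀ a b c d → _
      imaginary = solve 4 (λ a b c d →
        (con (+ 5) :* a :+ con (+ 3)) :* (con (+ 5) :* d :+ con (+ 4)) :+ (con (+ 5) :* b :+ con (+ 4))
            :* (con (+ 5) :* c :+ con (+ 3))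
        := con (+ 5) :* (con (+ 5) :* (a :* d :+ b :* c) :+
            (con (+ 4) :* (a :+ c) :+ (con (+ 3) :* (b :+ d) :+ con (+ 4))))
           :+ con (+ 4)) refl

    -- 5b + 4 has no integer zero: it is at least 4 for b ≥ 0 and at most -1 for b < 0.
    im-oblique : ∀ {z} → Oblique z → im z ≢ 0#
    im-oblique (_ , b , _ , (+ n , refl) , refl) e =
      <⇒≢ (subst (0# <_) (+-comm _ _) (0<+ (0<fromℤ-suc 3) (0≤* (fromℤ-nonNeg 5) (fromℤ-nonNeg n)))) e
    im-oblique (_ , b , _ , (-[1+ n ] , refl) , refl) e =
      <⇒≢ (0<+ 0<1 (0≤* (fromℤ-nonNeg 5) (fromℤ-nonNeg n))) (trans
        (trans (rearrange (fromℤ (+ n))) (cong (λ x → - (fromℤ (+ 5) * (- x) + fromℤ (+ 4))) (sym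
            (fromℤ-suc n))))
        (trans (cong -_ e) (solve 0 (:- con (+ 0) := con (+ 0)) refl)))
      where
      rearrange : ∀ x → 1# + fromℤ (+ 5) * x ≡ - (fromℤ (+ 5) * (- (1# + x)) + fromℤ (+ 4))
      rearrange = solve 1 (λ x → con (+ 1) :+ con (+ 5) :* x := :-
          (con (+ 5) :* (:- (con (+ 1) :+ x)) :+ con (+ 4))) refl

    three+four·i : F
    three+four·i = fromℤ (+ 3) , fromℤ (+ 4)

    Oblique-base : Oblique three+four·i
    Oblique-base = 0# , 0# , IsInteger-con (+ 0) , IsInteger-con (+ 0) , cong₂ _,_
      (solve 0 (con (+ 3) := con (+ 5) :* con (+ 0) :+ con (+ 3)) refl)
      (solve 0 (con (+ 4) := con (+ 5) :* con (+ 0) :+ con (+ 4)) refl)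

    Oblique-^ : ∀ {z} k → Oblique z → Oblique (z ^F suc k)
    Oblique-^ {z} zero    o = subst Oblique (sym (F.*-identityʳ z)) o
    Oblique-^ {z} (suc k) o = Oblique-* o (Oblique-^ k o)

    square^ : ℕ → F → F
    square^ zero    z = z
    square^ (suc t) z = square^ t (z *F z)

    Oblique-square^ : ∀ t {z} → Oblique z → Oblique (square^ t z)
    Oblique-square^ zero    o = o
    Oblique-square^ (suc t) o = Oblique-square^ t (Oblique-* o o)

    -- Turning the (k + 1)-st power of 3 + 4i by repeated squaring is the same as taking the (k +
    -- 1)-st power of a turned 3 + 4i, which is the `w` wanted.
    square^-^ : ∀ t z k → square^ t (z ^F k) ≡ square^ t z ^F k
    square^-^ zero    z k = refl
    square^-^ (suc t) z k = trans (cong (square^ t) (sym (^F-distrib-* z z k))) (square^-^ t (z *F z) k)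

    -- Squaring at least doubles the slope as long as the real part stays nonnegative.
    Turns : F → Set
    Turns z = ∃[ t ] re (square^ t z) < 0#

    turn-square : ∀ z → Turns (z *F z) → Turns z
    turn-square z (t , h) = suc t , h

    doubled-slope : ∀ z p → 0# ≤ re z → re z ≤ fromℤ (+ 2) * p * ∣ im z ∣ →
                    re (z *F z) ≤ p * ∣ im (z *F z) ∣
    doubled-slope (x , y) p 0≤x h = begin
      x * x - y * y
        ≤⟨ by (nonNeg-sq y) (solve 2 (λ x y → y :* y := x :* x :- (x :* x :- y :* y)) refl x y) ⟩
      x * x
        ≤⟨ *-monoˡ-≤ 0≤x h ⟩
      x * (fromℤ (+ 2) * p * ∣ y ∣)
        ≡⟨ solve 3 (λ x p y → x :* (con (+ 2) :* p :* y) := p :* (con (+ 2) :* x :* y)) refl x p ∣ y ∣ ⟩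
      p * (fromℤ (+ 2) * x * ∣ y ∣)
        ≡⟨ cong (λ a → p * (a * ∣ y ∣)) (sym (nonNeg⇒∣∣≡ (nonNeg (0≤* (fromℤ-nonNeg 2) 0≤x)))) ⟩
      p * (∣ fromℤ (+ 2) * x ∣ * ∣ y ∣)
        ≡⟨ cong (p *_) (sym (∣*∣ (fromℤ (+ 2) * x) y)) ⟩
      p * ∣ fromℤ (+ 2) * x * y ∣
        ≡⟨ cong (λ a → p * ∣ a ∣) (solve 2 (λ x y → con (+ 2) :* x :* y := x :* y :+ y :* x) refl x y) ⟩
      p * ∣ x * y + y * x ∣ ∎
      where open ≤-Reasoning

    re-square≤0 : ∀ z → 0# ≤ re z → re z ≤ ∣ im z ∣ → re (z *F z) ≤ 0#
    re-square≤0 (x , y) 0≤x x≤∣y∣ = by (*-mono-≤ 0≤x (0≤∣∣ y) x≤∣y∣ x≤∣y∣)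
      (trans (cong (λ s → s - x * x) (∣∣² y))
          (solve 2 (λ x y → y :* y :- x :* x := con (+ 0) :- (x :* x :- y :* y)) refl x y))

    im-square≡0 : ∀ z → re z ≡ 0# → im (z *F z) ≡ 0#
    im-square≡0 (x , y) refl = solve 1 (λ y → con (+ 0) :* y :+ y :* con (+ 0) := con (+ 0)) refl y

    -- Each squaring halves the bound on re / |im|. Once re ≤ |im|, the square has nonpositive real
    -- part; were that part zero, the fourth power would be real, which obliqueness excludes.
    turn : ∀ s z → Oblique z → re z ≤ fromℤ (+ 2) ^ s * ∣ im z ∣ → Turns z
    turn s z o h with 0# ≤? re z
    ... | no re<0 = 0 , re<0
    turn zero z o h | yes 0≤x with 0# ≤? re (z *F z)
    ... | no <0  = turn-square z (0 , <0)
    ... | yes 0≤ = ⊥-elim (im-oblique (Oblique-* (Oblique-* o o) (Oblique-* o o)) (im-square≡0 (z *F z)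
      (≤-antisym (re-square≤0 z 0≤x (≤-trans h (≤-reflexive (*-identityˡ _)))) 0≤)))
    turn (suc s) z o h | yes 0≤x =
      turn-square z (turn s (z *F z) (Oblique-* o o) (doubled-slope z (fromℤ (+ 2) ^ s) 0≤x h))

    SecondQuadrant : ℕ → Set
    SecondQuadrant k = ∃[ w ] re (w ^F suc k) < 0# × im (w ^F suc k) ≢ 0#

    abstract
      second-quadrant : ∀ k → SecondQuadrant k
      second-quadrant k =
          square^ t three+four·i
        , subst (λ z → re z < 0#) (square^-^ t three+four·i (suc k)) (proj₂ turned)
        , subst (λ z → im z ≢ 0#) (square^-^ t three+four·i (suc k)) (im-oblique (Oblique-square^ t o))
        where
        v : F
        v = three+four·i ^F suc k
        o : Oblique v
        o = Oblique-^ k Oblique-base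
        0<∣im∣ : 0# < ∣ im v ∣
        0<∣im∣ = 0≤∧≢⇒0< (0≤∣∣ _) λ e → im-oblique o (∣∣≤0⇒≡0 (≤-reflexive e))
        n : ℕ
        n = proj₁ (archimedean′ (re v) 0<∣im∣)
        turned : ∃[ t ] re (square^ t v) < 0#
        turned = turn n v o (≤-trans (proj₂ (archimedean′ (re v) 0<∣im∣))
          -- n ≤ 1 + n ≤ 2ⁿ turns the Archimedean bound on the slope into the power of 2 that `turn`
          -- consumes.
          (*-monoʳ-≤ (0≤∣∣ _) (≤-trans
            (by nonNeg-1 (solve 1 (λ n → con (+ 1) := (con (+ 1) :+ n :* con (+ 1)) :- n) refl (fromℤ
                (+ n))))
            (1+n·τ≤[1+τ]^n n 0≤1))))
        t : ℕ
        t = proj₁ turned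

    conj : F → F
    conj (a , b) = a , - b

    conj-^ : ∀ w k → conj w ^F k ≡ conj (w ^F k)
    conj-^ w zero    = cong₂ _,_ refl (solve 0 (con (+ 0) := :- con (+ 0)) refl)
    conj-^ w (suc k) = trans (cong (conj w *F_) (conj-^ w k)) (cong₂ _,_
      (solve 4 (λ a b c d → a :* c :- (:- b) :* (:- d) := a :* c :- b :* d) refl _ _ _ _)
      (solve 4 (λ a b c d → a :* (:- d) :+ (:- b) :* c := :- (a :* d :+ b :* c)) refl _ _ _ _))

    1F-^ : ∀ k → 1F ^F k ≡ 1F
    1F-^ zero    = refl
    1F-^ (suc k) = trans (F.*-identityˡ _) (1F-^ k)

    -- Substitute for an exact (k + 1)-st root of a negative multiple of the conjugate of `c`: a
    -- power pointing only roughly against `c` suffices. The candidates 1, `w` and `conj w` serve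
    -- every `c`, which makes `κ` and `S` uniform.
    Directions : ℕ → Carrier → Carrier → Set
    Directions k κ S = ∀ c → ∃[ w ] ‖ w ‖ ≤ S × re (c *F (w ^F suc k)) ≤ - (κ * ‖ c ‖)

    -- The origin lies inside the triangle spanned by 1, y and the conjugate of y
    -- when Re y < 0 and Im y ≠ 0.
    module Triangle (k : ℕ) (w : F) (α β i j κ : Carrier) (y≡ : w ^F suc k ≡ (- α , β))
      (0<α : 0# < α) (0<i : 0# < i) (0<j : 0# < j) (0<κ : 0# < κ)
      (αi≡1 : α * i ≡ 1#) (βj≡1 : ∣ β ∣ * j ≡ 1#) (Tκ≡1 : (1# + (i + (1# + α) * j)) * κ ≡ 1#) where

      -- Let m = κ‖c‖. If 1 and the better of y and its conjugate all failed, then |c₁| ≤ (1 + 1/α)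
      -- m and |c₂| < ((1 + α)/|β|) m. As κ is the reciprocal of 1 + 1/α + (1 + α)/|β|, adding these
      -- gives ‖c‖ < ‖c‖.
      squeeze : ∀ c₁ c₂ → - (κ * ‖ c₁ , c₂ ‖) < c₁ →
                ¬ - (κ * ‖ c₁ , c₂ ‖) < - (α * c₁) - ∣ β ∣ * ∣ c₂ ∣
      squeeze c₁ c₂ A B = <-irrefl (sym total) (0<+ (0<* 0<j 0<X) 0≤Y)
        where
        m X Y : Carrier
        m = κ * ‖ c₁ , c₂ ‖
        X = (1# + α) * m - ∣ β ∣ * ∣ c₂ ∣
        Y = m + i * m - ∣ c₁ ∣
        0≤m : 0# ≤ m
        0≤m = 0≤* (<⇒≤ 0<κ) (0≤‖‖ (c₁ , c₂))
        0<X : 0# < X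
        0<X = subst (0# <_) (identity α c₁ m (∣ β ∣ * ∣ c₂ ∣))
            (0<+ (0<- B) (0≤* (<⇒≤ 0<α) (<⇒≤ (0<- A))))
          where
          identity : ∀ α c m q → (- (α * c) - q) - - m + α * (c - - m) ≡ (1# + α) * m - q
          identity = solve 4 (λ α c m q → (:- (α :* c) :- q) :- :- m :+ α :* (c :- :- m) :=
              (con (+ 1) :+ α) :* m :- q) refl
        0≤Y : 0# ≤ Y
        0≤Y = 0≤ (∣∣≤ upper lower)
          where
          upper : c₁ ≤ m + i * m
          upper = by (nonNeg-+ (nonNeg 0≤m) (nonNeg-* (nonNeg (<⇒≤ 0<i)) (nonNeg-+ (<⇒≤ B)
              (nonNeg (0≤* (0≤∣∣ β) (0≤∣∣ c₂))))))
            (trans (identity α c₁ m (∣ β ∣ * ∣ c₂ ∣) i)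
                (trans (cong (λ u → m + i * m - u * c₁) αi≡1)
                (cong (λ u → m + i * m - u) (*-identityˡ c₁))))
            where
            identity : ∀ α c m q i → m + i * (((- (α * c) - q) - - m) + q) ≡ m + i * m - (α * i) * c
            identity = solve 5 (λ α c m q i → m :+ i :* (((:- (α :* c) :- q) :- :- m) :+ q) := m :+ i :*
                m :- (α :* i) :* c) refl
          lower : - c₁ ≤ m + i * m
          lower = by (nonNeg-+ (<⇒≤ A) (nonNeg (0≤* (<⇒≤ 0<i) 0≤m)))
            (solve 3 (λ c m n → (c :- :- m) :+ n := (m :+ n) :- :- c) refl c₁ m (i * m))
        total : j * X + Y ≡ 0#
        total = trans (identity α (∣ β ∣) i j κ ∣ c₁ ∣ ∣ c₂ ∣)
          (trans (cong₂ (λ t u → t * (∣ c₁ ∣ + ∣ c₂ ∣) - u * ∣ c₂ ∣ - ∣ c₁ ∣) Tκ≡1 βj≡1)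
            (solve 2 (λ p q → con (+ 1) :* (p :+ q) :- con (+ 1) :* q :- p := con (+ 0)) refl ∣ c₁ ∣ ∣
                c₂ ∣))
          where
          identity : ∀ α β i j κ p q → j * ((1# + α) * (κ * (p + q)) - β * q) +
              (κ * (p + q) + i * (κ * (p + q)) - p)
                     ≡ (1# + (i + (1# + α) * j)) * κ * (p + q) - β * j * q - p
          identity = solve 7 (λ α β i j κ p q →
            j :* ((con (+ 1) :+ α) :* (κ :* (p :+ q)) :- β :* q) :+
                (κ :* (p :+ q) :+ i :* (κ :* (p :+ q)) :- p)
            := (con (+ 1) :+ (i :+ (con (+ 1) :+ α) :* j)) :* κ :* (p :+ q) :- β :* j :* q :- p) refl

      Choice : F → Set
      Choice c = ∃[ w′ ] ‖ w′ ‖ ≤ 1# + ‖ w ‖ × re (c *F (w′ ^F suc k)) ≤ - (κ * ‖ c ‖)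

      choose-1 : ∀ c → re c ≤ - (κ * ‖ c ‖) → Choice c
      choose-1 c h = 1F
        , ≤-trans (≤-reflexive ‖1‖) (by (nonNeg (0≤‖‖ w))
            (solve 1 (λ w → w := (con (+ 1) :+ w) :- con (+ 1)) refl ‖ w ‖))
        , ≤-trans (≤-reflexive (cong re (trans (cong (c *F_) (1F-^ (suc k))) (F.*-identityʳ c)))) h

      bound : ‖ w ‖ ≤ 1# + ‖ w ‖
      bound = by nonNeg-1 (solve 1 (λ w → con (+ 1) := (con (+ 1) :+ w) :- w) refl ‖ w ‖)

      choose-w : ∀ c → ∣ β * im c ∣ ≡ β * im c → - (α * re c) - ∣ β ∣ * ∣ im c ∣ ≤ - (κ * ‖ c ‖) →
          Choice c
      choose-w c@(c₁ , c₂) e h = w , bound , ≤-trans (≤-reflexive (trans (cong (λ y → re (c *F y)) y≡)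
        (trans (real c₁ c₂ α β) (cong (λ u → - (α * c₁) - u) (trans (sym e) (∣*∣ β c₂)))))) h
        where
        real : ∀ c d a b → c * - a - d * b ≡ - (a * c) - b * d
        real = solve 4 (λ c d a b → c :* :- a :- d :* b := :- (a :* c) :- b :* d) refl

      choose-conj : ∀ c → ∣ β * im c ∣ ≡ - (β * im c) → - (α * re c) - ∣ β ∣ * ∣ im c ∣ ≤ - (κ * ‖ c ‖)
          → Choice c
      choose-conj c@(c₁ , c₂) e h = conj w , subst (_≤ 1# + ‖ w ‖) (sym ‖conj‖) bound
        , ≤-trans (≤-reflexive (trans (cong (λ y → re (c *F y)) (trans (conj-^ w (suc k))
            (cong conj y≡)))
        (trans (real c₁ c₂ α β) (cong (λ u → - (α * c₁) - u) (trans (sym e) (∣*∣ β c₂)))))) h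
        where
        ‖conj‖ : ‖ conj w ‖ ≡ ‖ w ‖
        ‖conj‖ = cong (λ u → ∣ re w ∣ + u) (∣-∣ (im w))
        real : ∀ c d a b → c * - a - d * (- b) ≡ - (a * c) - - (b * d)
        real = solve 4 (λ c d a b → c :* :- a :- d :* (:- b) := :- (a :* c) :- :- (b :* d)) refl

      choose : ∀ c → Choice c
      choose c with re c ≤? (- (κ * ‖ c ‖))
      ... | yes h = choose-1 c h
      ... | no A with (- (α * re c) - ∣ β ∣ * ∣ im c ∣) ≤? (- (κ * ‖ c ‖))
      ...   | no B  = ⊥-elim (squeeze (re c) (im c) A B)
      ...   | yes h with ∣∣-cases (β * im c)
      ...     | inj₁ (_ , e) = choose-w c e h
      ...     | inj₂ (_ , e) = choose-conj c e h

    0<-neg : ∀ {a} → a < 0# → 0# < - a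
    0<-neg {a} a<0 h = a<0 (by h (solve 1 (λ a → con (+ 0) :- (:- a) := a :- con (+ 0)) refl a))

    Positive⁻¹ : Carrier → Set
    Positive⁻¹ a = ∃[ i ] 0# < i × a * i ≡ 1#

    triangle : ∀ k w a b → w ^F suc k ≡ (- a , b) → 0# < a →
               (i : Positive⁻¹ a) (j : Positive⁻¹ ∣ b ∣) → Positive⁻¹
                   (1# + (proj₁ i + (1# + a) * proj₁ j)) →
               ∃[ κ ] ∃[ S ] 0# < κ × Directions k κ S
    triangle k w a b w^≡y 0<a (i , 0<i , ai≡1) (j , 0<j , bj≡1) (κ , 0<κ , Tκ≡1) =
      κ , 1# + ‖ w ‖ , 0<κ , Triangle.choose k w a b i j κ w^≡y 0<a 0<i 0<j 0<κ ai≡1 bj≡1 Tκ≡1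

    triangle′ : ∀ k w x b → w ^F suc k ≡ (x , b) → x < 0# → b ≢ 0# → ∃[ κ ] ∃[ S ] 0# < κ × Directions k
        κ S
    triangle′ k w x b w^≡y x<0 b≢0 = triangle k w (- x) b
      (trans w^≡y (cong (_, b) (solve 1 (λ a → a := :- (:- a)) refl x)))
      0<-x i j (inverse⁺ (0<+ 0<1 (0≤+ (<⇒≤ (proj₁ (proj₂ i))) (0≤* (0≤+ 0≤1 (<⇒≤ 0<-x))
          (<⇒≤ (proj₁ (proj₂ j)))))))
      where
      0<-x : 0# < - x
      0<-x = 0<-neg x<0
      i : Positive⁻¹ (- x)
      i = inverse⁺ 0<-x
      j : Positive⁻¹ ∣ b ∣
      j = inverse⁺ (0≤∧≢⇒0< (0≤∣∣ b) λ e → b≢0 (∣∣≤0⇒≡0 (≤-reflexive e)))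

    abstract
      directions : ∀ k → ∃[ κ ] ∃[ S ] 0# < κ × Directions k κ S
      directions k = from (second-quadrant k)
        where
        general : ∀ w y → w ^F suc k ≡ y → re y < 0# → im y ≢ 0# → ∃[ κ ] ∃[ S ] 0# < κ × Directions k κ
            S
        general w (x , b) = triangle′ k w x b
        from : SecondQuadrant k → ∃[ κ ] ∃[ S ] 0# < κ × Directions k κ S
        from (w , re<0 , im≢0) = general w (w ^F suc k) refl re<0 im≢0

  -- One pair of constants for the exponents 1, ..., n, since the degree of the dominating term is
  -- not known in advance.
  UniformDirections : ℕ → Carrier → Carrier → Set
  UniformDirections n κ S =
    ∀ k → k ℕ.< n → ∀ c → ∃[ w ] ‖ w ‖ ≤ S × re (c *F (w ^F suc k)) ≤ - (κ * ‖ c ‖)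

  combine : ∀ {n κ₁ S₁ κ₂ S₂ κ S} → UniformDirections n κ₁ S₁ → Directions n κ₂ S₂ →
            κ ≤ κ₁ → κ ≤ κ₂ → S₁ ≤ S → S₂ ≤ S → UniformDirections (suc n) κ S
  combine {n} h₁ h₂ κ≤κ₁ κ≤κ₂ S₁≤S S₂≤S k k<1+n c with k ℕ.≟ n
  ... | yes refl = let w , p , q = h₂ c in w , ≤-trans p S₂≤S , ≤-trans q (neg-mono-≤ (*-monoʳ-≤ (0≤‖‖ c) κ≤κ₂))
  ... | no k≢n   = let w , p , q = h₁ k (ℕ.≤∧≢⇒< (ℕ.s≤s⁻¹ k<1+n) k≢n) c in
    w , ≤-trans p S₁≤S , ≤-trans q (neg-mono-≤ (*-monoʳ-≤ (0≤‖‖ c) κ≤κ₁))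

  UniformlyDirected : ℕ → Set
  UniformlyDirected n = ∃[ κ ] ∃[ S ] 0# < κ × 1# ≤ S × UniformDirections n κ S

  abstract
    uniform-directions : ∀ n → UniformlyDirected n
    uniform-directions zero    = 1# , 1# , 0<1 , ≤-refl , λ k ()
    uniform-directions (suc n) = from (uniform-directions n) (directions n)
      where
      from : UniformlyDirected n → (∃[ κ ] ∃[ S ] 0# < κ × Directions n κ S) → UniformlyDirected (suc n)
      from (κ₁ , S₁ , 0<κ₁ , 1≤S₁ , h₁) (κ₂ , S₂ , 0<κ₂ , h₂) =
        let κ , 0<κ , κ≤κ₁ , κ≤κ₂ = minimum⁺ 0<κ₁ 0<κ₂
            S , S₁≤S , S₂≤S       = maximum S₁ S₂
        in κ , S , 0<κ , ≤-trans 1≤S₁ S₁≤S , combine h₁ h₂ κ≤κ₁ κ≤κ₂ S₁≤S S₂≤S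

-- Radii at which one term of a polynomial dominates

module Dominate (K : OrderedField) where
  open import Data.Empty using (⊥-elim)
  open import Data.Fin as Fin using (Fin; zero; suc; toℕ)
  import Data.Fin.Properties as Fin
  open import Data.Integer using (+_)
  open import Data.Nat as ℕ using (ℕ; zero; suc)
  import Data.Nat.Properties as ℕ
  open import Data.Product using (∃-syntax; _×_; _,_)
  open import Data.Sum using (_⊎_; inj₁; inj₂)
  open import Function using (_∘_)
  open import Relation.Binary.Definitions using (tri<; tri≈; tri>)
  open import Relation.Binary.PropositionalEquality using (_≡_; _≢_; refl; sym; trans; cong; cong₂; subst)
  open import Relation.Nullary using (¬_; Dec; yes; no)

  open Order K

  GreatestBelow : ∀ {n} → (Fin n → Set) → ℕ → Set
  GreatestBelow P t =
    (∀ i → toℕ i ℕ.< t → P i) ⊎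
    (∃[ j ] toℕ j ℕ.< t × ¬ P j × (∀ i → toℕ j ℕ.< toℕ i → toℕ i ℕ.< t → P i))

  greatest-below : ∀ {n} {P : Fin n → Set} → (∀ i → Dec (P i)) → ∀ t → GreatestBelow P t
  greatest-below P? zero = inj₁ λ i ()
  greatest-below {n} {P} P? (suc t) = from (t ℕ.<? n)
    where
    extend : (∀ i → toℕ i ≡ t → P i) → GreatestBelow P t → GreatestBelow P (suc t)
    extend Pt (inj₁ h) = inj₁ λ i i≤t → case i i≤t (toℕ i ℕ.≟ t)
      where
      case : ∀ i → toℕ i ℕ.< suc t → Dec (toℕ i ≡ t) → P i
      case i i≤t (yes i≡t) = Pt i i≡t
      case i i≤t (no i≢t)  = h i (ℕ.≤∧≢⇒< (ℕ.s≤s⁻¹ i≤t) i≢t)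
    extend Pt (inj₂ (j , j<t , ¬Pj , h)) = inj₂
        (j , ℕ.m≤n⇒m≤1+n j<t , ¬Pj , λ i j<i i≤t → case i j<i i≤t (toℕ i ℕ.≟ t))
      where
      case : ∀ i → toℕ j ℕ.< toℕ i → toℕ i ℕ.< suc t → Dec (toℕ i ≡ t) → P i
      case i j<i i≤t (yes i≡t) = Pt i i≡t
      case i j<i i≤t (no i≢t)  = h i j<i (ℕ.≤∧≢⇒< (ℕ.s≤s⁻¹ i≤t) i≢t)
    new : ∀ j → toℕ j ≡ t → Dec (P j) → GreatestBelow P (suc t)
    new j j≡t (yes Pj) = extend (λ i i≡t → subst P (Fin.toℕ-injective (trans j≡t (sym i≡t))) Pj)
        (greatest-below P? t)
    new j j≡t (no ¬Pj) = inj₂ (j , ℕ.≤-reflexive (cong suc j≡t) , ¬Pj ,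
      λ i j<i i≤t → ⊥-elim (ℕ.<-irrefl j≡t (ℕ.<-≤-trans j<i (ℕ.s≤s⁻¹ i≤t))))
    from : Dec (t ℕ.< n) → GreatestBelow P (suc t)
    from (yes t<n) = new (Fin.fromℕ< t<n) (Fin.toℕ-fromℕ< t<n) (P? _)
    from (no t≮n)  = extend (λ i i≡t → ⊥-elim (t≮n (subst (ℕ._< n) i≡t (Fin.toℕ<n i))))
        (greatest-below P? t)

  ^-antimono : ∀ {d i j} → 0# ≤ d → d ≤ 1# → i ℕ.≤ j → d ^ j ≤ d ^ i
  ^-antimono {j = j} 0≤d d≤1 ℕ.z≤n = ^≤1 j 0≤d d≤1
  ^-antimono 0≤d d≤1 (ℕ.s≤s i≤j) = *-monoˡ-≤ 0≤d (^-antimono 0≤d d≤1 i≤j)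

  module Terms {n} (β : Fin n → Carrier) (0≤β : ∀ i → 0# ≤ β i) where
    T : Carrier → Fin n → Carrier
    T r i = β i * r ^ suc (toℕ i)

    0≤T : ∀ {r} → 0# ≤ r → ∀ i → 0# ≤ T r i
    0≤T 0≤r i = 0≤* (0≤β i) (0≤^ (suc (toℕ i)) 0≤r)

    T-scale : ∀ d r i → T (d * r) i ≡ d ^ suc (toℕ i) * T r i
    T-scale d r i = trans (cong (β i *_) (^-distrib-* d r (suc (toℕ i))))
      (solve 3 (λ b x y → b :* (x :* y) := x :* (b :* y)) refl (β i) (d ^ suc (toℕ i))
          (r ^ suc (toℕ i)))

  -- Shrinking r by the factor d makes the k-th term dominate all terms of higher degree.  Among the
  -- lower terms that are still too large the one of highest degree takes over the role of k, so the
  -- process ends after at most n rounds.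
  module Descent {n} (β : Fin n → Carrier) (0≤β : ∀ i → 0# ≤ β i) (M₁ η E d : Carrier)
    (0<η : 0# < η) (0≤d : 0# ≤ d) (d≤1 : d ≤ 1#) (dE≤η : d * E ≤ η) (1≤Eη : 1# ≤ E * η) (1≤E : 1# ≤ E) where
    open Terms β 0≤β public

    -- Entry condition of a round: terms of higher degree are controlled only up to the large factor
    -- `E`, and terms of lower degree only by `M₁`.
    record Start (m r : Carrier) (k : Fin n) : Set where
      constructor start
      field
        0≤r   : 0# ≤ r
        upper : ∀ i → T r i ≤ M₁
        above : ∀ i → toℕ k ℕ.< toℕ i → T r i ≤ E * T r k
        lower : m ≤ T r k

    record Dominant (m r : Carrier) (k : Fin n) : Set where
      constructor dominant
      field
        0≤r   : 0# ≤ r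
        upper : ∀ i → T r i ≤ M₁
        other : ∀ i → i ≢ k → T r i ≤ η * T r k
        lower : m ≤ T r k

    module Step {m r k} (0≤m : 0# ≤ m) (s : Start m r k) where
      open Start s
      r′ : Carrier
      r′ = d * r
      0≤r′ : 0# ≤ r′
      0≤r′ = 0≤* 0≤d 0≤r
      E*  : ∀ {a} → 0# ≤ a → a ≤ E * a
      E* {a} 0≤a = ≤-trans (≤-reflexive (sym (*-identityˡ a))) (*-monoʳ-≤ 0≤a 1≤E)
      upper′ : ∀ i → T r′ i ≤ M₁
      upper′ i = ≤-trans (≤-reflexive (T-scale d r i))
          (≤-trans (*-monoʳ-≤ (0≤T 0≤r i) (^≤1 (suc (toℕ i)) 0≤d d≤1))
        (≤-trans (≤-reflexive (*-identityˡ _)) (upper i)))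
      lower′ : d ^ n * m ≤ T r′ k
      lower′ = ≤-trans (*-mono-≤ (0≤^ n 0≤d) (0≤T 0≤r k) (^-antimono 0≤d d≤1 (Fin.toℕ<n k)) lower)
          (≤-reflexive (sym (T-scale d r k)))
      above′ : ∀ i → toℕ k ℕ.< toℕ i → T r′ i ≤ η * T r′ k
      above′ i k<i = begin
        T r′ i
          ≡⟨ T-scale d r i ⟩
        d ^ suc (toℕ i) * T r i
          -- A term of higher degree loses at least one factor `d` more than term `k`, and d E ≤ η
          -- absorbs the factor `E`.
          ≤⟨ *-mono-≤ (0≤^ (suc (toℕ i)) 0≤d) (0≤* (≤-trans 0≤1 1≤E) (0≤T 0≤r k))
              (^-antimono 0≤d d≤1 (ℕ.s≤s k<i)) (above i k<i) ⟩
        d * d ^ suc (toℕ k) * (E * T r k)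
          ≡⟨ solve 4 (λ d x E t → d :* x :* (E :* t) := d :* E :* (x :* t)) refl d (d ^ suc (toℕ k)) E
              (T r k) ⟩
        d * E * (d ^ suc (toℕ k) * T r k)
          ≤⟨ *-monoʳ-≤ (0≤* (0≤^ (suc (toℕ k)) 0≤d) (0≤T 0≤r k)) dE≤η ⟩
        η * (d ^ suc (toℕ k) * T r k)
          ≡⟨ cong (η *_) (sym (T-scale d r k)) ⟩
        η * T r′ k ∎
        where open ≤-Reasoning
      finish : (∀ i → toℕ i ℕ.< toℕ k → T r′ i ≤ η * T r′ k) → Dominant (d ^ n * m) r′ k
      finish below = dominant 0≤r′ upper′ other lower′
        where
        other : ∀ i → i ≢ k → T r′ i ≤ η * T r′ k
        other i i≢k with ℕ.<-cmp (toℕ i) (toℕ k)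
        ... | tri< i<k _ _ = below i i<k
        ... | tri≈ _ i≡k _ = ⊥-elim (i≢k (Fin.toℕ-injective i≡k))
        ... | tri> _ _ k<i = above′ i k<i
      -- The entry condition holds again at `j`: terms between `j` and `k`, or above `k`, are at
      -- most η T_k, which is below T_j, and T_k itself is at most E η T_k ≤ E T_j because E η ≥ 1.
      restart : ∀ j → toℕ j ℕ.< toℕ k → ¬ T r′ j ≤ η * T r′ k →
                (∀ i → toℕ j ℕ.< toℕ i → toℕ i ℕ.< toℕ k → T r′ i ≤ η * T r′ k) →
                Start (η * (d ^ n * m)) r′ j
      restart j j<k big between = start 0≤r′ upper′ above″
          (≤-trans (*-monoˡ-≤ (<⇒≤ 0<η) lower′) (<⇒≤ big))
        where
        above″ : ∀ i → toℕ j ℕ.< toℕ i → T r′ i ≤ E * T r′ j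
        above″ i j<i with ℕ.<-cmp (toℕ i) (toℕ k)
        ... | tri< i<k _ _ = ≤-trans (≤-trans (between i j<i i<k) (<⇒≤ big)) (E* (0≤T 0≤r′ j))
        ... | tri> _ _ k<i = ≤-trans (≤-trans (above′ i k<i) (<⇒≤ big)) (E* (0≤T 0≤r′ j))
        ... | tri≈ _ i≡k _ = begin
          T r′ i              ≡⟨ cong (T r′) (Fin.toℕ-injective i≡k) ⟩
          T r′ k              ≡⟨ sym (*-identityˡ _) ⟩
          1# * T r′ k         ≤⟨ *-monoʳ-≤ (0≤T 0≤r′ k) 1≤Eη ⟩
          E * η * T r′ k      ≡⟨ *-assoc E η _ ⟩
          E * (η * T r′ k)    ≤⟨ *-monoˡ-≤ (≤-trans 0≤1 1≤E) (<⇒≤ big) ⟩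
          E * T r′ j          ∎
          where open ≤-Reasoning

  module _ (n : ℕ) (M₁ η E d : Carrier)
    (0<η : 0# < η) (0<d : 0# < d) (d≤1 : d ≤ 1#) (dE≤η : d * E ≤ η) (1≤Eη : 1# ≤ E * η) (1≤E : 1# ≤ E) where
    module D (β : Fin n → Carrier) (0≤β : ∀ i → 0# ≤ β i) =
      Descent β 0≤β M₁ η E d 0<η (<⇒≤ 0<d) d≤1 dE≤η 1≤Eη 1≤E
    open D using (Start; Dominant)

    -- The quantifiers put `m′` before the coefficients `β`. This uniform lower bound for the
    -- dominating term is what makes the contraction factor of the descent independent of the
    -- polynomial.
    Reaches : ℕ → Carrier → Carrier → Set
    Reaches b m m′ = ∀ β 0≤β r k → toℕ k ℕ.< b → Start β 0≤β m r k → ∃[ r ] ∃[ k ] Dominant β 0≤β m′ r k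

    weaken : ∀ {β 0≤β m m′ r k} → m′ ≤ m → Dominant β 0≤β m r k → Dominant β 0≤β m′ r k
    weaken m′≤m (D.dominant a b c d) = D.dominant a b c (≤-trans m′≤m d)

    abstract
      reach : ∀ b m → 0# < m → ∃[ m′ ] 0# < m′ × Reaches b m m′
      reach zero    m 0<m = m , 0<m , λ β 0≤β r k ()
      reach (suc b) m 0<m = from (reach b (η * (d ^ n * m)) (0<* 0<η 0<dm))
        where
        0<dm : 0# < d ^ n * m
        0<dm = 0<* (0<^ n 0<d) 0<m
        from : ∃[ m₁ ] 0# < m₁ × Reaches b (η * (d ^ n * m)) m₁ → ∃[ m′ ] 0# < m′ × Reaches (suc b) m m′
        from (m₁ , 0<m₁ , IH) = build (minimum⁺ 0<m₁ 0<dm)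
          where
          build : (∃[ m′ ] 0# < m′ × m′ ≤ m₁ × m′ ≤ d ^ n * m) → ∃[ m′ ] 0# < m′ × Reaches (suc b) m m′
          build (m′ , 0<m′ , m′≤m₁ , m′≤dm) = m′ , 0<m′ , go
            where
            go : Reaches (suc b) m m′
            go β 0≤β r k k≤b s = decide (greatest-below (λ i → T r′ i ≤? (η * T r′ k)) (toℕ k))
              where
              open D β 0≤β hiding (Start; Dominant)
              open Step (<⇒≤ 0<m) s
              decide : GreatestBelow (λ i → T r′ i ≤ η * T r′ k) (toℕ k) → ∃[ r ] ∃[ k ] Dominant β 0≤β
                  m′ r k
              decide (inj₁ below) = r′ , k , weaken m′≤dm (finish below)
              decide (inj₂ (j , j<k , big , between)) =
                let r″ , k″ , dom = IH β 0≤β r′ j (ℕ.<-≤-trans j<k (ℕ.s≤s⁻¹ k≤b)) (restart j j<k big between)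
                in r″ , k″ , weaken m′≤m₁ dom

  crossing : ∀ {P : ℕ → Set} → (∀ t → Dec (P t)) → ¬ P 0 → ∀ t → P t → ∃[ s ] ¬ P s × P (suc s)
  crossing P? ¬P0 zero    Pt = ⊥-elim (¬P0 Pt)
  crossing {P} P? ¬P0 (suc t) Pt = from (P? t)
    where
    from : Dec (P t) → ∃[ s ] ¬ P s × P (suc s)
    from (yes Pt′) = crossing P? ¬P0 t Pt′
    from (no ¬Pt)  = t , ¬Pt , Pt

  upper-bound : ∀ {n} (f : Fin n → Carrier) → ∃[ B ] ∀ i → f i ≤ B
  upper-bound {zero}  f = 0# , λ ()
  upper-bound {suc n} f = from (upper-bound (f ∘ suc))
    where
    from : (∃[ B ] ∀ i → f (suc i) ≤ B) → ∃[ B ] ∀ i → f i ≤ B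
    from (B , h) = let M , p , q = maximum (f zero) B in M , λ where
      zero    → p
      (suc i) → ≤-trans (h i) q

  module Halves (h : Carrier) (h+h≡1 : h + h ≡ 1#) where
    0≤h : 0# ≤ h
    0≤h = *-cancelˡ-≤ (0<+ 0<1 0≤1) (by nonNeg-1 (trans (sym h+h≡1)
      (solve 1 (λ h → h :+ h := (con (+ 1) :+ con (+ 1)) :* h :- (con (+ 1) :+ con (+ 1)) :* con (+ 0))
          refl h)))

    0<h : 0# < h
    0<h = 0≤∧≢⇒0< 0≤h λ h≡0 → 1≢0 (trans (sym h+h≡1) (trans (cong₂ _+_ h≡0 h≡0) (+-identityʳ 0#)))

    h≤1 : h ≤ 1#
    h≤1 = by (nonNeg 0≤h) (trans (solve 1 (λ h → h := (h :+ h) :- h) refl h) (cong (λ x → x - h) h+h≡1))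

    2^*h^≡1 : ∀ n → (1# + 1#) ^ n * h ^ n ≡ 1#
    2^*h^≡1 n = trans (sym (^-distrib-* (1# + 1#) h n))
      (trans (cong (_^ n) (trans (solve 1
          (λ h → (con (+ 1) :+ con (+ 1)) :* h := h :+ h) refl h) h+h≡1)) (1^ n))

    h^-small : ∀ B {M₁} → 0# < M₁ → ∃[ t ] h ^ t * B ≤ M₁
    h^-small B {M₁} 0<M₁ = from (archimedean′ B 0<M₁)
      where
      open ≤-Reasoning
      from : (∃[ t ] B ≤ fromℤ (+ t) * M₁) → ∃[ t ] h ^ t * B ≤ M₁
      from (t , B≤) = t , (begin
        h ^ t * B                          ≤⟨ *-monoˡ-≤ (0≤^ t 0≤h) B≤ ⟩
        h ^ t * (fromℤ (+ t) * M₁)         ≤⟨ *-monoˡ-≤ (0≤^ t 0≤h) (*-monoʳ-≤ (<⇒≤ 0<M₁)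
                                                (≤-trans (by nonNeg-1 (solve 1 (λ t → con (+ 1) := (con
                                                    (+ 1) :+ t :* con (+ 1)) :- t) refl (fromℤ (+ t))))
                                                  (1+n·τ≤[1+τ]^n t 0≤1))) ⟩
        h ^ t * ((1# + 1#) ^ t * M₁)       ≡⟨ solve 3 (λ h p m → h :* (p :* m) := p :* h :* m) refl
            (h ^ t) ((1# + 1#) ^ t) M₁ ⟩
        (1# + 1#) ^ t * h ^ t * M₁         ≡⟨ cong (_* M₁) (2^*h^≡1 t) ⟩
        1# * M₁                            ≡⟨ *-identityˡ M₁ ⟩
        M₁                                 ∎)

    module Begin {n} (β : Fin n → Carrier) (0≤β : ∀ i → 0# ≤ β i) (M₁ E : Carrier) (0<M₁ : 0# < M₁)
      (2^n≤E : (1# + 1#) ^ n ≤ E) where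
      open Terms β 0≤β

      Small : Carrier → Set
      Small r = ∀ i → T r i ≤ M₁

      Started : Set
      Started = ∃[ r ] ∃[ k ] 0# ≤ r × (∀ i → T r i ≤ M₁) × (∀ i → T r i ≤ E * T r k) × h ^ n * M₁ ≤ T r
          k

      -- Halving the radius divides each term by at most 2ⁿ. Right after the last term drops below
      -- `M₁`, the one that was still larger is at least `h ^ n * M₁`, so every term is within the
      -- factor 2ⁿ ≤ E of it.
      begin-at : ∀ r → 0# ≤ r → ¬ Small r → Small (h * r) → Started
      begin-at r 0≤r ¬small small = from (Fin.¬∀⟶∃¬ n _ (λ i → T r i ≤? M₁) ¬small)
        where
        from : (∃[ k ] ¬ T r k ≤ M₁) → Started
        from (k , M₁<T) = h * r , k , 0≤* 0≤h 0≤r , small , (λ i → ≤-trans (small i) M₁≤E) , low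
          where
          low : h ^ n * M₁ ≤ T (h * r) k
          low = ≤-trans (*-mono-≤ (0≤^ n 0≤h) (0≤T 0≤r k) (^-antimono 0≤h h≤1 (Fin.toℕ<n k)) (<⇒≤ M₁<T))
            (≤-reflexive (sym (T-scale h r k)))
          M₁≤E : M₁ ≤ E * T (h * r) k
          M₁≤E = ≤-trans (≤-reflexive (trans (sym (*-identityˡ M₁)) (trans
              (cong (_* M₁) (sym (2^*h^≡1 n))) (*-assoc _ _ M₁))))
            (*-mono-≤ (0≤^ n (0≤+ 0≤1 0≤1)) (0≤T (0≤* 0≤h 0≤r) k) 2^n≤E low)

      begin-from : ∀ r → 0# ≤ r → ¬ Small r → Started
      begin-from r 0≤r ¬small = bounded (upper-bound (T r))
        where
        shrunk : ∀ t → h * (h ^ t * r) ≡ h ^ suc t * r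
        shrunk t = sym (*-assoc h (h ^ t) r)
        crossed : (∃[ s ] ¬ Small (h ^ s * r) × Small (h ^ suc s * r)) → Started
        crossed (s , big , small) = begin-at (h ^ s * r) (0≤* (0≤^ s 0≤h) 0≤r) big
            (subst Small (sym (shrunk s)) small)
        eventually : ∀ B → (∀ i → T r i ≤ B) → (∃[ t ] h ^ t * B ≤ M₁) → Started
        eventually B T≤B (t , h^tB≤M₁) = crossed (crossing (λ t → Fin.all? λ i → T (h ^ t * r) i ≤? M₁)
          (λ small → ¬small (subst Small (*-identityˡ r) small)) t small)
          where
          small : Small (h ^ t * r)
          small i = ≤-trans (≤-reflexive (T-scale (h ^ t) r i)) (≤-trans
            (*-mono-≤ (0≤^ (suc (toℕ i)) (0≤^ t 0≤h)) (≤-trans (0≤T 0≤r i) (T≤B i))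
              (≤-trans (*-monoˡ-≤ (0≤^ t 0≤h) (^≤1 (toℕ i) (0≤^ t 0≤h) (^≤1 t 0≤h h≤1)))
                  (≤-reflexive (*-identityʳ _)))
              (T≤B i)) h^tB≤M₁)
        bounded : (∃[ B ] ∀ i → T r i ≤ B) → Started
        bounded (B , T≤B) = eventually B T≤B (h^-small B 0<M₁)

      begins : ∀ l → 0# < β l → Started
      begins l 0<βl = from (inverse⁺ 0<βl)
        where
        open ≤-Reasoning
        from : (∃[ j ] 0# < j × β l * j ≡ 1#) → Started
        from (j , 0<j , βj≡1) = begin-from r (≤-trans 0≤1 1≤r) λ small → big (≤-trans grows (small l))
          where
          r : Carrier
          -- With j = 1/β_l and r ≥ 1, already β_l r = β_l + M₁ exceeds `M₁`, so the halving starts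
          -- from a radius that is too large.
          r = 1# + j * M₁
          1≤r : 1# ≤ r
          1≤r = by (nonNeg (0≤* (<⇒≤ 0<j) (<⇒≤ 0<M₁)))
              (solve 1 (λ x → x := (con (+ 1) :+ x) :- con (+ 1)) refl (j * M₁))
          grows : β l + M₁ ≤ T r l
          grows = begin
            β l + M₁                    ≡⟨ cong (λ x → β l + x)
                (sym (trans (cong (_* M₁) βj≡1) (*-identityˡ M₁))) ⟩
            β l + β l * j * M₁          ≡⟨ solve 3
                (λ b j m → b :+ b :* j :* m := b :* ((con (+ 1) :+ j :* m) :* con (+ 1))) refl (β l) j
                M₁ ⟩
            β l * (r * 1#)              ≤⟨ *-monoˡ-≤ (0≤β l)
                (*-monoˡ-≤ (≤-trans 0≤1 1≤r) (1≤^ (toℕ l) 1≤r)) ⟩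
            T r l                       ∎
          big : ¬ β l + M₁ ≤ M₁
          big g = 0<βl (+-cancel-≤ (≤-trans g (≤-reflexive (sym (+-identityˡ M₁)))))

  -- The key lemma of Kneser's proof in uniform form: the dominating term lies between `m` and `M₁`,
  -- and each other nonconstant term is smaller by the factor `η`.
  record Dominated {n} (β : Fin n → Carrier) (M₁ η m : Carrier) : Set where
    field
      r     : Carrier
      k     : Fin n
      0≤r   : 0# ≤ r
      upper : ∀ i → β i * r ^ suc (toℕ i) ≤ M₁
      other : ∀ i → i ≢ k → β i * r ^ suc (toℕ i) ≤ η * (β k * r ^ suc (toℕ k))
      lower : m ≤ β k * r ^ suc (toℕ k)

  half : ∃[ h ] h + h ≡ 1#
  half = from (inverse⁺ {1# + 1#} (0<+ 0<1 0≤1))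
    where
    from : (∃[ h ] 0# < h × (1# + 1#) * h ≡ 1#) → ∃[ h ] h + h ≡ 1#
    from (h , _ , e) = h , trans (solve 1 (λ h → h :+ h := (con (+ 1) :+ con (+ 1)) :* h) refl h) e

  private
    dominate′ : ∀ n M₁ η → 0# < M₁ → 0# < η → η ≤ 1# → ∃[ m ] 0# < m ×
               (∀ (β : Fin n → Carrier) → (∀ i → 0# ≤ β i) → ∀ l → 0# < β l → Dominated β M₁ η m)
    dominate′ n M₁ η 0<M₁ 0<η η≤1 = choose-h half
      where
      Result : Set
      Result = ∃[ m ] 0# < m × (∀ (β : Fin n → Carrier) → (∀ i → 0# ≤ β i) → ∀ l → 0# < β l → Dominated
          β M₁ η m)

      choose-η⁻¹ : ∀ h → h + h ≡ 1# → (∃[ i ] 0# < i × η * i ≡ 1#) → Result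
      choose-η⁻¹ h h+h≡1 (i , 0<i , ηi≡1) = conclude
          (reach n M₁ η E d 0<η 0<d d≤1 dE≤η 1≤Eη 1≤E n (h ^ n * M₁) (0<* (0<^ n 0<h) 0<M₁))
        where
        open Halves h h+h≡1
        -- E = 2ⁿ/η is at least 2ⁿ and satisfies E η ≥ 1; d = 2⁻ⁿ η² is then chosen so that d E = η.
        P E d : Carrier
        P = (1# + 1#) ^ n
        E = P * i
        d = h ^ n * (η * η)
        1≤P : 1# ≤ P
        1≤P = 1≤^ n (by nonNeg-1 (solve 0 (con (+ 1) := (con (+ 1) :+ con (+ 1)) :- con (+ 1)) refl))
        1≤i : 1# ≤ i
        1≤i = ≤-trans (≤-reflexive (sym ηi≡1))
            (≤-trans (*-monoʳ-≤ (<⇒≤ 0<i) η≤1) (≤-reflexive (*-identityˡ i)))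
        0<d : 0# < d
        0<d = 0<* (0<^ n 0<h) (0<* 0<η 0<η)
        d≤1 : d ≤ 1#
        d≤1 = ≤-trans (*-mono-≤ (0≤^ n 0≤h) 0≤1 (^≤1 n 0≤h h≤1)
          (≤-trans (*-mono-≤ (<⇒≤ 0<η) 0≤1 η≤1 η≤1) (≤-reflexive (*-identityˡ 1#))))
              (≤-reflexive (*-identityˡ 1#))
        dE≤η : d * E ≤ η
        dE≤η = ≤-reflexive (trans (solve 4 (λ a e p i → (a :* (e :* e)) :* (p :* i) := (p :* a) :*
            (e :* i) :* e) refl (h ^ n) η P i)
          (trans (cong₂ (λ x y → x * y * η) (2^*h^≡1 n) ηi≡1)
              (solve 1 (λ e → con (+ 1) :* con (+ 1) :* e := e) refl η)))
        P≤E : P ≤ E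
        P≤E = ≤-trans (≤-reflexive (sym (*-identityʳ P))) (*-monoˡ-≤ (≤-trans 0≤1 1≤P) 1≤i)
        1≤E : 1# ≤ E
        1≤E = ≤-trans 1≤P P≤E
        1≤Eη : 1# ≤ E * η
        1≤Eη = ≤-trans 1≤P (≤-reflexive (sym (trans
            (solve 3 (λ p i e → p :* i :* e := p :* (e :* i)) refl P i η)
          (trans (cong (P *_) ηi≡1) (*-identityʳ P)))))
        conclude : (∃[ m ] 0# < m × Reaches n M₁ η E d 0<η 0<d d≤1 dE≤η 1≤Eη 1≤E n (h ^ n * M₁) m) →
            Result
        conclude (m , 0<m , reaches) = m , 0<m , λ β 0≤β l 0<βl → started β 0≤β
            (Begin.begins β 0≤β M₁ E 0<M₁ P≤E l 0<βl)
          where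
          started : ∀ (β : Fin n → Carrier) (0≤β : ∀ i → 0# ≤ β i) → Begin.Started β 0≤β M₁ E 0<M₁ P≤E →
              Dominated β M₁ η m
          started β 0≤β (r , k , 0≤r , small , ratio , low) = finish (reaches β 0≤β r k (Fin.toℕ<n k)
            (Descent.start 0≤r small (λ i _ → ratio i) low))
            where
            finish : (∃[ r ] ∃[ k ] D.Dominant n M₁ η E d 0<η 0<d d≤1 dE≤η 1≤Eη 1≤E β 0≤β m r k) →
                Dominated β M₁ η m
            finish (r , k , Descent.dominant 0≤r upper other lower) =
              record { r = r ; k = k ; 0≤r = 0≤r ; upper = upper ; other = other ; lower = lower }

      choose-h : (∃[ h ] h + h ≡ 1#) → Result
      choose-h (h , e) = choose-η⁻¹ h e (inverse⁺ 0<η)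

  abstract
    dominate : ∀ n M₁ η → 0# < M₁ → 0# < η → η ≤ 1# → ∃[ m ] 0# < m ×
               (∀ (β : Fin n → Carrier) → (∀ i → 0# ≤ β i) → ∀ l → 0# < β l → Dominated β M₁ η m)
    dominate = dominate′

-- Kneser's descent step

module Kneser (K : OrderedField) where
  open import Data.Fin as Fin using (Fin; zero; suc; toℕ; punchIn; fromℕ)
  import Data.Fin.Properties as Fin
  open import Data.Integer using (+_)
  open import Data.Nat as ℕ using (ℕ; zero; suc)
  import Data.Nat.Properties as ℕ
  open import Data.Product using (∃-syntax; _×_; _,_; proj₁; proj₂)
  open import Data.Vec using (Vec; []; _∷_)
  open import Data.Vec.Functional using (removeAt)
  open import Function using (_∘_)
  open import Relation.Binary.PropositionalEquality as ≡ using (_≡_; _≢_; refl; sym; trans; cong; cong₂; subst)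
  open import Relation.Nullary using (Dec; yes; no)

  open Order K
  open Gaussian K
  open Direction K
  open Dominate K
  open Poly ring using (evalM; taylor)
  open import Algebra.Properties.Semiring.Sum (CommutativeRing.semiring ring) using (sum; sum-remove; *-distribˡ-sum; sum-cong-≗)
  private
    module F = CommutativeRing ring
    module S = IntSolver ring

  scalar : Carrier → F
  scalar r = r , 0#

  scalar-* : ∀ r s → scalar r *F scalar s ≡ scalar (r * s)
  scalar-* r s = cong₂ _,_ (solve 2 (λ r s → r :* s :- con (+ 0) :* con (+ 0) := r :* s) refl r s)
    (solve 2 (λ r s → r :* con (+ 0) :+ con (+ 0) :* s := con (+ 0)) refl r s)

  scalar-^ : ∀ r n → scalar r ^F n ≡ scalar (r ^ n)
  scalar-^ r zero    = refl
  scalar-^ r (suc n) = trans (cong (scalar r *F_) (scalar-^ r n)) (scalar-* r (r ^ n))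

  ‖*scalar‖ : ∀ z {r} → 0# ≤ r → ‖ z *F scalar r ‖ ≡ ‖ z ‖ * r
  ‖*scalar‖ (a , b) {r} 0≤r = trans (cong₂ (λ x y → ∣ x ∣ + ∣ y ∣)
      (solve 3 (λ a b r → a :* r :- b :* con (+ 0) := a :* r) refl a b r)
      (solve 3 (λ a b r → a :* con (+ 0) :+ b :* r := b :* r) refl a b r))
    (trans (cong₂ _+_ (trans (∣*∣ a r) (cong (∣ a ∣ *_) (nonNeg⇒∣∣≡ (nonNeg 0≤r)))) (trans (∣*∣ b r)
        (cong (∣ b ∣ *_) (nonNeg⇒∣∣≡ (nonNeg 0≤r)))))
      (solve 3 (λ a b r → a :* r :+ b :* r := (a :+ b) :* r) refl ∣ a ∣ ∣ b ∣ r))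

  ‖^‖ : ∀ z n → ‖ z ^F n ‖ ≤ ‖ z ‖ ^ n
  ‖^‖ z zero    = ≤-reflexive ‖1‖
  ‖^‖ z (suc n) = ≤-trans (‖*‖ z (z ^F n)) (*-monoˡ-≤ (0≤‖‖ z) (‖^‖ z n))

  ‖sum‖ : ∀ {n} (f : Fin n → F) {B} → (∀ i → ‖ f i ‖ ≤ B) → ‖ sum f ‖ ≤ fromℤ (+ n) * B
  ‖sum‖ {zero}  f {B} h = ≤-reflexive (trans ‖0‖ (sym (zeroˡ B)))
  ‖sum‖ {suc n} f {B} h = ≤-trans (‖+‖ (f zero) (sum (f ∘ suc)))
      (≤-trans (+-mono-≤ (h zero) (‖sum‖ (f ∘ suc) (h ∘ suc)))
    (≤-reflexive (trans (solve 2 (λ n b → b :+ n :* b := (con (+ 1) :+ n) :* b) refl (fromℤ (+ n)) B)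
      (cong (_* B) (sym (fromℤ-suc n))))))

  coefficient : ∀ {n} → Vec F n → Fin (suc n) → F
  coefficient []      zero    = 1F
  coefficient (c ∷ p) zero    = c
  coefficient (c ∷ p) (suc i) = coefficient p i

  coefficient-last : ∀ {n} (p : Vec F n) → coefficient p (fromℕ n) ≡ 1F
  coefficient-last []      = refl
  coefficient-last (c ∷ p) = coefficient-last p

  evalM-sum : ∀ {n} (p : Vec F n) w → evalM p w ≡ sum (λ i → coefficient p i *F (w ^F toℕ i))
  evalM-sum []      w = sym (trans (F.+-identityʳ (1F *F 1F)) (F.*-identityˡ 1F))
  evalM-sum {suc n} (c ∷ p) w = cong₂ _+F_ (sym (F.*-identityʳ c)) (trans (cong (w *F_) (evalM-sum p w))
    (trans (*-distribˡ-sum {suc n} w (λ i → coefficient p i *F (w ^F toℕ i)))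
      (sum-cong-≗ {suc n} λ i → swap w (coefficient p i) (w ^F toℕ i))))
    where
    swap : ∀ w c v → w *F (c *F v) ≡ c *F (w *F v)
    swap w c v = trans (sym (F.*-assoc w c v)) (trans (cong (_*F v) (F.*-comm w c)) (F.*-assoc c w v))

  evalM-0 : ∀ {n} c (p : Vec F n) → evalM (c ∷ p) 0F ≡ c
  evalM-0 c p = trans (cong (c +F_) (F.zeroˡ _)) (F.+-identityʳ c)

  -- |1 + x + iy|² = 1 + 2x + x² + y² ≤ 1 - 2κhM + 2Λ²M², and the smallness of M makes the quadratic
  -- part cost at most half of the linear gain.
  decrease : ∀ x y κ Λ M h → h + h ≡ 1# → 0# ≤ M → x ≤ - (κ * h * M) → ∣ x ∣ ≤ Λ * M → ∣ y ∣ ≤ Λ * M →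
             (1# + 1#) * (Λ * Λ * M) ≤ κ * h → N (1F +F (x , y)) ≤ 1# - κ * h * M
  decrease x y κ Λ M h h+h≡1 0≤M x≤ ∣x∣≤ ∣y∣≤ small = by
    (nonNeg-+ (nonNeg-+ (nonNeg-+ (nonNeg-+ x≤ x≤) (nonNeg-* (nonNeg 0≤M) small)) (square x ∣x∣≤))
        (square y ∣y∣≤))
    (solve 6 (λ x y κ Λ M h →
      (((:- (κ :* h :* M) :- x) :+ (:- (κ :* h :* M) :- x)) :+ M :*
          (κ :* h :- (con (+ 1) :+ con (+ 1)) :* (Λ :* Λ :* M))
        :+ ((Λ :* M) :* (Λ :* M) :- x :* x)) :+ ((Λ :* M) :* (Λ :* M) :- y :* y)
      := (con (+ 1) :- κ :* h :* M) :- ((con (+ 1) :+ x) :* (con (+ 1) :+ x) :+ (con (+ 0) :+ y) :*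
          (con (+ 0) :+ y)))
      refl x y κ Λ M h)
    where
    square : ∀ z → ∣ z ∣ ≤ Λ * M → NonNeg ((Λ * M) * (Λ * M) - z * z)
    square z h = subst (λ s → NonNeg ((Λ * M) * (Λ * M) - s)) (∣∣² z)
        (*-mono-≤ (0≤∣∣ z) (≤-trans (0≤∣∣ z) h) h h)

  -- One step for a polynomial with constant coefficient a and higher coefficients a * b.
  module OneStep {ν} (b : Fin (suc ν) → F) (κ S h η M₁ m Λ : Carrier)
    (0≤κ : 0# ≤ κ) (0≤h : 0# ≤ h) (h+h≡1 : h + h ≡ 1#) (1≤S : 1# ≤ S) (0≤η : 0# ≤ η)
    (dirs : UniformDirections (suc ν) κ S)
    (ηsmall : fromℤ (+ suc ν) * (η * S ^ suc ν) ≤ κ * h) (Λ≡ : Λ ≡ S ^ suc ν + κ * h)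
    (M₁small : (1# + 1#) * (Λ * Λ * M₁) ≤ κ * h)
    (dom : Dominated (λ i → ‖ b i ‖) M₁ η m) where
    private
      n : ℕ
      n = suc ν


    open Dominated dom
    L M : Carrier
    L = S ^ n
    M = ‖ b k ‖ * r ^ suc (toℕ k)
    0≤S : 0# ≤ S
    0≤S = ≤-trans 0≤1 1≤S
    0≤L : 0# ≤ L
    0≤L = 0≤^ n 0≤S
    0≤M : 0# ≤ M
    0≤M = 0≤* (0≤‖‖ (b k)) (0≤^ (suc (toℕ k)) 0≤r)

    c : F
    c = b k *F scalar (r ^ suc (toℕ k))

    ‖c‖ : ‖ c ‖ ≡ M
    ‖c‖ = ‖*scalar‖ (b k) (0≤^ (suc (toℕ k)) 0≤r)

    S^≤L : ∀ (i : Fin n) → S ^ suc (toℕ i) ≤ L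
    S^≤L i = go (Fin.toℕ<n i)
      where
      go : ∀ {i n} → i ℕ.≤ n → S ^ i ≤ S ^ n
      go {n = n} ℕ.z≤n = 1≤^ n 1≤S
      go (ℕ.s≤s p) = *-monoˡ-≤ 0≤S (go p)

    module _ (w : F) (‖w‖≤S : ‖ w ‖ ≤ S) (turned : re (c *F (w ^F suc (toℕ k))) ≤ - (κ * ‖ c ‖)) where
      step : F
      step = scalar r *F w

      term : Fin n → F
      term i = b i *F (step ^F suc (toℕ i))

      term≡ : ∀ i → term i ≡ b i *F scalar (r ^ suc (toℕ i)) *F (w ^F suc (toℕ i))
      term≡ i = trans (cong (b i *F_) (trans (^F-distrib-* (scalar r) w (suc (toℕ i)))
        (cong (_*F (w ^F suc (toℕ i))) (scalar-^ r (suc (toℕ i)))))) (sym (F.*-assoc (b i) _ _))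

      ‖term‖ : ∀ i → ‖ term i ‖ ≤ (‖ b i ‖ * r ^ suc (toℕ i)) * L
      ‖term‖ i = begin
        ‖ term i ‖
          ≡⟨ cong ‖_‖ (term≡ i) ⟩
        ‖ b i *F scalar (r ^ suc (toℕ i)) *F (w ^F suc (toℕ i)) ‖
          ≤⟨ ‖*‖ _ _ ⟩
        ‖ b i *F scalar (r ^ suc (toℕ i)) ‖ * ‖ w ^F suc (toℕ i) ‖
          ≡⟨ cong (_* ‖ w ^F suc (toℕ i) ‖) (‖*scalar‖ (b i) (0≤^ (suc (toℕ i)) 0≤r)) ⟩
        (‖ b i ‖ * r ^ suc (toℕ i)) * ‖ w ^F suc (toℕ i) ‖
          ≤⟨ *-monoˡ-≤ (0≤* (0≤‖‖ (b i)) (0≤^ (suc (toℕ i)) 0≤r)) (≤-trans (‖^‖ w (suc (toℕ i)))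
               (≤-trans (^-mono-≤ (suc (toℕ i)) (0≤‖‖ w) ‖w‖≤S) (S^≤L i))) ⟩
        (‖ b i ‖ * r ^ suc (toℕ i)) * L ∎
        where open ≤-Reasoning

      e : F
      e = sum (removeAt term k)

      ‖e‖ : ‖ e ‖ ≤ κ * h * M
      ‖e‖ = begin
        ‖ e ‖
          ≤⟨ ‖sum‖ (removeAt term k) (λ i → ≤-trans (‖term‖ (punchIn k i))
               (*-monoʳ-≤ 0≤L (other (punchIn k i) (Fin.punchInᵢ≢i k i)))) ⟩
        fromℤ (+ ν) * (η * M * L)
          ≤⟨ *-monoʳ-≤ (0≤* (0≤* 0≤η 0≤M) 0≤L)
              (by nonNeg-1 (trans (solve 1 (λ v → con (+ 1) := (con (+ 1) :+ v) :- v) refl (fromℤ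
              (+ ν)))
               (cong (λ x → x - fromℤ (+ ν)) (sym (fromℤ-suc ν))))) ⟩
        fromℤ (+ n) * (η * M * L)
          ≡⟨ solve 4 (λ n e m l → n :* (e :* m :* l) := n :* (e :* l) :* m) refl (fromℤ (+ n)) η M L ⟩
        fromℤ (+ n) * (η * L) * M
          ≤⟨ *-monoʳ-≤ 0≤M ηsmall ⟩
        κ * h * M ∎
        where open ≤-Reasoning

      x y : Carrier
      x = re (term k) + re e
      y = im (term k) + im e

      ‖term-k+e‖ : ‖ term k ‖ + ‖ e ‖ ≤ Λ * M
      ‖term-k+e‖ = ≤-trans (+-mono-≤ (‖term‖ k) ‖e‖) (≤-reflexive (trans
        (solve 4 (λ m l k h → m :* l :+ k :* h :* m := (l :+ k :* h) :* m) refl M L κ h)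
            (cong (_* M) (sym Λ≡))))

      ∣x∣≤ : ∣ x ∣ ≤ Λ * M
      ∣x∣≤ = ≤-trans (∣+∣ _ _) (≤-trans (+-mono-≤ (∣re∣≤‖‖ (term k)) (∣re∣≤‖‖ e)) ‖term-k+e‖)

      ∣y∣≤ : ∣ y ∣ ≤ Λ * M
      ∣y∣≤ = ≤-trans (∣+∣ _ _) (≤-trans (+-mono-≤ (∣im∣≤‖‖ (term k)) (∣im∣≤‖‖ e)) ‖term-k+e‖)

      x≤ : x ≤ - (κ * h * M)
      -- The turned term contributes at most -κM and the remaining ones at most κhM; with h = ½ half
      -- of the gain is left.
      x≤ = ≤-trans (+-mono-≤ (≤-trans (≤-reflexive (cong re (term≡ k))) (≤-trans turned
          (≤-reflexive (cong (λ u → - (κ * u)) ‖c‖))))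
          (≤-trans (a≤∣a∣ (re e)) (≤-trans (∣re∣≤‖‖ e) ‖e‖)))
        (≤-reflexive (trans (cong (λ u → - (u * M) + κ * h * M) (trans (sym (*-identityʳ κ))
            (cong (κ *_) (sym h+h≡1))))
          (solve 3 (λ κ h m → :- (κ :* (h :+ h) :* m) :+ κ :* h :* m := :- (κ :* h :* m)) refl κ h M)))

      decreased : N (1F +F sum term) ≤ 1# - κ * h * M
      decreased = subst (λ s → N (1F +F s) ≤ 1# - κ * h * M) (sym (sum-remove {ν} {k} term))
        (decrease x y κ Λ M h h+h≡1 0≤M x≤ ∣x∣≤ ∣y∣≤ (≤-trans (*-monoˡ-≤ (0≤+ 0≤1 0≤1)
          (*-monoˡ-≤ (0≤sq Λ) (upper k))) M₁small))

      ‖step‖ : ‖ step ‖ ^ n ≤ r ^ n * L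
      ‖step‖ = ≤-trans (^-mono-≤ n (0≤‖‖ step)
          (≤-trans (≤-reflexive (trans (cong ‖_‖ (F.*-comm (scalar r) w)) (‖*scalar‖ w 0≤r)))
        (≤-trans (*-monoʳ-≤ 0≤r ‖w‖≤S) (≤-reflexive (*-comm S r))))) (≤-reflexive (^-distrib-* r S n))

  -- The constants depend on the degree only. The bound on `s` matters as much as the decrease:
  -- geometric decay of the values then forces geometric decay of the step lengths, hence
  -- convergence. This `κ` is unrelated to the constant of the directions.
  record Descends (ν : ℕ) : Set where
    field
      θ κ : Carrier
      0<θ : 0# < θ
      θ≤1 : θ ≤ 1#
      0≤κ : 0# ≤ κ
      descend : ∀ (p : Vec F (suc ν)) → ∃[ s ] N (evalM p s) ≤ (1# - θ) * N (evalM p 0F)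
                  × ‖ s ‖ ^ suc ν * ‖ s ‖ ^ suc ν ≤ κ * N (evalM p 0F)

  private
    module Conclude {ν} (κ S h η M₁ m Λ θ : Carrier)
      (0≤κ : 0# ≤ κ) (0≤h : 0# ≤ h) (h+h≡1 : h + h ≡ 1#) (1≤S : 1# ≤ S) (0≤η : 0# ≤ η)
      (dirs : UniformDirections (suc ν) κ S)
      (ηsmall : fromℤ (+ suc ν) * (η * S ^ suc ν) ≤ κ * h) (Λ≡ : Λ ≡ S ^ suc ν + κ * h)
      (M₁small : (1# + 1#) * (Λ * Λ * M₁) ≤ κ * h) (0≤M₁ : 0# ≤ M₁)
      (θ≤ : θ ≤ κ * h * m) (0≤m : 0# ≤ m)
      (dom : ∀ (β : Fin (suc ν) → Carrier) → (∀ i → 0# ≤ β i) → ∀ l → 0# < β l → Dominated β M₁ η m) where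
      private
        n : ℕ
        n = suc ν


      K′ : Carrier
      K′ = (1# + 1#) * ((M₁ * S ^ n) * (M₁ * S ^ n))

      Goal : Vec F n → Set
      Goal p = ∃[ s ] N (evalM p s) ≤ (1# - θ) * N (evalM p 0F)
                  × ‖ s ‖ ^ n * ‖ s ‖ ^ n ≤ K′ * N (evalM p 0F)

      module _ (a i : F) (ai≡1 : a *F i ≡ 1F) (t : Vec F ν) where
        b : Fin n → F
        b j = i *F coefficient t j

        normalised : ∀ w → i *F evalM (a ∷ t) w ≡ 1F +F sum (λ j → b j *F (w ^F suc (toℕ j)))
        normalised w = trans (F.distribˡ i a _) (cong₂ _+F_ (trans (F.*-comm i a) ai≡1) (begin
          i *F (w *F evalM t w)
            ≡⟨ sym (F.*-assoc i w _) ⟩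
          i *F w *F evalM t w
            ≡⟨ cong (i *F w *F_) (evalM-sum t w) ⟩
          i *F w *F sum (λ j → coefficient t j *F (w ^F toℕ j))
            ≡⟨ *-distribˡ-sum {n} (i *F w) (λ j → coefficient t j *F (w ^F toℕ j)) ⟩
          sum (λ j → i *F w *F (coefficient t j *F (w ^F toℕ j)))
            ≡⟨ sum-cong-≗ {n} (λ j → rearrange i w (coefficient t j) (w ^F toℕ j)) ⟩
          sum (λ j → b j *F (w ^F suc (toℕ j))) ∎))
          where
          open ≡.≡-Reasoning
          rearrange : ∀ i w c v → i *F w *F (c *F v) ≡ i *F c *F (w *F v)
          rearrange i w c v = trans (F.*-assoc i w _)
              (trans (cong (i *F_) (trans (sym (F.*-assoc w c v))
            (trans (cong (_*F v) (F.*-comm w c)) (F.*-assoc c w v)))) (sym (F.*-assoc i c _)))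

        Na*Ni≡1 : N a * N i ≡ 1#
        Na*Ni≡1 = trans (sym (N-* a i)) (trans (cong N ai≡1)
          (solve 0 (con (+ 1) :* con (+ 1) :+ con (+ 0) :* con (+ 0) := con (+ 1)) refl))

        N-eval : ∀ w → N (evalM (a ∷ t) w) ≡ N a * N (1F +F sum (λ j → b j *F (w ^F suc (toℕ j))))
        N-eval w = begin
          N p                          ≡⟨ sym (*-identityˡ (N p)) ⟩
          1# * N p                     ≡⟨ cong (_* N p) (sym Na*Ni≡1) ⟩
          N a * N i * N p              ≡⟨ *-assoc (N a) (N i) (N p) ⟩
          N a * (N i * N p)            ≡⟨ cong (N a *_) (trans (sym (N-* i p)) (cong N (normalised w)))
              ⟩
          N a * N (1F +F sum (λ j → b j *F (w ^F suc (toℕ j)))) ∎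
          where
          open ≡.≡-Reasoning
          p : F
          p = evalM (a ∷ t) w

        1≤‖a‖‖i‖ : 1# ≤ ‖ a ‖ * ‖ i ‖
        1≤‖a‖‖i‖ = ≤-trans (≤-reflexive (trans (sym ‖1‖) (cong ‖_‖ (sym ai≡1)))) (‖*‖ a i)

        ‖i‖≢0 : ‖ i ‖ ≢ 0#
        ‖i‖≢0 e = 0<1 (≤-trans 1≤‖a‖‖i‖ (≤-reflexive (trans (cong (‖ a ‖ *_) e) (zeroʳ _))))

        b-last : b (fromℕ ν) ≡ i
        b-last = trans (cong (i *F_) (coefficient-last t)) (F.*-identityʳ i)

        reduce : Dominated (λ j → ‖ b j ‖) M₁ η m → Goal (a ∷ t)
        reduce D = choose (dirs (toℕ (Dominated.k D)) (Fin.toℕ<n (Dominated.k D)) O.c)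
          where
          module O = OneStep {ν} b κ S h η M₁ m Λ 0≤κ 0≤h h+h≡1 1≤S 0≤η dirs ηsmall Λ≡ M₁small D
          open Dominated D
          choose : (∃[ w ] ‖ w ‖ ≤ S × re (O.c *F (w ^F suc (toℕ k))) ≤ - (κ * ‖ O.c ‖)) → Goal (a ∷ t)
          choose (w , ‖w‖≤S , turned) = step , smaller , short
            where
            step : F
            step = O.step w ‖w‖≤S turned
            smaller : N (evalM (a ∷ t) step) ≤ (1# - θ) * N (evalM (a ∷ t) 0F)
            smaller = ≤-trans (≤-reflexive (N-eval step))
                (≤-trans (*-monoˡ-≤ (0≤N a) (≤-trans (O.decreased w ‖w‖≤S turned)
                (≤-trans (+-mono-≤ ≤-refl (neg-mono-≤ (*-monoˡ-≤ (0≤* 0≤κ 0≤h) lower)))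
                    (+-mono-≤ ≤-refl (neg-mono-≤ θ≤)))))
              (≤-reflexive (trans (*-comm (N a) (1# - θ)) (cong (λ z → (1# - θ) * N z)
                  (sym (evalM-0 a t))))))
            -- p is monic, so the top coefficient of p / a is i = 1/a. The upper bound `M₁` for that
            -- term reads ‖i‖ rⁿ ≤ M₁, and 1 ≤ ‖a‖ ‖i‖ converts it into rⁿ ≤ ‖a‖ M₁.
            r^nL≤ : r ^ n * S ^ n ≤ ‖ a ‖ * (M₁ * S ^ n)
            r^nL≤ = begin
              r ^ n * S ^ n
                ≡⟨ sym (*-identityˡ _) ⟩
              1# * (r ^ n * S ^ n)
                ≤⟨ *-monoʳ-≤ (0≤* (0≤^ n 0≤r) O.0≤L) 1≤‖a‖‖i‖ ⟩
              ‖ a ‖ * ‖ i ‖ * (r ^ n * S ^ n)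
                ≡⟨ solve 4 (λ a i r s → a :* i :* (r :* s) := a :* (i :* r :* s)) refl (‖ a ‖) ‖ i ‖
                    (r ^ n) (S ^ n) ⟩
              ‖ a ‖ * (‖ i ‖ * r ^ n * S ^ n)
                ≤⟨ *-monoˡ-≤ (0≤‖‖ a) (*-monoʳ-≤ O.0≤L
                    (subst₂ (λ z d → ‖ z ‖ * r ^ suc d ≤ M₁) b-last (Fin.toℕ-fromℕ ν)
                    (upper (fromℕ ν)))) ⟩
              ‖ a ‖ * (M₁ * S ^ n) ∎
              where
              open ≤-Reasoning
              open ≡ using (subst₂)
            short : ‖ step ‖ ^ n * ‖ step ‖ ^ n ≤ K′ * N (evalM (a ∷ t) 0F)
            short = begin
              ‖ step ‖ ^ n * ‖ step ‖ ^ n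
                ≤⟨ *-mono-≤ (0≤^ n (0≤‖‖ step)) (0≤* (0≤‖‖ a) (0≤* 0≤M₁ O.0≤L)) bound bound ⟩
              (‖ a ‖ * (M₁ * S ^ n)) * (‖ a ‖ * (M₁ * S ^ n))
                ≡⟨ solve 2 (λ a g → (a :* g) :* (a :* g) := (g :* g) :* (a :* a)) refl ‖ a ‖
                    (M₁ * S ^ n) ⟩
              (M₁ * S ^ n) * (M₁ * S ^ n) * (‖ a ‖ * ‖ a ‖)
                ≤⟨ *-monoˡ-≤ (0≤sq (M₁ * S ^ n)) (‖‖²≤2N a) ⟩
              (M₁ * S ^ n) * (M₁ * S ^ n) * (2K * N a)
                ≡⟨ solve 2 (λ g a → g :* ((con (+ 1) :+ con (+ 1)) :* a) := (con (+ 1) :+ con (+ 1)) :*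
                    g :* a) refl ((M₁ * S ^ n) * (M₁ * S ^ n)) (N a) ⟩
              K′ * N a
                ≡⟨ cong (λ z → K′ * N z) (sym (evalM-0 a t)) ⟩
              K′ * N (evalM (a ∷ t) 0F) ∎
              where
              open ≤-Reasoning
              bound : ‖ step ‖ ^ n ≤ ‖ a ‖ * (M₁ * S ^ n)
              bound = ≤-trans (O.‖step‖ w ‖w‖≤S turned) r^nL≤

        goal : Goal (a ∷ t)
        goal = reduce (dom (λ j → ‖ b j ‖) (λ j → 0≤‖‖ (b j)) (fromℕ ν)
          (subst (λ z → 0# < ‖ z ‖) (sym b-last) (0≤∧≢⇒0< (0≤‖‖ i) ‖i‖≢0)))

      zeroGoal : ∀ t → Goal (0F ∷ t)
      zeroGoal t = 0F
        , ≤-reflexive (trans N≡0 (sym (trans (cong ((1# - θ) *_) N≡0) (zeroʳ _))))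
        , ≤-reflexive (trans (cong (λ z → z * ‖ 0F ‖ ^ ν * (‖ 0F ‖ * ‖ 0F ‖ ^ ν)) ‖0‖)
            (trans (cong (_* (‖ 0F ‖ * ‖ 0F ‖ ^ ν)) (zeroˡ _))
                (trans (zeroˡ _) (sym (trans (cong (K′ *_) N≡0) (zeroʳ K′))))))
        where
        N≡0 : N (evalM (0F ∷ t) 0F) ≡ 0#
        N≡0 = trans (cong N (evalM-0 0F t))
            (solve 0 (con (+ 0) :* con (+ 0) :+ con (+ 0) :* con (+ 0) := con (+ 0)) refl)

      0F? : ∀ a → Dec (a ≡ 0F)
      0F? a = decide (‖ a ‖ ≤? 0#)
        where
        decide : Dec (‖ a ‖ ≤ 0#) → Dec (a ≡ 0F)
        decide (yes h) = yes (‖‖≤0⇒≡0 a h)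
        decide (no h)  = no λ e → h (≤-reflexive (trans (cong ‖_‖ e) ‖0‖))

      goals : ∀ p → Goal p
      goals (a ∷ t) = split (0F? a)
        where
        split : Dec (a ≡ 0F) → Goal (a ∷ t)
        split (yes e) = subst (λ a → Goal (a ∷ t)) (sym e) (zeroGoal t)
        split (no a≢0) = let i , ai≡1 = invF a a≢0 in goal a i ai≡1 t

      0≤K′ : 0# ≤ K′
      0≤K′ = 0≤* (0≤+ 0≤1 0≤1) (0≤sq (M₁ * S ^ n))

    module Constants (ν : ℕ) where
      private
        n : ℕ
        n = suc ν

      with-m : ∀ κ S h η M₁ Λ → 0# < κ → 0# < h → h + h ≡ 1# → 1# ≤ S → 0# < η → 0# < M₁ →
        UniformDirections n κ S → fromℤ (+ n) * (η * S ^ n) ≤ κ * h → Λ ≡ S ^ n + κ * h → (1# + 1#) *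
            (Λ * Λ * M₁) ≤ κ * h →
        (∃[ m ] 0# < m × (∀ (β : Fin n → Carrier) →
            (∀ i → 0# ≤ β i) → ∀ l → 0# < β l → Dominated β M₁ η m)) → Descends ν
      with-m κ S h η M₁ Λ 0<κ 0<h h+h≡1 1≤S 0<η 0<M₁ dirs ηsmall Λ≡ M₁small (m , 0<m , dom) =
        from (minimum⁺ (0<* (0<* 0<κ 0<h) 0<m) 0<1)
        where
        from : (∃[ θ ] 0# < θ × θ ≤ κ * h * m × θ ≤ 1#) → Descends ν
        from (θ , 0<θ , θ≤ , θ≤1) = record { θ = θ ; κ = C.K′ ; 0<θ = 0<θ ; θ≤1 = θ≤1 ; 0≤κ = C.0≤K′ ; descend = C.goals }
          where
          module C = Conclude {ν} κ S h η M₁ m Λ θ (<⇒≤ 0<κ) (<⇒≤ 0<h) h+h≡1 1≤S (<⇒≤ 0<η) dirs ηsmall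
              Λ≡ M₁small
            (<⇒≤ 0<M₁) θ≤ (<⇒≤ 0<m) dom

      with-directions : ∀ h → h + h ≡ 1# → UniformlyDirected n → Descends ν
      with-directions h h+h≡1 (κ , S , 0<κ , 1≤S , dirs) = with-J (inverse⁺ 0<nL)
        where
        0<h : 0# < h
        0<h = Halves.0<h h h+h≡1
        0<L : 0# < S ^ n
        0<L = <-≤-trans 0<1 (1≤^ n 1≤S)
        0<nL : 0# < fromℤ (+ n) * S ^ n
        0<nL = 0<* (0<fromℤ-suc ν) 0<L
        Λ : Carrier
        Λ = S ^ n + κ * h
        0<Λ : 0# < Λ
        0<Λ = 0<+ 0<L (<⇒≤ (0<* 0<κ 0<h))
        -- J = 1/(n Sⁿ): η ≤ κhJ keeps the dominated terms below half of the turned one. Below, I =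
        -- 1/(2Λ²): M₁ = κhI keeps the quadratic remainder below half of the linear gain.
        with-J : (∃[ J ] 0# < J × fromℤ (+ n) * S ^ n * J ≡ 1#) → Descends ν
        with-J (J , 0<J , nLJ≡1) = with-η (minimum⁺ (0<* (0<* 0<κ 0<h) 0<J) 0<1)
          where
          with-η : (∃[ η ] 0# < η × η ≤ κ * h * J × η ≤ 1#) → Descends ν
          with-η (η , 0<η , η≤ , η≤1) = with-I (inverse⁺ (0<* (0<+ 0<1 0≤1) (0<* 0<Λ 0<Λ)))
            where
            ηsmall : fromℤ (+ n) * (η * S ^ n) ≤ κ * h
            ηsmall = ≤-trans (*-monoˡ-≤ (fromℤ-nonNeg n) (*-monoʳ-≤ (<⇒≤ 0<L) η≤)) (≤-reflexive
              (trans (solve 4 (λ n k j l → n :* (k :* j :* l) := n :* l :* j :* k) refl (fromℤ (+ n))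
                  (κ * h) J (S ^ n))
                (trans (cong (_* (κ * h)) nLJ≡1) (*-identityˡ _))))
            with-I : (∃[ I ] 0# < I × (1# + 1#) * (Λ * Λ) * I ≡ 1#) → Descends ν
            with-I (I , 0<I , 2ΛΛI≡1) = with-m κ S h η (κ * h * I) Λ 0<κ 0<h h+h≡1 1≤S 0<η 0<M₁ dirs
                ηsmall refl
              (≤-reflexive (trans (solve 3 (λ l k i → (con (+ 1) :+ con (+ 1)) :* (l :* l :*
                  (k :* i)) := (con (+ 1) :+ con (+ 1)) :* (l :* l) :* i :* k) refl Λ (κ * h) I)
                (trans (cong (_* (κ * h)) 2ΛΛI≡1) (*-identityˡ _))))
              (dominate n (κ * h * I) η 0<M₁ 0<η η≤1)
              where
              0<M₁ : 0# < κ * h * I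
              0<M₁ = 0<* (0<* 0<κ 0<h) 0<I

  abstract
    descends : ∀ ν → Descends ν
    descends ν = Constants.with-directions ν (proj₁ half) (proj₂ half) (uniform-directions (suc ν))

-- Convergence of the descent to a root

module Iterate (K : OrderedField) where
  open import Data.Integer using (+_)
  open import Data.Nat as ℕ using (ℕ; zero; suc)
  import Data.Nat.Properties as ℕ
  open import Data.Product using (∃-syntax; _×_; _,_; proj₁; proj₂)
  open import Data.Vec using (Vec)
  open import Relation.Binary.PropositionalEquality using (_≡_; refl; sym; trans; cong; cong₂; subst)

  open Order K
  open Gaussian K
  open Kneser K
  open Poly ring using (evalM; taylor)
  private
    module F = CommutativeRing ring
    module S = IntSolver ring

  1-nτ≤[1-τ]^n : ∀ n {τ} → 0# ≤ τ → τ ≤ 1# → 1# - fromℤ (+ n) * τ ≤ (1# - τ) ^ n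
  1-nτ≤[1-τ]^n zero    {τ} 0≤τ τ≤1 = ≤-reflexive
      (solve 1 (λ τ → con (+ 1) :- con (+ 0) :* τ := con (+ 1)) refl τ)
  1-nτ≤[1-τ]^n (suc n) {τ} 0≤τ τ≤1 = begin
    1# - fromℤ (+ suc n) * τ
      ≡⟨ cong (λ s → 1# - s * τ) (fromℤ-suc n) ⟩
    1# - (1# + fromℤ (+ n)) * τ
      ≤⟨ by (nonNeg-* (nonNeg (fromℤ-nonNeg n)) (nonNeg-sq τ))
           (solve 2 (λ n τ → n :* (τ :* τ) := (con (+ 1) :- τ) :* (con (+ 1) :- n :* τ) :- (con (+ 1) :-
               (con (+ 1) :+ n) :* τ))
             refl (fromℤ (+ n)) τ) ⟩
    (1# - τ) * (1# - fromℤ (+ n) * τ)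
      ≤⟨ *-monoˡ-≤ (0≤ τ≤1) (1-nτ≤[1-τ]^n n 0≤τ τ≤1) ⟩
    (1# - τ) ^ suc n ∎
    where open ≤-Reasoning

  module Geometric (τ : Carrier) (0<τ : 0# < τ) (τ≤1 : τ ≤ 1#) where
    ρ : Carrier
    ρ = 1# - τ
    0≤ρ : 0# ≤ ρ
    0≤ρ = 0≤ τ≤1
    ρ≤1 : ρ ≤ 1#
    ρ≤1 = by (nonNeg (<⇒≤ 0<τ)) (solve 1 (λ t → t := con (+ 1) :- (con (+ 1) :- t)) refl τ)

    -- Explicit decay without logarithms: jτ ≤ (1 + τ)ʲ by Bernoulli, and (1 + τ)(1 - τ) ≤ 1.
    jτρ^j≤1 : ∀ j → fromℤ (+ j) * τ * ρ ^ j ≤ 1#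
    jτρ^j≤1 j = begin
      fromℤ (+ j) * τ * ρ ^ j     ≤⟨ *-monoʳ-≤ (0≤^ j 0≤ρ)
          (≤-trans (by nonNeg-1 (solve 1 (λ x → con (+ 1) := (con (+ 1) :+ x) :- x) refl _))
                                        (1+n·τ≤[1+τ]^n j (<⇒≤ 0<τ))) ⟩
      (1# + τ) ^ j * ρ ^ j        ≡⟨ sym (^-distrib-* (1# + τ) ρ j) ⟩
      ((1# + τ) * ρ) ^ j          ≤⟨ ^≤1 j (0≤* (0≤+ 0≤1 (<⇒≤ 0<τ)) 0≤ρ)
                                        (by (nonNeg-sq τ) (solve 1 (λ t → t :* t := con (+ 1) :- (con
                                            (+ 1) :+ t) :* (con (+ 1) :- t)) refl τ)) ⟩
      1#                          ∎
      where open ≤-Reasoning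

    ρ^-antimono : ∀ j m → ρ ^ (j ℕ.+ m) ≤ ρ ^ j
    ρ^-antimono j m = ≤-trans (≤-reflexive (^-+ ρ j m))
        (≤-trans (*-monoˡ-≤ (0≤^ j 0≤ρ) (^≤1 m 0≤ρ ρ≤1)) (≤-reflexive (*-identityʳ _)))

    vanishes : ∀ B {ε} → 0# ≤ B → 0# < ε → ∃[ J ] ∀ m → B * ρ ^ (J ℕ.+ m) ≤ ε
    vanishes B {ε} 0≤B 0<ε = from (archimedean′ B (0<* 0<τ 0<ε))
      where
      from : (∃[ J ] B ≤ fromℤ (+ J) * (τ * ε)) → ∃[ J ] ∀ m → B * ρ ^ (J ℕ.+ m) ≤ ε
      from (J , B≤) = J , λ m → begin
        B * ρ ^ (J ℕ.+ m)                    ≤⟨ *-monoˡ-≤ 0≤B (ρ^-antimono J m) ⟩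
        B * ρ ^ J                            ≤⟨ *-monoʳ-≤ (0≤^ J 0≤ρ) B≤ ⟩
        fromℤ (+ J) * (τ * ε) * ρ ^ J        ≡⟨ solve 4
            (λ j t e r → j :* (t :* e) :* r := j :* t :* r :* e) refl (fromℤ (+ J)) τ ε (ρ ^ J) ⟩
        fromℤ (+ J) * τ * ρ ^ J * ε          ≤⟨ *-monoʳ-≤ (<⇒≤ 0<ε) (jτρ^j≤1 J) ⟩
        1# * ε                               ≡⟨ *-identityˡ ε ⟩
        ε                                    ∎
        where open ≤-Reasoning

  sq-cancel-≤ : ∀ {a b} → 0# ≤ b → a * a ≤ b * b → a ≤ b
  sq-cancel-≤ {a} {b} 0≤b h = ^-cancel-≤ 1 0≤b (≤-trans (≤-reflexive (cong (a *_) (*-identityʳ a)))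
    (≤-trans h (≤-reflexive (cong (b *_) (sym (*-identityʳ b))))))

  -- The sequence stands for its limit, an exact root that need not exist in the field itself.
  record Root {n} (p : Vec F n) (z₀ : F) (δ : Carrier) : Set where
    field
      zs     : ℕ → F
      near   : ∀ j → ‖ zs j -F z₀ ‖ ≤ δ
      cauchy : ∀ ε → 0# < ε → ∃[ J ] ∀ m → ‖ zs (J ℕ.+ m) -F zs J ‖ ≤ ε
      root   : ∀ ε → 0# < ε → ∃[ J ] ∀ m → ‖ evalM p (zs (J ℕ.+ m)) ‖ ≤ ε

  -- The assumption on `τ` makes ρ = 1 - τ a lower-cost 2n-th root of the contraction factor: |p|²
  -- shrinks by ρ²ⁿ per step, and ‖s‖²ⁿ ≤ κ|p|² turns this into step lengths shrinking by ρ.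
  module Iteration {ν} (D : Descends ν) (τ : Carrier) (0<τ : 0# < τ) (τ≤1 : τ ≤ 1#)
    (1-θ≤ : 1# - Descends.θ D ≤ (1# - τ) ^ suc ν * (1# - τ) ^ suc ν) (p : Vec F (suc ν)) where
    open Descends D
    private
      n : ℕ
      n = suc ν

    open Geometric τ 0<τ τ≤1

    Step : F → Set
    Step z = ∃[ s ] N (evalM p (z +F s)) ≤ (1# - θ) * N (evalM p z) × ‖ s ‖ ^ n * ‖ s ‖ ^ n ≤ κ * N
        (evalM p z)

    step : ∀ z → Step z
    step z = from (taylor p z)
      where
      from : (∃[ q ] ∀ w → evalM {n} q w ≡ evalM p (z +F w)) → Step z
      from (q , e) = let s , a , b = descend q in s
        , subst (λ x → x ≤ (1# - θ) * N (evalM p z)) (cong N (e s))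
            (subst (λ x → N (evalM q s) ≤ (1# - θ) * x) at0 a)
        , subst (λ x → ‖ s ‖ ^ n * ‖ s ‖ ^ n ≤ κ * x) at0 b
        where
        at0 : N (evalM q 0F) ≡ N (evalM p z)
        at0 = cong N (trans (e 0F) (cong (evalM p) (F.+-identityʳ z)))

    module _ (z₀ : F) where
      zs : ℕ → F
      zs zero    = z₀
      zs (suc j) = zs j +F proj₁ (step (zs j))

      private
        s : ℕ → F
        s j = proj₁ (step (zs j))
        N₀ : Carrier
        N₀ = N (evalM p z₀)
        σ : Carrier
        σ = ρ ^ n * ρ ^ n
        0≤σ : 0# ≤ σ
        0≤σ = 0≤sq (ρ ^ n)

      N-zs : ∀ j → N (evalM p (zs j)) ≤ σ ^ j * N₀
      N-zs zero    = ≤-reflexive (sym (*-identityˡ N₀))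
      N-zs (suc j) = ≤-trans (proj₁ (proj₂ (step (zs j)))) (≤-trans
        (*-mono-≤ (0≤ θ≤1) (0≤* (0≤^ j 0≤σ) (0≤N (evalM p z₀))) 1-θ≤ (N-zs j))
            (≤-reflexive (sym (*-assoc σ _ _))))

      σ^≤ρ^ : ∀ j → σ ^ j ≤ ρ ^ j
      σ^≤ρ^ j = ^-mono-≤ j 0≤σ (≤-trans (*-mono-≤ (0≤^ n 0≤ρ) 0≤1 ρ^n≤ρ (^≤1 n 0≤ρ ρ≤1))
          (≤-reflexive (*-identityʳ ρ)))
        where
        ρ^n≤ρ : ρ ^ n ≤ ρ
        ρ^n≤ρ = ≤-trans (*-monoˡ-≤ 0≤ρ (^≤1 ν 0≤ρ ρ≤1)) (≤-reflexive (*-identityʳ ρ))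

      module _ (δ : Carrier) (0≤δ : 0# ≤ δ) (small : κ * N₀ ≤ δ ^ n * δ ^ n) where
        ‖s‖ : ∀ j → ‖ s j ‖ ≤ δ * ρ ^ j
        ‖s‖ j = ^-cancel-≤ ν 0≤δρ (sq-cancel-≤ (0≤^ n 0≤δρ) (begin
          ‖ s j ‖ ^ n * ‖ s j ‖ ^ n
            ≤⟨ proj₂ (proj₂ (step (zs j))) ⟩
          κ * N (evalM p (zs j))
            ≤⟨ *-monoˡ-≤ 0≤κ (N-zs j) ⟩
          κ * (σ ^ j * N₀)
            ≡⟨ solve 3 (λ k s n → k :* (s :* n) := k :* n :* s) refl κ (σ ^ j) N₀ ⟩
          κ * N₀ * σ ^ j
            ≤⟨ *-monoʳ-≤ (0≤^ j 0≤σ) small ⟩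
          δ ^ n * δ ^ n * σ ^ j
            ≡⟨ cong (δ ^ n * δ ^ n *_) (trans (^-distrib-* (ρ ^ n) (ρ ^ n) j)
                (cong₂ _*_ (^-swap ρ n j) (^-swap ρ n j))) ⟩
          δ ^ n * δ ^ n * ((ρ ^ j) ^ n * (ρ ^ j) ^ n)
            ≡⟨ solve 2 (λ d r → d :* d :* (r :* r) := (d :* r) :* (d :* r)) refl (δ ^ n) ((ρ ^ j) ^ n) ⟩
          (δ ^ n * (ρ ^ j) ^ n) * (δ ^ n * (ρ ^ j) ^ n)
            ≡⟨ cong₂ _*_ (sym (^-distrib-* δ (ρ ^ j) n)) (sym (^-distrib-* δ (ρ ^ j) n)) ⟩
          (δ * ρ ^ j) ^ n * (δ * ρ ^ j) ^ n ∎))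
          where
          open ≤-Reasoning
          0≤δρ : 0# ≤ δ * ρ ^ j
          0≤δρ = 0≤* 0≤δ (0≤^ j 0≤ρ)
          ^-swap : ∀ a n j → (a ^ n) ^ j ≡ (a ^ j) ^ n
          ^-swap a zero    j = 1^ j
          ^-swap a (suc n) j = trans (^-distrib-* a (a ^ n) j) (cong (a ^ j *_) (^-swap a n j))

        -- The geometric series is summed without division, by carrying the factor τ = 1 - ρ along.
        distance : ∀ j m → τ * ‖ zs (j ℕ.+ m) -F zs j ‖ ≤ δ * (ρ ^ j - ρ ^ (j ℕ.+ m))
        distance j zero = ≤-reflexive (trans
            (trans (cong (λ i → τ * ‖ zs i -F zs j ‖) (ℕ.+-identityʳ j))
          (trans (cong (λ z → τ * ‖ z ‖) (F.-‿inverseʳ (zs j))) (trans (cong (τ *_) ‖0‖) (zeroʳ τ))))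
          (sym (trans (cong (λ i → δ * (ρ ^ j - ρ ^ i)) (ℕ.+-identityʳ j)) (solve 2
              (λ d r → d :* (r :- r) := con (+ 0)) refl δ (ρ ^ j)))))
        distance j (suc m) = subst (λ i → τ * ‖ zs i -F zs j ‖ ≤ δ * (ρ ^ j - ρ ^ i))
            (sym (ℕ.+-suc j m)) (begin
          τ * ‖ zs k +F s k -F zs j ‖
            ≡⟨ cong (λ z → τ * ‖ z ‖) (S.solve 3 (λ a b c → (a S.:+ b) S.:- c S.:= (a S.:- c) S.:+ b)
                refl (zs k) (s k) (zs j)) ⟩
          τ * ‖ (zs k -F zs j) +F s k ‖
            ≤⟨ *-monoˡ-≤ (<⇒≤ 0<τ) (‖+‖ (zs k -F zs j) (s k)) ⟩
          τ * (‖ zs k -F zs j ‖ + ‖ s k ‖)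
            ≡⟨ solve 3 (λ t a b → t :* (a :+ b) := t :* a :+ t :* b) refl τ _ _ ⟩
          τ * ‖ zs k -F zs j ‖ + τ * ‖ s k ‖
            ≤⟨ +-mono-≤ (distance j m) (*-monoˡ-≤ (<⇒≤ 0<τ) (‖s‖ k)) ⟩
          δ * (ρ ^ j - ρ ^ k) + τ * (δ * ρ ^ k)
            ≡⟨ solve 4 (λ d a b t → d :* (a :- b) :+ t :* (d :* b) := d :* (a :- (con (+ 1) :- t) :* b))
                refl δ (ρ ^ j) (ρ ^ k) τ ⟩
          δ * (ρ ^ j - ρ * ρ ^ k) ∎)
          where
          open ≤-Reasoning
          k : ℕ
          k = j ℕ.+ m

        distance′ : ∀ j m → τ * ‖ zs (j ℕ.+ m) -F zs j ‖ ≤ δ * ρ ^ j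
        distance′ j m = ≤-trans (distance j m) (*-monoˡ-≤ 0≤δ (by (nonNeg (0≤^ (j ℕ.+ m) 0≤ρ))
          (solve 2 (λ a b → b := a :- (a :- b)) refl (ρ ^ j) (ρ ^ (j ℕ.+ m)))))

        rooted : ∀ {δ′} → δ ≡ τ * δ′ → Root p z₀ δ′
        rooted {δ′} δ≡ = record
          { zs     = zs
          ; near   = λ j → *-cancelˡ-≤ 0<τ (≤-trans (distance′ 0 j)
              (≤-reflexive (trans (*-identityʳ δ) δ≡)))
          ; cauchy = cauchy
          ; root   = root }
          where
          cauchy : ∀ ε → 0# < ε → ∃[ J ] ∀ m → ‖ zs (J ℕ.+ m) -F zs J ‖ ≤ ε
          cauchy ε 0<ε = from (vanishes δ 0≤δ (0<* 0<τ 0<ε))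
            where
            from : (∃[ J ] ∀ m → δ * ρ ^ (J ℕ.+ m) ≤ τ * ε) → ∃[ J ] ∀ m → ‖ zs (J ℕ.+ m) -F zs J ‖ ≤ ε
            from (J , h) = J , λ m → *-cancelˡ-≤ 0<τ (≤-trans (distance′ J m)
              (subst (λ i → δ * ρ ^ i ≤ τ * ε) (ℕ.+-identityʳ J) (h 0)))
          root : ∀ ε → 0# < ε → ∃[ J ] ∀ m → ‖ evalM p (zs (J ℕ.+ m)) ‖ ≤ ε
          root ε 0<ε = from (vanishes (2K * N₀) (0≤* (0≤+ 0≤1 0≤1) (0≤N (evalM p z₀))) (0<* 0<ε 0<ε))
            where
            from : (∃[ J ] ∀ m → 2K * N₀ * ρ ^ (J ℕ.+ m) ≤ ε * ε) → ∃[ J ] ∀ m → ‖ evalM p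
                (zs (J ℕ.+ m)) ‖ ≤ ε
            from (J , h) = J , λ m → sq-cancel-≤ (<⇒≤ 0<ε) (≤-trans (‖‖²≤2N (evalM p (zs (J ℕ.+ m))))
              (≤-trans (*-monoˡ-≤ (0≤+ 0≤1 0≤1) (≤-trans (N-zs (J ℕ.+ m)) (*-monoʳ-≤ (0≤N (evalM p z₀))
                  (σ^≤ρ^ (J ℕ.+ m)))))
                (≤-trans (≤-reflexive (solve 3 (λ k r n → k :* (r :* n) := k :* n :* r) refl 2K (ρ ^
                    (J ℕ.+ m)) N₀)) (h m))))

  -- `η` and `R` come before the polynomial. Uniform `R` is needed in the factorisation, where the
  -- quotients vary with the precision demanded.
  record Localises (ν : ℕ) : Set where
    field
      close : ∀ δ → 0# < δ → ∃[ η ] 0# < η ×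
          (∀ (p : Vec F (suc ν)) z₀ → ‖ evalM p z₀ ‖ ≤ η → Root p z₀ δ)
      far   : ∀ C → 0# ≤ C → ∃[ R ] 0# ≤ R ×
          (∀ (p : Vec F (suc ν)) z₀ → ‖ evalM p z₀ ‖ ≤ C → Root p z₀ R)

  private
    module Localise (ν : ℕ) (D : Descends ν) (τ : Carrier) (0<τ : 0# < τ) (τ≤1 : τ ≤ 1#)
      (1-θ≤ : 1# - Descends.θ D ≤ (1# - τ) ^ suc ν * (1# - τ) ^ suc ν) where
      open Descends D
      n : ℕ
      n = suc ν
      0<κ+1 : 0# < κ + 1#
      0<κ+1 = subst (0# <_) (+-comm 1# κ) (0<+ 0<1 0≤κ)

      N≤² : ∀ {z C} → ‖ z ‖ ≤ C → N z ≤ C * C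
      N≤² {z} h = ≤-trans (N≤‖‖² z) (*-mono-≤ (0≤‖‖ z) (≤-trans (0≤‖‖ z) h) h h)

      close : ∀ δ → 0# < δ → ∃[ η ] 0# < η × (∀ (p : Vec F n) z₀ → ‖ evalM p z₀ ‖ ≤ η → Root p z₀ δ)
      close δ 0<δ = from (inverse⁺ 0<κ+1)
        where
        t : Carrier
        t = (τ * δ) ^ n * (τ * δ) ^ n
        0<t : 0# < t
        0<t = 0<* (0<^ n (0<* 0<τ 0<δ)) (0<^ n (0<* 0<τ 0<δ))
        from : (∃[ i ] 0# < i × (κ + 1#) * i ≡ 1#) → ∃[ η ] 0# < η ×
            (∀ (p : Vec F n) z₀ → ‖ evalM p z₀ ‖ ≤ η → Root p z₀ δ)
        from (i , 0<i , κi≡1) = pick (minimum⁺ 0<1 (0<* 0<t 0<i))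
          where
          pick : (∃[ η ] 0# < η × η ≤ 1# × η ≤ t * i) → ∃[ η ] 0# < η ×
              (∀ (p : Vec F n) z₀ → ‖ evalM p z₀ ‖ ≤ η → Root p z₀ δ)
          pick (η , 0<η , η≤1 , η≤ti) = η , 0<η , λ p z₀ h →
            Iteration.rooted D τ 0<τ τ≤1 1-θ≤ p z₀ (τ * δ) (<⇒≤ (0<* 0<τ 0<δ)) (small (N≤² h)) refl
            where
            open ≤-Reasoning
            small : ∀ {x} → x ≤ η * η → κ * x ≤ t
            small {x} h = begin
              κ * x            ≤⟨ *-monoˡ-≤ 0≤κ (≤-trans h
                  (*-mono-≤ (<⇒≤ 0<η) (<⇒≤ (0<* 0<t 0<i)) η≤1 η≤ti)) ⟩
              κ * (1# * (t * i))  ≤⟨ *-monoʳ-≤ (0≤* 0≤1 (<⇒≤ (0<* 0<t 0<i)))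
                                     (by nonNeg-1 (solve 1 (λ k → con (+ 1) :=
                                         (k :+ con (+ 1)) :- k) refl κ)) ⟩
              (κ + 1#) * (1# * (t * i))  ≡⟨ solve 3
                  (λ k t i → k :* (con (+ 1) :* (t :* i)) := t :* (k :* i)) refl (κ + 1#) t i ⟩
              t * ((κ + 1#) * i)  ≡⟨ trans (cong (t *_) κi≡1) (*-identityʳ t) ⟩
              t                ∎

      far : ∀ C → 0# ≤ C → ∃[ R ] 0# ≤ R × (∀ (p : Vec F n) z₀ → ‖ evalM p z₀ ‖ ≤ C → Root p z₀ R)
      far C 0≤C = from (inverse⁺ 0<τ)
        where
        d : Carrier
        -- With d ≥ 1 the bound κC² ≤ d ≤ d²ⁿ holds without taking a root.
        d = 1# + κ * (C * C)
        1≤d : 1# ≤ d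
        1≤d = by (nonNeg (0≤* 0≤κ (0≤sq C)))
            (solve 1 (λ x → x := (con (+ 1) :+ x) :- con (+ 1)) refl (κ * (C * C)))
        d≤d^n : d ≤ d ^ n * d ^ n
        d≤d^n = begin
          d              ≡⟨ sym (trans (*-identityʳ _) (*-identityʳ d)) ⟩
          d * 1# * 1#    ≤⟨ *-mono-≤ (0≤* (≤-trans 0≤1 1≤d) 0≤1) (0≤^ n (≤-trans 0≤1 1≤d))
              (*-monoˡ-≤ (≤-trans 0≤1 1≤d) (1≤^ ν 1≤d)) (1≤^ n 1≤d) ⟩
          d ^ n * d ^ n  ∎
          where open ≤-Reasoning
        from : (∃[ i ] 0# < i × τ * i ≡ 1#) → ∃[ R ] 0# ≤ R ×
            (∀ (p : Vec F n) z₀ → ‖ evalM p z₀ ‖ ≤ C → Root p z₀ R)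
        from (i , 0<i , τi≡1) = i * d , 0≤* (<⇒≤ 0<i) (≤-trans 0≤1 1≤d) , λ p z₀ h →
          Iteration.rooted D τ 0<τ τ≤1 1-θ≤ p z₀ d (≤-trans 0≤1 1≤d)
            (≤-trans (*-monoˡ-≤ 0≤κ (N≤² h)) (≤-trans (by nonNeg-1
                (solve 1 (λ x → con (+ 1) := (con (+ 1) :+ x) :- x) refl _)) d≤d^n))
            (trans (sym (trans (cong (_* d) τi≡1) (*-identityˡ d))) (*-assoc τ i d))

    localise′ : ∀ ν → Localises ν
    localise′ ν = from (inverse⁺ (0<fromℤ-suc (ν ℕ.+ n)))
      where
      n : ℕ
      n = suc ν
      D : Descends ν
      D = descends ν
      open Descends D
      from : (∃[ i ] 0# < i × fromℤ (+ (n ℕ.+ n)) * i ≡ 1#) → Localises ν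
      from (i , 0<i , e) = record { close = L.close ; far = L.far }
        where
        τ : Carrier
        -- τ = θ/(2n), so that Bernoulli gives 1 - θ = 1 - 2nτ ≤ (1 - τ)²ⁿ.
        τ = θ * i
        2nτ≡θ : fromℤ (+ (n ℕ.+ n)) * τ ≡ θ
        2nτ≡θ = trans (solve 3 (λ n t i → n :* (t :* i) := t :* (n :* i)) refl (fromℤ (+ (n ℕ.+ n))) θ
            i) (trans (cong (θ *_) e) (*-identityʳ θ))
        0<τ : 0# < τ
        0<τ = 0<* 0<θ 0<i
        τ≤θ : τ ≤ θ
        τ≤θ = ≤-trans (≤-reflexive (sym (*-identityˡ τ))) (≤-trans (*-monoʳ-≤ (<⇒≤ 0<τ)
          (by (nonNeg (fromℤ-nonNeg (ν ℕ.+ n)))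
              (trans (solve 1 (λ x → x := (con (+ 1) :+ x) :- con (+ 1)) refl _)
            (cong (λ x → x - 1#) (sym (fromℤ-suc (ν ℕ.+ n))))))) (≤-reflexive 2nτ≡θ))
        τ≤1 : τ ≤ 1#
        τ≤1 = ≤-trans τ≤θ θ≤1
        1-θ≤ : 1# - θ ≤ (1# - τ) ^ n * (1# - τ) ^ n
        1-θ≤ = ≤-trans (≤-reflexive (cong (λ x → 1# - x) (sym 2nτ≡θ)))
          (≤-trans (1-nτ≤[1-τ]^n (n ℕ.+ n) (<⇒≤ 0<τ) τ≤1) (≤-reflexive (^-+ (1# - τ) n n)))
        module L = Localise ν D τ 0<τ τ≤1 1-θ≤

  abstract
    localise : ∀ ν → Localises ν
    localise = localise′

-- Stability of the inequality between the means

module AMGM (K : OrderedField) where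
  open import Data.Integer using (+_)
  open import Data.Nat using (ℕ; zero; suc)
  open import Data.Product using (∃-syntax; _×_; _,_)
  open import Data.Vec using (Vec; []; _∷_)
  open import Data.Vec.Relation.Unary.All using (All; []; _∷_)
  open import Relation.Binary.PropositionalEquality using (_≡_; refl; sym; trans; cong; cong₂; subst)

  open Order K
  open Dominate K using (half; module Halves)
  open Iterate K using (sq-cancel-≤)

  total product : ∀ {n} → Vec Carrier n → Carrier
  total   []       = 0#
  total   (x ∷ xs) = x + total xs
  product []       = 1#
  product (x ∷ xs) = x * product xs

  0≤total : ∀ {n} {xs : Vec Carrier n} → All (0# ≤_) xs → 0# ≤ total xs
  0≤total []       = ≤-refl
  0≤total (h ∷ hs) = 0≤+ h (0≤total hs)

  0≤product : ∀ {n} {xs : Vec Carrier n} → All (0# ≤_) xs → 0# ≤ product xs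
  0≤product []       = 0≤1
  0≤product (h ∷ hs) = 0≤* h (0≤product hs)

  -- The tangent line of a ↦ aᵏ⁺¹ with its remainder.
  tangent : ∀ k {a b} → 0# ≤ a → 0# ≤ b →
    (fromℤ (+ suc k) + 1#) * a ^ suc k * b + (b - a) * (b - a) * b ^ k ≤ b ^ suc (suc k) + fromℤ
        (+ suc k) * a ^ suc (suc k)
  tangent zero {a} {b} 0≤a 0≤b = ≤-reflexive (solve 2 (λ a b →
    (con (+ 1) :+ con (+ 1)) :* (a :* con (+ 1)) :* b :+ (b :- a) :* (b :- a) :* con (+ 1)
    := b :* (b :* con (+ 1)) :+ con (+ 1) :* (a :* (a :* con (+ 1)))) refl a b)
  tangent (suc k) {a} {b} 0≤a 0≤b = by
    (nonNeg-+ (nonNeg-* (nonNeg 0≤b) (tangent k 0≤a 0≤b))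
        (nonNeg-* (nonNeg-* (nonNeg (fromℤ-nonNeg (suc (suc k)))) (nonNeg (0≤^ (suc k) 0≤a)))
        (nonNeg-sq (b - a))))
    (trans (cong (λ m → b * ((b ^ suc (suc k) + fromℤ (+ suc k) * a ^ suc (suc k)) -
        ((fromℤ (+ suc k) + 1#) * a ^ suc k * b + (b - a) * (b - a) * b ^ k))
                        + m * a ^ suc k * ((b - a) * (b - a))) (fromℤ-suc (suc k)))
     (trans (identity (fromℤ (+ suc k)) (a ^ suc k) (b ^ k) a b)
      (cong (λ m → (b ^ suc (suc (suc k)) + m * a ^ suc (suc (suc k))) - ((m + 1#) * a ^ suc
          (suc k) * b + (b - a) * (b - a) * b ^ suc k)) (sym (fromℤ-suc (suc k))))))
    where
    identity : ∀ m A B a b →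
      b * ((b * (b * B) + m * (a * A)) - ((m + 1#) * A * b + (b - a) * (b - a) * B)) + (1# + m) * A *
          ((b - a) * (b - a))
      ≡ (b * (b * (b * B)) + (1# + m) * (a * (a * A))) -
          (((1# + m) + 1#) * (a * A) * b + (b - a) * (b - a) * (b * B))
    identity = solve 5 (λ m A B a b →
      b :* ((b :* (b :* B) :+ m :* (a :* A)) :-
          ((m :+ con (+ 1)) :* A :* b :+ (b :- a) :* (b :- a) :* B)) :+ (con (+ 1) :+ m) :* A :*
          ((b :- a) :* (b :- a))
      := (b :* (b :* (b :* B)) :+ (con (+ 1) :+ m) :* (a :* (a :* A))) :-
          (((con (+ 1) :+ m) :+ con (+ 1)) :* (a :* A) :* b :+ (b :- a) :* (b :- a) :* (b :* B))) refl

  -- a is the mean of the entries other than x when all of them have mean b.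
  module Split (m : ℕ) (x b i : Carrier) (mi≡1 : fromℤ (+ suc m) * i ≡ 1#) where
    a : Carrier
    a = ((fromℤ (+ suc m) + 1#) * b - x) * i

    ma≡ : fromℤ (+ suc m) * a ≡ (fromℤ (+ suc m) + 1#) * b - x
    ma≡ = trans (solve 3 (λ m c i → m :* (c :* i) := m :* i :* c) refl (fromℤ (+ suc m))
        ((fromℤ (+ suc m) + 1#) * b - x) i)
      (trans (cong (_* ((fromℤ (+ suc m) + 1#) * b - x)) mi≡1) (*-identityˡ _))

    x≡ : x ≡ (fromℤ (+ suc m) + 1#) * b - fromℤ (+ suc m) * a
    x≡ = trans (solve 2 (λ c x → x := c :- (c :- x)) refl ((fromℤ (+ suc m) + 1#) * b) x)
        (cong (λ y → (fromℤ (+ suc m) + 1#) * b - y) (sym ma≡))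

    bounded : 0# ≤ a → 0# ≤ b → x * a ^ suc m + (b - a) * (b - a) * b ^ m ≤ b ^ suc (suc m)
    bounded 0≤a 0≤b = by (tangent m 0≤a 0≤b)
        (trans (identity (fromℤ (+ suc m)) (a ^ suc m) (b ^ suc (suc m)) ((b - a) *
        (b - a) * b ^ m) a b)
      (cong (λ x → b ^ suc (suc m) - (x * a ^ suc m + (b - a) * (b - a) * b ^ m)) (sym x≡)))
      where
      identity : ∀ m A B q a b → (B + m * (a * A)) - ((m + 1#) * A * b + q) ≡ B -
          (((m + 1#) * b - m * a) * A + q)
      identity = solve 6 (λ m A B q a b → (B :+ m :* (a :* A)) :- ((m :+ con (+ 1)) :* A :* b :+ q) := B
          :- (((m :+ con (+ 1)) :* b :- m :* a) :* A :+ q)) refl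

    module _ {t} (0≤t : 0# ≤ t) (x+t≤ : x + t ≤ (fromℤ (+ suc m) + 1#) * b) where
      t≤ma : t ≤ fromℤ (+ suc m) * a
      t≤ma = ≤-trans (by x+t≤ (solve 3 (λ c x t → c :- (x :+ t) := (c :- x) :- t) refl
          ((fromℤ (+ suc m) + 1#) * b) x t)) (≤-reflexive (sym ma≡))
      0≤a : 0# ≤ a
      0≤a = *-cancelˡ-≤ (0<fromℤ-suc m) (≤-trans (≤-reflexive (zeroʳ _)) (≤-trans 0≤t t≤ma))

  private
    inverseOf : ∀ m → ∃[ i ] 0# < i × fromℤ (+ suc m) * i ≡ 1#
    inverseOf m = inverse⁺ (0<fromℤ-suc m)

    fromℤ-suc′ : ∀ n → fromℤ (+ suc n) ≡ fromℤ (+ n) + 1#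
    fromℤ-suc′ n = trans (fromℤ-suc n) (+-comm 1# _)

  -- By induction the entries after `x` may be replaced by the bound `a` for their mean; the tangent
  -- inequality then bounds x · aᵐ⁺¹.
  amgm : ∀ m (xs : Vec Carrier (suc m)) {b} → 0# ≤ b → All (0# ≤_) xs → total xs ≤ fromℤ (+ suc m) * b →
      product xs ≤ b ^ suc m
  amgm zero (x ∷ []) {b} 0≤b _ h = ≤-trans (≤-reflexive (*-identityʳ x))
      (≤-trans (≤-reflexive (sym (+-identityʳ x)))
    (≤-trans h (≤-reflexive (trans (*-identityˡ b) (sym (*-identityʳ b))))))
  amgm (suc m) (x ∷ xs) {b} 0≤b (0≤x ∷ 0≤xs) h = from (inverseOf m)
    where
    open ≤-Reasoning
    h′ : x + total xs ≤ (fromℤ (+ suc m) + 1#) * b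
    h′ = subst (λ c → x + total xs ≤ c * b) (fromℤ-suc′ (suc m)) h
    from : (∃[ i ] 0# < i × fromℤ (+ suc m) * i ≡ 1#) → x * product xs ≤ b ^ suc (suc m)
    from (i , _ , mi≡1) = begin
      x * product xs
        ≤⟨ *-monoˡ-≤ 0≤x (amgm m xs (0≤a (0≤total 0≤xs) h′) 0≤xs (t≤ma (0≤total 0≤xs) h′)) ⟩
      x * a ^ suc m
        ≤⟨ by (nonNeg-* (nonNeg-sq (b - a)) (nonNeg (0≤^ m 0≤b)))
            (solve 2 (λ y q → q := (y :+ q) :- y) refl _ _) ⟩
      x * a ^ suc m + (b - a) * (b - a) * b ^ m
        ≤⟨ bounded (0≤a (0≤total 0≤xs) h′) 0≤b ⟩
      b ^ suc (suc m) ∎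
      where open Split m x b i mi≡1

  -- The convex power lies below its chord between ε = 0 and ε = 1.
  [1+ε]^k≤ : ∀ k {ε} → 0# ≤ ε → ε ≤ 1# → (1# + ε) ^ k ≤ 1# + ε * ((1# + 1#) ^ k - 1#)
  [1+ε]^k≤ zero    {ε} 0≤ε ε≤1 = ≤-reflexive
      (solve 1 (λ e → con (+ 1) := con (+ 1) :+ e :* (con (+ 1) :- con (+ 1))) refl ε)
  [1+ε]^k≤ (suc k) {ε} 0≤ε ε≤1 = ≤-trans (*-monoˡ-≤ (0≤+ 0≤1 0≤ε) ([1+ε]^k≤ k 0≤ε ε≤1))
    (by (nonNeg-* (nonNeg-* (nonNeg 0≤ε) (1≤^ k
        (by nonNeg-1 (solve 0 (con (+ 1) := (con (+ 1) :+ con (+ 1)) :- con (+ 1)) refl)))) ε≤1)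
      (solve 2 (λ e p → e :* (p :- con (+ 1)) :* (con (+ 1) :- e) :=
        (con (+ 1) :+ e :* ((con (+ 1) :+ con (+ 1)) :* p :- con (+ 1))) :- (con (+ 1) :+ e) :*
            (con (+ 1) :+ e :* (p :- con (+ 1)))) refl ε ((1# + 1#) ^ k)))

  Stable : ℕ → Carrier → Carrier → Set
  Stable n ε₀ ε₁ = ∀ (xs : Vec Carrier n) → All (0# ≤_) xs → total xs ≤ fromℤ (+ n) + ε₁ → 1# - ε₁ ≤
      product xs →
                   All (λ x → ∣ x - 1# ∣ ≤ ε₀) xs

  HeadStable : ℕ → Carrier → Carrier → Set
  HeadStable n ε₀ ε₁ = ∀ x (xs : Vec Carrier n) → 0# ≤ x → All (0# ≤_) xs → x + total xs ≤ fromℤ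
      (+ suc n) + ε₁ → 1# - ε₁ ≤ x * product xs →
                   ∣ x - 1# ∣ ≤ ε₀

  private
    module Head (m : ℕ) (x : Carrier) (xs : Vec Carrier (suc m)) (0≤x : 0# ≤ x) (0≤xs : All (0# ≤_) xs)
        (ε ε₀ h i : Carrier)
      (0≤ε : 0# ≤ ε) (ε≤1 : ε ≤ 1#) (h+h≡1 : h + h ≡ 1#) (0≤ε₀ : 0# ≤ ε₀)
          (mi≡1 : fromℤ (+ suc m) * i ≡ 1#)
      (ε≤ : ε ≤ ε₀ * h) (small : fromℤ (+ suc m) * fromℤ (+ suc m) * (1# + 1#) ^ suc (suc m) * ε ≤
          (ε₀ * h) * (ε₀ * h))
      (sum≤ : x + total xs ≤ fromℤ (+ suc (suc m)) + ε) (≤product : 1# - ε ≤ x * product xs) where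
      M b P : Carrier
      M = fromℤ (+ suc m)
      b = 1# + ε
      P = (1# + 1#) ^ suc (suc m)
      0≤b : 0# ≤ b
      0≤b = 0≤+ 0≤1 0≤ε
      1≤b : 1# ≤ b
      1≤b = by (nonNeg 0≤ε) (solve 1 (λ e → e := (con (+ 1) :+ e) :- con (+ 1)) refl ε)
      sum≤′ : x + total xs ≤ (M + 1#) * b
      sum≤′ = ≤-trans sum≤ (≤-trans (≤-reflexive (cong (_+ ε) (fromℤ-suc′ (suc m))))
          (by (nonNeg (0≤* (fromℤ-nonNeg (suc m)) 0≤ε))
        (solve 2 (λ m e → m :* e := (m :+ con (+ 1)) :* (con (+ 1) :+ e) :- (m :+ con (+ 1) :+ e)) refl
            M ε)))
      open Split m x b i mi≡1
      A : 0# ≤ a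
      A = 0≤a (0≤total 0≤xs) sum≤′
      -- The product is at least 1 - ε, while the mean inequality allows at most (1 + ε)ᵐ⁺² ≤ 1 +
      -- ε(P - 1). The remainder of the tangent inequality, a multiple of the squared gap, has to
      -- fit in between.
      gap²≤ : (b - a) * (b - a) ≤ ε * P
      gap²≤ = begin
        (b - a) * (b - a)
          ≤⟨ ≤-trans (≤-reflexive (sym (*-identityʳ _))) (*-monoˡ-≤ (0≤sq (b - a)) (1≤^ m 1≤b)) ⟩
        (b - a) * (b - a) * b ^ m
          ≤⟨ by (bounded A 0≤b) (solve 3 (λ y q B → B :- (y :+ q) := (B :- y) :- q) refl (x * a ^ suc m)
              ((b - a) * (b - a) * b ^ m) (b ^ suc (suc m))) ⟩
        b ^ suc (suc m) - x * a ^ suc m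
          ≤⟨ +-mono-≤ ([1+ε]^k≤ (suc (suc m)) 0≤ε ε≤1)
              (neg-mono-≤ (≤-trans ≤product (*-monoˡ-≤ 0≤x (amgm m xs A 0≤xs
              (t≤ma (0≤total 0≤xs) sum≤′))))) ⟩
        1# + ε * (P - 1#) - (1# - ε)
          ≡⟨ solve 2 (λ e p → con (+ 1) :+ e :* (p :- con (+ 1)) :- (con (+ 1) :- e) := e :* p) refl ε P
              ⟩
        ε * P ∎
        where open ≤-Reasoning
      M[b-a]≡ : M * (b - a) ≡ x - b
      M[b-a]≡ = trans (solve 3 (λ m a b → m :* (b :- a) := m :* b :- m :* a) refl M a b)
        (trans (cong (λ y → M * b - y) ma≡)
            (solve 3 (λ m b x → m :* b :- ((m :+ con (+ 1)) :* b :- x) := x :- b) refl M b x))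
      ∣x-b∣≤ : ∣ x - b ∣ ≤ ε₀ * h
      ∣x-b∣≤ = sq-cancel-≤ (≤-trans 0≤ε ε≤) (begin
        ∣ x - b ∣ * ∣ x - b ∣
          ≡⟨ squared (x - b) ⟩
        (x - b) * (x - b)
          ≡⟨ cong₂ _*_ (sym M[b-a]≡) (sym M[b-a]≡) ⟩
        M * (b - a) * (M * (b - a))
          ≡⟨ solve 2 (λ m d → m :* d :* (m :* d) := m :* m :* (d :* d)) refl M (b - a) ⟩
        M * M * ((b - a) * (b - a))
          ≤⟨ *-monoˡ-≤ (0≤sq M) gap²≤ ⟩
        M * M * (ε * P)
          ≡⟨ solve 3 (λ m e p → m :* (e :* p) := m :* p :* e) refl (M * M) ε P ⟩
        M * M * P * ε
          ≤⟨ small ⟩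
        (ε₀ * h) * (ε₀ * h) ∎)
        where
        open ≤-Reasoning
        squared : ∀ z → ∣ z ∣ * ∣ z ∣ ≡ z * z
        squared z = trans (sym (∣*∣ z z)) (nonNeg⇒∣∣≡ (nonNeg-sq z))
      conclusion : ∣ x - 1# ∣ ≤ ε₀
      conclusion = begin
        ∣ x - 1# ∣
          ≡⟨ cong ∣_∣ (solve 2 (λ x e → x :- con (+ 1) := (x :- (con (+ 1) :+ e)) :+ e) refl x ε) ⟩
        ∣ (x - b) + ε ∣
          ≤⟨ ∣+∣ (x - b) ε ⟩
        ∣ x - b ∣ + ∣ ε ∣
          ≤⟨ +-mono-≤ ∣x-b∣≤ (≤-trans (≤-reflexive (nonNeg⇒∣∣≡ (nonNeg 0≤ε))) ε≤) ⟩
        ε₀ * h + ε₀ * h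
          ≡⟨ solve 2 (λ e h → e :* h :+ e :* h := e :* (h :+ h)) refl ε₀ h ⟩
        ε₀ * (h + h)
          ≡⟨ trans (cong (ε₀ *_) h+h≡1) (*-identityʳ ε₀) ⟩
        ε₀ ∎
        where open ≤-Reasoning

    head-stable : ∀ n {ε₀} → 0# < ε₀ → ∃[ ε₁ ] 0# < ε₁ × (∀ ε → 0# ≤ ε → ε ≤ ε₁ → HeadStable n ε₀ ε)
    head-stable zero {ε₀} 0<ε₀ = ε₀ , 0<ε₀ , go
      where
      go : ∀ ε → 0# ≤ ε → ε ≤ ε₀ → HeadStable zero ε₀ ε
      go ε 0≤ε ε≤ε₀ x [] 0≤x [] s p = ≤-trans (∣∣≤ upper lower) ε≤ε₀
        where
        upper : x - 1# ≤ ε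
        upper = by s (solve 2 (λ x e → (con (+ 1) :+ e) :- (x :+ con (+ 0)) := e :- (x :- con (+ 1)))
            refl x ε)
        lower : - (x - 1#) ≤ ε
        lower = by p (solve 2 (λ x e → x :* con (+ 1) :- (con (+ 1) :- e) := e :- :- (x :- con (+ 1)))
            refl x ε)
    head-stable (suc m) {ε₀} 0<ε₀ = from half (inverseOf m)
      where
      Goal : Set
      Goal = ∃[ ε₁ ] 0# < ε₁ × (∀ ε → 0# ≤ ε → ε ≤ ε₁ → HeadStable (suc m) ε₀ ε)
      from : (∃[ h ] h + h ≡ 1#) → (∃[ i ] 0# < i × fromℤ (+ suc m) * i ≡ 1#) → Goal
      from (h , h+h≡1) (i , _ , mi≡1) = invert (inverse⁺ 0<C)
        where
        C e : Carrier
        C = fromℤ (+ suc m) * fromℤ (+ suc m) * (1# + 1#) ^ suc (suc m)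
        e = ε₀ * h
        0<C : 0# < C
        0<C = 0<* (0<* (0<fromℤ-suc m) (0<fromℤ-suc m)) (0<^ (suc (suc m)) (0<+ 0<1 0≤1))
        0<e : 0# < e
        0<e = 0<* 0<ε₀ (Halves.0<h h h+h≡1)
        invert : (∃[ j ] 0# < j × C * j ≡ 1#) → Goal
        invert (j , 0<j , Cj≡1) = pick (minimum⁺ 0<1 0<e)
          where
          pick : (∃[ e₁ ] 0# < e₁ × e₁ ≤ 1# × e₁ ≤ e) → Goal
          pick (e₁ , 0<e₁ , e₁≤1 , e₁≤e) = pick₂ (minimum⁺ 0<e₁ (0<* 0<j (0<* 0<e 0<e)))
            where
            pick₂ : (∃[ ε₁ ] 0# < ε₁ × ε₁ ≤ e₁ × ε₁ ≤ j * (e * e)) → Goal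
            pick₂ (ε₁ , 0<ε₁ , ε₁≤e₁ , ε₁≤) = ε₁ , 0<ε₁ , λ ε 0≤ε ε≤ x xs 0≤x 0≤xs s p →
              Head.conclusion m x xs 0≤x 0≤xs ε ε₀ h i 0≤ε (≤-trans (≤-trans ε≤ ε₁≤e₁) e₁≤1) h+h≡1
                  (<⇒≤ 0<ε₀) mi≡1
                (≤-trans (≤-trans ε≤ ε₁≤e₁) e₁≤e)
                (≤-trans (*-monoˡ-≤ (<⇒≤ 0<C) (≤-trans ε≤ ε₁≤))
                    (≤-reflexive (trans (sym (*-assoc C j (e * e))) (trans (cong (_* (e * e)) Cj≡1)
                    (*-identityˡ _)))))
                s p

    -- Once the head is within `εₕ` of 1, removing it changes the sum and the product so little that
    -- the tail satisfies the hypotheses with `ε′`, and the induction continues there.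
    stable′ : ∀ n {ε₀} → 0# < ε₀ → ∃[ ε₁ ] 0# < ε₁ × (∀ ε → 0# ≤ ε → ε ≤ ε₁ → Stable n ε₀ ε)
    stable′ zero    {ε₀} 0<ε₀ = 1# , 0<1 , λ { ε _ _ [] [] _ _ → [] }
    stable′ (suc n) {ε₀} 0<ε₀ = from half (stable′ n 0<ε₀)
      where
      Goal : Set
      Goal = ∃[ ε₁ ] 0# < ε₁ × (∀ ε → 0# ≤ ε → ε ≤ ε₁ → Stable (suc n) ε₀ ε)
      from : (∃[ h ] h + h ≡ 1#) → (∃[ ε₁ ] 0# < ε₁ × (∀ ε → 0# ≤ ε → ε ≤ ε₁ → Stable n ε₀ ε)) → Goal
      from (h , h+h≡1) (ε′ , 0<ε′ , IH) = pick (minimum⁺ 0<ε₀ 0<ε′h)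
        where
        0<ε′h : 0# < ε′ * h
        0<ε′h = 0<* 0<ε′ (Halves.0<h h h+h≡1)
        pick : (∃[ εₕ ] 0# < εₕ × εₕ ≤ ε₀ × εₕ ≤ ε′ * h) → Goal
        pick (εₕ , 0<εₕ , εₕ≤ε₀ , εₕ≤) = heads (head-stable n 0<εₕ)
          where
          heads : (∃[ ε₁ ] 0# < ε₁ × (∀ ε → 0# ≤ ε → ε ≤ ε₁ → HeadStable n εₕ ε)) → Goal
          heads (ε₂ , 0<ε₂ , H) = finish (minimum⁺ 0<ε₂ 0<ε′h)
            where
            finish : (∃[ ε₁ ] 0# < ε₁ × ε₁ ≤ ε₂ × ε₁ ≤ ε′ * h) → Goal
            finish (ε₁ , 0<ε₁ , ε₁≤ε₂ , ε₁≤) = ε₁ , 0<ε₁ , go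
              where
              go : ∀ ε → 0# ≤ ε → ε ≤ ε₁ → Stable (suc n) ε₀ ε
              go ε 0≤ε ε≤ε₁ (x ∷ xs) (0≤x ∷ 0≤xs) s p = ≤-trans close εₕ≤ε₀ ∷ IH ε′ (<⇒≤ 0<ε′) ≤-refl xs
                  0≤xs s′ p′
                where
                close : ∣ x - 1# ∣ ≤ εₕ
                close = H ε 0≤ε (≤-trans ε≤ε₁ ε₁≤ε₂) x xs 0≤x 0≤xs s p
                sum≤ε′ : εₕ + ε ≤ ε′
                sum≤ε′ = ≤-trans (+-mono-≤ εₕ≤ (≤-trans ε≤ε₁ ε₁≤))
                    (≤-reflexive (trans (solve 2 (λ e h → e :* h :+ e :* h := e :* (h :+ h)) refl ε′ h)
                  (trans (cong (ε′ *_) h+h≡1) (*-identityʳ ε′))))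
                s′ : total xs ≤ fromℤ (+ n) + ε′
                s′ = by (nonNeg-+ (nonNeg-+ s (≤-trans (-a≤∣a∣ (x - 1#)) close)) sum≤ε′)
                  (trans (cong (λ m → ((m + ε) - (x + total xs) + (εₕ - - (x - 1#))) + (ε′ - (εₕ + ε)))
                      (fromℤ-suc n))
                    (solve 6 (λ m e x t h e′ → ((((con (+ 1) :+ m) :+ e) :- (x :+ t)) :+ (h :- :-
                        (x :- con (+ 1)))) :+ (e′ :- (h :+ e)) := (m :+ e′) :- t)
                      refl (fromℤ (+ n)) ε x (total xs) εₕ ε′))
                x≤ : x ≤ 1# + εₕ
                x≤ = by (≤-trans (a≤∣a∣ (x - 1#)) close)
                    (solve 2 (λ x h → h :- (x :- con (+ 1)) := (con (+ 1) :+ h) :- x) refl x εₕ)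
                p′ : 1# - ε′ ≤ product xs
                p′ = *-cancelˡ-≤ {1# + εₕ} (0<+ 0<1 (<⇒≤ 0<εₕ)) (≤-trans
                  (by (nonNeg-+ sum≤ε′ (nonNeg (0≤* (<⇒≤ 0<εₕ) (<⇒≤ 0<ε′))))
                    (solve 3 (λ h e e′ → (e′ :- (h :+ e)) :+ h :* e′ := (con (+ 1) :- e) :- (con
                        (+ 1) :+ h) :* (con (+ 1) :- e′)) refl εₕ ε ε′))
                  (≤-trans p (*-monoʳ-≤ (0≤product 0≤xs) x≤)))

  abstract
    stable : ∀ n {ε₀} → 0# < ε₀ → ∃[ ε₁ ] 0# < ε₁ × (∀ ε → 0# ≤ ε → ε ≤ ε₁ → Stable n ε₀ ε)
    stable = stable′

-- Approximate factorisations in Newton form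

module Newton (K : OrderedField) where
  open import Data.Integer using (+_)
  open import Data.Nat as ℕ using (ℕ; zero; suc)
  open import Data.Product using (∃-syntax; _×_; _,_; proj₁; proj₂)
  open import Data.Vec using (Vec; []; _∷_; map)
  open import Data.Vec.Relation.Unary.All as All using (All; []; _∷_)
  open import Relation.Binary.PropositionalEquality using (_≡_; refl; sym; trans; cong; subst)

  open Order K
  open Gaussian K
  open Direction K using (_^F_)
  open Kneser K using (‖^‖)
  open Iterate K using (Root; Localises; localise)
  open AMGM K using (product)
  open Poly ring using (evalM; quotient; evalM-quotient; second; second-quotient)
  private
    module F = CommutativeRing ring
    module S = IntSolver ring

  -- Newton form r₁ + (z − y₁) (r₂ + (z − y₂) (⋯)) of a monic polynomial, encoded by the pairs (yᵢ , rᵢ).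
  newton : ∀ {n} → Vec (F × F) n → F → F
  newton []            z = 1F
  newton ((y , r) ∷ l) z = r +F (z -F y) *F newton l z

  roots : ∀ {n} → Vec (F × F) n → Vec F n
  roots = map proj₁

  sumF : ∀ {n} → Vec F n → F
  sumF []       = 0F
  sumF (y ∷ ys) = y +F sumF ys

  -- Division at an approximate root leaves a small nonzero remainder, so the representation is
  -- exact but only close to a product. `trace` is Vieta's formula for the sum of the roots, up to
  -- ε.
  record Factorisation {n} (p : Vec F n) (R ε : Carrier) : Set where
    field
      pairs   : Vec (F × F) n
      formula : ∀ z → evalM p z ≡ newton pairs z
      bounded : All (λ yr → ‖ proj₁ yr ‖ ≤ R) pairs
      small   : All (λ yr → ‖ proj₂ yr ‖ ≤ ε) pairs
      trace   : ‖ sumF (roots pairs) +F second 0F p ‖ ≤ ε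

  private
    -- `1# + R` in place of `R` makes the bound increase with the degree, so that one value covers
    -- all coefficients of a quotient.
    evalBound : Carrier → Carrier → ℕ → Carrier
    evalBound C R zero    = 1#
    evalBound C R (suc n) = C + (1# + R) * evalBound C R n

    module _ {C R} (0≤C : 0# ≤ C) (0≤R : 0# ≤ R) where
      0≤evalBound : ∀ n → 0# ≤ evalBound C R n
      0≤evalBound zero    = 0≤1
      0≤evalBound (suc n) = 0≤+ 0≤C (0≤* (0≤+ 0≤1 0≤R) (0≤evalBound n))

      evalBound-suc : ∀ n → evalBound C R n ≤ evalBound C R (suc n)
      evalBound-suc n = by (nonNeg-+ (nonNeg 0≤C) (nonNeg (0≤* 0≤R (0≤evalBound n))))
        (solve 3 (λ c r e → c :+ r :* e := (c :+ (con (+ 1) :+ r) :* e) :- e) refl C R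
            (evalBound C R n))

      ‖evalM‖ : ∀ {n} (p : Vec F n) {y} → All (λ c → ‖ c ‖ ≤ C) p → ‖ y ‖ ≤ R → ‖ evalM p y ‖ ≤
          evalBound C R n
      ‖evalM‖ []      _        _ = ≤-reflexive ‖1‖
      ‖evalM‖ {suc n} (c ∷ p) {y} (h ∷ hs) g = ≤-trans (‖+‖ c _)
          (+-mono-≤ h (≤-trans (‖*‖ y (evalM p y))
        (*-mono-≤ (0≤‖‖ y) (0≤evalBound n) (≤-trans g (by nonNeg-1
            (solve 1 (λ r → con (+ 1) := (con (+ 1) :+ r) :- r) refl R))) (‖evalM‖ p hs g))))

      quotient-bounded : ∀ {n} (p : Vec F (suc n)) {y} → All (λ c → ‖ c ‖ ≤ C) p → ‖ y ‖ ≤ R →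
                         All (λ c → ‖ c ‖ ≤ evalBound C R n) (quotient p y)
      quotient-bounded (c ∷ [])    _        _ = []
      quotient-bounded {suc n} (c ∷ d ∷ p) (_ ∷ hs) g = ‖evalM‖ (d ∷ p) hs g
        ∷ All.map (λ h → ≤-trans h (evalBound-suc n)) (quotient-bounded (d ∷ p) hs g)

    -- `R` is fixed before `ε`: the search for a root starts at 0, where |p| ≤ C, so `far` bounds
    -- the root whatever the precision, and this in turn bounds the coefficients of the quotient.
    factorise′ : ∀ n C → 0# ≤ C → ∃[ R ] 0# ≤ R ×
        (∀ (p : Vec F n) → All (λ c → ‖ c ‖ ≤ C) p → ∀ ε → 0# < ε → Factorisation p R ε)
    factorise′ zero C 0≤C = 0# , ≤-refl , λ { [] [] ε 0<ε → record
      { pairs = [] ; formula = λ z → refl ; bounded = [] ; small = []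
      ; trace = ≤-trans (≤-reflexive (trans (cong ‖_‖ (F.+-identityˡ 0F)) ‖0‖)) (<⇒≤ 0<ε) } }
    factorise′ (suc n) C 0≤C = from (Localises.far (localise n) C 0≤C)
      where
      Goal : Set
      Goal = ∃[ R ] 0# ≤ R × (∀ (p : Vec F (suc n)) → All (λ c → ‖ c ‖ ≤ C) p → ∀ ε → 0# < ε →
          Factorisation p R ε)
      from : (∃[ R ] 0# ≤ R × (∀ (p : Vec F (suc n)) z₀ → ‖ evalM p z₀ ‖ ≤ C → Root p z₀ R)) → Goal
      from (R₁ , 0≤R₁ , rootOf) = combine (factorise′ n (evalBound C R₁ n) (0≤evalBound 0≤C 0≤R₁ n))
        where
        combine : (∃[ R ] 0# ≤ R × (∀ (p : Vec F n) → All
            (λ c → ‖ c ‖ ≤ evalBound C R₁ n) p → ∀ ε → 0# < ε → Factorisation p R ε)) → Goal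
        combine (R₂ , 0≤R₂ , IH) = pick (maximum R₁ R₂)
          where
          pick : (∃[ R ] R₁ ≤ R × R₂ ≤ R) → Goal
          pick (R , R₁≤R , R₂≤R) = R , ≤-trans 0≤R₁ R₁≤R , go
            where
            go : ∀ (p : Vec F (suc n)) → All (λ c → ‖ c ‖ ≤ C) p → ∀ ε → 0# < ε → Factorisation p R ε
            go p bs ε 0<ε = atRoot (Root.root approx ε 0<ε)
              where
              at0 : ∀ {m} (p : Vec F (suc m)) → All (λ c → ‖ c ‖ ≤ C) p → ‖ evalM p 0F ‖ ≤ C
              at0 (c ∷ p) (h ∷ _) = ≤-trans (≤-reflexive
                  (cong ‖_‖ (trans (cong (c +F_) (F.zeroˡ (evalM p 0F))) (F.+-identityʳ c)))) h
              approx : Root p 0F R₁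
              approx = rootOf p 0F (at0 p bs)
              atRoot : (∃[ J ] ∀ m → ‖ evalM p (Root.zs approx (J ℕ.+ m)) ‖ ≤ ε) → Factorisation p R ε
              atRoot (J , h) = extend (IH (quotient p y) (quotient-bounded 0≤C 0≤R₁ p bs ‖y‖≤R₁) ε 0<ε)
                where
                y : F
                y = Root.zs approx (J ℕ.+ 0)
                ‖y‖≤R₁ : ‖ y ‖ ≤ R₁
                ‖y‖≤R₁ = subst (λ z → ‖ z ‖ ≤ R₁) (S.solve 1 (λ y → y S.:- S.con (+ 0) S.:= y) refl y)
                    (Root.near approx (J ℕ.+ 0))
                extend : Factorisation (quotient p y) R₂ ε → Factorisation p R ε
                extend fac = record
                  { pairs   = (y , evalM p y) ∷ pairs
                  ; formula = λ z → trans (evalM-quotient p y z)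
                      (cong (λ q → evalM p y +F (z -F y) *F q) (formula z))
                  ; bounded = ≤-trans ‖y‖≤R₁ R₁≤R ∷ All.map (λ h → ≤-trans h R₂≤R) bounded
                  ; small   = h 0 ∷ small
                  ; trace   = traced p y (h 0) pairs trace }
                  where
                  open Factorisation fac
                  -- Every division transfers its root exactly to the second coefficient. An error
                  -- enters only at the last, linear factor c + z, whose value at y is c + y.
                  traced : ∀ {n} (p : Vec F (suc n)) y → ‖ evalM p y ‖ ≤ ε → (l : Vec (F × F) n) → ‖
                      sumF (roots l) +F second 0F (quotient p y) ‖ ≤ ε →
                           ‖ (y +F sumF (roots l)) +F second 0F p ‖ ≤ ε
                  traced (c ∷ []) y h [] _ = subst (λ z → ‖ z ‖ ≤ ε)
                      (S.solve 2 (λ c y → c S.:+ y S.:* S.con (+ 1) S.:= (y S.:+ S.con (+ 0)) S.:+ c)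
                      refl c y) h
                  traced p@(c ∷ d ∷ _) y _ l t = subst (λ z → ‖ z ‖ ≤ ε)
                    (trans (cong (sumF (roots l) +F_) (second-quotient 0F 0F p y))
                      (S.solve 3 (λ s t y → s S.:+ (t S.:+ y) S.:= (y S.:+ s) S.:+ t) refl
                          (sumF (roots l)) (second 0F p) y)) t

  abstract
    factorise : ∀ n C → 0# ≤ C → ∃[ R ] 0# ≤ R ×
        (∀ (p : Vec F n) → All (λ c → ‖ c ‖ ≤ C) p → ∀ ε → 0# < ε → Factorisation p R ε)
    factorise = factorise′

  geometric : Carrier → ℕ → Carrier
  geometric T zero    = 0#
  geometric T (suc n) = 1# + T * geometric T n

  0≤geometric : ∀ {T} → 0# ≤ T → ∀ n → 0# ≤ geometric T n
  0≤geometric 0≤T zero    = ≤-refl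
  0≤geometric 0≤T (suc n) = 0≤+ 0≤1 (0≤* 0≤T (0≤geometric 0≤T n))

  module _ {ε T} (0≤ε : 0# ≤ ε) (0≤T : 0# ≤ T) where
    -- Read at -1 this becomes a lower bound for the product of the distances, since the left side
    -- is known to be at least 1 there.
    ‖newton‖ : ∀ {n} (l : Vec (F × F) n) z → All (λ yr → ‖ z -F proj₁ yr ‖ ≤ T) l → All
        (λ yr → ‖ proj₂ yr ‖ ≤ ε) l →
               ‖ newton l z ‖ ≤ product (map (λ y → ‖ z -F y ‖) (roots l)) + ε * geometric T n
    ‖newton‖ [] z _ _ = ≤-reflexive (trans ‖1‖
        (solve 1 (λ e → con (+ 1) := con (+ 1) :+ e :* con (+ 0)) refl ε))
    ‖newton‖ {suc n} ((y , r) ∷ l) z (t ∷ ts) (e ∷ es) = begin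
      ‖ r +F (z -F y) *F newton l z ‖
        ≤⟨ ≤-trans (‖+‖ r _) (+-mono-≤ e (≤-trans (‖*‖ (z -F y) (newton l z)) (*-monoˡ-≤ (0≤‖‖ (z -F y))
            (‖newton‖ l z ts es)))) ⟩
      ε + ‖ z -F y ‖ * (P + ε * G)
        ≤⟨ by (nonNeg-* (nonNeg-* (nonNeg 0≤ε) (nonNeg (0≤geometric 0≤T n))) t)
             (solve 5 (λ e x p g t → e :* g :* (t :- x) := (x :* p :+ e :* (con (+ 1) :+ t :* g)) :-
                 (e :+ x :* (p :+ e :* g)))
               refl ε (‖ z -F y ‖) P G T) ⟩
      ‖ z -F y ‖ * P + ε * (1# + T * G) ∎
      where
      open ≤-Reasoning
      P G : Carrier
      P = product (map (λ y → ‖ z -F y ‖) (roots l))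
      G = geometric T n

    -- Each node was chosen as an approximate root of a quotient. Its own factor vanishes in the
    -- Newton form and the outer remainders are small, so it is an approximate root of the whole
    -- polynomial too.
    newton-at-root : ∀ {n} (l : Vec (F × F) n) →
        (∀ {y y′} → ‖ y ‖ ≤ T → ‖ y′ ‖ ≤ T → ‖ y -F y′ ‖ ≤ T + T) →
      All (λ yr → ‖ proj₁ yr ‖ ≤ T) l → All (λ yr → ‖ proj₂ yr ‖ ≤ ε) l →
      All (λ yr → ‖ newton l (proj₁ yr) ‖ ≤ ε * geometric (T + T) n) l
    newton-at-root [] d _ _ = []
    newton-at-root {suc n} ((y , r) ∷ l) d (t ∷ ts) (e ∷ es) = head ∷ tail
      where
      G : Carrier
      G = geometric (T + T) n
      0≤TG : 0# ≤ (T + T) * G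
      0≤TG = 0≤* (0≤+ 0≤T 0≤T) (0≤geometric (0≤+ 0≤T 0≤T) n)
      head : ‖ r +F (y -F y) *F newton l y ‖ ≤ ε * (1# + (T + T) * G)
      head = ≤-trans (≤-reflexive (cong ‖_‖ (S.solve 3
          (λ r y n → r S.:+ (y S.:- y) S.:* n S.:= r) refl r y (newton l y))))
        (≤-trans e (by (nonNeg-* (nonNeg 0≤ε) (nonNeg 0≤TG)) (solve 2
            (λ e g → e :* g := e :* (con (+ 1) :+ g) :- e) refl ε ((T + T) * G))))
      step : ∀ {yr : F × F} → ‖ proj₁ yr ‖ ≤ T × ‖ newton l (proj₁ yr) ‖ ≤ ε * G → ‖ r +F
          (proj₁ yr -F y) *F newton l (proj₁ yr) ‖ ≤ ε * (1# + (T + T) * G)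
      step {y′ , _} (t′ , h) = ≤-trans (‖+‖ r _)
          (≤-trans (+-mono-≤ e (≤-trans (‖*‖ (y′ -F y) (newton l y′)) (*-mono-≤ (0≤‖‖ _)
          (0≤* 0≤ε (0≤geometric (0≤+ 0≤T 0≤T) n)) (d t′ t) h)))
        (≤-reflexive (solve 3 (λ e t g → e :+ t :* (e :* g) := e :* (con (+ 1) :+ t :* g)) refl ε
            (T + T) G)))
      tail : All (λ yr → ‖ r +F (proj₁ yr -F y) *F newton l (proj₁ yr) ‖ ≤ ε * (1# + (T + T) * G)) l
      tail = All.map (λ {yr} → step {yr}) (All.zip (ts , newton-at-root l d ts es))

  powerBound : Carrier → ℕ → Carrier
  powerBound Z zero    = 0#
  powerBound Z (suc n) = 1# + (powerBound Z n + Z ^ n) + Z * powerBound Z n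

  0≤powerBound : ∀ {Z} → 0# ≤ Z → ∀ n → 0# ≤ powerBound Z n
  0≤powerBound 0≤Z zero    = ≤-refl
  0≤powerBound 0≤Z (suc n) = 0≤+ (0≤+ 0≤1 (0≤+ (0≤powerBound 0≤Z n) (0≤^ n 0≤Z)))
      (0≤* 0≤Z (0≤powerBound 0≤Z n))

  -- The error is linear in ε with a factor depending on ‖z‖ and n only, so it disappears when ε
  -- tends to 0 for fixed z.
  newton-near-power : ∀ {n ε} (l : Vec (F × F) n) z → 0# ≤ ε → ε ≤ 1# →
    All (λ yr → ‖ proj₁ yr ‖ ≤ ε) l → All (λ yr → ‖ proj₂ yr ‖ ≤ ε) l →
    ‖ newton l z -F (z ^F n) ‖ ≤ ε * powerBound ‖ z ‖ n
  newton-near-power {ε = ε} [] z 0≤ε ε≤1 _ _ =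
    ≤-reflexive (trans (cong ‖_‖ (F.-‿inverseʳ 1F)) (trans ‖0‖ (sym (zeroʳ ε))))
  newton-near-power {suc n} {ε} ((y , r) ∷ l) z 0≤ε ε≤1 (a ∷ as) (b ∷ bs) = begin
    ‖ r +F (z -F y) *F q -F z *F w ‖
      ≡⟨ cong ‖_‖ (S.solve 5 (λ r z y q w → (r S.:+ (z S.:- y) S.:* q) S.:- z S.:* w S.:= (r S.:+ S.:-
          (y S.:* q)) S.:+ z S.:* (q S.:- w)) refl r z y q w) ⟩
    ‖ (r +F (-F (y *F q))) +F z *F (q -F w) ‖
      ≤⟨ ≤-trans (‖+‖ (r +F (-F (y *F q))) (z *F (q -F w))) (+-mono-≤
           (≤-trans (‖+‖ r (-F (y *F q))) (+-mono-≤ b (≤-trans (≤-reflexive (‖-‖ (y *F q)))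
             (≤-trans (‖*‖ y q) (*-mono-≤ (0≤‖‖ y) 0≤B a ‖q‖≤)))))
           (≤-trans (‖*‖ z (q -F w)) (*-monoˡ-≤ (0≤‖‖ z) IH))) ⟩
    (ε + ε * (G + ‖ z ‖ ^ n)) + ‖ z ‖ * (ε * G)
      ≡⟨ solve 4 (λ e g p z → (e :+ e :* (g :+ p)) :+ z :* (e :* g) := e :*
          (con (+ 1) :+ (g :+ p) :+ z :* g)) refl ε G (‖ z ‖ ^ n) ‖ z ‖ ⟩
    ε * powerBound ‖ z ‖ (suc n) ∎
    where
    open ≤-Reasoning
    q w : F
    q = newton l z
    w = z ^F n
    G : Carrier
    G = powerBound ‖ z ‖ n
    IH : ‖ q -F w ‖ ≤ ε * G
    IH = newton-near-power l z 0≤ε ε≤1 as bs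
    0≤B : 0# ≤ G + ‖ z ‖ ^ n
    0≤B = 0≤+ (0≤powerBound (0≤‖‖ z) n) (0≤^ n (0≤‖‖ z))
    ‖q‖≤ : ‖ q ‖ ≤ G + ‖ z ‖ ^ n
    ‖q‖≤ = ≤-trans (≤-reflexive (cong ‖_‖ (S.solve 2 (λ q w → q S.:= (q S.:- w) S.:+ w) refl q w)))
      (≤-trans (‖+‖ (q -F w) w) (+-mono-≤ (≤-trans IH
          (≤-trans (*-monoʳ-≤ (0≤powerBound (0≤‖‖ z) n) ε≤1) (≤-reflexive (*-identityˡ G)))) (‖^‖ z n)))

-- Concentration of the approximate roots at zero

module Concentrate (K : OrderedField) where
  open import Data.Integer using (+_)
  open import Data.Nat using (ℕ; suc)
  open import Data.Product using (∃-syntax; _×_; _,_; proj₁; proj₂)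
  open import Data.Vec using (Vec; []; _∷_; map)
  open import Data.Vec.Relation.Unary.All as All using (All; []; _∷_)
  open import Relation.Binary.PropositionalEquality using (_≡_; refl; sym; trans; cong; cong₂)
  open import Relation.Nullary using (Dec; yes; no; contradiction)

  open Order K
  open Gaussian K
  open Direction K using (_^F_)
  open Dominate K using (half; module Halves)
  open Iterate K using (Root; Localises; localise)
  open AMGM K using (product; total; stable; Stable)
  open Newton K
  open Poly ring using (evalM; second)
  private
    module F = CommutativeRing ring
    module S = IntSolver ring

  -1F : F
  -1F = -F 1F

  shrink : ∀ {a} G → 0# < a → 0# ≤ G → ∃[ e ] 0# < e × e ≤ a × e * G ≤ a
  shrink {a} G 0<a 0≤G = from (inverse⁺ {1# + G} (0<+ 0<1 0≤G))
    where
    from : (∃[ i ] 0# < i × (1# + G) * i ≡ 1#) → ∃[ e ] 0# < e × e ≤ a × e * G ≤ a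
    -- a / (1 + G) satisfies both bounds at once.
    from (i , 0<i , e) = a * i , 0<* 0<a 0<i
      , by (nonNeg (0≤* (0≤* (<⇒≤ 0<a) (<⇒≤ 0<i)) 0≤G))
          (trans (solve 3 (λ a i g → a :* i :* g := a :* ((con (+ 1) :+ g) :* i) :- a :* i) refl a i G)
              (cong (λ x → x - a * i) (trans (cong (a *_) e) (*-identityʳ a))))
      , by (nonNeg (0≤* (<⇒≤ 0<a) (<⇒≤ 0<i)))
          (trans (solve 3 (λ a i g → a :* i := a :* ((con (+ 1) :+ g) :* i) :- a :* i :* g) refl a i G)
              (cong (λ x → x - a * i * G) (trans (cong (a *_) e) (*-identityʳ a))))

  squeeze-0 : ∀ {a B} → 0# ≤ B → (∀ ε → 0# < ε → ε ≤ 1# → a ≤ ε * B) → a ≤ 0#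
  squeeze-0 {a} {B} 0≤B h = decide (a ≤? 0#)
    where
    decide : Dec (a ≤ 0#) → a ≤ 0#
    decide (yes a≤0) = a≤0
    decide (no 0<a)  = contradiction a≤ah ah<a
      where
      η : Carrier
      η = proj₁ half
      h+h≡1 : η + η ≡ 1#
      h+h≡1 = proj₂ half
      0<aη : 0# < a * η
      0<aη = 0<* 0<a (Halves.0<h η h+h≡1)
      aη+aη≡a : a * η + a * η ≡ a
      aη+aη≡a = trans (solve 2 (λ a h → a :* h :+ a :* h := a :* (h :+ h)) refl a η)
          (trans (cong (a *_) h+h≡1) (*-identityʳ a))
      ah<a : a * η < a
      ah<a g = 0<aη (by g (trans (cong (λ x → a * η - x) (sym aη+aη≡a)) (solve 1
          (λ y → y :- (y :+ y) := con (+ 0) :- y) refl (a * η))))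
      from : (∃[ e ] 0# < e × e ≤ a * η × e * B ≤ a * η) → a ≤ a * η
      from (e , 0<e , _ , eB≤) = small (minimum⁺ 0<e 0<1)
        where
        small : (∃[ ε ] 0# < ε × ε ≤ e × ε ≤ 1#) → a ≤ a * η
        small (ε , 0<ε , ε≤e , ε≤1) = ≤-trans (h ε 0<ε ε≤1) (≤-trans (*-monoʳ-≤ 0≤B ε≤e) eB≤)
      a≤ah : a ≤ a * η
      a≤ah = from (shrink B 0<aη 0≤B)

  coefficients-bounded : ∀ {n} (p : Vec F n) → ∃[ C ] 0# ≤ C × All (λ c → ‖ c ‖ ≤ C) p
  coefficients-bounded []      = 0# , ≤-refl , []
  coefficients-bounded (c ∷ p) = from (coefficients-bounded p)
    where
    from : (∃[ C ] 0# ≤ C × All (λ c → ‖ c ‖ ≤ C) p) → ∃[ C ] 0# ≤ C × All (λ c → ‖ c ‖ ≤ C) (c ∷ p)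
    from (C , 0≤C , h) = ‖ c ‖ + C , 0≤+ (0≤‖‖ c) 0≤C
      , by (nonNeg 0≤C) (solve 2 (λ x c → c := (x :+ c) :- x) refl ‖ c ‖ C)
      ∷ All.map (λ g → ≤-trans g (by (nonNeg (0≤‖‖ c)) (solve 2
          (λ x c → x := (x :+ c) :- c) refl ‖ c ‖ C))) h

  -- What positivity of a limit eigenvalue says about a point within `δ` of the limit. Unlike
  -- positivity itself it is decidable.
  NearPositive : Carrier → F → Set
  NearPositive δ y = ∣ im y ∣ ≤ δ × - δ ≤ 1# + re y

  -- For the characteristic polynomial p of A − I, a root z of p is an eigenvalue 1 + z of A.
  Positive-roots : ∀ {n} → Vec F n → Set
  Positive-roots p = ∀ z₀ δ → Root p z₀ δ → NearPositive δ z₀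

  private
    -- The norm of 1 + y, the approximate eigenvalue of A that belongs to the approximate root y of
    -- the shifted polynomial.
    dist : F → Carrier
    dist y = ‖ -1F -F y ‖

    dist≡ : ∀ y → dist y ≡ ∣ 1# + re y ∣ + ∣ im y ∣
    dist≡ (a , b) = cong₂ _+_ (trans (cong ∣_∣ (solve 1
        (λ a → :- con (+ 1) :+ :- a := :- (con (+ 1) :+ a)) refl a)) (∣-∣ (1# + a)))
      (trans (cong ∣_∣ (solve 1 (λ b → :- con (+ 0) :+ :- b := :- b) refl b)) (∣-∣ b))

    ∣u∣≤ : ∀ {u δ} → 0# ≤ δ → - δ ≤ u → ∣ u ∣ ≤ u + (δ + δ)
    ∣u∣≤ {u} {δ} 0≤δ h = ∣∣≤ (by (nonNeg-+ (nonNeg 0≤δ) (nonNeg 0≤δ))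
        (solve 2 (λ u d → d :+ d := (u :+ (d :+ d)) :- u) refl u δ))
      (by (nonNeg-+ h h) (solve 2 (λ u d → (u :- :- d) :+ (u :- :- d) :=
          (u :+ (d :+ d)) :- :- u) refl u δ))

    -- For a nearly positive number the norm is nearly the real part, so the norms add up to nearly
    -- the trace.
    dist≤ : ∀ {y δ} → 0# ≤ δ → NearPositive δ y → dist y ≤ 1# + re y + (δ + δ + δ)
    dist≤ {y} {δ} 0≤δ (h , k) = ≤-trans (≤-reflexive (dist≡ y)) (≤-trans (+-mono-≤ (∣u∣≤ 0≤δ k) h)
      (≤-reflexive (solve 2 (λ u d → u :+ (d :+ d) :+ d := u :+ (d :+ d :+ d)) refl (1# + re y) δ)))

    ‖y‖≤ : ∀ {y δ e} → 0# ≤ δ → NearPositive δ y → ∣ dist y - 1# ∣ ≤ e → ‖ y ‖ ≤ e + (δ + δ + δ) + δ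
    ‖y‖≤ {y@(a , b)} {δ} {e} 0≤δ near@(h , k) g = +-mono-≤ (∣∣≤ upper lower) h
      where
      upper : a ≤ e + (δ + δ + δ)
      upper = by (nonNeg-+ (nonNeg-+ (≤-trans (a≤∣a∣ (dist y - 1#)) g) (nonNeg-+
          (nonNeg-+ (nonNeg-+ (nonNeg 0≤δ) (nonNeg 0≤δ)) (nonNeg 0≤δ)) (nonNeg (0≤∣∣ b))))
          (a≤∣a∣ (1# + a)))
        (trans (cong (λ d → ((e - (d - 1#)) + ((δ + δ + δ) + ∣ b ∣)) + (∣ 1# + a ∣ - (1# + a)))
            (dist≡ y))
          (solve 5 (λ a e d u v → ((e :- ((u :+ v) :- con (+ 1))) :+ ((d :+ d :+ d) :+ v)) :+ (u :-
              (con (+ 1) :+ a)) := (e :+ (d :+ d :+ d)) :- a)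
            refl a e δ ∣ 1# + a ∣ ∣ b ∣))
      lower : - a ≤ e + (δ + δ + δ)
      lower = by (nonNeg-+ (≤-trans (-a≤∣a∣ (dist y - 1#)) g) (dist≤ 0≤δ near))
        (solve 4 (λ a e d x → (e :- :- (x :- con (+ 1))) :+ ((con (+ 1) :+ a :+ (d :+ d :+ d)) :- x) :=
            (e :+ (d :+ d :+ d)) :- :- a)
          refl a e δ (dist y))

    total-dist : ∀ {n} (ys : Vec F n) {δ} → 0# ≤ δ → All (NearPositive δ) ys →
                 total (map dist ys) ≤ fromℤ (+ n) + re (sumF ys) + fromℤ (+ n) * (δ + δ + δ)
    total-dist []       {δ} 0≤δ [] = ≤-reflexive
        (solve 1 (λ d → con (+ 0) := con (+ 0) :+ con (+ 0) :+ con (+ 0) :* d) refl (δ + δ + δ))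
    total-dist {suc n} (y ∷ ys) {δ} 0≤δ (h ∷ hs) = ≤-trans
        (+-mono-≤ (dist≤ {y} 0≤δ h) (total-dist ys 0≤δ hs)) (≤-reflexive
      (trans (solve 4 (λ n a s d → (con (+ 1) :+ a :+ d) :+ (n :+ s :+ n :* d) := (con (+ 1) :+ n) :+
          (a :+ s) :+ (con (+ 1) :+ n) :* d)
          refl (fromℤ (+ n)) (re y) (re (sumF ys)) (δ + δ + δ))
        (cong (λ m → m + (re y + re (sumF ys)) + m * (δ + δ + δ)) (sym (fromℤ-suc n)))))

    0≤dists : ∀ {n} (ys : Vec F n) → All (0# ≤_) (map dist ys)
    0≤dists []       = []
    0≤dists (y ∷ ys) = 0≤‖‖ (-1F -F y) ∷ 0≤dists ys

  -- In the application p(-1) = det (-A) is a nonzero integer, and the second coefficient is minus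
  -- the trace of A - I, whose diagonal entries are at most 0.
  module _ {ν} (p : Vec F (suc ν)) (positive : Positive-roots p)
    (norm : 1# ≤ ‖ evalM p -1F ‖) (trace≤0 : 0# ≤ re (second 0F p)) where
    private
      n : ℕ
      n = suc ν


    private
      Small : Carrier → Set
      Small ε₀ = ∃[ l ] (∀ z → evalM p z ≡ newton {n} l z) × All (λ yr → ‖ proj₁ yr ‖ ≤ ε₀) l
                   × All (λ yr → ‖ proj₂ yr ‖ ≤ ε₀) l × ‖ sumF (roots l) +F second 0F p ‖ ≤ ε₀

      module Final (ε₀ e δ ε₁ ε R η : Carrier)
        (0≤δ : 0# ≤ δ) (0≤ε : 0# ≤ ε) (0≤R : 0# ≤ R) (0≤ε₁ : 0# ≤ ε₁)
        (e+4δ≤ε₀ : e + (δ + δ + δ) + δ ≤ ε₀) (ε≤ε₀ : ε ≤ ε₀)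
        (stb : Stable n e ε₁) (sums : ε + fromℤ (+ n) * (δ + δ + δ) ≤ ε₁)
        (G₁ : ε * geometric (1# + R) n ≤ ε₁) (G₂ : ε * geometric (R + R) n ≤ η)
        (close : ∀ (p : Vec F n) z₀ → ‖ evalM p z₀ ‖ ≤ η → Root p z₀ δ)
        (fac : Factorisation p R ε) where
        open Factorisation fac

        near : All (λ yr → NearPositive δ (proj₁ yr)) pairs
        near = All.map (λ {yr} h → positive (proj₁ yr) δ (close p (proj₁ yr)
            (≤-trans (≤-reflexive (cong ‖_‖ (formula (proj₁ yr)))) (≤-trans h G₂))))
          (newton-at-root 0≤ε 0≤R pairs (λ {y} {y′} a b → ≤-trans (‖+‖ y (-F y′)) (+-mono-≤ a
              (≤-trans (≤-reflexive (‖-‖ y′)) b))) bounded small)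

        All-roots : ∀ {P : F → Set} {m} {l : Vec (F × F) m} → All (λ yr → P (proj₁ yr)) l → All P
            (roots l)
        All-roots []       = []
        All-roots (h ∷ hs) = h ∷ All-roots hs

        All-roots⁻ : ∀ {P : F → Set} {m} (l : Vec (F × F) m) → All P (roots l) → All
            (λ yr → P (proj₁ yr)) l
        All-roots⁻ []      []       = []
        All-roots⁻ (_ ∷ l) (h ∷ hs) = h ∷ All-roots⁻ l hs

        ys : Vec F n
        ys = roots pairs

        sum≤ : total (map dist ys) ≤ fromℤ (+ n) + ε₁
        sum≤ = ≤-trans (total-dist ys 0≤δ (All-roots near))
            (by (nonNeg-+ (nonNeg-+ sums re≤) (nonNeg trace≤0))
          (solve 6 (λ e1 e d n s t → ((e1 :- (e :+ n :* d)) :+ (e :- (s :+ t))) :+ t := (n :+ e1) :-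
              (n :+ s :+ n :* d))
            refl ε₁ ε (δ + δ + δ) (fromℤ (+ n)) (re (sumF ys)) (re (second 0F p))))
          where
          re≤ : re (sumF ys) + re (second 0F p) ≤ ε
          re≤ = ≤-trans (a≤∣a∣ _) (≤-trans (∣re∣≤‖‖ (sumF ys +F second 0F p)) trace)

        ≤product : 1# - ε₁ ≤ product (map dist ys)
        ≤product = by (nonNeg-+ (≤-trans norm (≤-trans (≤-reflexive (cong ‖_‖ (formula -1F)))
            (‖newton‖ 0≤ε (0≤+ 0≤1 0≤R) pairs -1F (All.map (λ {yr} h → ≤-trans (‖+‖ -1F (-F proj₁ yr))
              (+-mono-≤ (≤-reflexive (trans (‖-‖ 1F) ‖1‖)) (≤-trans (≤-reflexive (‖-‖ (proj₁ yr))) h)))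
                  bounded) small))) G₁)
          (solve 3 (λ p g e → ((p :+ g) :- con (+ 1)) :+ (e :- g) := p :- (con (+ 1) :- e)) refl
              (product (map dist ys)) (ε * geometric (1# + R) n) ε₁)

        All-map⁻ : ∀ {P : Carrier → Set} {m} (ys : Vec F m) → All P (map dist ys) → All
            (λ y → P (dist y)) ys
        All-map⁻ []       []       = []
        All-map⁻ (_ ∷ ys) (h ∷ hs) = h ∷ All-map⁻ ys hs

        dists-near-1 : All (λ y → ∣ dist y - 1# ∣ ≤ e) ys
        dists-near-1 = All-map⁻ ys (stb (map dist ys) (0≤dists ys) sum≤ ≤product)

        conclusion : Small ε₀
        conclusion = pairs , formula
          , All-roots⁻ pairs (All.map (λ {y} (h , k) → ≤-trans (‖y‖≤ {y} 0≤δ h k) e+4δ≤ε₀)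
              (All.zip (All-roots near , dists-near-1)))
          , All.map (λ h → ≤-trans h ε≤ε₀) small , ≤-trans trace ε≤ε₀

      -- The order of the choices matters: `stable` turns `e` into `ε₁`, both limit `δ`, `close`
      -- turns `δ` into `η`, and `R` has to be known before `ε` because errors are magnified by
      -- powers of 1 + R and 2R.
      small-roots : ∀ ε₀ → 0# < ε₀ → Small ε₀
      small-roots ε₀ 0<ε₀ = with-e (shrink (1# + 1#) 0<ε₀ (0≤+ 0≤1 0≤1))
        where
        with-e : (∃[ e ] 0# < e × e ≤ ε₀ × e * (1# + 1#) ≤ ε₀) → Small ε₀
        with-e (e , 0<e , e≤ε₀ , 2e≤ε₀) = with-ε₁ (stable n 0<e)
          where
          with-ε₁ : (∃[ ε₁ ] 0# < ε₁ × (∀ ε → 0# ≤ ε → ε ≤ ε₁ → Stable n e ε)) → Small ε₀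
          with-ε₁ (ε₁ , 0<ε₁ , stb) = with-e₁ (shrink (1# + 1#) 0<ε₁ (0≤+ 0≤1 0≤1))
            where
            with-e₁ : (∃[ e₁ ] 0# < e₁ × e₁ ≤ ε₁ × e₁ * (1# + 1#) ≤ ε₁) → Small ε₀
            with-e₁ (e₁ , 0<e₁ , _ , 2e₁≤ε₁) = with-m (minimum⁺ 0<e 0<e₁)
              where
              N3 : Carrier
              -- 3n covers the loss of 3δ for each summand of the total, and 4 the loss of 4δ in the
              -- estimate of a single root.
              N3 = (1# + 1# + 1#) * fromℤ (+ n) + (1# + 1# + 1# + 1#)
              0≤3 : 0# ≤ 1# + 1# + 1#
              0≤3 = 0≤+ (0≤+ 0≤1 0≤1) 0≤1
              0≤N3 : 0# ≤ N3
              0≤N3 = 0≤+ (0≤* 0≤3 (fromℤ-nonNeg n)) (0≤+ 0≤3 0≤1)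
              with-m : (∃[ m ] 0# < m × m ≤ e × m ≤ e₁) → Small ε₀
              with-m (m , 0<m , m≤e , m≤e₁) = with-δ (shrink N3 0<m 0≤N3)
                where
                with-δ : (∃[ δ ] 0# < δ × δ ≤ m × δ * N3 ≤ m) → Small ε₀
                with-δ (δ , 0<δ , _ , δN3≤m) = with-η (Localises.close (localise ν) δ 0<δ)
                  where
                  4δ≤e : (δ + δ + δ) + δ ≤ e
                  4δ≤e = ≤-trans (by (nonNeg-+ δN3≤m (nonNeg-* (nonNeg (<⇒≤ 0<δ)) (nonNeg
                      (0≤* 0≤3 (fromℤ-nonNeg n)))))
                    (solve 3 (λ d m n → (m :- d :* ((con (+ 1) :+ con (+ 1) :+ con (+ 1)) :* n :+ (con
                        (+ 1) :+ con (+ 1) :+ con (+ 1) :+ con (+ 1))))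
                       :+ d :* ((con (+ 1) :+ con (+ 1) :+ con (+ 1)) :* n) := m :-
                           ((d :+ d :+ d) :+ d)) refl δ m (fromℤ (+ n)))) m≤e
                  3nδ≤e₁ : fromℤ (+ n) * (δ + δ + δ) ≤ e₁
                  3nδ≤e₁ = ≤-trans (by (nonNeg-+ δN3≤m (nonNeg-* (nonNeg (<⇒≤ 0<δ))
                      (nonNeg (0≤+ 0≤3 0≤1))))
                    (solve 3 (λ d m n → (m :- d :* ((con (+ 1) :+ con (+ 1) :+ con (+ 1)) :* n :+ (con
                        (+ 1) :+ con (+ 1) :+ con (+ 1) :+ con (+ 1))))
                       :+ d :* (con (+ 1) :+ con (+ 1) :+ con (+ 1) :+ con (+ 1)) := m :- n :*
                           (d :+ d :+ d)) refl δ m (fromℤ (+ n)))) m≤e₁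
                  with-η : (∃[ η ] 0# < η × (∀ (p : Vec F n) z₀ → ‖ evalM p z₀ ‖ ≤ η → Root p z₀ δ)) →
                      Small ε₀
                  with-η (η , 0<η , close) = with-C (coefficients-bounded p)
                    where
                    with-C : (∃[ C ] 0# ≤ C × All (λ c → ‖ c ‖ ≤ C) p) → Small ε₀
                    with-C (C , 0≤C , bs) = with-R (factorise n C 0≤C)
                      where
                      with-R : (∃[ R ] 0# ≤ R × (∀ (p : Vec F n) → All
                          (λ c → ‖ c ‖ ≤ C) p → ∀ ε → 0# < ε → Factorisation p R ε)) → Small ε₀
                      with-R (R , 0≤R , fac) = with-m₂ (minimum⁺ 0<m 0<η)
                        where
                        G : Carrier
                        G = geometric (1# + R) n + geometric (R + R) n
                        g₁ : 0# ≤ geometric (1# + R) n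
                        g₁ = 0≤geometric (0≤+ 0≤1 0≤R) n
                        g₂ : 0# ≤ geometric (R + R) n
                        g₂ = 0≤geometric (0≤+ 0≤R 0≤R) n
                        e₁≤ε₁ : e₁ ≤ ε₁
                        e₁≤ε₁ = ≤-trans (by (nonNeg (<⇒≤ 0<e₁))
                            (solve 1 (λ e → e := e :* (con (+ 1) :+ con (+ 1)) :- e) refl e₁)) 2e₁≤ε₁
                        with-m₂ : (∃[ m₂ ] 0# < m₂ × m₂ ≤ m × m₂ ≤ η) → Small ε₀
                        with-m₂ (m₂ , 0<m₂ , m₂≤m , m₂≤η) = with-ε (shrink G 0<m₂ (0≤+ g₁ g₂))
                          where
                          with-ε : (∃[ ε ] 0# < ε × ε ≤ m₂ × ε * G ≤ m₂) → Small ε₀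
                          with-ε (ε , 0<ε , ε≤m₂ , εG≤m₂) = Final.conclusion ε₀ e δ ε₁ ε R η (<⇒≤ 0<δ)
                              (<⇒≤ 0<ε) 0≤R (<⇒≤ 0<ε₁)
                            (≤-trans (≤-reflexive (solve 2 (λ e d → e :+ (d :+ d :+ d) :+ d := e :+
                                ((d :+ d :+ d) :+ d)) refl e δ))
                              (≤-trans (+-mono-≤ ≤-refl 4δ≤e) (≤-trans (≤-reflexive
                                  (solve 1 (λ e → e :+ e := e :* (con (+ 1) :+ con (+ 1))) refl e))
                                  2e≤ε₀)))
                            (≤-trans ε≤m₂ (≤-trans m₂≤m (≤-trans m≤e e≤ε₀)))
                            (stb ε₁ (<⇒≤ 0<ε₁) ≤-refl)
                            (≤-trans (+-mono-≤ (≤-trans ε≤m₂ (≤-trans m₂≤m m≤e₁)) 3nδ≤e₁)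
                              (≤-trans (≤-reflexive (solve 1 (λ e → e :+ e := e :* (con (+ 1) :+ con
                                  (+ 1))) refl e₁)) 2e₁≤ε₁))
                            (≤-trans (*-monoˡ-≤ (<⇒≤ 0<ε) (by (nonNeg g₂) (solve 2
                                (λ a b → b := (a :+ b) :- a) refl (geometric (1# + R) n)
                                (geometric (R + R) n))))
                              (≤-trans εG≤m₂ (≤-trans m₂≤m (≤-trans m≤e₁ e₁≤ε₁))))
                            (≤-trans (*-monoˡ-≤ (<⇒≤ 0<ε) (by (nonNeg g₁) (solve 2
                                (λ a b → a := (a :+ b) :- b) refl (geometric (1# + R) n)
                                (geometric (R + R) n))))
                              (≤-trans εG≤m₂ m₂≤η))
                            close (fac p bs ε 0<ε)

      equal : ∀ {a b} B → 0# ≤ B → (∀ ε → 0# < ε → ε ≤ 1# → ‖ a -F b ‖ ≤ ε * B) → a ≡ b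
      equal {a} {b} B 0≤B h = trans (S.solve 2 (λ a b → a S.:= (a S.:- b) S.:+ b) refl a b)
        (trans (cong (_+F b) (‖‖≤0⇒≡0 (a -F b) (squeeze-0 0≤B h))) (F.+-identityˡ b))

      ‖sumF‖ : ∀ {m ε} (ys : Vec F m) → All (λ y → ‖ y ‖ ≤ ε) ys → ‖ sumF ys ‖ ≤ ε * fromℤ (+ m)
      ‖sumF‖ {ε = ε} []       []       = ≤-reflexive (trans ‖0‖ (sym (zeroʳ ε)))
      ‖sumF‖ {suc m} {ε} (y ∷ ys) (h ∷ hs) = ≤-trans (‖+‖ y (sumF ys))
          (≤-trans (+-mono-≤ h (‖sumF‖ ys hs))
        (≤-reflexive (trans (solve 2 (λ e m → e :+ e :* m := e :* (con (+ 1) :+ m)) refl ε (fromℤ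
            (+ m)))
          (cong (ε *_) (sym (fromℤ-suc m))))))

      roots-small : ∀ {m ε} (l : Vec (F × F) m) → All (λ yr → ‖ proj₁ yr ‖ ≤ ε) l → All
          (λ y → ‖ y ‖ ≤ ε) (roots l)
      roots-small []      []       = []
      roots-small (_ ∷ l) (h ∷ hs) = h ∷ roots-small l hs

    abstract
      -- Neither side depends on ε, so approximations of every precision force equality.
      power : ∀ z → evalM p z ≡ z ^F n
      power z = equal (powerBound ‖ z ‖ n) (0≤powerBound (0≤‖‖ z) n) λ ε 0<ε ε≤1 → bound ε 0<ε ε≤1
          (small-roots ε 0<ε)
        where
        bound : ∀ ε → 0# < ε → ε ≤ 1# → Small ε → ‖ evalM p z -F (z ^F n) ‖ ≤ ε * powerBound ‖ z ‖ n
        bound ε 0<ε ε≤1 (l , formula , ys , rs , _) = ≤-trans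
            (≤-reflexive (cong (λ q → ‖ q -F (z ^F n) ‖) (formula z)))
          (newton-near-power l z (<⇒≤ 0<ε) ε≤1 ys rs)

      traceless : second 0F p ≡ 0F
      traceless = equal (1# + fromℤ (+ n)) (0≤+ 0≤1 (fromℤ-nonNeg n)) λ ε 0<ε ε≤1 → bound ε
          (small-roots ε 0<ε)
        where
        bound : ∀ ε → Small ε → ‖ second 0F p -F 0F ‖ ≤ ε * (1# + fromℤ (+ n))
        bound ε (l , _ , ys , _ , t) = begin
          ‖ second 0F p -F 0F ‖
            ≡⟨ cong ‖_‖ (S.solve 2 (λ s t → t S.:- S.con (+ 0) S.:= (s S.:+ t) S.:+ S.:- s) refl
                (sumF (roots l)) (second 0F p)) ⟩
          ‖ (sumF (roots l) +F second 0F p) +F (-F sumF (roots l)) ‖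
            ≤⟨ ≤-trans (‖+‖ _ _) (+-mono-≤ t (≤-trans (≤-reflexive (‖-‖ (sumF (roots l)))) (‖sumF‖
                (roots l) (roots-small l ys)))) ⟩
          ε + ε * fromℤ (+ n)
            ≡⟨ solve 2 (λ e m → e :+ e :* m := e :* (con (+ 1) :+ m)) refl ε (fromℤ (+ n)) ⟩
          ε * (1# + fromℤ (+ n)) ∎
          where open ≤-Reasoning

-- Null and Cauchy sequences

module Sequences (K : OrderedField) where
  open import Data.Integer using (+_)
  open import Data.Nat as ℕ using (ℕ)
  import Data.Nat.Properties as ℕ
  open import Data.Product using (∃-syntax; _×_; _,_; proj₁; proj₂)
  open import Relation.Binary.PropositionalEquality using (_≡_; refl; sym; trans; cong; subst)
  open import Relation.Nullary using (¬_; Dec; yes; no; contradiction)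

  open Order K
  open Gaussian K
  open Dominate K using (half; module Halves)
  open Iterate K using (sq-cancel-≤)
  open Concentrate K using (shrink)
  private
    module S = IntSolver ring

  record Eventually (P : ℕ → Set) : Set where
    constructor eventually
    field
      start : ℕ
      holds : ∀ m → P (start ℕ.+ m)

  both : ∀ {P Q : ℕ → Set} → Eventually P → Eventually Q → Eventually (λ k → P k × Q k)
  both {P} {Q} (eventually I p) (eventually J q) = eventually (I ℕ.+ J) λ m →
    subst P (sym (ℕ.+-assoc I J m)) (p (J ℕ.+ m)) ,
    subst Q (trans (sym (ℕ.+-assoc J I m)) (cong (ℕ._+ m) (ℕ.+-comm J I))) (q (I ℕ.+ m))

  map-eventually : ∀ {P Q : ℕ → Set} → (∀ k → P k → Q k) → Eventually P → Eventually Q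
  map-eventually f (eventually J p) = eventually J λ m → f (J ℕ.+ m) (p m)

  Null Cauchy : (ℕ → Carrier) → Set
  Null s   = ∀ ε → 0# < ε → Eventually λ k → ∣ s k ∣ ≤ ε
  Cauchy s = ∀ ε → 0# < ε → ∃[ J ] ∀ m → ∣ s (J ℕ.+ m) - s J ∣ ≤ ε

  halve : ∀ {ε} → 0# < ε → ∃[ e ] 0# < e × e + e ≡ ε
  halve {ε} 0<ε = ε * proj₁ half , 0<* 0<ε (Halves.0<h (proj₁ half) (proj₂ half)) ,
    trans (solve 2 (λ e h → e :* h :+ e :* h := e :* (h :+ h)) refl ε (proj₁ half))
        (trans (cong (ε *_) (proj₂ half)) (*-identityʳ ε))

  Null-resp : ∀ {s t} → (∀ k → s k ≡ t k) → Null s → Null t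
  Null-resp {s} {t} e h ε 0<ε = map-eventually (λ k g → subst (λ x → ∣ x ∣ ≤ ε) (e k) g) (h ε 0<ε)

  Null-0 : Null (λ _ → 0#)
  Null-0 ε 0<ε = eventually 0 λ m → ≤-trans (≤-reflexive (nonNeg⇒∣∣≡ nonNeg-0)) (<⇒≤ 0<ε)

  Null-+ : ∀ {s t} → Null s → Null t → Null (λ k → s k + t k)
  Null-+ {s} {t} hs ht ε 0<ε = from (halve 0<ε)
    where
    from : (∃[ e ] 0# < e × e + e ≡ ε) → Eventually λ k → ∣ s k + t k ∣ ≤ ε
    from (e , 0<e , e+e≡ε) = map-eventually
      (λ k (p , q) → ≤-trans (∣+∣ (s k) (t k)) (≤-trans (+-mono-≤ p q) (≤-reflexive e+e≡ε)))
      (both (hs e 0<e) (ht e 0<e))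

  Null-neg : ∀ {s} → Null s → Null (λ k → - s k)
  Null-neg {s} h ε 0<ε = map-eventually (λ k p → ≤-trans (≤-reflexive (∣-∣ (s k))) p) (h ε 0<ε)

  Bounded : (ℕ → Carrier) → Set
  Bounded s = ∃[ B ] 0# ≤ B × Eventually λ k → ∣ s k ∣ ≤ B

  Cauchy⇒Bounded : ∀ {s} → Cauchy s → Bounded s
  Cauchy⇒Bounded {s} c = from (c 1# 0<1)
    where
    from : (∃[ J ] ∀ m → ∣ s (J ℕ.+ m) - s J ∣ ≤ 1#) → Bounded s
    from (J , h) = 1# + ∣ s J ∣ , 0≤+ 0≤1 (0≤∣∣ (s J)) , eventually J λ m →
      ≤-trans (≤-reflexive (cong ∣_∣ (solve 2 (λ a b → a := (a :- b) :+ b) refl (s (J ℕ.+ m)) (s J))))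
        (≤-trans (∣+∣ (s (J ℕ.+ m) - s J) (s J)) (+-mono-≤ (h m) ≤-refl))

  Null-* : ∀ {s t} → Bounded s → Null t → Null (λ k → s k * t k)
  Null-* {s} {t} (B , 0≤B , hs) ht ε 0<ε = from (shrink B 0<ε 0≤B)
    where
    from : (∃[ e ] 0# < e × e ≤ ε × e * B ≤ ε) → Eventually λ k → ∣ s k * t k ∣ ≤ ε
    from (e , 0<e , _ , eB≤ε) = map-eventually
      (λ k (p , q) → ≤-trans (≤-reflexive (∣*∣ (s k) (t k)))
          (≤-trans (*-mono-≤ (0≤∣∣ (s k)) (<⇒≤ 0<e) p q) (≤-trans (≤-reflexive (*-comm B e)) eB≤ε)))
      (both hs (ht e 0<e))

  ≤⇒<-half : ∀ {ε e a} → 0# < e → e + e ≡ ε → a ≤ e → a < ε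
  ≤⇒<-half {ε} {e} 0<e e+e≡ε h = ≤-<-trans h
    (subst (e <_) e+e≡ε (subst (_< e + e) (+-identityˡ e) (+-mono-<-≤ 0<e ≤-refl)))

  Cauchy′ : (ℕ → Carrier) → Set
  Cauchy′ s = ∀ ε → 0# < ε → ∃[ N ] ∀ m n → N ℕ.≤ m → N ℕ.≤ n → ∣ s m - s n ∣ < ε

  Cauchy⇒Cauchy′ : ∀ {s} → Cauchy s → Cauchy′ s
  Cauchy⇒Cauchy′ {s} h ε 0<ε = from (halve 0<ε)
    where
    Goal : Set
    Goal = ∃[ N ] ∀ m n → N ℕ.≤ m → N ℕ.≤ n → ∣ s m - s n ∣ < ε
    from : (∃[ e ] 0# < e × e + e ≡ ε) → Goal
    from (e , 0<e , e+e≡ε) = from₂ (halve 0<e)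
      where
      from₂ : (∃[ d ] 0# < d × d + d ≡ e) → Goal
      from₂ (d , 0<d , d+d≡e) = from₃ (h d 0<d)
        where
        from₃ : (∃[ J ] ∀ m → ∣ s (J ℕ.+ m) - s J ∣ ≤ d) → Goal
        from₃ (J , g) = J , λ m n J≤m J≤n → ≤⇒<-half 0<e e+e≡ε (≤-trans
          (≤-reflexive (cong ∣_∣ (solve 3 (λ a b c → a :- b := (a :- c) :+ (:- (b :- c))) refl (s m)
              (s n) (s J))))
          (≤-trans (∣+∣ (s m - s J) (- (s n - s J)))
              (≤-trans (+-mono-≤ (near m J≤m) (≤-trans (≤-reflexive (∣-∣ _)) (near n J≤n)))
              (≤-reflexive d+d≡e))))
          where
          near : ∀ m → J ℕ.≤ m → ∣ s m - s J ∣ ≤ d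
          near m J≤m = subst (λ m → ∣ s m - s J ∣ ≤ d) (ℕ.m+[n∸m]≡n J≤m) (g (m ℕ.∸ J))

  Cauchy′⇒Cauchy : ∀ {s} → Cauchy′ s → Cauchy s
  Cauchy′⇒Cauchy {s} h ε 0<ε = from (h ε 0<ε)
    where
    from : (∃[ N ] ∀ m n → N ℕ.≤ m → N ℕ.≤ n → ∣ s m - s n ∣ < ε) → ∃[ J ] ∀ m → ∣ s (J ℕ.+ m) - s J ∣ ≤
        ε
    from (N , g) = N , λ m → <⇒≤ (g (N ℕ.+ m) N (ℕ.m≤m+n N m) ℕ.≤-refl)

  Null′ : (ℕ → Carrier) → Set
  Null′ s = ∀ ε → 0# < ε → ∃[ N ] ∀ n → N ℕ.≤ n → ∣ s n ∣ < ε

  Null⇒Null′ : ∀ {s} → Null s → Null′ s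
  Null⇒Null′ {s} h ε 0<ε = from (halve 0<ε)
    where
    Goal : Set
    Goal = ∃[ N ] ∀ n → N ℕ.≤ n → ∣ s n ∣ < ε
    from : (∃[ e ] 0# < e × e + e ≡ ε) → Goal
    from (e , 0<e , e+e≡ε) = from₂ (h e 0<e)
      where
      from₂ : Eventually (λ k → ∣ s k ∣ ≤ e) → Goal
      from₂ (eventually N g) = N , λ n N≤n → subst (λ n → ∣ s n ∣ < ε) (ℕ.m+[n∸m]≡n N≤n)
          (≤⇒<-half 0<e e+e≡ε (g (n ℕ.∸ N)))

  Null′⇒Null : ∀ {s} → Null′ s → Null s
  Null′⇒Null {s} h ε 0<ε = from (h ε 0<ε)
    where
    from : (∃[ N ] ∀ n → N ℕ.≤ n → ∣ s n ∣ < ε) → Eventually λ k → ∣ s k ∣ ≤ ε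
    from (N , g) = eventually N λ m → <⇒≤ (g (N ℕ.+ m) (ℕ.m≤m+n N m))

  Null-minus-refl : ∀ {s t : ℕ → Carrier} → (∀ k → s k ≡ t k) → Null (λ k → s k - t k)
  Null-minus-refl {s} {t} h = Null-resp
      (λ k → trans (solve 1 (λ a → con (+ 0) := a :- a) refl (t k)) (cong (_- t k) (sym (h k)))) Null-0

  Null-minus-sym : ∀ {s t : ℕ → Carrier} → Null (λ k → s k - t k) → Null (λ k → t k - s k)
  Null-minus-sym {s} {t} h = Null-resp (λ k → solve 2 (λ a b → :- (a :- b) := b :- a) refl (s k) (t k))
      (Null-neg h)

  Null-minus-trans : ∀ {s t u : ℕ → Carrier} → Null (λ k → s k - t k) → Null (λ k → t k - u k) → Null
      (λ k → s k - u k)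
  Null-minus-trans {s} {t} {u} g h = Null-resp
      (λ k → solve 3 (λ a b c → (a :- b) :+ (b :- c) := a :- c) refl (s k) (t k) (u k)) (Null-+ g h)

  Null-minus-+ : ∀ {s t u v : ℕ → Carrier} → Null (λ k → s k - t k) → Null (λ k → u k - v k) → Null
      (λ k → (s k + u k) - (t k + v k))
  Null-minus-+ {s} {t} {u} {v} g h = Null-resp
    (λ k → solve 4 (λ a b c d → (a :- b) :+ (c :- d) := (a :+ c) :- (b :+ d)) refl (s k) (t k) (u k)
        (v k)) (Null-+ g h)

  Null-minus-neg : ∀ {s t : ℕ → Carrier} → Null (λ k → s k - t k) → Null (λ k → (- s k) - (- t k))
  Null-minus-neg {s} {t} h = Null-resp
      (λ k → solve 2 (λ a b → :- (a :- b) := (:- a) :- (:- b)) refl (s k) (t k)) (Null-neg h)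

  Null-minus-* : ∀ {s t u v : ℕ → Carrier} → Cauchy s → Cauchy v → Null (λ k → s k - t k) → Null
      (λ k → u k - v k) → Null (λ k → s k * u k - t k * v k)
  Null-minus-* {s} {t} {u} {v} cs cv g h = Null-resp
    (λ k → solve 4 (λ a b c d → a :* (c :- d) :+ d :* (a :- b) := a :* c :- b :* d) refl (s k) (t k)
        (u k) (v k))
    (Null-+ (Null-* (Cauchy⇒Bounded cs) h) (Null-* (Cauchy⇒Bounded cv) g))

  NullF CauchyF : (ℕ → F) → Set
  NullF s   = ∀ ε → 0# < ε → Eventually λ k → ‖ s k ‖ ≤ ε
  CauchyF s = ∀ ε → 0# < ε → ∃[ J ] ∀ m → ‖ s (J ℕ.+ m) -F s J ‖ ≤ ε

  Null⇒NullF : ∀ {s : ℕ → F} → Null (λ k → re (s k)) → Null (λ k → im (s k)) → NullF s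
  Null⇒NullF {s} hr hi ε 0<ε = from (halve 0<ε)
    where
    from : (∃[ e ] 0# < e × e + e ≡ ε) → Eventually λ k → ‖ s k ‖ ≤ ε
    from (e , 0<e , e+e≡ε) = map-eventually (λ k (p , q) → ≤-trans (+-mono-≤ p q) (≤-reflexive e+e≡ε))
        (both (hr e 0<e) (hi e 0<e))

  NullF⇒Null-re : ∀ {s : ℕ → F} → NullF s → Null (λ k → re (s k))
  NullF⇒Null-re {s} h ε 0<ε = map-eventually (λ k p → ≤-trans (∣re∣≤‖‖ (s k)) p) (h ε 0<ε)

  NullF⇒Null-im : ∀ {s : ℕ → F} → NullF s → Null (λ k → im (s k))
  NullF⇒Null-im {s} h ε 0<ε = map-eventually (λ k p → ≤-trans (∣im∣≤‖‖ (s k)) p) (h ε 0<ε)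

  Cauchy⇒CauchyF : ∀ {s : ℕ → F} → Cauchy (λ k → re (s k)) → Cauchy (λ k → im (s k)) → CauchyF s
  Cauchy⇒CauchyF {s} hr hi ε 0<ε = from (halve 0<ε)
    where
    centred : ∀ {t : ℕ → Carrier} {e e′} → 0# < e → e + e ≡ e′ → ∀ I J →
        (∀ m → ∣ t (I ℕ.+ m) - t I ∣ ≤ e) → ∀ m → ∣ t ((I ℕ.+ J) ℕ.+ m) - t (I ℕ.+ J) ∣ ≤ e′
    centred {t} 0<e e+e≡ I J h m = ≤-trans (≤-reflexive (cong ∣_∣ (trans
        (cong (λ k → t k - t (I ℕ.+ J)) (ℕ.+-assoc I J m))
        (solve 3 (λ a b c → a :- b := (a :- c) :+ :- (b :- c)) refl (t (I ℕ.+ (J ℕ.+ m))) (t (I ℕ.+ J))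
            (t I)))))
      (≤-trans (∣+∣ _ _) (≤-trans (+-mono-≤ (h (J ℕ.+ m)) (≤-trans (≤-reflexive (∣-∣ _)) (h J)))
          (≤-reflexive e+e≡)))
    Goal : Set
    Goal = ∃[ J ] ∀ m → ‖ s (J ℕ.+ m) -F s J ‖ ≤ ε
    from : (∃[ e ] 0# < e × e + e ≡ ε) → Goal
    from (e , 0<e , e+e≡ε) = from₂ (halve 0<e)
      where
      from₂ : (∃[ d ] 0# < d × d + d ≡ e) → Goal
      from₂ (d , 0<d , d+d≡e) = combine (hr d 0<d) (hi d 0<d)
        where
        combine : (∃[ I ] ∀ m → ∣ re (s (I ℕ.+ m)) - re (s I) ∣ ≤ d) →
            (∃[ J ] ∀ m → ∣ im (s (J ℕ.+ m)) - im (s J) ∣ ≤ d) → Goal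
        combine (I , p) (J , q) = I ℕ.+ J , λ m → ≤-trans (+-mono-≤
          (centred {λ k → re (s k)} 0<d d+d≡e I J p m)
          (subst (λ k → ∣ im (s (k ℕ.+ m)) - im (s k) ∣ ≤ e) (ℕ.+-comm J I)
              (centred {λ k → im (s k)} 0<d d+d≡e J I q m)))
          (≤-reflexive e+e≡ε)

  ‖‖≤+ : ∀ a b → ‖ a ‖ ≤ ‖ b ‖ + ‖ a -F b ‖
  ‖‖≤+ a b = ≤-trans (≤-reflexive (cong ‖_‖ (S.solve 2 (λ a b → a S.:= b S.:+ (a S.:- b)) refl a b)))
      (‖+‖ b (a -F b))

  ‖‖≤+′ : ∀ a b → ‖ b ‖ ≤ ‖ a ‖ + ‖ a -F b ‖
  ‖‖≤+′ a b = ≤-trans (‖‖≤+ b a) (+-mono-≤ ≤-refl (≤-reflexive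
    (trans (cong ‖_‖ (S.solve 2 (λ a b → b S.:- a S.:= S.:- (a S.:- b)) refl a b)) (‖-‖ (a -F b)))))

  -- The 1-norm is multiplicative up to the factor 2, by comparison with the multiplicative `N`.
  ‖‖*‖‖≤ : ∀ z w → ‖ z ‖ * ‖ w ‖ ≤ 2K * ‖ z *F w ‖
  ‖‖*‖‖≤ z w = sq-cancel-≤ (0≤* (0≤+ 0≤1 0≤1) (0≤‖‖ (z *F w))) (begin
    ‖ z ‖ * ‖ w ‖ * (‖ z ‖ * ‖ w ‖)
      ≡⟨ solve 2 (λ a b → a :* b :* (a :* b) := a :* a :* (b :* b)) refl ‖ z ‖ ‖ w ‖ ⟩
    ‖ z ‖ * ‖ z ‖ * (‖ w ‖ * ‖ w ‖)
      ≤⟨ *-mono-≤ (0≤sq ‖ z ‖) (0≤* (0≤+ 0≤1 0≤1) (0≤N w)) (‖‖²≤2N z) (‖‖²≤2N w) ⟩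
    2K * N z * (2K * N w)
      ≡⟨ solve 3 (λ t a b → t :* a :* (t :* b) := t :* t :* (a :* b)) refl 2K (N z) (N w) ⟩
    2K * 2K * (N z * N w)
      ≡⟨ cong (2K * 2K *_) (sym (N-* z w)) ⟩
    2K * 2K * N (z *F w)
      ≤⟨ *-monoˡ-≤ (0≤sq 2K) (N≤‖‖² (z *F w)) ⟩
    2K * 2K * (‖ z *F w ‖ * ‖ z *F w ‖)
      ≡⟨ solve 2 (λ t n → t :* t :* (n :* n) := t :* n :* (t :* n)) refl 2K ‖ z *F w ‖ ⟩
    2K * ‖ z *F w ‖ * (2K * ‖ z *F w ‖) ∎)
    where open ≤-Reasoning

  -- Absence of zero divisors among limits, without a zero test for limits. A decidable comparison
  -- at one term, after which `t` moves by at most q = ε/4, decides: either `t` stays within ε, or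
  -- it stays above q, and then a null product would make `s` null.
  NullF-cancel : ∀ {s t : ℕ → F} → CauchyF t → ¬ NullF s → NullF (λ k → s k *F t k) → NullF t
  NullF-cancel {s} {t} ct s≉0 st≈0 ε 0<ε = from (halve 0<ε)
    where
    Goal : Set
    Goal = Eventually λ k → ‖ t k ‖ ≤ ε
    from : (∃[ e ] 0# < e × e + e ≡ ε) → Goal
    from (e , 0<e , e+e≡ε) = from₂ (halve 0<e)
      where
      from₂ : (∃[ q ] 0# < q × q + q ≡ e) → Goal
      from₂ (q , 0<q , q+q≡e) = centre (ct q 0<q)
        where
        centre : (∃[ J ] ∀ m → ‖ t (J ℕ.+ m) -F t J ‖ ≤ q) → Goal
        centre (J , h) = decide (‖ t J ‖ ≤? e)
          where
          q≤e : q ≤ e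
          q≤e = by (nonNeg (<⇒≤ 0<q)) (trans (solve 1 (λ q → q := (q :+ q) :- q) refl q)
              (cong (λ x → x - q) q+q≡e))
          decide : Dec (‖ t J ‖ ≤ e) → Goal
          decide (yes g) = eventually J λ m → ≤-trans (‖‖≤+ (t (J ℕ.+ m)) (t J))
              (≤-trans (+-mono-≤ g (≤-trans (h m) q≤e)) (≤-reflexive e+e≡ε))
          decide (no big) = contradiction s≈0 s≉0
            where
            q≤t : Eventually λ k → q ≤ ‖ t k ‖
            q≤t = eventually J λ m → by (nonNeg-+ (<⇒≤ big)
                (nonNeg-+ (‖‖≤+′ (t (J ℕ.+ m)) (t J)) (h m)))
              (trans (cong (λ x → (‖ t J ‖ - x) +
                  ((‖ t (J ℕ.+ m) ‖ + ‖ t (J ℕ.+ m) -F t J ‖ - ‖ t J ‖) + (q - ‖ t (J ℕ.+ m) -F t J ‖)))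
                  (sym q+q≡e))
                (solve 4 (λ tj q tm d → (tj :- (q :+ q)) :+ ((tm :+ d :- tj) :+ (q :- d)) := tm :- q)
                    refl (‖ t J ‖) q (‖ t (J ℕ.+ m) ‖) (‖ t (J ℕ.+ m) -F t J ‖)))
            s≈0 : NullF s
            s≈0 ε′ 0<ε′ = from₃ (halve (0<* 0<ε′ 0<q))
              where
              from₃ : (∃[ e′ ] 0# < e′ × e′ + e′ ≡ ε′ * q) → Eventually λ k → ‖ s k ‖ ≤ ε′
              from₃ (e′ , 0<e′ , e′+e′≡) = map-eventually (λ k (g , b) → *-cancelˡ-≤ 0<q (begin
                  q * ‖ s k ‖                ≤⟨ *-monoʳ-≤ (0≤‖‖ (s k)) b ⟩
                  ‖ t k ‖ * ‖ s k ‖          ≡⟨ *-comm _ _ ⟩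
                  ‖ s k ‖ * ‖ t k ‖          ≤⟨ ‖‖*‖‖≤ (s k) (t k) ⟩
                  2K * ‖ s k *F t k ‖        ≤⟨ *-monoˡ-≤ (0≤+ 0≤1 0≤1) g ⟩
                  2K * e′                    ≡⟨ trans
                      (solve 1 (λ e → (con (+ 1) :+ con (+ 1)) :* e := e :+ e) refl e′) e′+e′≡ ⟩
                  ε′ * q                     ≡⟨ *-comm ε′ q ⟩
                  q * ε′                     ∎)) (both (st≈0 e′ 0<e′) q≤t)
                where open ≤-Reasoning

  -- Equality to zero of a limit is stable under double negation: at each precision a single
  -- decidable comparison settles it, and the large alternative contradicts nullity.
  NullF-stable : ∀ {s : ℕ → F} → CauchyF s → ¬ ¬ NullF s → NullF s
  NullF-stable {s} cs s≈0 ε 0<ε = from (halve 0<ε)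
    where
    Goal : Set
    Goal = Eventually λ k → ‖ s k ‖ ≤ ε
    from : (∃[ e ] 0# < e × e + e ≡ ε) → Goal
    from (e , 0<e , e+e≡ε) = from₂ (halve 0<e)
      where
      from₂ : (∃[ q ] 0# < q × q + q ≡ e) → Goal
      from₂ (q , 0<q , q+q≡e) = centre (cs q 0<q)
        where
        q≤e : q ≤ e
        q≤e = by (nonNeg (<⇒≤ 0<q)) (trans (solve 1 (λ q → q := (q :+ q) :- q) refl q)
            (cong (λ x → x - q) q+q≡e))
        centre : (∃[ J ] ∀ m → ‖ s (J ℕ.+ m) -F s J ‖ ≤ q) → Goal
        centre (J , h) = decide (‖ s J ‖ ≤? e)
          where
          decide : Dec (‖ s J ‖ ≤ e) → Goal
          decide (yes g) = eventually J λ m → ≤-trans (‖‖≤+ (s (J ℕ.+ m)) (s J))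
              (≤-trans (+-mono-≤ g (≤-trans (h m) q≤e)) (≤-reflexive e+e≡ε))
          decide (no big) = contradiction (λ null → big (near (both (null q 0<q) (eventually J h)))) s≈0
            where
            near : Eventually (λ k → ‖ s k ‖ ≤ q × ‖ s k -F s J ‖ ≤ q) → ‖ s J ‖ ≤ e
            near (eventually I g) = ≤-trans (‖‖≤+′ (s (I ℕ.+ 0)) (s J))
                (≤-trans (+-mono-≤ (proj₁ (g 0)) (proj₂ (g 0))) (≤-reflexive q+q≡e))

  above-half : ∀ {a h} → h + h ≡ 1# → ∣ a - 1# ∣ < h → 0# + h < a
  above-half {a} {h} h+h≡1 small a≤h = small (≤-trans (by a≤h (trans
      (solve 2 (λ a h → (con (+ 0) :+ h) :- a := (h :+ h :- a) :- h) refl a h)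
      (trans (cong (λ o → (o - a) - h) h+h≡1)
          (solve 2 (λ a h → (con (+ 1) :- a) :- h := (:- (a :- con (+ 1))) :- h) refl a h))))
    (-a≤∣a∣ (a - 1#)))

-- Transfer between roots, integers and limits

module Bridge (K : OrderedField) where
  open import Data.Fin using (Fin; zero; suc)
  open import Data.Integer as ℤ using (ℤ; +_; -[1+_])
  import Data.Integer.Properties as ℤ
  open import Data.Nat as ℕ using (ℕ; zero; suc)
  open import Data.Product using (∃-syntax; _,_; proj₁; proj₂)
  open import Data.Vec using (Vec)
  open import Function using (_∘_)
  open import Relation.Binary.PropositionalEquality using (_≡_; _≢_; refl; sym; trans; cong; cong₂)
  open import Relation.Nullary using (Dec; contradiction)
  open import Relation.Nullary.Decidable using (_×-dec_)

  open Order K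
  open Gaussian K
  open Direction K using (_^F_)
  open Iterate K using (Root)
  open Concentrate K using (NearPositive; squeeze-0)
  open Sequences K
  open Poly ring using (evalM)
  open import Algebra.Properties.Semiring.Sum (CommutativeRing.semiring ring) using (sum)
  private
    module F = CommutativeRing ring
    module S = IntSolver ring

  near-positive? : ∀ δ z → Dec (NearPositive δ z)
  near-positive? δ z = (∣ im z ∣ ≤? δ) ×-dec ((- δ) ≤? (1# + re z))

  module _ {n} {p : Vec F n} {z₀ δ} (R : Root p z₀ δ) where
    open Root R

    Cauchy-re : Cauchy (λ k → 1# + re (zs k))
    Cauchy-re ε 0<ε = from (cauchy ε 0<ε)
      where
      from : (∃[ J ] ∀ m → ‖ zs (J ℕ.+ m) -F zs J ‖ ≤ ε) → ∃[ J ] ∀ m → ∣ (1# + re (zs (J ℕ.+ m))) -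
          (1# + re (zs J)) ∣ ≤ ε
      from (J , h) = J , λ m → ≤-trans (≤-reflexive
          (cong ∣_∣ (solve 2 (λ a b → (con (+ 1) :+ a) :- (con (+ 1) :+ b) := a :- b) refl (re
          (zs (J ℕ.+ m))) (re (zs J)))))
        (≤-trans (∣re∣≤‖‖ (zs (J ℕ.+ m) -F zs J)) (h m))

    Cauchy-im : Cauchy (λ k → im (zs k))
    Cauchy-im ε 0<ε = from (cauchy ε 0<ε)
      where
      from : (∃[ J ] ∀ m → ‖ zs (J ℕ.+ m) -F zs J ‖ ≤ ε) → ∃[ J ] ∀ m → ∣ im (zs (J ℕ.+ m)) - im (zs J)
          ∣ ≤ ε
      from (J , h) = J , λ m → ≤-trans (∣im∣≤‖‖ (zs (J ℕ.+ m) -F zs J)) (h m)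

    NullF-root : NullF (λ k → evalM p (zs k))
    NullF-root ε 0<ε = eventually (proj₁ (root ε 0<ε)) (proj₂ (root ε 0<ε))

    near-im : Null (λ k → im (zs k)) → ∣ im z₀ ∣ ≤ δ
    near-im h = by (nonNeg-* nonNeg-1 (squeeze-0 {∣ im z₀ ∣ - δ} 0≤1 λ ε 0<ε _ → from ε (h ε 0<ε)))
      (solve 2 (λ a d → con (+ 1) :* (con (+ 0) :- (a :- d)) := d :- a) refl ∣ im z₀ ∣ δ)
      where
      from : ∀ ε → Eventually (λ k → ∣ im (zs k) ∣ ≤ ε) → ∣ im z₀ ∣ - δ ≤ ε * 1#
      from ε (eventually J g) = by (nonNeg-+ (nonNeg-+ (g 0) (near k))
          (nonNeg-+ (∣im∣≤‖‖ (zs k -F z₀)) triangle))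
        (solve 6 (λ a d e x y w → ((e :- x) :+ (d :- y)) :+ ((y :- w) :+ ((x :+ w) :- a)) := e :* con
            (+ 1) :- (a :- d)) refl
          ∣ im z₀ ∣ δ ε (∣ im (zs k) ∣) (‖ zs k -F z₀ ‖) (∣ im (zs k -F z₀) ∣))
        where
        k : ℕ
        k = J ℕ.+ 0
        triangle : ∣ im z₀ ∣ ≤ ∣ im (zs k) ∣ + ∣ im (zs k -F z₀) ∣
        triangle = ≤-trans (≤-reflexive (cong ∣_∣ (solve 2 (λ a b → a := b :+ :- (b :+ :- a)) refl
            (im z₀) (im (zs k)))))
          (≤-trans (∣+∣ (im (zs k)) (- im (zs k -F z₀)))
              (+-mono-≤ ≤-refl (≤-reflexive (∣-∣ (im (zs k -F z₀))))))

    near-re : ∀ k → 0# ≤ 1# + re (zs k) → - δ ≤ 1# + re z₀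
    near-re k h = by (nonNeg-+ (nonNeg h)
        (nonNeg-+ (≤-trans (a≤∣a∣ (re (zs k -F z₀))) (∣re∣≤‖‖ (zs k -F z₀))) (near k)))
      (solve 4 (λ a b d y → (con (+ 1) :+ b) :+ ((y :- (b :+ :- a)) :+ (d :- y)) := (con
          (+ 1) :+ a) :- :- d) refl (re z₀) (re (zs k)) δ (‖ zs k -F z₀ ‖))

  constant-root : ∀ {n} {p : Vec F n} {z₀} → evalM p z₀ ≡ 0F → NullF (λ _ → evalM p z₀)
  constant-root e ε 0<ε = eventually 0 λ m → ≤-trans (≤-reflexive (trans (cong ‖_‖ e) ‖0‖)) (<⇒≤ 0<ε)

  integer : ℤ → F
  integer i = fromℤ i , 0#

  integer-+ : ∀ i j → integer (i ℤ.+ j) ≡ integer i +F integer j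
  integer-+ i j = cong₂ _,_ (fromℤ-+ i j) (sym (+-identityʳ 0#))

  integer-* : ∀ i j → integer (i ℤ.* j) ≡ integer i *F integer j
  integer-* i j = cong₂ _,_ (trans (fromℤ-* i j)
      (solve 2 (λ a b → a :* b := a :* b :- con (+ 0) :* con (+ 0)) refl (fromℤ i) (fromℤ j)))
    (solve 2 (λ a b → con (+ 0) := a :* con (+ 0) :+ con (+ 0) :* b) refl (fromℤ i) (fromℤ j))

  integer-neg : ∀ i → integer (ℤ.- i) ≡ -F integer i
  integer-neg i = cong₂ _,_ (fromℤ-neg i) (solve 0 (con (+ 0) := :- con (+ 0)) refl)

  integer-^ : ∀ s n → integer s ^F n ≡ integer (s ℤ.^ n)
  integer-^ s zero    = refl
  integer-^ s (suc n) = trans (cong (integer s *F_) (integer-^ s n)) (sym (integer-* s (s ℤ.^ n)))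

  fromℤ≡0 : ∀ i → fromℤ i ≡ 0# → i ≡ + 0
  fromℤ≡0 (+ zero)  e = refl
  fromℤ≡0 (+ suc n) e = contradiction e (<⇒≢ (0<fromℤ-suc n))
  fromℤ≡0 -[1+ n ]  e = contradiction (trans (solve 1 (λ a → a := :- (:- a)) refl (fromℤ (+ suc n)))
    (trans (cong (λ x → - x) e) (solve 0 (:- con (+ 0) := con (+ 0)) refl))) (<⇒≢ (0<fromℤ-suc n))

  integer-injective : ∀ i j → integer i ≡ integer j → i ≡ j
  integer-injective i j e = ℤ.i-j≡0⇒i≡j i j (fromℤ≡0 (i ℤ.- j) (trans (cong proj₁ (integer-+ i (ℤ.- j)))
    (trans (cong (λ x → fromℤ i + x) (fromℤ-neg j))
        (trans (cong (_- fromℤ j) (cong proj₁ e))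
        (solve 1 (λ a → a :- a := con (+ 0)) refl (fromℤ j))))))

  1≤‖integer‖ : ∀ i → i ≢ + 0 → 1# ≤ ‖ integer i ‖
  1≤‖integer‖ i i≢0 = ≤-trans (bound i i≢0) (∣re∣≤‖‖ (integer i))
    where
    positive : ∀ n → 1# ≤ fromℤ (+ suc n)
    positive n = by (nonNeg (fromℤ-nonNeg n))
        (trans (solve 1 (λ a → a := (con (+ 1) :+ a) :- con (+ 1)) refl (fromℤ (+ n)))
      (cong (_- 1#) (sym (fromℤ-suc n))))
    bound : ∀ i → i ≢ + 0 → 1# ≤ ∣ fromℤ i ∣
    bound (+ zero)  h = contradiction refl h
    bound (+ suc n) h = ≤-trans (positive n) (a≤∣a∣ (fromℤ (+ suc n)))
    bound -[1+ n ]  h = ≤-trans (positive n)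
        (≤-trans (a≤∣a∣ (fromℤ (+ suc n))) (≤-reflexive (sym (∣-∣ (fromℤ (+ suc n))))))

  -- The entries of (1 + z) I - A and z I - (A - I), which identify the eigenvalue 1 + z of A with
  -- the root z.
  shift-entry : ∀ a d z → (-F a) +F (1F +F z) *F d ≡ (-F (a -F d)) +F z *F d
  shift-entry = S.solve 3 (λ a d z → (S.:- a) S.:+ (S.con (+ 1) S.:+ z) S.:* d S.:= (S.:- (a S.:- d))
      S.:+ z S.:* d) refl

  re-sum≤0 : ∀ {n} (f : Fin n → F) → (∀ i → re (f i) ≤ 0#) → re (sum f) ≤ 0#
  re-sum≤0 {zero}  f h = ≤-refl
  re-sum≤0 {suc n} f h = ≤-trans (+-mono-≤ (h zero) (re-sum≤0 (f ∘ suc) (h ∘ suc)))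
      (≤-reflexive (+-identityʳ 0#))

  re-sum≡0 : ∀ {n} (f : Fin n → F) → (∀ i → re (f i) ≤ 0#) → 0# ≤ re (sum f) → ∀ i → re (f i) ≡ 0#
  re-sum≡0 {suc n} f h s zero = ≤-antisym (h zero)
      (≤-trans s (≤-trans (+-mono-≤ ≤-refl (re-sum≤0 (f ∘ suc) (h ∘ suc))) (≤-reflexive
      (+-identityʳ _))))
  re-sum≡0 {suc n} f h s (suc i) = re-sum≡0 (f ∘ suc) (h ∘ suc)
      (≤-trans s (≤-trans (+-mono-≤ (h zero) ≤-refl) (≤-reflexive (+-identityˡ _)))) i

  neg-nonNeg : ∀ z → re z ≤ 0# → 0# ≤ re (-F z)
  neg-nonNeg (a , _) h = by h (solve 1 (λ a → con (+ 0) :- a := :- a :- con (+ 0)) refl a)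

-- The rationals as an ordered field

module Real where
  open import Data.Integer as ℤ using (ℤ; +_; -[1+_])
  import Data.Integer.Properties as ℤ
  open import Data.Nat as ℕ using (ℕ; zero; suc)
  import Data.Nat.Properties as ℕ
  import Data.Nat.Coprimality as Coprime
  open import Data.Product using (∃-syntax; _,_)
  open import Data.Rational as ℚ using (ℚ; 0ℚ; 1ℚ; mkℚ)
  import Data.Rational.Properties as ℚ
  open import Data.Sum using (_⊎_; inj₁; inj₂)
  open import Relation.Binary.PropositionalEquality using (_≡_; _≢_; refl; sym; trans; cong; subst)
  open import Defs

  0≤b-a : ∀ {a b} → a ℚ.≤ b → 0ℚ ℚ.≤ b ℚ.- a
  0≤b-a {a} {b} h = subst (ℚ._≤ b ℚ.- a) (ℚ.+-inverseʳ a) (ℚ.+-monoˡ-≤ (ℚ.- a) h)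

  a≤b : ∀ {a b} → 0ℚ ℚ.≤ b ℚ.- a → a ℚ.≤ b
  a≤b {a} {b} h = ℚ.≤-trans (ℚ.≤-reflexive (sym (ℚ.+-identityˡ a))) (ℚ.≤-trans (ℚ.+-monoˡ-≤ a h)
    (ℚ.≤-reflexive (trans (ℚ.+-assoc b (ℚ.- a) a) (trans (cong (b ℚ.+_) (ℚ.+-inverseˡ a))
        (ℚ.+-identityʳ b)))))

  integerℚ : ℕ → ℚ
  integerℚ n = mkℚ (+ n) 0 (Coprime.sym (Coprime.1-coprimeTo n))

  fromℤ≡ : ∀ n → IntSolver.fromℤ ℚ.+-*-commutativeRing (+ n) ≡ integerℚ n
  fromℤ≡ zero    = refl
  fromℤ≡ (suc n) = trans (IntSolver.fromℤ-+ ℚ.+-*-commutativeRing (+ 1) (+ n))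
      (trans (cong (1ℚ ℚ.+_) (fromℤ≡ n))
    (trans (cong (λ i → (+ 1 ℤ.+ i) ℚ./ 1) (ℤ.*-identityʳ (+ n))) (ℚ.↥p/↧p≡p (integerℚ (suc n)))))

  private
    total : ∀ a → 0ℚ ℚ.≤ a ⊎ 0ℚ ℚ.≤ ℚ.- a
    total a with ℚ.≤-total 0ℚ a
    ... | inj₁ h = inj₁ h
    ... | inj₂ h = inj₂ (ℚ.neg-antimono-≤ h)

    antisym : ∀ {a} → 0ℚ ℚ.≤ a → 0ℚ ℚ.≤ ℚ.- a → a ≡ 0ℚ
    antisym {a} h k = ℚ.≤-antisym (subst (ℚ._≤ 0ℚ) (neg-neg a) (ℚ.neg-antimono-≤ k)) h
      where
      neg-neg : ∀ a → ℚ.- (ℚ.- a) ≡ a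
      neg-neg (mkℚ (+ zero) _ _)  = refl
      neg-neg (mkℚ ℤ.+[1+ n ] _ _) = refl
      neg-neg (mkℚ -[1+ n ] _ _)  = refl

    inverse : ∀ a → a ≢ 0ℚ → ∃[ b ] a ℚ.* b ≡ 1ℚ
    inverse a a≢0 = ℚ.1/_ a {{ℚ.≢-nonZero a≢0}} , ℚ.*-inverseʳ a {{ℚ.≢-nonZero a≢0}}

    archimedean : ∀ a → ∃[ n ] 0ℚ ℚ.≤ IntSolver.fromℤ ℚ.+-*-commutativeRing (+ n) ℚ.- a
    -- The denominator is at least 1, so the absolute value of the numerator is a bound.
    archimedean a@(mkℚ p d _) = ℤ.∣ p ∣ , 0≤b-a
        (ℚ.≤-trans (ℚ.*≤* {a} {integerℚ ℤ.∣ p ∣} (ℤ.≤-trans (ℤ.≤-reflexive (ℤ.*-identityʳ p))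
        (bound p)))
        (ℚ.≤-reflexive (sym (fromℤ≡ ℤ.∣ p ∣))))
      where
      bound : ∀ p → p ℤ.≤ + ℤ.∣ p ∣ ℤ.* + suc d
      bound (+ n)    = ℤ.≤-trans (ℤ.+≤+ (ℕ.m≤m*n n (suc d))) (ℤ.≤-reflexive (ℤ.pos-* n (suc d)))
      bound -[1+ n ] = ℤ.-≤+

  ℚ-field : OrderedField
  ℚ-field = record
    { isCommutativeRing = ℚ.+-*-isCommutativeRing
    ; NonNeg            = 0ℚ ℚ.≤_
    ; nonNeg?           = 0ℚ ℚ.≤?_
    ; nonNeg-total      = total
    ; nonNeg-antisym    = antisym
    ; nonNeg-+          = λ {a} {b} h k → ℚ.+-mono-≤ h k
    ; nonNeg-*          = λ {a} {b} h k → subst (ℚ._≤ a ℚ.* b) (ℚ.*-zeroˡ b)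
        (ℚ.*-monoʳ-≤-nonNeg b {{ℚ.nonNegative k}} h)
    ; inverse           = inverse
    ; 1≢0               = λ ()
    ; archimedean       = archimedean }

-- The rings of real and complex numbers

module Complex where
  open import Data.Integer as ℤ using (ℤ)
  open import Data.Nat as ℕ using (ℕ)
  import Data.Nat.Properties as ℕ
  open import Data.Product using (∃-syntax; _×_; _,_)
  open import Data.Rational as ℚ using (ℚ; 0ℚ; 1ℚ)
  import Data.Rational.Properties as ℚ
  open import Data.Sum using (inj₁; inj₂)
  open import Level using (0ℓ)
  open import Relation.Binary.PropositionalEquality using (_≡_; refl; sym; trans; subst)
  open import Relation.Nullary using (¬_)
  open import Defs
  open Real
  open Sequences ℚ-field

  module K = Order ℚ-field
  module G = Gaussian ℚ-field

  K≤⇒≤ : ∀ {a b} → a K.≤ b → a ℚ.≤ b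
  K≤⇒≤ = a≤b

  ≤⇒K≤ : ∀ {a b} → a ℚ.≤ b → a K.≤ b
  ≤⇒K≤ = 0≤b-a

  K<⇒< : ∀ {a b} → a K.< b → a ℚ.< b
  K<⇒< a<b = ℚ.≰⇒> λ b≤a → a<b (≤⇒K≤ b≤a)

  <⇒K< : ∀ {a b} → a ℚ.< b → a K.< b
  <⇒K< a<b b≤a = ℚ.<-irrefl refl (ℚ.<-≤-trans a<b (K≤⇒≤ b≤a))

  ∣∣≡ : ∀ a → K.∣ a ∣ ≡ ℚ.∣ a ∣
  ∣∣≡ a with K.∣∣-cases a
  ... | inj₁ (h , e) = trans e (sym (ℚ.0≤p⇒∣p∣≡p h))
  ... | inj₂ (h , e) = trans e (trans (sym (ℚ.0≤p⇒∣p∣≡p h)) (ℚ.∣-p∣≡∣p∣ a))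

  ≈⇒Null : ∀ {x y} → x ≈ᴿ y → Null λ k → seq x k K.- seq y k
  ≈⇒Null {x} {y} h = Null′⇒Null {λ k → seq x k K.- seq y k} λ ε 0<ε → from ε (h ε (K<⇒< 0<ε))
    where
    from : ∀ ε → (∃[ N ] ∀ n → N ℕ.≤ n → ℚ.∣ seq x n ℚ.- seq y n ∣ ℚ.< ε) → ∃[ N ] ∀ n → N ℕ.≤ n → K.∣
        seq x n K.- seq y n ∣ K.< ε
    from ε (N , g) = N , λ n N≤n → <⇒K< (subst (ℚ._< ε) (sym (∣∣≡ (seq x n ℚ.- seq y n))) (g n N≤n))

  Null⇒≈ : ∀ {x y} → Null (λ k → seq x k K.- seq y k) → x ≈ᴿ y
  Null⇒≈ {x} {y} h ε 0<ε = from (Null⇒Null′ {λ k → seq x k K.- seq y k} h ε (<⇒K< 0<ε))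
    where
    from : (∃[ N ] ∀ n → N ℕ.≤ n → K.∣ seq x n K.- seq y n ∣ K.< ε) → ∃[ N ] ∀ n → N ℕ.≤ n → ℚ.∣ seq x n
        ℚ.- seq y n ∣ ℚ.< ε
    from (N , g) = N , λ n N≤n → subst (ℚ._< ε) (∣∣≡ (seq x n ℚ.- seq y n)) (K<⇒< (g n N≤n))

  IsCauchy⇒Cauchy : ∀ x → Cauchy (seq x)
  IsCauchy⇒Cauchy x = Cauchy′⇒Cauchy {seq x} λ ε 0<ε → from ε (cauchy x ε (K<⇒< 0<ε))
    where
    from : ∀ ε → (∃[ N ] ∀ m n → N ℕ.≤ m → N ℕ.≤ n → ℚ.∣ seq x m ℚ.- seq x n ∣ ℚ.< ε) →
           ∃[ N ] ∀ m n → N ℕ.≤ m → N ℕ.≤ n → K.∣ seq x m K.- seq x n ∣ K.< ε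
    from ε (N , g) = N , λ m n N≤m N≤n → <⇒K<
        (subst (ℚ._< ε) (sym (∣∣≡ (seq x m ℚ.- seq x n))) (g m n N≤m N≤n))

  Cauchy⇒IsCauchy : ∀ {s} → Cauchy s → IsCauchy s
  Cauchy⇒IsCauchy {s} h ε 0<ε = from (Cauchy⇒Cauchy′ {s} h ε (<⇒K< 0<ε))
    where
    from : (∃[ N ] ∀ m n → N ℕ.≤ m → N ℕ.≤ n → K.∣ s m K.- s n ∣ K.< ε) →
           ∃[ N ] ∀ m n → N ℕ.≤ m → N ℕ.≤ n → ℚ.∣ s m ℚ.- s n ∣ ℚ.< ε
    from (N , g) = N , λ m n N≤m N≤n → subst (ℚ._< ε) (∣∣≡ (s m ℚ.- s n)) (K<⇒< (g m n N≤m N≤n))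

  -- Operations act termwise, so the laws of ℚ hold exactly at every term; this supplies the ring
  -- axioms other than the congruences.
  pointwise : ∀ {x y} → (∀ k → seq x k ≡ seq y k) → x ≈ᴿ y
  pointwise {x} {y} h = Null⇒≈ {x} {y} (Null-minus-refl {seq x} {seq y} h)

  ≈ᴿ-sym : ∀ {x y} → x ≈ᴿ y → y ≈ᴿ x
  ≈ᴿ-sym {x} {y} h = Null⇒≈ {y} {x} (Null-minus-sym {seq x} {seq y} (≈⇒Null {x} {y} h))

  ≈ᴿ-trans : ∀ {x y z} → x ≈ᴿ y → y ≈ᴿ z → x ≈ᴿ z
  ≈ᴿ-trans {x} {y} {z} h k = Null⇒≈ {x} {z}
      (Null-minus-trans {seq x} {seq y} {seq z} (≈⇒Null {x} {y} h) (≈⇒Null {y} {z} k))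

  +ᴿ-cong : ∀ {x y u v} → x ≈ᴿ y → u ≈ᴿ v → x +ᴿ u ≈ᴿ y +ᴿ v
  +ᴿ-cong {x} {y} {u} {v} h k = Null⇒≈ {x +ᴿ u} {y +ᴿ v}
    (Null-minus-+ {seq x} {seq y} {seq u} {seq v} (≈⇒Null {x} {y} h) (≈⇒Null {u} {v} k))

  -ᴿ-cong : ∀ {x y} → x ≈ᴿ y → -ᴿ x ≈ᴿ -ᴿ y
  -ᴿ-cong {x} {y} h = Null⇒≈ { -ᴿ x} { -ᴿ y} (Null-minus-neg {seq x} {seq y} (≈⇒Null {x} {y} h))

  *ᴿ-cong : ∀ {x y u v} → x ≈ᴿ y → u ≈ᴿ v → x *ᴿ u ≈ᴿ y *ᴿ v
  *ᴿ-cong {x} {y} {u} {v} h k = Null⇒≈ {x *ᴿ u} {y *ᴿ v}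
    (Null-minus-* {seq x} {seq y} {seq u} {seq v} (IsCauchy⇒Cauchy x) (IsCauchy⇒Cauchy v)
        (≈⇒Null {x} {y} h) (≈⇒Null {u} {v} k))

  1ᴿ : ℝ
  1ᴿ = fromℚ 1ℚ

  ℝ-ring : CommutativeRing 0ℓ 0ℓ
  ℝ-ring = record
    { Carrier = ℝ ; _≈_ = _≈ᴿ_ ; _+_ = _+ᴿ_ ; _*_ = _*ᴿ_ ; -_ = -ᴿ_ ; 0# = 0ᴿ ; 1# = 1ᴿ
    ; isCommutativeRing = record
      { isRing = record
        { +-isAbelianGroup = record
          { isGroup = record
            { isMonoid = record
              { isSemigroup = record
                { isMagma = record
                  { isEquivalence = record
                    { refl  = λ {x} → pointwise {x} {x} λ _ → refl
                    ; sym   = λ {x} {y} → ≈ᴿ-sym {x} {y}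
                    ; trans = λ {x} {y} {z} → ≈ᴿ-trans {x} {y} {z} }
                  ; ∙-cong = λ {x} {y} {u} {v} → +ᴿ-cong {x} {y} {u} {v} }
                ; assoc = λ x y z → pointwise {(x +ᴿ y) +ᴿ z} {x +ᴿ (y +ᴿ z)} λ k → ℚ.+-assoc (seq x k)
                    (seq y k) (seq z k) }
              ; identity = (λ x → pointwise {0ᴿ +ᴿ x} {x} λ k → ℚ.+-identityˡ (seq x k))
                         , (λ x → pointwise {x +ᴿ 0ᴿ} {x} λ k → ℚ.+-identityʳ (seq x k)) }
            ; inverse = (λ x → pointwise { (-ᴿ x) +ᴿ x} {0ᴿ} λ k → ℚ.+-inverseˡ (seq x k))
                      , (λ x → pointwise {x +ᴿ (-ᴿ x)} {0ᴿ} λ k → ℚ.+-inverseʳ (seq x k))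
            ; ⁻¹-cong = λ {x} {y} → -ᴿ-cong {x} {y} }
          ; comm = λ x y → pointwise {x +ᴿ y} {y +ᴿ x} λ k → ℚ.+-comm (seq x k) (seq y k) }
        ; *-cong = λ {x} {y} {u} {v} → *ᴿ-cong {x} {y} {u} {v}
        ; *-assoc = λ x y z → pointwise {(x *ᴿ y) *ᴿ z} {x *ᴿ (y *ᴿ z)} λ k → ℚ.*-assoc (seq x k)
            (seq y k) (seq z k)
        ; *-identity = (λ x → pointwise {1ᴿ *ᴿ x} {x} λ k → ℚ.*-identityˡ (seq x k))
                     , (λ x → pointwise {x *ᴿ 1ᴿ} {x} λ k → ℚ.*-identityʳ (seq x k))
        ; distrib = (λ x y z → pointwise {x *ᴿ (y +ᴿ z)} {x *ᴿ y +ᴿ x *ᴿ z} λ k → ℚ.*-distribˡ-+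
            (seq x k) (seq y k) (seq z k))
                  , (λ x y z → pointwise {(y +ᴿ z) *ᴿ x} {y *ᴿ x +ᴿ z *ᴿ x} λ k → ℚ.*-distribʳ-+
                      (seq x k) (seq y k) (seq z k)) }
      ; *-comm = λ x y → pointwise {x *ᴿ y} {y *ᴿ x} λ k → ℚ.*-comm (seq x k) (seq y k) } }

  private
    module ℝr = CommutativeRing ℝ-ring

  -ᶜ_ : ℂ → ℂ
  -ᶜ z = (-ᴿ re z) +i (-ᴿ im z)

  1ᶜ : ℂ
  1ᶜ = 1ᴿ +i 0ᴿ

  private
    open ComplexLaws ℝ-ring using (⊗-assoc; ⊗-comm; ⊗-identityˡ; ⊗-distribˡ)
    pair : ℂ → ℝ × ℝ
    pair z = re z , im z

    ≈ᶜ-trans : ∀ {z w v} → z ≈ᶜ w → w ≈ᶜ v → z ≈ᶜ v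
    ≈ᶜ-trans {z} {w} {v} (a , b) (c , d) = ℝr.trans {re z} {re w} {re v} a c , ℝr.trans {im z} {im w}
        {im v} b d

    +ᶜ-cong : ∀ {z w u v} → z ≈ᶜ w → u ≈ᶜ v → z +ᶜ u ≈ᶜ w +ᶜ v
    +ᶜ-cong {z} {w} {u} {v} (a , b) (c , d) = +ᴿ-cong {re z} {re w} {re u} {re v} a c , +ᴿ-cong {im z}
        {im w} {im u} {im v} b d

    *ᶜ-comm : ∀ z w → z *ᶜ w ≈ᶜ w *ᶜ z
    *ᶜ-comm z w = ⊗-comm (pair z) (pair w)

    *ᶜ-identityˡ : ∀ z → 1ᶜ *ᶜ z ≈ᶜ z
    *ᶜ-identityˡ z = ⊗-identityˡ (pair z)

    *ᶜ-distribˡ : ∀ x y z → x *ᶜ (y +ᶜ z) ≈ᶜ x *ᶜ y +ᶜ x *ᶜ z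
    *ᶜ-distribˡ x y z = ⊗-distribˡ (pair x) (pair y) (pair z)

    *ᶜ-cong : ∀ {z w u v} → z ≈ᶜ w → u ≈ᶜ v → z *ᶜ u ≈ᶜ w *ᶜ v
    *ᶜ-cong {z} {w} {u} {v} (a , b) (c , d) =
        +ᴿ-cong {re z *ᴿ re u} {re w *ᴿ re v} { -ᴿ (im z *ᴿ im u)} { -ᴿ (im w *ᴿ im v)}
            (*ᴿ-cong {re z} {re w} {re u} {re v} a c)
          (-ᴿ-cong {im z *ᴿ im u} {im w *ᴿ im v} (*ᴿ-cong {im z} {im w} {im u} {im v} b d))
      , +ᴿ-cong {re z *ᴿ im u} {re w *ᴿ im v} {im z *ᴿ re u} {im w *ᴿ re v}
          (*ᴿ-cong {re z} {re w} {im u} {im v} a d)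
          (*ᴿ-cong {im z} {im w} {re u} {re v} b c)

  ℂ-ring : CommutativeRing 0ℓ 0ℓ
  ℂ-ring = record
    { Carrier = ℂ ; _≈_ = _≈ᶜ_ ; _+_ = _+ᶜ_ ; _*_ = _*ᶜ_ ; -_ = -ᶜ_ ; 0# = 0ᶜ ; 1# = 1ᶜ
    ; isCommutativeRing = record
      { isRing = record
        { +-isAbelianGroup = record
          { isGroup = record
            { isMonoid = record
              { isSemigroup = record
                { isMagma = record
                  { isEquivalence = record
                    { refl  = λ {z} → ℝr.refl {re z} , ℝr.refl {im z}
                    ; sym   = λ {z} {w} (a , b) → ℝr.sym {re z} {re w} a , ℝr.sym {im z} {im w} b
                    ; trans = λ {z} {w} {v} → ≈ᶜ-trans {z} {w} {v} }
                  ; ∙-cong = λ {z} {w} {u} {v} → +ᶜ-cong {z} {w} {u} {v} }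
                ; assoc = λ x y z → ℝr.+-assoc (re x) (re y) (re z) , ℝr.+-assoc (im x) (im y) (im z) }
              ; identity = (λ z → ℝr.+-identityˡ (re z) , ℝr.+-identityˡ (im z))
                         , (λ z → ℝr.+-identityʳ (re z) , ℝr.+-identityʳ (im z)) }
            ; inverse = (λ z → ℝr.-‿inverseˡ (re z) , ℝr.-‿inverseˡ (im z))
                      , (λ z → ℝr.-‿inverseʳ (re z) , ℝr.-‿inverseʳ (im z))
            ; ⁻¹-cong = λ {z} {w} (a , b) → -ᴿ-cong {re z} {re w} a , -ᴿ-cong {im z} {im w} b }
          ; comm = λ z w → ℝr.+-comm (re z) (re w) , ℝr.+-comm (im z) (im w) }
        ; *-cong = λ {z} {w} {u} {v} → *ᶜ-cong {z} {w} {u} {v}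
        ; *-assoc = λ x y z → ⊗-assoc (pair x) (pair y) (pair z)
        ; *-identity = *ᶜ-identityˡ , λ z → ≈ᶜ-trans {z *ᶜ 1ᶜ} {1ᶜ *ᶜ z} {z} (*ᶜ-comm z 1ᶜ)
            (*ᶜ-identityˡ z)
        ; distrib = *ᶜ-distribˡ , λ x y z → ≈ᶜ-trans {(y +ᶜ z) *ᶜ x} {x *ᶜ (y +ᶜ z)} {y *ᶜ x +ᶜ z *ᶜ x}
            (*ᶜ-comm (y +ᶜ z) x)
            (≈ᶜ-trans {x *ᶜ (y +ᶜ z)} {x *ᶜ y +ᶜ x *ᶜ z} {y *ᶜ x +ᶜ z *ᶜ x} (*ᶜ-distribˡ x y z)
              (+ᶜ-cong {x *ᶜ y} {y *ᶜ x} {x *ᶜ z} {z *ᶜ x} (*ᶜ-comm x y) (*ᶜ-comm x z))) }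
      ; *-comm = *ᶜ-comm } }

  -- Operations of ℂ act on the terms of the underlying sequences of Gaussian rationals.
  at : ℂ → ℕ → G.F
  at z k = seq (re z) k , seq (im z) k

  private
    minus-0 : ∀ {x} → x ≈ᴿ 0ᴿ → Null (seq x)
    minus-0 {x} h = Null-resp {λ k → seq x k K.- 0ℚ} {seq x} (λ k → ℚ.+-identityʳ (seq x k))
        (≈⇒Null {x} {0ᴿ} h)

    minus-0⁻ : ∀ {x} → Null (seq x) → x ≈ᴿ 0ᴿ
    minus-0⁻ {x} h = Null⇒≈ {x} {0ᴿ} (Null-resp {seq x} {λ k → seq x k K.- 0ℚ}
        (λ k → sym (ℚ.+-identityʳ (seq x k))) h)

  ≈0⇒NullF : ∀ {z} → z ≈ᶜ 0ᶜ → NullF (at z)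
  ≈0⇒NullF {z} (a , b) = Null⇒NullF {at z} (minus-0 {re z} a) (minus-0 {im z} b)

  NullF⇒≈0 : ∀ {z} → NullF (at z) → z ≈ᶜ 0ᶜ
  NullF⇒≈0 {z} h = minus-0⁻ {re z} (NullF⇒Null-re {at z} h) , minus-0⁻ {im z} (NullF⇒Null-im {at z} h)

  at-Cauchy : ∀ z → CauchyF (at z)
  at-Cauchy z = Cauchy⇒CauchyF {at z} (IsCauchy⇒Cauchy (re z)) (IsCauchy⇒Cauchy (im z))

  *ᶜ-cancel : ∀ {z w} → ¬ z ≈ᶜ 0ᶜ → z *ᶜ w ≈ᶜ 0ᶜ → w ≈ᶜ 0ᶜ
  *ᶜ-cancel {z} {w} z≉0 zw≈0 = NullF⇒≈0 {w}
      (NullF-cancel {at z} {at w} (at-Cauchy w) (λ h → z≉0 (NullF⇒≈0 {z} h)) (≈0⇒NullF {z *ᶜ w} zw≈0))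

  1ᶜ≉0 : ¬ 1ᶜ ≈ᶜ 0ᶜ
  1ᶜ≉0 (h , _) = from (h ℚ.½ (ℚ.*<* (ℤ.+<+ (ℕ.s≤s ℕ.z≤n))))
    where
    from : ¬ (∃[ N ] ∀ n → N ℕ.≤ n → ℚ.∣ 1ℚ ℚ.- 0ℚ ∣ ℚ.< ℚ.½)
    from (N , g) with g N ℕ.≤-refl
    ... | ℚ.*<* (ℤ.+<+ (ℕ.s≤s ()))

-- The spectrum of a 0-1 matrix

module Spectral where
  open import Data.Fin using (Fin; zero; suc; toℕ)
  open import Data.Integer as ℤ using (ℤ; +_)
  import Data.Integer.Properties as ℤ
  open import Data.Nat as ℕ using (ℕ; zero; suc)
  open import Data.Product using (∃-syntax; _×_; _,_; proj₁; proj₂)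
  open import Data.Rational as ℚ using (ℚ; 0ℚ; 1ℚ)
  import Data.Rational.Properties as ℚ
  open import Data.Vec using (Vec; lookup)
  open import Relation.Binary.PropositionalEquality using (_≡_; _≢_; refl; sym; trans; cong; cong₂; subst)
  open import Relation.Nullary using (¬_)
  open import Relation.Nullary.Decidable using (decidable-stable)
  open import Defs
  open Real
  open Complex
  open Sequences ℚ-field
  open Iterate ℚ-field using (Root)
  open Concentrate ℚ-field using (NearPositive; Positive-roots; -1F; power; traceless)
  open Bridge ℚ-field

  ℤ-ring : CommutativeRing _ _
  ℤ-ring = ℤ.+-*-commutativeRing

  module PF = Poly G.ring
  module Pℂ = Poly ℂ-ring
  module Pℤ = Poly ℤ-ring
  module DF = Det G.ring
  module Dℂ = Det ℂ-ring
  module Dℤ = Det ℤ-ring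
  private
    module F = CommutativeRing G.ring
    module C = CommutativeRing ℂ-ring

  -- Termwise operations make the k-th term of a determinant over ℂ literally a determinant of
  -- Gaussian rationals.
  det-at : ∀ {n} (M : Dℂ.Matrix n n) k → at (Dℂ.det M) k ≡ DF.det (λ i j → at (M i j) k)
  det-at M k = DetHom.det-homo {A = ℂ-ring} {B = G.ring} at-k M
    where
    at-k : DetHom.RawHomomorphism ℂ-ring G.ring
    at-k = record { φ = λ z → at z k ; φ-+ = λ _ _ → refl ; φ-* = λ _ _ → refl ; φ-neg = λ _ → refl ; φ-0 = refl ; φ-1 = refl }

  det-integer : ∀ {n} (M : Dℤ.Matrix n n) → integer (Dℤ.det M) ≡ DF.det (λ i j → integer (M i j))
  det-integer = DetHom.det-homo {A = ℤ-ring} {B = G.ring} embedding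
    where
    embedding : DetHom.RawHomomorphism ℤ-ring G.ring
    embedding = record { φ = integer ; φ-+ = integer-+ ; φ-* = integer-* ; φ-neg = integer-neg ; φ-0 = refl ; φ-1 = refl }

  integer-δ : ∀ {n} (i j : Fin n) → integer (Dℤ.δ i j) ≡ DF.δ i j
  integer-δ zero    zero    = refl
  integer-δ zero    (suc j) = refl
  integer-δ (suc i) zero    = refl
  integer-δ (suc i) (suc j) = integer-δ i j

  at-δ : ∀ {n} (i j : Fin n) k → at (Dℂ.δ i j) k ≡ DF.δ i j
  at-δ zero    zero    k = refl
  at-δ zero    (suc j) k = refl
  at-δ (suc i) zero    k = refl
  at-δ (suc i) (suc j) k = at-δ i j k

  entry : ∀ {n} → Matrix01 n → Fin n → Fin n → ℤ
  entry A i j = + toℕ (lookup (lookup A i) j)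

  at-complexify : ∀ {n} (A : Matrix01 n) i j k → at (complexify A i j) k ≡ integer (entry A i j)
  at-complexify A i j k = cong (_, 0ℚ)
      (trans (ℚ.↥p/↧p≡p (integerℚ (toℕ (lookup (lookup A i) j))))
      (sym (fromℤ≡ (toℕ (lookup (lookup A i) j)))))

  module _ {n} (A : Matrix01 n) where
    shifted : Dℤ.Matrix n n
    shifted i j = entry A i j ℤ.- Dℤ.δ i j

    shiftedF : DF.Matrix n n
    shiftedF i j = integer (entry A i j) G.-F DF.δ i j

    shifted≡ : ∀ i j → integer (shifted i j) ≡ shiftedF i j
    shifted≡ i j = trans (integer-+ (entry A i j) (ℤ.- Dℤ.δ i j))
      (cong (integer (entry A i j) G.+F_) (trans (integer-neg (Dℤ.δ i j)) (cong G.-F_ (integer-δ i j))))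

    det-char-integer : ∀ s → integer (Dℤ.det (Pℤ.char shifted s)) ≡ DF.det
        (PF.char shiftedF (integer s))
    det-char-integer s = trans (det-integer (Pℤ.char shifted s)) (DF.det-cong λ i j →
      trans (integer-+ (ℤ.- shifted i j) (s ℤ.* Dℤ.δ i j))
        (cong₂ G._+F_ (trans (integer-neg (shifted i j)) (cong G.-F_ (shifted≡ i j)))
          (trans (integer-* s (Dℤ.δ i j)) (cong (integer s G.*F_) (integer-δ i j)))))

    p : Vec G.F n
    p = proj₁ (PF.charPoly shiftedF)

    p≡det : ∀ z → PF.evalM p z ≡ DF.det (PF.char shiftedF z)
    p≡det = proj₁ (proj₂ (PF.charPoly shiftedF))

    -- If the terms of μ are 1 + z_k, those of det (μ I - A) are p(z_k). A sequence of approximate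
    -- roots of p thus becomes an exact root of the characteristic polynomial of A.
    char-limit : ∀ μ z k → at μ k ≡ G.1F G.+F z → at (Dℂ.det (Pℂ.char (complexify A) μ)) k ≡ PF.evalM p
        z
    char-limit μ z k e = trans (det-at (Pℂ.char (complexify A) μ) k)
        (trans (DF.det-cong step) (sym (p≡det z)))
      where
      step : ∀ i j → (G.-F at (complexify A i j) k) G.+F at μ k G.*F at (Dℂ.δ i j) k ≡ PF.char shiftedF
          z i j
      step i j = trans (cong₂ (λ a m → (G.-F a) G.+F m G.*F at (Dℂ.δ i j) k) (at-complexify A i j k) e)
        (trans (cong (λ d → (G.-F integer (entry A i j)) G.+F (G.1F G.+F z) G.*F d) (at-δ i j k))
          (shift-entry (integer (entry A i j)) (DF.δ i j) z))

    eigenvalue : ∀ μ → Dℂ.Singular (Pℂ.char (complexify A) μ) → IsEigenvalue (complexify A) μ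
    eigenvalue μ (v , v≉0 , kernel) = v , v≉0 , λ i → Pℂ.char-kernel⇒eigen (complexify A) μ v i
        (kernel i)

    module _ (H : AllEigenvaluesPositive (complexify A)) where

      -- The only place where the hypothesis on the eigenvalues is applied. The eigenvector comes
      -- from a vanishing determinant and exists under double negation, which the conclusion
      -- inherits.
      limit-positive : ∀ μ (zs : ℕ → G.F) → (∀ k → at μ k ≡ G.1F G.+F zs k) → NullF
          (λ k → PF.evalM p (zs k)) → ¬ ¬ IsPositiveReal μ
      limit-positive μ zs e h ¬pos = Dℂ.det≈0⇒singular (λ {z} {w} → *ᶜ-cancel {z} {w}) 1ᶜ≉0 M det≈0 λ s
          → ¬pos (H μ (eigenvalue μ s))
        where
        M : Dℂ.Matrix n n
        M = Pℂ.char (complexify A) μ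
        det≈0 : Dℂ.det M ≈ᶜ 0ᶜ
        det≈0 = NullF⇒≈0 {Dℂ.det M} λ ε 0<ε → map-eventually
            (λ k g → subst (λ z → G.‖ z ‖ K.≤ ε) (sym (char-limit μ (zs k) k (e k))) g) (h ε 0<ε)

      positive-roots : Positive-roots p
      positive-roots z₀ δ R = decidable-stable (near-positive? δ z₀) λ ¬near →
        limit-positive μ zs at-μ (NullF-root R) λ pos → ¬near (near-positive pos)
        where
        open Root R
        μ : ℂ
        μ = mkℝ (λ k → 1ℚ ℚ.+ G.re (zs k)) (Cauchy⇒IsCauchy {λ k → 1ℚ ℚ.+ G.re (zs k)} (Cauchy-re R))
            +i mkℝ (λ k → G.im (zs k)) (Cauchy⇒IsCauchy {λ k → G.im (zs k)} (Cauchy-im R))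
        at-μ : ∀ k → at μ k ≡ G.1F G.+F zs k
        at-μ k = cong (1ℚ ℚ.+ G.re (zs k) ,_) (sym (ℚ.+-identityˡ (G.im (zs k))))
        near-positive : IsPositiveReal μ → NearPositive δ z₀
        near-positive (im≈0 , ε , 0<ε , N , h) =
          near-im R (Null-resp {λ k → G.im (zs k) K.- 0ℚ} {λ k → G.im (zs k)}
              (λ k → ℚ.+-identityʳ (G.im (zs k))) (≈⇒Null {im μ} {0ᴿ} im≈0)) ,
          near-re R N (≤⇒K≤ {0ℚ} {1ℚ ℚ.+ G.re (zs N)}
              (ℚ.≤-trans (ℚ.<⇒≤ 0<ε) (ℚ.≤-trans (ℚ.≤-reflexive (sym (ℚ.+-identityˡ ε))) (ℚ.<⇒≤
              (h N ℕ.≤-refl)))))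
          where
          import Data.Nat.Properties as ℕ

      -- The point z = -1 belongs to the eigenvalue 0. If the determinant vanished, the constant
      -- sequence -1 would make 0 a positive eigenvalue.
      det-nonzero : Dℤ.det (Pℤ.char shifted (ℤ.- + 1)) ≢ + 0
      det-nonzero e = limit-positive 0ᶜ (λ _ → -1F) (λ _ → refl) (constant-root {p = p} { -1F} root) λ
          { (_ , ε , 0<ε , N , h) → irrefl ε 0<ε (h N ℕ.≤-refl) }
        where
        import Data.Nat.Properties as ℕ
        root : PF.evalM p -1F ≡ G.0F
        root = trans (p≡det -1F) (trans (sym (det-char-integer (ℤ.- + 1))) (cong integer e))
        irrefl : ∀ ε → 0ℚ ℚ.< ε → ¬ 0ℚ ℚ.+ ε ℚ.< 0ℚ
        irrefl ε 0<ε h = ℚ.<-irrefl refl (ℚ.<-trans 0<ε (subst (ℚ._< 0ℚ) (ℚ.+-identityˡ ε) h))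

      norm : 1ℚ K.≤ G.‖ PF.evalM p -1F ‖
      norm = subst (λ z → 1ℚ K.≤ G.‖ z ‖) (trans (det-char-integer (ℤ.- + 1)) (sym (p≡det -1F)))
        (1≤‖integer‖ (Dℤ.det (Pℤ.char shifted (ℤ.- + 1))) det-nonzero)

      second≡ : PF.second G.0F p ≡ G.-F DF.sum (λ i → shiftedF i i)
      second≡ = proj₂ (proj₂ (PF.charPoly shiftedF))

      diagonal≤0 : ∀ i → G.re (shiftedF i i) K.≤ 0ℚ
      diagonal≤0 i = subst (λ d → G.re (integer (entry A i i) G.-F d) K.≤ 0ℚ) (sym (DF.δ-refl i))
          (bit (lookup (lookup A i) i))
        where
        bit : ∀ (b : Fin 2) → G.re (integer (+ toℕ b) G.-F G.1F) K.≤ 0ℚ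
        bit zero       = ≤⇒K≤ {G.re (integer (+ 0) G.-F G.1F)} {0ℚ} (ℚ.*≤* ℤ.-≤+)
        bit (suc zero) = ≤⇒K≤ {G.re (integer (+ 1) G.-F G.1F)} {0ℚ} (ℚ.*≤* (ℤ.+≤+ ℕ.z≤n))

      trace≤0 : 0ℚ K.≤ G.re (PF.second G.0F p)
      trace≤0 = subst (λ z → 0ℚ K.≤ G.re z) (sym second≡)
          (neg-nonNeg (DF.sum (λ i → shiftedF i i)) (re-sum≤0 (λ i → shiftedF i i) diagonal≤0))

  -- The equalities over the Gaussian rationals descend to the integers by injectivity; the values
  -- at integers `s` are all that nilpotency requires.
  positive-spectrum : ∀ {ν} (A : Matrix01 (suc ν)) → AllEigenvaluesPositive (complexify A) →
    (∀ s → Dℤ.det (Pℤ.char (shifted A) s) ≡ s ℤ.^ suc ν) × (∀ i → lookup (lookup A i) i ≡ suc zero)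
  positive-spectrum {ν} A H = determinant , diagonal
    where
    determinant : ∀ s → Dℤ.det (Pℤ.char (shifted A) s) ≡ s ℤ.^ suc ν
    determinant s = integer-injective _ _
        (trans (det-char-integer A s) (trans (sym (p≡det A (integer s)))
      (trans (power (p A) (positive-roots A H) (norm A H) (trace≤0 A H) (integer s))
          (integer-^ s (suc ν)))))
    sum≡0 : DF.sum (λ i → shiftedF A i i) ≡ G.0F
    sum≡0 = trans (sym (neg-neg _)) (cong G.-F_
        (trans (sym (second≡ A H)) (traceless (p A) (positive-roots A H) (norm A H) (trace≤0 A H))))
      where
      open import Algebra.Properties.Ring F.ring using () renaming (-‿involutive to neg-neg)
    diagonal : ∀ i → lookup (lookup A i) i ≡ suc zero
    diagonal i = bit (lookup (lookup A i) i)
        (subst (λ d → G.re (integer (entry A i i) G.-F d) ≡ 0ℚ) (DF.δ-refl i)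
      (re-sum≡0 (λ i → shiftedF A i i) (diagonal≤0 A H)
          (K.≤-reflexive {0ℚ} {G.re (DF.sum (λ i → shiftedF A i i))} (sym (cong G.re sum≡0))) i))
      where
      bit : ∀ (b : Fin 2) → G.re (integer (+ toℕ b) G.-F G.1F) ≡ 0ℚ → b ≡ suc zero
      bit zero       ()
      bit (suc zero) e = refl

-- Walks, nilpotency and directed cycles

module Walks where
  open import Data.Bool using (Bool; true; false; if_then_else_)
  open import Data.Empty using (⊥-elim)
  open import Data.Fin as Fin using (Fin; zero; suc; toℕ)
  import Data.Fin.Properties as Fin
  open import Data.Fin.Relation.Unary.Top using (view; ‵fromℕ; ‵inj₁)
  open import Data.Integer as ℤ using (ℤ; +_)
  import Data.Integer.Properties as ℤ
  open import Data.Nat as ℕ using (ℕ; zero; suc; _≤_; _<_; z≤n; s≤s)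
  import Data.Nat.Properties as ℕ
  open import Data.Nat.Induction using (<-wellFounded)
  open import Data.Product using (∃-syntax; _×_; _,_; proj₁; proj₂)
  open import Data.Vec using (lookup)
  open import Data.Vec.Properties using ([]=⇒lookup; lookup⇒[]=)
  open import Function using (_∘_)
  open import Induction.WellFounded using (Acc; acc)
  open import Relation.Binary.Definitions using (tri<; tri≈; tri>)
  open import Relation.Binary.PropositionalEquality as ≡ using (_≡_; _≢_; refl; sym; trans; cong; cong₂; subst; subst₂)
  open import Relation.Nullary using (¬_; Dec; yes; no; contradiction)
  open import Relation.Nullary.Decidable using (decidable-stable; _×-dec_; map′)
  open import Algebra.Properties.Semiring.Sum ℕ.+-*-semiring using (sum)
  open import Defs

  private
    module Dℤ = Det ℤ.+-*-commutativeRing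
    module Pℤ = Poly ℤ.+-*-commutativeRing

  ≤sum : ∀ {n} (f : Fin n → ℕ) i → f i ≤ sum f
  ≤sum f zero    = ℕ.m≤m+n _ _
  ≤sum f (suc i) = ℕ.≤-trans (≤sum (f ∘ suc) i) (ℕ.m≤n+m _ _)

  sum-mono : ∀ {n} (f g : Fin n → ℕ) → (∀ i → f i ≤ g i) → sum f ≤ sum g
  sum-mono {zero}  f g h = z≤n
  sum-mono {suc n} f g h = ℕ.+-mono-≤ (h zero) (sum-mono (f ∘ suc) (g ∘ suc) (h ∘ suc))

  sum-const : ∀ n m → sum {n} (λ _ → m) ≡ n ℕ.* m
  sum-const zero    m = refl
  sum-const (suc n) m = cong (m ℕ.+_) (sum-const n m)

  sum≢0⇒∃ : ∀ {n} (f : Fin n → ℕ) → sum f ≢ 0 → ∃[ i ] f i ≢ 0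
  sum≢0⇒∃ {zero}  f h = contradiction refl h
  sum≢0⇒∃ {suc n} f h with f zero ℕ.≟ 0
  ... | no f0≢0 = zero , f0≢0
  ... | yes f0≡0 with sum≢0⇒∃ (f ∘ suc) (λ s≡0 → h (cong₂ ℕ._+_ f0≡0 s≡0))
  ...   | i , fi≢0 = suc i , fi≢0

  argmax : ∀ {n} (f : Fin (suc n) → ℕ) → ∃[ i ] ∀ j → f j ≤ f i
  argmax {zero}  f = zero , λ { zero → ℕ.≤-refl }
  argmax {suc n} f with argmax (f ∘ suc)
  ... | i , h with f zero ℕ.≤? f (suc i)
  ...   | yes f0≤ = suc i , λ { zero → f0≤ ; (suc j) → h j }
  ...   | no f0≰  = zero , λ { zero → ℕ.≤-refl ; (suc j) → ℕ.≤-trans (h j) (ℕ.<⇒≤ (ℕ.≰⇒> f0≰)) }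

  -- The number of walks of length k from i, that is, the i-th entry of Bᵏ applied to the all-ones
  -- vector.
  walks : ∀ {n} → (Fin n → Fin n → ℕ) → ℕ → Fin n → ℕ
  walks g zero    i = 1
  walks g (suc k) i = sum λ j → g i j ℕ.* walks g k j

  sum-+ : ∀ {n} (f : Fin n → ℕ) → + sum f ≡ Dℤ.sum (λ i → + f i)
  sum-+ {zero}  f = refl
  sum-+ {suc n} f = trans (ℤ.pos-+ (f zero) (sum (f ∘ suc))) (cong (ℤ._+_ (+ f zero)) (sum-+ (f ∘ suc)))

  ∣sum∣ : ∀ {n} (f : Fin n → ℤ) → ℤ.∣ Dℤ.sum f ∣ ≤ sum (λ i → ℤ.∣ f i ∣)
  ∣sum∣ {zero}  f = z≤n
  ∣sum∣ {suc n} f = ℕ.≤-trans (ℤ.∣i+j∣≤∣i∣+∣j∣ (f zero) (Dℤ.sum (f ∘ suc)))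
      (ℕ.+-monoʳ-≤ ℤ.∣ f zero ∣ (∣sum∣ (f ∘ suc)))

  -- Let B be the matrix g and u the all-ones vector.  If det (sI − B) = sⁿ, Cramer's rule solves
  -- (sI − B) W = sⁿ u over ℤ, and subtracting sⁿ⁻¹ u, sⁿ⁻² B u, … turns W into an integral
  -- solution of (sI − B) W = Bⁿ u, which vanishes once s is large.
  module Nilpotent {ν} (g : Fin (suc ν) → Fin (suc ν) → ℕ) (g≤1 : ∀ i j → g i j ≤ 1)
    (det≡ : ∀ s → Dℤ.det (Pℤ.char (λ i j → + g i j) s) ≡ s ℤ.^ suc ν) where
    private
      n : ℕ
      n = suc ν

    open IntSolver ℤ.+-*-commutativeRing using (solve; _:+_; _:*_; _:-_; :-_; _:=_)

    B : Dℤ.Matrix n n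
    B i j = + g i j

    w : ℕ → Fin n → ℤ
    w k i = + walks g k i

    B·w : ∀ k i → (B Dℤ.·ᵛ w k) i ≡ w (suc k) i
    B·w k i = trans (Dℤ.sum-cong-≋ {n} λ j → sym (ℤ.pos-* (g i j) (walks g k j)))
        (sym (sum-+ λ j → g i j ℕ.* walks g k j))

    Solves : ℤ → (Fin n → ℤ) → (Fin n → ℤ) → Set
    Solves s x b = ∀ i → s ℤ.* x i ℤ.- (B Dℤ.·ᵛ x) i ≡ b i

    lower : ∀ s m k x → Solves s x (λ i → s ℤ.^ suc m ℤ.* w k i) → Solves s
        (λ i → x i ℤ.- s ℤ.^ m ℤ.* w k i) (λ i → s ℤ.^ m ℤ.* w (suc k) i)
    lower s m k x h i = begin
      s ℤ.* (x i ℤ.- q ℤ.* w k i) ℤ.- (B Dℤ.·ᵛ (λ j → x j ℤ.- q ℤ.* w k j)) i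
        ≡⟨ cong (λ t → s ℤ.* (x i ℤ.- q ℤ.* w k i) ℤ.- t) product ⟩
      s ℤ.* (x i ℤ.- q ℤ.* w k i) ℤ.- ((B Dℤ.·ᵛ x) i ℤ.- q ℤ.* (B Dℤ.·ᵛ w k) i)
        ≡⟨ solve 6 (λ s x q w b c → s :* (x :- q :* w) :- (b :- q :* c) := (s :* x :- b) :- s :* q :* w
            :+ q :* c) refl
             s (x i) q (w k i) ((B Dℤ.·ᵛ x) i) ((B Dℤ.·ᵛ w k) i) ⟩
      (s ℤ.* x i ℤ.- (B Dℤ.·ᵛ x) i) ℤ.- s ℤ.* q ℤ.* w k i ℤ.+ q ℤ.* (B Dℤ.·ᵛ w k) i
        ≡⟨ cong₂ (λ a b → a ℤ.- s ℤ.* q ℤ.* w k i ℤ.+ q ℤ.* b) (h i) (B·w k i) ⟩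
      s ℤ.* q ℤ.* w k i ℤ.- s ℤ.* q ℤ.* w k i ℤ.+ q ℤ.* w (suc k) i
        ≡⟨ cong (ℤ._+ q ℤ.* w (suc k) i) (ℤ.+-inverseʳ (s ℤ.* q ℤ.* w k i)) ⟩
      + 0 ℤ.+ q ℤ.* w (suc k) i
        ≡⟨ ℤ.+-identityˡ _ ⟩
      q ℤ.* w (suc k) i ∎
      where
      open ≡.≡-Reasoning
      q : ℤ
      q = s ℤ.^ m
      product : (B Dℤ.·ᵛ (λ j → x j ℤ.- q ℤ.* w k j)) i ≡ (B Dℤ.·ᵛ x) i ℤ.- q ℤ.* (B Dℤ.·ᵛ w k) i
      product = trans (Dℤ.sum-cong-≋ {n} λ j → solve 4
          (λ b x q w → b :* (x :- q :* w) := b :* x :+ :- q :* (b :* w)) refl (B i j) (x j) q (w k j))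
        (trans (Dℤ.∑-distrib-+ {n} (λ j → B i j ℤ.* x j) (λ j → ℤ.- q ℤ.* (B i j ℤ.* w k j)))
          (cong (λ t → (B Dℤ.·ᵛ x) i ℤ.+ t) (trans (sym
              (Dℤ.*-distribˡ-sum {n} (ℤ.- q) (λ j → B i j ℤ.* w k j))) (sym (ℤ.neg-distribˡ-* q _)))))

    lowers : ∀ s m k x → Solves s x (λ i → s ℤ.^ m ℤ.* w k i) → ∃[ y ] Solves s y (w (m ℕ.+ k))
    lowers s zero    k x h = x , λ i → trans (h i) (ℤ.*-identityˡ (w k i))
    lowers s (suc m) k x h = let y , e = lowers s m (suc k) _ (lower s m k x h) in y , subst (λ l → Solves s y (w l)) (ℕ.+-suc m k) e

    solution : ∀ s → ∃[ y ] Solves s y (w n)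
    solution s = let x , e = Dℤ.cramer (Pℤ.char B s) (w 0)
                     y , h = lowers s n 0 x λ i → trans (sym (Pℤ.char-kernel B s x i))
                         (trans (e i) (cong (ℤ._* + 1) (det≡ s)))
                 in y , subst (λ l → Solves s y (w l)) (ℕ.+-identityʳ n) h

    total : ℕ
    total = sum (walks g n)

    s₀ : ℕ
    -- Exceeds `n`, a bound for the row sums of B, by more than `total`, a bound for each entry of
    -- the right-hand side.
    s₀ = suc (n ℕ.+ total)

    small⇒0 : ∀ {m} → s₀ ℕ.* m ≤ total ℕ.+ n ℕ.* m → m ≡ 0
    small⇒0 {zero}  _ = refl
    small⇒0 {suc m} h = ⊥-elim (ℕ.<-irrefl refl (begin-strict
      total                              <⟨ ℕ.n<1+n total ⟩
      suc total                          ≤⟨ ℕ.m≤m*n (suc total) (suc m) ⟩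
      suc total ℕ.* suc m                ≤⟨ ℕ.+-cancelʳ-≤ (n ℕ.* suc m) _ _
          (ℕ.≤-trans (ℕ.≤-reflexive eq) h) ⟩
      total                              ∎))
      where
      open ℕ.≤-Reasoning
      eq : suc total ℕ.* suc m ℕ.+ n ℕ.* suc m ≡ s₀ ℕ.* suc m
      eq = trans (sym (ℕ.*-distribʳ-+ (suc m) (suc total) n))
          (cong (ℕ._* suc m) (cong suc (ℕ.+-comm total n)))

    -- Compare absolute values in a row where |y| is largest: s₀|y| ≤ total + n|y|. Since |y| is a
    -- natural number, it must be 0; over ℚ the solution would merely be small.
    vanish : ∀ y → Solves (+ s₀) y (w n) → ∀ i → y i ≡ + 0
    vanish y h i = ℤ.∣i∣≡0⇒i≡0 (ℕ.n≤0⇒n≡0 (ℕ.≤-trans (top-max i) (ℕ.≤-reflexive top≡0)))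
      where
      top : Fin n
      top = proj₁ (argmax λ j → ℤ.∣ y j ∣)
      top-max : ∀ j → ℤ.∣ y j ∣ ≤ ℤ.∣ y top ∣
      top-max = proj₂ (argmax λ j → ℤ.∣ y j ∣)
      term : ∀ j → ℤ.∣ B top j ℤ.* y j ∣ ≤ ℤ.∣ y top ∣
      term j = begin
        ℤ.∣ B top j ℤ.* y j ∣        ≡⟨ ℤ.abs-* (B top j) (y j) ⟩
        g top j ℕ.* ℤ.∣ y j ∣        ≤⟨ ℕ.*-mono-≤ (g≤1 top j) (top-max j) ⟩
        1 ℕ.* ℤ.∣ y top ∣            ≡⟨ ℕ.*-identityˡ _ ⟩
        ℤ.∣ y top ∣                  ∎
        where open ℕ.≤-Reasoning
      bound : s₀ ℕ.* ℤ.∣ y top ∣ ≤ total ℕ.+ n ℕ.* ℤ.∣ y top ∣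
      bound = begin
        s₀ ℕ.* ℤ.∣ y top ∣
          ≡⟨ sym (ℤ.abs-* (+ s₀) (y top)) ⟩
        ℤ.∣ + s₀ ℤ.* y top ∣
          ≡⟨ cong ℤ.∣_∣ (trans (solve 2 (λ a b → a := (a :- b) :+ b) refl (+ s₀ ℤ.* y top)
              ((B Dℤ.·ᵛ y) top)) (cong (λ t → t ℤ.+ (B Dℤ.·ᵛ y) top) (h top))) ⟩
        ℤ.∣ w n top ℤ.+ (B Dℤ.·ᵛ y) top ∣
          ≤⟨ ℤ.∣i+j∣≤∣i∣+∣j∣ (w n top) ((B Dℤ.·ᵛ y) top) ⟩
        walks g n top ℕ.+ ℤ.∣ (B Dℤ.·ᵛ y) top ∣
          ≤⟨ ℕ.+-mono-≤ (≤sum (walks g n) top)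
              (ℕ.≤-trans (∣sum∣ (λ j → B top j ℤ.* y j))
              (sum-mono (λ j → ℤ.∣ B top j ℤ.* y j ∣) (λ _ → ℤ.∣ y top ∣) term)) ⟩
        total ℕ.+ sum {n} (λ _ → ℤ.∣ y top ∣)
          ≡⟨ cong (total ℕ.+_) (sum-const n ℤ.∣ y top ∣) ⟩
        total ℕ.+ n ℕ.* ℤ.∣ y top ∣ ∎
        where open ℕ.≤-Reasoning
      top≡0 : ℤ.∣ y top ∣ ≡ 0
      top≡0 = small⇒0 bound

    walks≡0 : ∀ i → walks g n i ≡ 0
    walks≡0 i = ℤ.+-injective (from (solution (+ s₀)))
      where
      from : (∃[ y ] Solves (+ s₀) y (w n)) → w n i ≡ + 0
      from (y , h) = trans (sym (h i)) (trans
          (cong₂ (λ a b → + s₀ ℤ.* a ℤ.- b) (vanish y h i)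
          (Dℤ.sum-zero λ j → trans (cong (B i j ℤ.*_) (vanish y h j)) (ℤ.*-zeroʳ (B i j))))
        (trans (cong (ℤ._- + 0) (ℤ.*-zeroʳ (+ s₀))) refl))

  bit : Bool → ℕ
  bit b = if b then 1 else 0

  adjacency : ∀ {n} → Digraph n → Fin n → Fin n → ℕ
  adjacency G i j = bit (lookup (lookup G i) j)

  module _ {n} (G : Digraph n) where
    private
      g : Fin n → Fin n → ℕ
      g = adjacency G

    Edge⇒g≡1 : ∀ {i j} → Edge G i j → g i j ≡ 1
    Edge⇒g≡1 e = cong bit ([]=⇒lookup e)

    g≢0⇒Edge : ∀ {i j} → g i j ≢ 0 → Edge G i j
    g≢0⇒Edge {i} {j} h = lookup⇒[]= j (lookup G i) (is-true (lookup (lookup G i) j) h)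
      where
      is-true : ∀ b → bit b ≢ 0 → b ≡ true
      is-true true  _ = refl
      is-true false h = contradiction refl h

    extend-walk : ∀ {i j} k → Edge G i j → walks g k j ≤ walks g (suc k) i
    extend-walk {i} {j} k e = ℕ.≤-trans
        (ℕ.≤-reflexive (trans (sym (ℕ.*-identityˡ _)) (cong (ℕ._* walks g k j) (sym (Edge⇒g≡1 e)))))
      (≤sum (λ j → g i j ℕ.* walks g k j) j)

    cycle⇒walks : (C : DirectedCycle G) → ∀ k i → 1 ≤ walks g k (DirectedCycle.c C i)
    cycle⇒walks cyc zero    i = ℕ.≤-refl
    cycle⇒walks cyc (suc k) i with view i
    -- From the last vertex the walk continues along the closing edge.
    ... | ‵fromℕ           = ℕ.≤-trans (cycle⇒walks cyc k zero) (extend-walk k close)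
      where open DirectedCycle cyc
    ... | ‵inj₁ {i = j} _  = ℕ.≤-trans (cycle⇒walks cyc k (suc j)) (extend-walk k (step j))
      where open DirectedCycle cyc

    IsWalk : (ℕ → Fin n) → ℕ → Set
    IsWalk f k = ∀ t → t < k → Edge G (f t) (f (suc t))

    walks≢0⇒walk : ∀ k i → walks g k i ≢ 0 → ∃[ f ] f 0 ≡ i × IsWalk f k
    walks≢0⇒walk zero    i h = (λ _ → i) , refl , λ t ()
    walks≢0⇒walk (suc k) i h = from (sum≢0⇒∃ (λ j → g i j ℕ.* walks g k j) h)
      where
      from : (∃[ j ] g i j ℕ.* walks g k j ≢ 0) → ∃[ f ] f 0 ≡ i × IsWalk f (suc k)
      from (j , gw≢0) = prepend (walks≢0⇒walk k j λ w≡0 → gw≢0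
          (trans (cong (g i j ℕ.*_) w≡0) (ℕ.*-zeroʳ (g i j))))
        where
        prepend : (∃[ f ] f 0 ≡ j × IsWalk f k) → ∃[ f ] f 0 ≡ i × IsWalk f (suc k)
        prepend (f , f0≡j , walk) = f′ , refl , walk′
          where
          f′ : ℕ → Fin n
          f′ zero    = i
          f′ (suc t) = f t
          walk′ : IsWalk f′ (suc k)
          walk′ zero    _         = subst (Edge G i) (sym f0≡j)
              (g≢0⇒Edge λ g≡0 → gw≢0 (cong (ℕ._* walks g k j) g≡0))
          walk′ (suc t) (s≤s t<k) = walk t t<k

    -- A closed walk of minimal length visits distinct vertices.
    closed⇒cycle : ∀ ℓ → Acc _<_ ℓ → (f : ℕ → Fin n) → IsWalk f (suc ℓ) → f (suc ℓ) ≡ f 0 →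
        DirectedCycle G
    closed⇒cycle ℓ (acc rec) f walk closed = decide
        (Fin.any? λ i → Fin.any? λ j → (i Fin.<? j) ×-dec (f (toℕ i) Fin.≟ f (toℕ j)))
      where
      shorten : (∃[ i ] ∃[ j ] toℕ {suc ℓ} i < toℕ {suc ℓ} j × f (toℕ i) ≡ f (toℕ j)) → DirectedCycle G
      shorten (i , j , i<j , fi≡fj) = closed⇒cycle d (rec (ℕ.<-≤-trans d<j (ℕ.s≤s⁻¹ (Fin.toℕ<n j))))
          (λ t → f (toℕ i ℕ.+ t))
        (λ t t≤d → subst (λ k → Edge G (f (toℕ i ℕ.+ t)) (f k)) (sym (ℕ.+-suc (toℕ i) t))
            (walk (toℕ i ℕ.+ t) (ℕ.<-trans (ℕ.<-≤-trans (ℕ.+-monoʳ-< (toℕ i) t≤d) (ℕ.≤-reflexive i+d≡j))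
            (Fin.toℕ<n j))))
        (trans (cong f i+d≡j) (trans (sym fi≡fj) (cong f (sym (ℕ.+-identityʳ (toℕ i))))))
        where
        d : ℕ
        d = toℕ j ℕ.∸ suc (toℕ i)
        i+d≡j : toℕ i ℕ.+ suc d ≡ toℕ j
        i+d≡j = trans (ℕ.+-suc (toℕ i) d) (ℕ.m+[n∸m]≡n i<j)
        d<j : d < toℕ j
        d<j = ℕ.≤-trans (ℕ.m≤n+m (suc d) (toℕ i)) (ℕ.≤-reflexive i+d≡j)
      decide : Dec (∃[ i ] ∃[ j ] toℕ {suc ℓ} i < toℕ {suc ℓ} j × f (toℕ i) ≡ f (toℕ j)) → DirectedCycle
          G
      decide (yes repeat)   = shorten repeat
      decide (no ¬repeat) = record
        { ℓ        = ℓ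
        ; c        = f ∘ toℕ
        ; distinct = λ {i} {j} fi≡fj → decidable-stable (i Fin.≟ j) λ i≢j → ordered i j i≢j fi≡fj
        ; step     = λ i → subst (λ k → Edge G (f k) (f (suc (toℕ i)))) (sym (Fin.toℕ-inject₁ i))
            (walk (toℕ i) (ℕ.m≤n⇒m≤1+n (Fin.toℕ<n i)))
        ; close    = subst₂ (Edge G) (cong f (sym (Fin.toℕ-fromℕ ℓ))) closed (walk ℓ ℕ.≤-refl) }
        where
        ordered : ∀ i j → i ≢ j → ¬ f (toℕ i) ≡ f (toℕ j)
        ordered i j i≢j e with ℕ.<-cmp (toℕ i) (toℕ j)
        ... | tri< i<j _ _ = ¬repeat (i , j , i<j , e)
        ... | tri≈ _ i≡j _ = i≢j (Fin.toℕ-injective i≡j)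
        ... | tri> _ _ j<i = ¬repeat (j , i , j<i , sym e)

    -- A walk with n steps has n + 1 positions, so some vertex repeats and cuts out a closed walk.
    walk⇒cycle : ∀ (f : ℕ → Fin n) → IsWalk f n → DirectedCycle G
    walk⇒cycle f walk = from (Fin.pigeonhole (ℕ.n<1+n n) (f ∘ toℕ))
      where
      from : (∃[ i ] ∃[ j ] toℕ {suc n} i < toℕ {suc n} j × f (toℕ i) ≡ f (toℕ j)) → DirectedCycle G
      from (i , j , i<j , fi≡fj) = closed⇒cycle d (<-wellFounded d) (λ t → f (toℕ i ℕ.+ t))
        (λ t t≤d → subst (λ k → Edge G (f (toℕ i ℕ.+ t)) (f k)) (sym (ℕ.+-suc (toℕ i) t))
            (walk (toℕ i ℕ.+ t) (ℕ.<-≤-trans (ℕ.+-monoʳ-< (toℕ i) t≤d) (ℕ.≤-trans (ℕ.≤-reflexive i+d≡j)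
            (ℕ.s≤s⁻¹ (Fin.toℕ<n j))))))
        (trans (cong f i+d≡j) (trans (sym fi≡fj) (cong f (sym (ℕ.+-identityʳ (toℕ i))))))
        where
        d : ℕ
        d = toℕ j ℕ.∸ suc (toℕ i)
        i+d≡j : toℕ i ℕ.+ suc d ≡ toℕ j
        i+d≡j = trans (ℕ.+-suc (toℕ i) d) (ℕ.m+[n∸m]≡n i<j)

    NoWalks : Set
    NoWalks = ∀ i → walks g n i ≡ 0

    NoWalks⇒Acyclic : NoWalks → Acyclic G
    NoWalks⇒Acyclic none cyc = ℕ.<-irrefl refl
        (ℕ.≤-trans (cycle⇒walks cyc n zero) (ℕ.≤-reflexive (none _)))

    Acyclic⇒NoWalks : Acyclic G → NoWalks
    Acyclic⇒NoWalks acyclic i = decidable-stable (walks g n i ℕ.≟ 0) λ w≢0 →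
      let f , _ , walk = walks≢0⇒walk n i w≢0 in acyclic (walk⇒cycle f walk)

    -- Counting walks of length n decides acyclicity, which allows the acyclic digraphs to be listed
    -- by filtering.
    acyclic? : Dec (Acyclic G)
    acyclic? = map′ NoWalks⇒Acyclic Acyclic⇒NoWalks (Fin.all? λ i → walks g n i ℕ.≟ 0)

-- The bijection between digraphs and matrices

open import Data.Bool using (Bool; true; false; not)
import Data.Bool.Properties as Bool
open import Data.Empty using (⊥-elim)
open import Data.Fin as Fin using (Fin; zero; suc; toℕ)
import Data.Fin.Properties as Fin
open import Data.Integer as ℤ using (ℤ; +_)
open import Data.List using (List; []; _∷_; map; filter; cartesianProductWith; length)
open import Data.List.Membership.Propositional using () renaming (_∈_ to _∈ₗ_)
open import Data.List.Membership.Propositional.Properties using (∈-map⁺; ∈-map⁻; ∈-filter⁺; ∈-filter⁻; ∈-cartesianProductWith⁺)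
open import Data.List.Properties using (length-map)
open import Data.List.Relation.Unary.All using ([]; _∷_)
open import Data.List.Relation.Unary.Any using (here; there)
open import Data.List.Relation.Unary.AllPairs using ([]; _∷_)
open import Data.List.Relation.Unary.Unique.Propositional using (Unique)
open import Data.List.Relation.Unary.Unique.Propositional.Properties using (map⁺; filter⁺; cartesianProductWith⁺)
open import Data.Nat as ℕ using (ℕ; zero; suc; NonZero)
import Data.Nat.Properties as ℕ
open import Data.Product using (∃-syntax; _×_; _,_; proj₁; proj₂)
open import Data.Rational as ℚ using (ℚ; 0ℚ; 1ℚ; ½)
import Data.Rational.Properties as ℚ
open import Data.Vec as Vec using (Vec; lookup; tabulate)
import Data.Vec.Properties as Vec
open import Function using (_∘_)
open import Function.Bundles using (mk⇔)
open import Relation.Binary.PropositionalEquality as ≡ using (_≡_; _≢_; refl; sym; trans; cong; cong₂; subst)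
open import Relation.Nullary using (¬_; Dec; yes; no; contradiction)
open import Defs
open Complex
open Sequences Real.ℚ-field using (NullF-stable; above-half)
open Spectral using (module Pℂ; module Dℂ; module Dℤ; shifted; positive-spectrum)
open Walks

-- The loops of G are complemented, so that loopless digraphs become I plus their adjacency matrix
-- and the correspondence is a bijection between all digraphs and all matrices.
flip : ∀ {n} → Fin n → Fin n → Bool → Bool
flip i j b with i Fin.≟ j
... | yes _ = not b
... | no _  = b

flip-involutive : ∀ {n} (i j : Fin n) b → flip i j (flip i j b) ≡ b
flip-involutive i j b with i Fin.≟ j
... | yes _ = Bool.not-involutive b
... | no _  = refl

flip-refl : ∀ {n} (i : Fin n) b → flip i i b ≡ not b
flip-refl i b with i Fin.≟ i
... | yes _  = refl
... | no i≢i = contradiction refl i≢i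

flip-≢ : ∀ {n} {i j : Fin n} b → i ≢ j → flip i j b ≡ b
flip-≢ {i = i} {j} b i≢j with i Fin.≟ j
... | yes i≡j = contradiction i≡j i≢j
... | no _    = refl

digit : Bool → Fin 2
digit false = zero
digit true  = suc zero

undigit : Fin 2 → Bool
undigit zero       = false
undigit (suc zero) = true

digit-undigit : ∀ d → digit (undigit d) ≡ d
digit-undigit zero       = refl
digit-undigit (suc zero) = refl

undigit-digit : ∀ b → undigit (digit b) ≡ b
undigit-digit false = refl
undigit-digit true  = refl

toMatrix : ∀ {n} → Digraph n → Matrix01 n
toMatrix G = tabulate λ i → tabulate λ j → digit (flip i j (lookup (lookup G i) j))

toDigraph : ∀ {n} → Matrix01 n → Digraph n
toDigraph A = tabulate λ i → tabulate λ j → flip i j (undigit (lookup (lookup A i) j))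

lookup² : ∀ {X : Set} {n} (f : Fin n → Fin n → X) i j → lookup
    (lookup (tabulate λ i → tabulate (f i)) i) j ≡ f i j
lookup² f i j = trans (cong (λ r → lookup r j) (Vec.lookup∘tabulate (λ i → tabulate (f i)) i))
    (Vec.lookup∘tabulate (f i) j)

tabulate² : ∀ {X : Set} {n} (M : Vec (Vec X n) n) {f : Fin n → Fin n → X} →
    (∀ i j → f i j ≡ lookup (lookup M i) j) →
            tabulate (λ i → tabulate (f i)) ≡ M
tabulate² M h = trans (Vec.tabulate-cong λ i → trans (Vec.tabulate-cong (h i))
    (Vec.tabulate∘lookup (lookup M i))) (Vec.tabulate∘lookup M)

toMatrix-toDigraph : ∀ {n} (A : Matrix01 n) → toMatrix (toDigraph A) ≡ A
toMatrix-toDigraph A = tabulate² A λ i j → trans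
    (cong (digit ∘ flip i j) (lookup² (λ i j → flip i j (undigit (lookup (lookup A i) j))) i j))
  (trans (cong digit (flip-involutive i j _)) (digit-undigit _))

toDigraph-toMatrix : ∀ {n} (G : Digraph n) → toDigraph (toMatrix G) ≡ G
toDigraph-toMatrix G = tabulate² G λ i j → trans
    (cong (flip i j ∘ undigit) (lookup² (λ i j → digit (flip i j (lookup (lookup G i) j))) i j))
  (trans (cong (flip i j) (undigit-digit _)) (flip-involutive i j _))

module _ {n} (G : Digraph n) where
  edge : Fin n → Fin n → Bool
  edge i j = lookup (lookup G i) j

  toMatrix-entry : ∀ i j → lookup (lookup (toMatrix G) i) j ≡ digit (flip i j (edge i j))
  toMatrix-entry = lookup² (λ i j → digit (flip i j (edge i j)))

  loopless : (∀ i → lookup (lookup (toMatrix G) i) i ≡ suc zero) → ∀ i → edge i i ≡ false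
  loopless h i = from (edge i i) (trans (sym (cong digit (flip-refl i (edge i i))))
      (trans (sym (toMatrix-entry i i)) (h i)))
    where
    from : ∀ b → digit (not b) ≡ suc zero → b ≡ false
    from false _ = refl

  shifted-toMatrix : (∀ i → edge i i ≡ false) → ∀ i j → shifted (toMatrix G) i j ≡ + adjacency G i j
  shifted-toMatrix h i j = trans (cong (λ d → + toℕ d ℤ.- Dℤ.δ i j) (toMatrix-entry i j))
      (cases (i Fin.≟ j))
    where
    value : ∀ b → + toℕ (digit b) ℤ.- + 0 ≡ + bit b
    value false = refl
    value true  = refl
    cases : Dec (i ≡ j) → + toℕ (digit (flip i j (edge i j))) ℤ.- Dℤ.δ i j ≡ + adjacency G i j
    cases (yes refl) = trans (cong₂ (λ b d → + toℕ (digit b) ℤ.- d)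
        (trans (flip-refl i (edge i i)) (cong not (h i))) (Dℤ.δ-refl i))
      (cong (λ b → + bit b) (sym (h i)))
    cases (no i≢j)   = trans (cong₂ (λ b d → + toℕ (digit b) ℤ.- d) (flip-≢ (edge i j) i≢j)
        (Dℤ.δ-≢ i≢j)) (value (edge i j))

-- Acyclicity and positivity of the spectrum

bit≤1 : ∀ b → bit b ℕ.≤ 1
bit≤1 false = ℕ.z≤n
bit≤1 true  = ℕ.≤-refl

positive⇒acyclic : ∀ {ν} (G : Digraph (suc ν)) → AllEigenvaluesPositive (complexify (toMatrix G)) →
    Acyclic G
positive⇒acyclic {ν} G H = NoWalks⇒Acyclic G
    (Nilpotent.walks≡0 (adjacency G) (λ i j → bit≤1 (edge G i j)) λ s →
  trans (Dℤ.det-cong {suc ν} λ i j → cong (λ b → ℤ.- b ℤ.+ s ℤ.* Dℤ.δ i j)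
      (sym (shifted-toMatrix G no-loop i j))) (proj₁ (positive-spectrum (toMatrix G) H) s))
  where
  no-loop : ∀ i → edge G i i ≡ false
  no-loop = loopless G (proj₂ (positive-spectrum (toMatrix G) H))

private
  module C = CommutativeRing ℂ-ring

≈1⇒positive : ∀ μ → μ ≈ᶜ 1ᶜ → IsPositiveReal μ
≈1⇒positive μ (re≈1 , im≈0) = im≈0 , ½ , 0<½ , from (re≈1 ½ 0<½)
  where
  0<½ : 0ℚ ℚ.< ½
  0<½ = ℚ.*<* (ℤ.+<+ (ℕ.s≤s ℕ.z≤n))
  from : (∃[ N ] ∀ n → N ℕ.≤ n → ℚ.∣ seq (re μ) n ℚ.- 1ℚ ∣ ℚ.< ½) → ∃[ N ] ∀ n → N ℕ.≤ n → 0ℚ ℚ.+ ½ ℚ.<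
      seq (re μ) n
  from (N , h) = N , λ n N≤n → K<⇒< {0ℚ ℚ.+ ½} {seq (re μ) n} (above-half {seq (re μ) n} {½} refl
    (<⇒K< {K.∣ seq (re μ) n ℚ.- 1ℚ ∣} {½} (subst (ℚ._< ½) (sym (∣∣≡ (seq (re μ) n ℚ.- 1ℚ))) (h n N≤n))))

acyclic⇒positive : ∀ {n} (G : Digraph n) → Acyclic G → AllEigenvaluesPositive (complexify (toMatrix G))
acyclic⇒positive {n} G acyclic μ (v , v≉0 , Av≈μv) = ≈1⇒positive μ (Pℂ.x-1≈0⇒x≈1 {μ} μ-1≈0)
  where
  A : ComplexMatrix n
  A = complexify (toMatrix G)

  no-loop : ∀ i → edge G i i ≡ false
  no-loop i = from (edge G i i) refl
    where
    from : ∀ b → edge G i i ≡ b → b ≡ false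
    from false _ = refl
    from true  e = ⊥-elim (acyclic (record
      { ℓ = 0 ; c = λ _ → i ; distinct = λ { {zero} {zero} _ → refl } ; step = λ () ; close =
          Vec.lookup⇒[]= i (lookup G i) e }))

  Null-walks : ℕ → Fin n → Set
  Null-walks k i = walks (adjacency G) k i ≡ 0

  successor : ∀ k i j → edge G i j ≡ true → Null-walks (suc k) i → Null-walks k j
  successor k i j e w≡0 = ℕ.n≤0⇒n≡0 (ℕ.≤-trans (extend-walk G k (Vec.lookup⇒[]= j (lookup G i) e))
      (ℕ.≤-reflexive w≡0))

  module _ (μ≉1 : ¬ μ C.- 1ᶜ ≈ᶜ 0ᶜ) where
    -- Nilpotency in coordinates: (μ - 1) vᵢ is the sum of vⱼ over the successors j of i. If no walk
    -- of length k + 1 leaves i, none of length k leaves j, so these vⱼ vanish by induction; length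
    -- 0 cannot occur, as there is always one empty walk.
    vanishes : ∀ k i → Null-walks k i → v i ≈ᶜ 0ᶜ
    vanishes (suc k) i w≡0 = *ᶜ-cancel {μ C.- 1ᶜ} {v i} μ≉1
        (Pℂ.fixed⇒eigen-1 {μ} {v i} {(A · v) i} (Av≈μv i) difference)
      where
      coefficient : Fin 2 → ℂ → ℂ
      coefficient d e = (C.- fromℕᶜ (toℕ d)) +ᶜ 1ᶜ *ᶜ e
      zero-coefficient : ∀ j → edge G i j ≡ false → coefficient (lookup (lookup (toMatrix G) i) j)
          (Dℂ.δ i j) ≈ᶜ 0ᶜ
      zero-coefficient j e = subst (λ d → coefficient d (Dℂ.δ i j) ≈ᶜ 0ᶜ)
          (sym (trans (toMatrix-entry G i j) (cong (digit ∘ flip i j) e))) (cases (i Fin.≟ j))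
        where
        cases : Dec (i ≡ j) → coefficient (digit (flip i j false)) (Dℂ.δ i j) ≈ᶜ 0ᶜ
        cases (yes refl) = ≡.subst₂ (λ b d → coefficient (digit b) d ≈ᶜ 0ᶜ) (sym (flip-refl i false))
            (sym (Dℂ.δ-refl i))
          (pointwise {re (coefficient (suc zero) 1ᶜ)} {0ᴿ} (λ _ → refl) , pointwise
              {im (coefficient (suc zero) 1ᶜ)} {0ᴿ} (λ _ → refl))
        cases (no i≢j) = ≡.subst₂ (λ b d → coefficient (digit b) d ≈ᶜ 0ᶜ) (sym (flip-≢ false i≢j))
            (sym (Dℂ.δ-≢ i≢j))
          (pointwise {re (coefficient zero 0ᶜ)} {0ᴿ} (λ _ → refl) , pointwise {im (coefficient zero 0ᶜ)}
              {0ᴿ} (λ _ → refl))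
      term : ∀ j b → edge G i j ≡ b → coefficient (lookup (lookup (toMatrix G) i) j) (Dℂ.δ i j) *ᶜ v j
          ≈ᶜ 0ᶜ
      term j true  e = let q = coefficient (lookup (lookup (toMatrix G) i) j) (Dℂ.δ i j) in
        C.trans {q *ᶜ v j} {q *ᶜ 0ᶜ} {0ᶜ} (C.*-congˡ {q} {v j} {0ᶜ}
            (vanishes k j (successor k i j e w≡0))) (C.zeroʳ q)
      term j false e = let q = coefficient (lookup (lookup (toMatrix G) i) j) (Dℂ.δ i j) in
        C.trans {q *ᶜ v j} {0ᶜ *ᶜ v j} {0ᶜ} (C.*-congʳ {v j} {q} {0ᶜ} (zero-coefficient j e))
            (C.zeroˡ (v j))
      difference : 1ᶜ *ᶜ v i C.- (A · v) i ≈ᶜ 0ᶜ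
      difference = C.trans {1ᶜ *ᶜ v i C.- (A · v) i} {(Pℂ.char A 1ᶜ Dℂ.·ᵛ v) i} {0ᶜ}
        (C.sym {(Pℂ.char A 1ᶜ Dℂ.·ᵛ v) i} {1ᶜ *ᶜ v i C.- (A · v) i} (Pℂ.char-kernel A 1ᶜ v i))
        (Dℂ.sum-zero {n} {λ j → Pℂ.char A 1ᶜ i j *ᶜ v j} λ j → term j (edge G i j) refl)

  μ-1≈0 : μ C.- 1ᶜ ≈ᶜ 0ᶜ
  -- Whether μ is 1 cannot be decided, but equality of limits is stable: assuming μ ≠ 1 kills the
  -- whole eigenvector.
  μ-1≈0 = NullF⇒≈0 {μ C.- 1ᶜ} (NullF-stable {at (μ C.- 1ᶜ)} (at-Cauchy (μ C.- 1ᶜ)) λ ¬null →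
    v≉0 λ i → vanishes (λ μ≈1 → ¬null (≈0⇒NullF {μ C.- 1ᶜ} μ≈1)) n i (Acyclic⇒NoWalks G acyclic i))

-- Enumeration and counting

vectors : ∀ {X : Set} → List X → ∀ n → List (Vec X n)
vectors xs zero    = Vec.[] ∷ []
vectors xs (suc n) = cartesianProductWith Vec._∷_ xs (vectors xs n)

vectors-unique : ∀ {X : Set} {xs : List X} → Unique xs → ∀ n → Unique (vectors xs n)
vectors-unique u zero    = [] ∷ []
vectors-unique u (suc n) = cartesianProductWith⁺ Vec._∷_ Vec.∷-injective u (vectors-unique u n)

vectors-complete : ∀ {X : Set} {xs : List X} → (∀ x → x ∈ₗ xs) → ∀ {n} (v : Vec X n) → v ∈ₗ vectors xs n
vectors-complete h Vec.[]       = here refl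
vectors-complete h (x Vec.∷ v) = ∈-cartesianProductWith⁺ Vec._∷_ (h x) (vectors-complete h v)

bools : List Bool
bools = false ∷ true ∷ []

digraphs : ∀ n → List (Digraph n)
digraphs n = vectors (vectors bools n) n

digraphs-unique : ∀ n → Unique (digraphs n)
digraphs-unique n = vectors-unique (vectors-unique (((λ ()) ∷ []) ∷ [] ∷ []) n) n

digraphs-complete : ∀ {n} (G : Digraph n) → G ∈ₗ digraphs n
digraphs-complete = vectors-complete
    (vectors-complete λ { false → here refl ; true → there (here refl) })

theorem1 : (n : ℕ) .{{_ : NonZero n}} →
    ∃[ k ] (NumberOf (λ (G : Digraph n) → Acyclic G) k
    × NumberOf (λ (A : Matrix01 n) → AllEigenvaluesPositive (complexify A)) k)
theorem1 (suc ν) = length acyclics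
  , record
    { elements = acyclics
    ; unique   = filter⁺ acyclic? (digraphs-unique n)
    ; complete = λ G → mk⇔ (∈-filter⁺ acyclic? (digraphs-complete G))
        (proj₂ ∘ ∈-filter⁻ acyclic? {xs = digraphs n})
    ; size     = refl }
  , record
    { elements = map toMatrix acyclics
    ; unique   = map⁺ injective (filter⁺ acyclic? (digraphs-unique n))
    ; complete = λ A → mk⇔ (listed A) (positive A)
    ; size     = length-map toMatrix acyclics }
  where
  n : ℕ
  n = suc ν
  acyclics : List (Digraph n)
  acyclics = filter acyclic? (digraphs n)
  injective : ∀ {G H} → toMatrix {n} G ≡ toMatrix H → G ≡ H
  injective {G} {H} e = trans (sym (toDigraph-toMatrix G))
      (trans (cong toDigraph e) (toDigraph-toMatrix H))
  listed : ∀ A → AllEigenvaluesPositive (complexify A) → A ∈ₗ map toMatrix acyclics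
  listed A H = subst (_∈ₗ map toMatrix acyclics) (toMatrix-toDigraph A)
      (∈-map⁺ toMatrix (∈-filter⁺ acyclic? (digraphs-complete (toDigraph A))
    (positive⇒acyclic (toDigraph A) (subst (λ A → AllEigenvaluesPositive (complexify A)) (sym
        (toMatrix-toDigraph A)) H))))
  positive : ∀ A → A ∈ₗ map toMatrix acyclics → AllEigenvaluesPositive (complexify A)
  positive A A∈ = from (∈-map⁻ toMatrix A∈)
    where
    from : (∃[ G ] G ∈ₗ acyclics × A ≡ toMatrix G) → AllEigenvaluesPositive (complexify A)
    from (G , G∈ , refl) = acyclic⇒positive G (proj₂ (∈-filter⁻ acyclic? {xs = digraphs n} G∈))
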